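{- The following decision problem is undecidable: given a set $B$ of exactly $29$ Wang bars, decide whether the entire plane can be tiled by translated copies of Wang bars from $B$ such that every unit segment shared by two adjacent Wang bars in the tiling receives the same color from both of them.
   Context: A Wang bar of length $\ell$ (a positive integer) is a $\ell\times 1$ rectangle (horizontal length $\ell$, height $1$) whose top and bottom sides are each divided into $\ell$ unit segments, each unit segment being assigned a color, and whose left and right vertical sides (of length $1$) are each assigned a color. A Wang tile is a Wang bar of length $1$. A tiling of the plane by a set of Wang bars is a covering of the plane by translated copies (no rotations) of bars from the set with disjoint interiors, placed edge-to-edge with corners at integer lattice points, such that for any two adjacent bars the colors on each common unit segment coincide. Copies of each bar may be used any number of times (not every bar must be used). -}

module Defs where

open import Data.Nat using (ℕ; zero; suc; _+_; _*_; _^_; _<_; _≤_)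
open import Data.Integer as ℤ using (ℤ)
open import Data.Fin using (Fin; toℕ)
open import Data.Vec using (Vec; []; _∷_; lookup; toList; map)
open import Data.List using (List; []; _∷_)
open import Data.Product using (Σ; ∃; _×_; _,_)
open import Data.Sum using (_⊎_)
open import Data.Empty using (⊥)
open import Relation.Binary.PropositionalEquality using (_≡_)

-- Wang bars.  Colours are natural numbers.
-- A bar of length ℓ = suc k has ℓ top colours, ℓ bottom colours
-- (listed left to right) and a left and a right colour.

record Bar : Set where
  field
    k      : ℕ
    top    : Vec ℕ (suc k)
    bottom : Vec ℕ (suc k)
    left   : ℕ
    right  : ℕ

len : Bar → ℕ
len b = suc (Bar.k b)

-- A unit cell of the plane, covered by the j-th unit square of a copy of
-- bar number i of the bar set B.
Cell : ∀ {n} → Vec Bar n → Set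
Cell {n} B = Σ (Fin n) λ i → Fin (len (lookup B i))

topColour : ∀ {n} (B : Vec Bar n) → Cell B → ℕ
topColour B (i , j) = lookup (Bar.top (lookup B i)) j

bottomColour : ∀ {n} (B : Vec Bar n) → Cell B → ℕ
bottomColour B (i , j) = lookup (Bar.bottom (lookup B i)) j

HNext : ∀ {n} (B : Vec Bar n) → Cell B → Cell B → Set
HNext B (i , j) (i′ , j′) =
  (toℕ j ≡ Bar.k (lookup B i) × toℕ j′ ≡ 0 ×
     Bar.right (lookup B i) ≡ Bar.left (lookup B i′))
  ⊎ (suc (toℕ j) ≤ Bar.k (lookup B i) × i′ ≡ i × toℕ j′ ≡ suc (toℕ j))

record Tiling {n} (B : Vec Bar n) : Set where
  field
    place : ℤ → ℤ → Cell B
    horiz : ∀ x y → HNext B (place x y) (place (x ℤ.+ ℤ.1ℤ) y)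
    vert  : ∀ x y → topColour B (place x y) ≡ bottomColour B (place x (y ℤ.+ ℤ.1ℤ))

Tileable : ∀ {n} → Vec Bar n → Set
Tileable B = Tiling B

-- B is a *set* of n bars: its entries are pairwise distinct.
Distinct : ∀ {n} → Vec Bar n → Set
Distinct {n} B = ∀ (i j : Fin n) → lookup B i ≡ lookup B j → i ≡ j

-- Computability model: partial recursive (μ-recursive) functions.

data PR : ℕ → Set where
  Z : ∀ {n} → PR n
  S : PR 1
  P : ∀ {n} → Fin n → PR n
  C : ∀ {m n} → PR m → Vec (PR n) m → PR n
  R : ∀ {n} → PR n → PR (suc (suc n)) → PR (suc n)
  M : ∀ {n} → PR (suc n) → PR n

data Eval : ∀ {n} → PR n → Vec ℕ n → ℕ → Set
data EvalAll : ∀ {n m} → Vec (PR n) m → Vec ℕ n → Vec ℕ m → Set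

data Eval where
  eZ  : ∀ {n} {xs : Vec ℕ n} → Eval Z xs 0
  eS  : ∀ {x} → Eval S (x ∷ []) (suc x)
  eP  : ∀ {n} {xs : Vec ℕ n} (i : Fin n) → Eval (P i) xs (lookup xs i)
  eC  : ∀ {m n} {f : PR m} {gs : Vec (PR n) m} {xs ys y} →
        EvalAll gs xs ys → Eval f ys y → Eval (C f gs) xs y
  eR0 : ∀ {n} {f : PR n} {g xs y} →
        Eval f xs y → Eval (R f g) (0 ∷ xs) y
  eRs : ∀ {n} {f : PR n} {g xs k r y} →
        Eval (R f g) (k ∷ xs) r → Eval g (k ∷ r ∷ xs) y →
        Eval (R f g) (suc k ∷ xs) y
  eM  : ∀ {n} {f : PR (suc n)} {xs y} →
        Eval f (y ∷ xs) 0 →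
        (∀ z → z < y → ∃ λ v → Eval f (z ∷ xs) (suc v)) →
        Eval (M f) xs y

data EvalAll where
  []  : ∀ {n} {xs : Vec ℕ n} → EvalAll [] xs []
  _∷_ : ∀ {n m} {g : PR n} {gs : Vec (PR n) m} {xs y ys} →
        Eval g xs y → EvalAll gs xs ys → EvalAll (g ∷ gs) xs (y ∷ ys)

-- Encoding of finite data as natural numbers (bijection List ℕ ≃ ℕ).

encList : List ℕ → ℕ
encList []       = 0
encList (x ∷ xs) = 2 ^ x * suc (2 * encList xs)

encBar : Bar → ℕ
encBar b = encList (Bar.k b ∷ Bar.left b ∷ Bar.right b ∷
                    encList (toList (Bar.top b)) ∷
                    encList (toList (Bar.bottom b)) ∷ [])

code : ∀ {n} → Vec Bar n → ℕ
code B = encList (toList (map encBar B))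

DecidesTiling : ℕ → PR 1 → Set
DecidesTiling n f = ∀ (B : Vec Bar n) → Distinct B →
  (Tileable B → Eval f (code B ∷ []) 1) × ((Tileable B → ⊥) → Eval f (code B ∷ []) 0)

-- From a decider f for sets of 29 bars one builds a register machine that runs f on the code of a
-- set of bars describing the machine's own failure to halt: it loops if f answers "not tileable" and
-- halts if f answers "tileable". The number a codes the transition table of the machine and is at the
-- same time its input, so no recursion theorem is needed: the machine computes the code of the bars
-- from a.
--
-- Bars are obtained from machines in three steps. A run is a tiling of a quadrant by payload tiles
-- read off from a. As the quadrant is not the plane, an aperiodic hierarchical tile set of
-- Robinson's kind forces larger and larger squares, each of which starts the run afresh on its free
-- rows and columns; this Wang tile set has a number of tiles that depends on a. Finally 29 bars simulate
-- any Wang tile set: the tile and the colours are recorded by small horizontal displacements of four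
-- long bars, and unit bars transmit the marks that compare the displacements of adjacent rows.

module Submission where

-- The self-reference is not circular because `a` is a variable of the fixed formula `tileF`: the
-- program depends on `f` alone, its transition table is then coded by `a`, and row 0 of the run
-- writes `a + 1` in unary whatever `a` is. So everything that the machine must compute is written
-- in a small language whose semantics serves the geometry and whose compilation serves the machine.
-- Runs are skewed by one cell per step, so that the left and bottom colours of a tile determine the
-- other two. In the hierarchy, the level of a line is the number of trailing zeros of its position
-- in base 3 and its rank is the last nonzero digit. Edges only carry counters modulo 3 for three
-- neighbouring levels, and the work is to show that deleting the lines of level 0 leaves a grid
-- that obeys the same rule. For the bars, 29 leaves no room for one bar per tile: a tile is a
-- displacement, written in a base so large that sums of displacements can be decoded, and the
-- equality of horizontally adjacent colours follows only by comparing two consecutive rows of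
-- opposite parity.

module Expressions where

  open import Defs
  open import Data.Bool using (if_then_else_)
  open import Data.Fin using (Fin; zero; suc; #_)
  open import Data.List as List using (List; []; _∷_)
  open import Data.Nat
  open import Data.Nat.Properties
  open import Data.Product using (∃; _×_; _,_)
  open import Data.Sum using (_⊎_; inj₁; inj₂)
  open import Data.Vec as Vec using (Vec; []; _∷_; lookup; tabulate)
  open import Data.Vec.Properties using (tabulate∘lookup)
  open import Function using (id)
  open import Relation.Binary.PropositionalEquality
  open import Relation.Nullary using (¬_; Dec; yes; no; does; contradiction)
  open import Relation.Nullary.Decidable using (_×-dec_; _⊎-dec_; ¬?)

  -- Terms and decidable formulas over the naturals, and their compilation

  interval : (ℕ → ℕ) → ℕ → ℕ → List ℕ
  interval f s zero    = []
  interval f s (suc m) = f s ∷ interval f (suc s) m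

  natrec : ℕ → (ℕ → ℕ → ℕ) → ℕ → ℕ
  natrec b s zero    = b
  natrec b s (suc k) = s k (natrec b s k)

  infixl 6 _⊕_ _⊖_
  infixl 7 _⊗_
  infixr 8 _⇑_
  infix  4 _≐_ _≺_
  infixr 3 _⩓_
  infixr 2 _⩔_

  -- Just enough to write the set of bars as a function of `a`. Quantifiers are bounded, so truth is
  -- decidable and `ite` can use it. `codes c e` is the code of the list of the values of `e` at 0,
  -- ..., c - 1; it is there for the sides of bars whose length depends on `a`.
  data Tm : ℕ → Set
  data Fm : ℕ → Set

  data Tm where
    var : ∀ {n} → Fin n → Tm n
    lit : ∀ {n} → ℕ → Tm n
    _⊕_ _⊗_ _⊖_ _⇑_ : ∀ {n} → Tm n → Tm n → Tm n
    ite : ∀ {n} → Fm n → Tm n → Tm n → Tm n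
    rec : ∀ {n} → Tm n → Tm n → Tm (2 + n) → Tm n
    call : ∀ {m n} → Tm m → Vec (Tm n) m → Tm n
    codes : ∀ {n} → Tm n → Tm (suc n) → Tm n

  data Fm where
    _≐_ _≺_ : ∀ {n} → Tm n → Tm n → Fm n
    _⩓_ _⩔_ : ∀ {n} → Fm n → Fm n → Fm n
    ∼_ : ∀ {n} → Fm n → Fm n
    ex : ∀ {n} → Tm n → Fm (suc n) → Fm n
    callF : ∀ {m n} → Fm m → Vec (Tm n) m → Fm n

  ⟦_⟧ : ∀ {n} → Tm n → Vec ℕ n → ℕ
  ⟦_⟧* : ∀ {n m} → Vec (Tm n) m → Vec ℕ n → Vec ℕ m
  Holds : ∀ {n} → Fm n → Vec ℕ n → Set
  holds? : ∀ {n} (f : Fm n) (xs : Vec ℕ n) → Dec (Holds f xs)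

  ⟦ var i ⟧ xs = lookup xs i
  ⟦ lit k ⟧ xs = k
  ⟦ s ⊕ t ⟧ xs = ⟦ s ⟧ xs + ⟦ t ⟧ xs
  ⟦ s ⊗ t ⟧ xs = ⟦ s ⟧ xs * ⟦ t ⟧ xs
  ⟦ s ⊖ t ⟧ xs = ⟦ s ⟧ xs ∸ ⟦ t ⟧ xs
  ⟦ s ⇑ t ⟧ xs = ⟦ s ⟧ xs ^ ⟦ t ⟧ xs
  ⟦ ite f s t ⟧ xs = if does (holds? f xs) then ⟦ s ⟧ xs else ⟦ t ⟧ xs
  ⟦ rec c b s ⟧ xs = natrec (⟦ b ⟧ xs) (λ k r → ⟦ s ⟧ (k ∷ r ∷ xs)) (⟦ c ⟧ xs)
  ⟦ call t ts ⟧ xs = ⟦ t ⟧ (⟦ ts ⟧* xs)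
  ⟦ codes c e ⟧ xs = encList (interval (λ j → ⟦ e ⟧ (j ∷ xs)) 0 (⟦ c ⟧ xs))

  ⟦ [] ⟧* xs = []
  ⟦ t ∷ ts ⟧* xs = ⟦ t ⟧ xs ∷ ⟦ ts ⟧* xs

  Holds (s ≐ t) xs = ⟦ s ⟧ xs ≡ ⟦ t ⟧ xs
  Holds (s ≺ t) xs = ⟦ s ⟧ xs < ⟦ t ⟧ xs
  Holds (f ⩓ g) xs = Holds f xs × Holds g xs
  Holds (f ⩔ g) xs = Holds f xs ⊎ Holds g xs
  Holds (∼ f) xs = ¬ Holds f xs
  Holds (ex b f) xs = ∃ λ k → k < ⟦ b ⟧ xs × Holds f (k ∷ xs)
  Holds (callF f ts) xs = Holds f (⟦ ts ⟧* xs)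

  holds? (s ≐ t) xs = ⟦ s ⟧ xs ≟ ⟦ t ⟧ xs
  holds? (s ≺ t) xs = ⟦ s ⟧ xs <? ⟦ t ⟧ xs
  holds? (f ⩓ g) xs = holds? f xs ×-dec holds? g xs
  holds? (f ⩔ g) xs = holds? f xs ⊎-dec holds? g xs
  holds? (∼ f) xs = ¬? (holds? f xs)
  holds? (ex b f) xs = anyUpTo? (λ k → holds? f (k ∷ xs)) (⟦ b ⟧ xs)
  holds? (callF f ts) xs = holds? f (⟦ ts ⟧* xs)

  χ : ∀ {a} {A : Set a} → Dec A → ℕ
  χ d = if does d then 1 else 0

  χ-cong : ∀ {A B : Set} (a : Dec A) (b : Dec B) → (A → B) → (B → A) → χ a ≡ χ b
  χ-cong (yes _) (yes _) _ _ = refl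
  χ-cong (yes a) (no ¬b) f _ = contradiction (f a) ¬b
  χ-cong (no ¬a) (yes b) _ g = contradiction (g b) ¬a
  χ-cong (no _)  (no _)  _ _ = refl

  -- Compilation of expressions to partial recursive functions

  call₁ : ∀ {n} → PR 1 → PR n → PR n
  call₁ f a = C f (a ∷ [])

  call₂ : ∀ {n} → PR 2 → PR n → PR n → PR n
  call₂ f a b = C f (a ∷ b ∷ [])

  e₁ : ∀ {n} {f a} {xs : Vec ℕ n} {x y} → Eval a xs x → Eval f (x ∷ []) y → Eval (call₁ f a) xs y
  e₁ a f = eC (a ∷ []) f

  e₂ : ∀ {n} {f a b} {xs : Vec ℕ n} {x y z} →
       Eval a xs x → Eval b xs y → Eval f (x ∷ y ∷ []) z → Eval (call₂ f a b) xs z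
  e₂ a b f = eC (a ∷ b ∷ []) f

  projections : ∀ {m n} → (Fin n → Fin m) → Vec (PR m) n
  projections g = tabulate (λ i → P (g i))

  eval-projections : ∀ {m n} (g : Fin n → Fin m) (xs : Vec ℕ m) →
                     EvalAll (projections g) xs (tabulate (λ i → lookup xs (g i)))
  eval-projections {n = zero}  g xs = []
  eval-projections {n = suc n} g xs = eP (g zero) ∷ eval-projections (λ i → g (suc i)) xs

  drop₂ : ∀ {n k r} (xs : Vec ℕ n) → EvalAll (projections (λ i → suc (suc i))) (k ∷ r ∷ xs) xs
  drop₂ {k = k} {r} xs = subst (EvalAll _ _) (tabulate∘lookup xs) (eval-projections (λ i → suc (suc i)) (k ∷ r ∷ xs))

  keep : ∀ {n} (xs : Vec ℕ n) → EvalAll (projections id) xs xs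
  keep xs = subst (EvalAll _ _) (tabulate∘lookup xs) (eval-projections id xs)

  constPR : ∀ {n} → ℕ → PR n
  constPR zero    = Z
  constPR (suc k) = call₁ S (constPR k)

  eval-const : ∀ {n} k {xs : Vec ℕ n} → Eval (constPR k) xs k
  eval-const zero    = eZ
  eval-const (suc k) = e₁ (eval-const k) eS

  addPR mulPR subPR powPR monusPR eqPR ltPR orPR andPR consPR : PR 2
  predPR isZeroPR : PR 1
  addPR = R (P zero) (call₁ S (P (suc zero)))
  mulPR = R Z (call₂ addPR (P (# 2)) (P (# 1)))
  predPR = R Z (P zero)
  isZeroPR = R (constPR 1) Z
  -- Recursion runs over the first argument, so this subtracts the first from the second; `monusPR`
  -- swaps them. For the same reason `powPR` takes the exponent first.
  subPR = R (P zero) (call₁ predPR (P (suc zero)))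
  monusPR = call₂ subPR (P (# 1)) (P (# 0))
  powPR = R (constPR 1) (call₂ mulPR (P (# 2)) (P (# 1)))
  eqPR = call₁ isZeroPR (call₂ addPR monusPR subPR)
  ltPR = call₁ isZeroPR (call₁ isZeroPR subPR)
  orPR = call₁ isZeroPR (call₁ isZeroPR addPR)
  andPR = mulPR
  consPR = call₂ mulPR (call₂ powPR (P (# 0)) (constPR 2))
                       (call₁ S (call₂ mulPR (constPR 2) (P (# 1))))

  eval-add : ∀ x y → Eval addPR (x ∷ y ∷ []) (x + y)
  eval-add zero y = eR0 (eP zero)
  eval-add (suc x) y = eRs (eval-add x y) (e₁ (eP (suc zero)) eS)

  eval-mul : ∀ x y → Eval mulPR (x ∷ y ∷ []) (x * y)
  eval-mul zero y = eR0 eZ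
  eval-mul (suc x) y = eRs (eval-mul x y) (e₂ (eP (# 2)) (eP (# 1)) (eval-add y (x * y)))

  eval-pred : ∀ x → Eval predPR (x ∷ []) (pred x)
  eval-pred zero = eR0 eZ
  eval-pred (suc x) = eRs (eval-pred x) (eP zero)

  eval-sub : ∀ x y → Eval subPR (x ∷ y ∷ []) (y ∸ x)
  eval-sub zero y = eR0 (eP zero)
  eval-sub (suc x) y = eRs (eval-sub x y)
    (e₁ (eP (suc zero)) (subst (Eval predPR _) (pred[m∸n]≡m∸[1+n] y x) (eval-pred (y ∸ x))))

  eval-monus : ∀ x y → Eval monusPR (x ∷ y ∷ []) (x ∸ y)
  eval-monus x y = e₂ (eP (# 1)) (eP (# 0)) (eval-sub y x)

  eval-pow : ∀ y x → Eval powPR (y ∷ x ∷ []) (x ^ y)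
  eval-pow zero x = eR0 (eval-const 1)
  eval-pow (suc y) x = eRs (eval-pow y x) (e₂ (eP (# 2)) (eP (# 1)) (eval-mul x (x ^ y)))

  isZero : ℕ → ℕ
  isZero zero    = 1
  isZero (suc _) = 0

  eval-isZero : ∀ x → Eval isZeroPR (x ∷ []) (isZero x)
  eval-isZero zero = eR0 (eval-const 1)
  eval-isZero (suc x) = eRs (eval-isZero x) eZ

  isZero-eq : ∀ x y → isZero ((x ∸ y) + (y ∸ x)) ≡ χ (x ≟ y)
  isZero-eq zero zero = refl
  isZero-eq zero (suc y) = refl
  isZero-eq (suc x) zero = refl
  isZero-eq (suc x) (suc y) = trans (isZero-eq x y) (χ-cong (x ≟ y) (suc x ≟ suc y) (cong suc) suc-injective)

  isZero-lt : ∀ x y → isZero (isZero (y ∸ x)) ≡ χ (x <? y)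
  isZero-lt zero zero = refl
  isZero-lt zero (suc y) = refl
  isZero-lt (suc x) zero = refl
  isZero-lt (suc x) (suc y) = trans (isZero-lt x y) (χ-cong (x <? y) (suc x <? suc y) s≤s (λ { (s≤s p) → p }))

  eval-eq : ∀ x y → Eval eqPR (x ∷ y ∷ []) (χ (x ≟ y))
  eval-eq x y = subst (Eval eqPR _) (isZero-eq x y)
    (e₁ (e₂ (eval-monus x y) (eval-sub x y) (eval-add _ _)) (eval-isZero _))

  eval-lt : ∀ x y → Eval ltPR (x ∷ y ∷ []) (χ (x <? y))
  eval-lt x y = subst (Eval ltPR _) (isZero-lt x y)
    (e₁ (e₁ (eval-sub x y) (eval-isZero _)) (eval-isZero _))

  eval-or : ∀ {A B : Set} (a : Dec A) (b : Dec B) → Eval orPR (χ a ∷ χ b ∷ []) (χ (a ⊎-dec b))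
  eval-or a b = subst (Eval orPR _) (lemma a b) (e₁ (e₁ (eval-add _ _) (eval-isZero _)) (eval-isZero _))
    where
    lemma : ∀ {A B : Set} (a : Dec A) (b : Dec B) → isZero (isZero (χ a + χ b)) ≡ χ (a ⊎-dec b)
    lemma (yes _) _       = refl
    lemma (no _)  (yes _) = refl
    lemma (no _)  (no _)  = refl

  eval-and : ∀ {A B : Set} (a : Dec A) (b : Dec B) → Eval andPR (χ a ∷ χ b ∷ []) (χ (a ×-dec b))
  eval-and a b = subst (Eval andPR _) (lemma a b) (eval-mul _ _)
    where
    lemma : ∀ {A B : Set} (a : Dec A) (b : Dec B) → χ a * χ b ≡ χ (a ×-dec b)
    lemma (yes _) (yes _) = refl
    lemma (yes _) (no _)  = refl
    lemma (no _)  _       = refl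

  eval-not : ∀ {A : Set} (a : Dec A) → Eval isZeroPR (χ a ∷ []) (χ (¬? a))
  eval-not (yes a) = eval-isZero 1
  eval-not (no _)  = eval-isZero 0

  eval-cons : ∀ x r → Eval consPR (x ∷ r ∷ []) (2 ^ x * suc (2 * r))
  eval-cons x r = e₂ (e₂ (eP _) (eval-const 2) (eval-pow x 2))
                     (e₁ (e₂ (eval-const 2) (eP (# 1)) (eval-mul 2 r)) eS)
                     (eval-mul (2 ^ x) (suc (2 * r)))

  -- Recursion on the truth value: the base case returns the third argument, and the single step for
  -- 1 returns the second. Both branches are evaluated first, which is harmless because all terms
  -- are total.
  iteBaseStep : PR 3
  iteBaseStep = R (P (# 1)) (P (# 2))

  eval-ite : ∀ {A : Set} (a : Dec A) x y → Eval iteBaseStep (χ a ∷ x ∷ y ∷ []) (if does a then x else y)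
  eval-ite (yes _) x y = eRs (eR0 (eP (# 1))) (eP (# 2))
  eval-ite (no _)  x y = eR0 (eP (# 1))

  -- With n elements in total, the list is consed up from its last element.
  codesStep : ∀ {n} → PR n → PR (suc n) → PR (2 + n)
  codesStep c e = call₂ consPR
    (C e (call₂ monusPR (C c (projections (λ i → suc (suc i)))) (call₁ S (P zero)) ∷ projections (λ i → suc (suc i))))
    (P (suc zero))

  compile : ∀ {n} → Tm n → PR n
  compileF : ∀ {n} → Fm n → PR n
  compile* : ∀ {n m} → Vec (Tm n) m → Vec (PR n) m

  compile (var i) = P i
  compile (lit k) = constPR k
  compile (s ⊕ t) = call₂ addPR (compile s) (compile t)
  compile (s ⊗ t) = call₂ mulPR (compile s) (compile t)
  compile (s ⊖ t) = call₂ monusPR (compile s) (compile t)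
  compile (s ⇑ t) = call₂ powPR (compile t) (compile s)
  compile (ite f s t) = C iteBaseStep (compileF f ∷ compile s ∷ compile t ∷ [])
  compile (rec c b s) = C (R (compile b) (compile s)) (compile c ∷ projections id)
  compile (call t ts) = C (compile t) (compile* ts)
  compile (codes c e) = C (R Z (codesStep (compile c) (compile e))) (compile c ∷ projections id)

  compileF (s ≐ t) = call₂ eqPR (compile s) (compile t)
  compileF (s ≺ t) = call₂ ltPR (compile s) (compile t)
  compileF (f ⩓ g) = call₂ andPR (compileF f) (compileF g)
  compileF (f ⩔ g) = call₂ orPR (compileF f) (compileF g)
  compileF (∼ f) = call₁ isZeroPR (compileF f)
  compileF (ex b f) = C (R Z (call₂ orPR (C (compileF f) (P zero ∷ projections (λ i → suc (suc i)))) (P (suc zero))))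
                        (compile b ∷ projections id)
  compileF (callF f ts) = C (compileF f) (compile* ts)

  compile* [] = []
  compile* (t ∷ ts) = compile t ∷ compile* ts

  compile-correct : ∀ {n} (t : Tm n) xs → Eval (compile t) xs (⟦ t ⟧ xs)
  compileF-correct : ∀ {n} (f : Fm n) xs → Eval (compileF f) xs (χ (holds? f xs))
  compile*-correct : ∀ {n m} (ts : Vec (Tm n) m) xs → EvalAll (compile* ts) xs (⟦ ts ⟧* xs)

  compile-correct (var i) xs = eP i
  compile-correct (lit k) xs = eval-const k
  compile-correct (s ⊕ t) xs = e₂ (compile-correct s xs) (compile-correct t xs) (eval-add _ _)
  compile-correct (s ⊗ t) xs = e₂ (compile-correct s xs) (compile-correct t xs) (eval-mul _ _)
  compile-correct (s ⊖ t) xs = e₂ (compile-correct s xs) (compile-correct t xs) (eval-monus _ _)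
  compile-correct (s ⇑ t) xs = e₂ (compile-correct t xs) (compile-correct s xs) (eval-pow _ _)
  compile-correct (ite f s t) xs =
    eC (compileF-correct f xs ∷ compile-correct s xs ∷ compile-correct t xs ∷ []) (eval-ite (holds? f xs) _ _)
  compile-correct (rec c b s) xs = eC (compile-correct c xs ∷ keep xs) (loop (⟦ c ⟧ xs))
    where
    loop : ∀ k → Eval (R (compile b) (compile s)) (k ∷ xs) (natrec (⟦ b ⟧ xs) (λ k r → ⟦ s ⟧ (k ∷ r ∷ xs)) k)
    loop zero = eR0 (compile-correct b xs)
    loop (suc k) = eRs (loop k) (compile-correct s _)
  compile-correct (call t ts) xs = eC (compile*-correct ts xs) (compile-correct t _)
  compile-correct (codes c e) xs = eC (compile-correct c xs ∷ keep xs)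
    (subst (Eval _ _) (cong (λ s → encList (interval f s N)) (n∸n≡0 N)) (loop N ≤-refl))
    where
    N = ⟦ c ⟧ xs
    f = λ j → ⟦ e ⟧ (j ∷ xs)
    -- After m steps the accumulator codes the last m values, those from index `N ∸ m` on.
    loop : ∀ m → m ≤ N → Eval (R Z (codesStep (compile c) (compile e))) (m ∷ xs) (encList (interval f (N ∸ m) m))
    loop zero _ = eR0 eZ
    loop (suc m) m<N = eRs (loop m (<⇒≤ m<N))
      (e₂ (eC (e₂ (eC (drop₂ xs) (compile-correct c xs)) (e₁ (eP zero) eS) (eval-monus N (suc m)) ∷ drop₂ xs)
              (compile-correct e _))
          (subst (Eval _ _) (cong (λ s → encList (interval f s m)) (sym (suc-pred-∸ m<N))) (eP (suc zero)))
          (eval-cons _ _))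
      where
      suc-pred-∸ : ∀ {m n} → m < n → suc (n ∸ suc m) ≡ n ∸ m
      suc-pred-∸ {zero} {suc n} _ = refl
      suc-pred-∸ {suc m} {suc n} (s≤s p) = suc-pred-∸ p

  compileF-correct (s ≐ t) xs = e₂ (compile-correct s xs) (compile-correct t xs) (eval-eq _ _)
  compileF-correct (s ≺ t) xs = e₂ (compile-correct s xs) (compile-correct t xs) (eval-lt _ _)
  compileF-correct (f ⩓ g) xs = e₂ (compileF-correct f xs) (compileF-correct g xs) (eval-and (holds? f xs) (holds? g xs))
  compileF-correct (f ⩔ g) xs = e₂ (compileF-correct f xs) (compileF-correct g xs) (eval-or (holds? f xs) (holds? g xs))
  compileF-correct (∼ f) xs = e₁ (compileF-correct f xs) (eval-not (holds? f xs))
  compileF-correct (ex b f) xs = eC (compile-correct b xs ∷ keep xs) (loop (⟦ b ⟧ xs))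
    where
    P? = λ k → holds? f (k ∷ xs)
    step : ∀ k → χ (P? k ⊎-dec anyUpTo? P? k) ≡ χ (anyUpTo? P? (suc k))
    step k = χ-cong (P? k ⊎-dec anyUpTo? P? k) (anyUpTo? P? (suc k))
      (λ { (inj₁ h) → k , ≤-refl , h ; (inj₂ (j , j<k , h)) → j , m<n⇒m<1+n j<k , h })
      (λ { (j , s≤s j≤k , h) → split (m≤n⇒m<n∨m≡n j≤k) h })
      where
      split : ∀ {j} → j < k ⊎ j ≡ k → Holds f (j ∷ xs) → Holds f (k ∷ xs) ⊎ ∃ λ i → i < k × Holds f (i ∷ xs)
      split (inj₁ j<k) h = inj₂ (_ , j<k , h)
      split (inj₂ refl) h = inj₁ h
    loop : ∀ k → Eval _ (k ∷ xs) (χ (anyUpTo? P? k))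
    loop zero = eR0 eZ
    loop (suc k) = subst (Eval _ _) (step k)
      (eRs (loop k) (e₂ (eC (eP zero ∷ drop₂ xs) (compileF-correct f (k ∷ xs))) (eP (suc zero))
                        (eval-or (P? k) (anyUpTo? P? k))))
  compileF-correct (callF f ts) xs = eC (compile*-correct ts xs) (compileF-correct f _)

  compile*-correct [] xs = []
  compile*-correct (t ∷ ts) xs = compile-correct t xs ∷ compile*-correct ts xs

-- Register machines that compute partial recursive functions

module RegisterMachines where

  open import Defs
  open import Data.Bool using (if_then_else_)
  open import Data.Fin using (zero; suc)
  open import Data.List as List using (List; []; _∷_; _++_; length; [_])
  open import Data.List.Properties using (++-assoc; length-++)
  open import Data.Maybe using (Maybe; just; nothing)
  open import Data.Nat
  open import Data.Nat.Properties
  open import Data.Nat.Tactic.RingSolver using (solve-∀)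
  open import Data.Product using (∃; _×_; _,_; proj₁; proj₂)
  open import Data.Vec as Vec using (Vec; []; _∷_; lookup)
  open import Function using (_∘_)
  open import Relation.Binary.PropositionalEquality hiding ([_])
  open import Relation.Nullary using (does)
  open import Relation.Nullary.Decidable using (dec-true; dec-false)

  data Src : Set where
    zer          : Src
    same inc dec : ℕ → Src

  -- Jumps are relative, so that code works at every address. `jzf i k` skips k instructions if
  -- register i is zero, and `jb 0` stays where it is forever.
  data Instr : Set where
    asg : ℕ → Src → Instr
    jzf : ℕ → ℕ → Instr
    jb  : ℕ → Instr

  Regs : Set
  Regs = ℕ → ℕ

  State : Set
  State = ℕ × Regs

  fetch : List Instr → ℕ → Maybe Instr
  fetch []       _       = nothing
  fetch (c ∷ cs) zero    = just c
  fetch (c ∷ cs) (suc q) = fetch cs q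

  source : Src → Regs → ℕ
  source zer      ρ = 0
  source (same k) ρ = ρ k
  source (inc k)  ρ = suc (ρ k)
  source (dec k)  ρ = pred (ρ k)

  _[_≔_] : Regs → ℕ → ℕ → Regs
  (ρ [ i ≔ v ]) r = if does (r ≟ i) then v else ρ r

  jump : ℕ → ℕ → ℕ → ℕ
  jump zero    k q = suc (k + q)
  jump (suc _) k q = suc q

  execute : Instr → State → State
  execute (asg i s) (q , ρ) = suc q , ρ [ i ≔ source s ρ ]
  execute (jzf i k) (q , ρ) = jump (ρ i) k q , ρ
  execute (jb k)    (q , ρ) = q ∸ k , ρ

  update-same : ∀ ρ i v → (ρ [ i ≔ v ]) i ≡ v
  update-same ρ i v rewrite dec-true (i ≟ i) refl = refl

  update-other : ∀ ρ i v {r} → r ≢ i → (ρ [ i ≔ v ]) r ≡ ρ r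
  update-other ρ i v {r} r≢i rewrite dec-false (r ≟ i) r≢i = refl

  infixr 5 _◅_ _◅◅_

  data Path (cs : List Instr) : State → State → Set where
    ε   : ∀ {s} → Path cs s s
    _◅_ : ∀ {c s t} → fetch cs (proj₁ s) ≡ just c → Path cs (execute c s) t → Path cs s t

  _◅◅_ : ∀ {cs s t u} → Path cs s t → Path cs t u → Path cs s u
  ε       ◅◅ q = q
  (e ◅ p) ◅◅ q = e ◅ (p ◅◅ q)

  within : ∀ {cs cs′ s t} → cs ≡ cs′ → Path cs s t → Path cs′ s t
  within refl p = p

  from : ∀ {cs q q′ ρ t} → q ≡ q′ → Path cs (q , ρ) t → Path cs (q′ , ρ) t
  from refl p = p

  upto : ∀ {cs s q q′ ρ} → q ≡ q′ → Path cs s (q , ρ) → Path cs s (q′ , ρ)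
  upto refl p = p

  fetch-++ : ∀ pre c post → fetch (pre ++ c ∷ post) (length pre) ≡ just c
  fetch-++ []        c post = refl
  fetch-++ (_ ∷ pre) c post = fetch-++ pre c post

  -- The arbitrary surrounding code makes runs compose: a run of a piece of code remains valid
  -- inside every loop or longer program built around it.
  Runs : List Instr → Regs → Regs → Set
  Runs cs ρ ρ′ = ∀ pre post → Path (pre ++ cs ++ post) (length pre , ρ) (length pre + length cs , ρ′)

  runs-[] : ∀ {ρ} → Runs [] ρ ρ
  runs-[] pre post rewrite +-identityʳ (length pre) = ε

  infixr 4 _⨟_
  _⨟_ : ∀ {cs ds ρ ρ₁ ρ₂} → Runs cs ρ ρ₁ → Runs ds ρ₁ ρ₂ → Runs (cs ++ ds) ρ ρ₂
  _⨟_ {cs} {ds} {ρ} {ρ₁} {ρ₂} r s pre post =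
    within (cong (pre ++_) (sym (++-assoc cs ds post))) (r pre (ds ++ post))
    ◅◅ within text≡ (upto end≡ (from (length-++ pre) (s (pre ++ cs) post)))
    where
    text≡ : (pre ++ cs) ++ ds ++ post ≡ pre ++ (cs ++ ds) ++ post
    text≡ = trans (++-assoc pre cs (ds ++ post)) (cong (pre ++_) (sym (++-assoc cs ds post)))
    end≡ : length (pre ++ cs) + length ds ≡ length pre + length (cs ++ ds)
    end≡ = trans (cong (_+ length ds) (length-++ pre))
             (trans (+-assoc (length pre) _ _) (cong (length pre +_) (sym (length-++ cs))))

  runs-asg : ∀ i s {ρ} → Runs [ asg i s ] ρ (ρ [ i ≔ source s ρ ])
  runs-asg i s {ρ} pre post = fetch-++ pre (asg i s) post ◅
    upto (sym (+-comm (length pre) 1)) ε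

  -- For a body of length n the test skips n + 1 instructions, the body and the closing jump, and
  -- the closing jump stands n + 1 places after the test.
  while : ℕ → List Instr → List Instr
  while r body = jzf r (suc (length body)) ∷ body ++ [ jb (suc (length body)) ]

  length-while : ∀ p (body : List Instr) e → p + length (jzf 0 0 ∷ body ++ [ jb e ]) ≡ suc (suc (length body) + p)
  length-while p body e = trans (cong (λ n → p + suc n) (length-++ body)) (lemma p (length body))
    where
    lemma : ∀ p n → p + suc (n + 1) ≡ suc (suc n + p)
    lemma = solve-∀

  runs-exit : ∀ r body {ρ} → ρ r ≡ 0 → Runs (while r body) ρ ρ
  runs-exit r body {ρ} z pre post = fetch-++ pre _ _ ◅
    from (cong (λ v → jump v (suc (length body)) (length pre)) (sym z))
      (upto (sym (length-while (length pre) body (suc (length body)))) ε)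

  runs-iterate : ∀ r body {ρ ρ₁ k} → ρ r ≡ suc k → Runs body ρ ρ₁ →
                 ∀ pre post → Path (pre ++ while r body ++ post) (length pre , ρ) (length pre , ρ₁)
  runs-iterate r body {ρ} {ρ₁} z b pre post = fetch-++ pre _ _ ◅
    from (cong (λ v → jump v (suc n) p) (sym z)) (inner ◅◅ back ◅ again)
    where
    p = length pre
    n = length body
    jmp = jb (suc n)
    text = pre ++ while r body ++ post
    text≡ : (pre ++ [ jzf r (suc n) ]) ++ body ++ jmp ∷ post ≡ text
    text≡ = trans (++-assoc pre _ _) (cong (λ x → pre ++ jzf r (suc n) ∷ x) (sym (++-assoc body [ jmp ] post)))
    len₁ : length (pre ++ [ jzf r (suc n) ]) ≡ suc p
    len₁ = trans (length-++ pre) (+-comm p 1)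
    inner : Path text (suc p , ρ) (suc p + n , ρ₁)
    inner = subst₂ (λ c q → Path c (q , ρ) (q + n , ρ₁)) text≡ len₁ (b (pre ++ [ jzf r (suc n) ]) (jmp ∷ post))
    back : fetch text (suc p + n) ≡ just jmp
    back = subst₂ (λ c q → fetch c q ≡ just jmp)
      (trans (++-assoc (pre ++ [ jzf r (suc n) ]) body (jmp ∷ post)) text≡)
      (trans (length-++ (pre ++ [ jzf r (suc n) ]) {body}) (cong (_+ n) len₁))
      (fetch-++ ((pre ++ [ jzf r (suc n) ]) ++ body) jmp post)
    again : Path text (suc p + n ∸ suc n , ρ₁) (p , ρ₁)
    again = subst (λ q → Path text (q , ρ₁) (p , ρ₁)) (sym (m+n∸n≡m p n)) ε

  runs-while-++ : ∀ r body rest {ρ ρ₁ ρ₂ k} → ρ r ≡ suc k → Runs body ρ ρ₁ → Runs (while r body ++ rest) ρ₁ ρ₂ →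
                  Runs (while r body ++ rest) ρ ρ₂
  runs-while-++ r body rest {ρ} {ρ₁} {ρ₂} z b w pre post = enter ◅◅ w pre post
    where
    enter : Path (pre ++ (while r body ++ rest) ++ post) (length pre , ρ) (length pre , ρ₁)
    enter = subst (λ c → Path c (length pre , ρ) (length pre , ρ₁))
              (cong (pre ++_) (sym (++-assoc (while r body) rest post))) (runs-iterate r body z b pre (rest ++ post))

  -- Compiling partial recursive functions to register programs: the arguments are read from
  -- the registers in the vector, the result goes to o, and registers from b on are scratch space.

  range : ℕ → ∀ m → Vec ℕ m
  range o zero    = []
  range o (suc m) = o ∷ range (suc o) m

  program : ∀ {n} → PR n → Vec ℕ n → ℕ → ℕ → List Instr
  programs : ∀ {n m} → Vec (PR n) m → Vec ℕ n → ℕ → ℕ → List Instr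

  program Z is o b = [ asg o zer ]
  program S (i ∷ []) o b = [ asg o (inc i) ]
  program (P j) is o b = [ asg o (same (lookup is j)) ]
  program (C {m} f gs) is o b = programs gs is b (m + b) ++ program f (range b m) o (m + b)
  -- Register `b` counts the remaining iterations, `1 + b` the finished ones, and `2 + b`
  -- accumulates. The new value goes to `3 + b` first, because `g` reads the old one from `2 + b`.
  program (R f g) (i ∷ is) o b =
    [ asg b (same i) ] ++ [ asg (1 + b) zer ] ++ program f is (2 + b) (4 + b) ++
    while b (program g (1 + b ∷ 2 + b ∷ is) (3 + b) (4 + b) ++
             [ asg (2 + b) (same (3 + b)) ] ++ [ asg (1 + b) (inc (1 + b)) ] ++ [ asg b (dec b) ]) ++
    [ asg o (same (2 + b)) ]
  -- Register `b` holds the candidate and `1 + b` the value of `f` there, which is also the loop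
  -- test.
  program (M f) is o b =
    [ asg b zer ] ++ program f (b ∷ is) (1 + b) (2 + b) ++
    while (1 + b) ([ asg b (inc b) ] ++ program f (b ∷ is) (1 + b) (2 + b)) ++
    [ asg o (same b) ]

  programs []       is o b = []
  programs (g ∷ gs) is o b = program g is o b ++ programs gs is (suc o) b

  Input : ∀ {n} → Regs → ℕ → Vec ℕ n → Vec ℕ n → Set
  Input ρ b is xs = ∀ j → lookup is j < b × ρ (lookup is j) ≡ lookup xs j

  Frame : ℕ → ℕ → Regs → Regs → Set
  Frame o b ρ ρ′ = ∀ r → r < b → r ≢ o → ρ′ r ≡ ρ r

  ≢-fresh : ∀ {r b} k → r < b → r ≢ k + b
  ≢-fresh {r} {b} k r<b refl = <⇒≱ r<b (m≤n+m b k)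

  <-fresh : ∀ {r b} k → r < b → r < k + b
  <-fresh {b = b} k r<b = <-≤-trans r<b (m≤n+m b k)

  input-step : ∀ {n ρ ρ′ b b′} (is xs : Vec ℕ n) → Input ρ b is xs → b ≤ b′ →
               (∀ r → r < b → ρ′ r ≡ ρ r) → Input ρ′ b′ is xs
  input-step is xs inp b≤b′ fr j = <-≤-trans (proj₁ (inp j)) b≤b′ , trans (fr _ (proj₁ (inp j))) (proj₂ (inp j))

  program-correct : ∀ {n} (f : PR n) {xs y is o b ρ} → Eval f xs y → Input ρ b is xs → o < b →
    ∃ λ ρ′ → Runs (program f is o b) ρ ρ′ × ρ′ o ≡ y × Frame o b ρ ρ′
  programs-correct : ∀ {n m} (gs : Vec (PR n) m) {xs ys is o i b ρ} → EvalAll gs xs ys → Input ρ i is xs → i ≤ o → m + o ≤ b →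
    ∃ λ ρ′ → Runs (programs gs is o b) ρ ρ′ × Input ρ′ b (range o m) ys × (∀ r → r < o → ρ′ r ≡ ρ r)

  program-correct Z {o = o} {ρ = ρ} eZ inp o<b = _ , runs-asg o zer , update-same ρ o 0 , λ r _ → update-other ρ o 0
  program-correct S {is = i ∷ []} {o} {b} {ρ} eS inp o<b =
    _ , runs-asg o (inc i) , trans (update-same ρ o _) (cong suc (proj₂ (inp zero))) , λ r _ → update-other ρ o _
  program-correct (P j) {o = o} {ρ = ρ} (eP .j) inp o<b =
    _ , runs-asg o _ , trans (update-same ρ o _) (proj₂ (inp j)) , λ r _ → update-other ρ o _
  program-correct (C {m} f gs) {b = b} (eC gs⇓ f⇓) inp o<b =
    let ρ₁ , r₁ , inp₁ , fr₁ = programs-correct gs gs⇓ inp ≤-refl ≤-refl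
        ρ₂ , r₂ , e₂ , fr₂ = program-correct f f⇓ inp₁ (<-fresh m o<b)
    in ρ₂ , (r₁ ⨟ r₂) , e₂ , λ r r<b r≢o → trans (fr₂ r (<-fresh m r<b) r≢o) (fr₁ r r<b)
  program-correct (R f g) {K ∷ xs} {y} {i ∷ is} {o} {b} {ρ} ev inp o<b =
    let ρ₃ , run₃ , rem₃ , cnt₃ , acc₃ , fr₃ = loop ev 0 (+-identityʳ K)
        ρ₄ , run₄ , acc₄ , fr₄ = exit ρ₃ rem₃ acc₃
    in ρ₄ , run₃ run₄ , acc₄ , λ r r<b r≢o → trans (fr₄ r r<b r≢o) (fr₃ r r<b)
    where
    body = program g (1 + b ∷ 2 + b ∷ is) (3 + b) (4 + b) ++
             [ asg (2 + b) (same (3 + b)) ] ++ [ asg (1 + b) (inc (1 + b)) ] ++ [ asg b (dec b) ]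
    tail = while b body ++ [ asg o (same (2 + b)) ]

    exit : ∀ ρ₃ → ρ₃ b ≡ 0 → ρ₃ (2 + b) ≡ y → ∃ λ ρ₄ → Runs tail ρ₃ ρ₄ × ρ₄ o ≡ y × Frame o b ρ₃ ρ₄
    exit ρ₃ rem acc = _ , (runs-exit b body rem ⨟ runs-asg o _) , trans (update-same ρ₃ o _) acc ,
      λ r _ → update-other ρ₃ o _

    -- The loop state after k of the k + d iterations; whatever runs from there to the end
    -- extends to a run of the whole program.
    loop : ∀ {k v} → Eval (R f g) (k ∷ xs) v → ∀ d → k + d ≡ K →
      ∃ λ ρ₃ → (∀ {ρ₄} → Runs tail ρ₃ ρ₄ → Runs (program (R f g) (i ∷ is) o b) ρ ρ₄) ×
               ρ₃ b ≡ d × ρ₃ (1 + b) ≡ k × ρ₃ (2 + b) ≡ v × (∀ r → r < b → ρ₃ r ≡ ρ r)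
    loop (eR0 f⇓) d eq =
      let ρ₁ = ρ [ b ≔ ρ i ]
          ρ₂ = ρ₁ [ 1 + b ≔ 0 ]
          fr₂ = λ r r<b → trans (update-other ρ₁ (1 + b) 0 (≢-fresh 1 r<b)) (update-other ρ b _ (≢-fresh 0 r<b))
          ρ₃ , run₃ , acc₃ , fr₃ = program-correct f {is = is} {2 + b} {4 + b} {ρ₂} f⇓
            (input-step is xs (inp ∘ suc) (m≤n+m b 4) fr₂) (m≤n+m (3 + b) 1)
      in ρ₃ , (λ t → runs-asg b (same i) ⨟ runs-asg (1 + b) zer ⨟ run₃ ⨟ t) ,
         trans (fr₃ b (m≤n+m (suc b) 3) (≢-sym 2+b≢b)) (trans (update-other ρ₁ (1 + b) 0 (≢-sym 1+b≢b))
           (trans (update-same ρ b _) (trans (proj₂ (inp zero)) (sym eq)))) ,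
         trans (fr₃ (1 + b) (m≤n+m (2 + b) 2) (≢-sym 1+n≢n)) (update-same ρ₁ (1 + b) 0) ,
         acc₃ ,
         λ r r<b → trans (fr₃ r (<-fresh 4 r<b) (≢-fresh 2 r<b)) (fr₂ r r<b)
      where
      1+b≢b : 1 + b ≢ b
      1+b≢b = 1+n≢n
      2+b≢b : 2 + b ≢ b
      2+b≢b e = m≢1+n+m b {1} (sym e)
    loop {suc k} (eRs {r = v₀} ev₀ g⇓) d eq =
      let ρ₃ , ext , rem₃ , cnt₃ , acc₃ , fr₃ = loop ev₀ (suc d) (trans (+-suc k d) eq)
          ρ₄ , run₄ , val₄ , fr₄ = program-correct g {is = 1 + b ∷ 2 + b ∷ is} {3 + b} {4 + b} {ρ₃} g⇓
            (λ { zero → m≤n+m (2 + b) 2 , cnt₃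
               ; (suc zero) → m≤n+m (3 + b) 1 , acc₃
               ; (suc (suc j)) → input-step is xs (inp ∘ suc) (m≤n+m b 4) fr₃ j }) ≤-refl
          ρ₅ = ρ₄ [ 2 + b ≔ ρ₄ (3 + b) ]
          ρ₆ = ρ₅ [ 1 + b ≔ suc (ρ₅ (1 + b)) ]
          ρ₇ = ρ₆ [ b ≔ pred (ρ₆ b) ]
          keep₇ = λ r (n₀ : r ≢ b) (n₁ : r ≢ 1 + b) (n₂ : r ≢ 2 + b) →
                  trans (update-other ρ₆ b (pred (ρ₆ b)) n₀)
                    (trans (update-other ρ₅ (1 + b) (suc (ρ₅ (1 + b))) n₁) (update-other ρ₄ (2 + b) (ρ₄ (3 + b)) n₂))
      in ρ₇ ,
         (λ t → ext (runs-while rem₃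
             (run₄ ⨟ runs-asg (2 + b) (same (3 + b)) ⨟ runs-asg (1 + b) (inc (1 + b)) ⨟ runs-asg b (dec b)) t)) ,
         trans (update-same ρ₆ b _) (cong pred (trans (update-other ρ₅ (1 + b) _ (≢-sym 1+n≢n))
           (trans (update-other ρ₄ (2 + b) _ b≢2+b)
             (trans (fr₄ b (m≤n+m (suc b) 3) b≢3+b) rem₃)))) ,
         trans (update-other ρ₆ b (pred (ρ₆ b)) 1+n≢n) (trans (update-same ρ₅ (1 + b) _)
           (cong suc (trans (update-other ρ₄ (2 + b) _ (≢-sym 1+n≢n))
             (trans (fr₄ (1 + b) (m≤n+m (2 + b) 2) (b≢2+b ∘ suc-injective)) cnt₃)))) ,
         trans (update-other ρ₆ b _ (b≢2+b ∘ sym)) (trans (update-other ρ₅ (1 + b) _ 1+n≢n)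
           (trans (update-same ρ₄ (2 + b) _) val₄)) ,
         λ r r<b → trans (keep₇ r (≢-fresh 0 r<b) (≢-fresh 1 r<b) (≢-fresh 2 r<b))
           (trans (fr₄ r (<-fresh 4 r<b) (≢-fresh 3 r<b)) (fr₃ r r<b))
      where
      b≢2+b : b ≢ 2 + b
      b≢2+b = m≢1+n+m b
      b≢3+b : b ≢ 3 + b
      b≢3+b = m≢1+n+m b
      runs-while : ∀ {ρ₃ ρ₇ ρ₈ d} → ρ₃ b ≡ suc d → Runs body ρ₃ ρ₇ → Runs tail ρ₇ ρ₈ → Runs tail ρ₃ ρ₈
      runs-while = runs-while-++ b body [ asg o (same (2 + b)) ]
  program-correct (M f) {xs} {y} {is} {o} {b} {ρ} (eM f⇓ below) inp o<b =
    let ρ₁ , ext , y₁ , v₁ , fr₁ = search y ≤-refl 0 f⇓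
    in ρ₁ [ o ≔ ρ₁ b ] , ext (runs-exit (1 + b) body v₁ ⨟ runs-asg o (same b)) ,
       trans (update-same ρ₁ o _) y₁ , λ r r<b r≢o → trans (update-other ρ₁ o _ r≢o) (fr₁ r r<b)
    where
    body = [ asg b (inc b) ] ++ program f (b ∷ is) (1 + b) (2 + b)
    tail = while (1 + b) body ++ [ asg o (same b) ]

    evaluate : ∀ ρ₀ z {v} → ρ₀ b ≡ z → (∀ r → r < b → ρ₀ r ≡ ρ r) → Eval f (z ∷ xs) v →
      ∃ λ ρ₁ → Runs (program f (b ∷ is) (1 + b) (2 + b)) ρ₀ ρ₁ × ρ₁ (1 + b) ≡ v × ρ₁ b ≡ z × (∀ r → r < b → ρ₁ r ≡ ρ r)
    evaluate ρ₀ z b₀ fr₀ f⇓ =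
      let ρ₁ , run₁ , v₁ , fr₁ = program-correct f {is = b ∷ is} {1 + b} {2 + b} {ρ₀} f⇓
            (λ { zero → m≤n+m (1 + b) 1 , b₀
               ; (suc j) → input-step is xs inp (m≤n+m b 2) fr₀ j }) ≤-refl
      in ρ₁ , run₁ , v₁ , trans (fr₁ b (m≤n+m (1 + b) 1) (≢-sym 1+n≢n)) b₀ ,
         λ r r<b → trans (fr₁ r (<-fresh 2 r<b) (≢-fresh 1 r<b)) (fr₀ r r<b)

    -- By induction on the candidate: `below` makes the value at every smaller candidate a
    -- successor, so the loop is entered again and reaches the next one.
    search : ∀ z → z ≤ y → ∀ v → Eval f (z ∷ xs) v →
      ∃ λ ρ₁ → (∀ {ρ₂} → Runs tail ρ₁ ρ₂ → Runs (program (M f) is o b) ρ ρ₂) ×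
               ρ₁ b ≡ z × ρ₁ (1 + b) ≡ v × (∀ r → r < b → ρ₁ r ≡ ρ r)
    search zero z≤y v f⇓₀ =
      let ρ₁ , run₁ , v₁ , b₁ , fr₁ = evaluate (ρ [ b ≔ 0 ]) 0 (update-same ρ b 0)
                                        (λ r r<b → update-other ρ b 0 (≢-fresh 0 r<b)) f⇓₀
      in ρ₁ , (λ t → runs-asg b zer ⨟ run₁ ⨟ t) , b₁ , v₁ , fr₁
    search (suc z) z<y v f⇓₀ =
      let v₀ , f⇓₁ = below z z<y
          ρ₀ , ext , b₀ , v₀≡ , fr₀ = search z (<⇒≤ z<y) (suc v₀) f⇓₁
          ρ₁ , run₁ , v₁ , b₁ , fr₁ = evaluate (ρ₀ [ b ≔ suc (ρ₀ b) ]) (suc z)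
            (trans (update-same ρ₀ b _) (cong suc b₀))
            (λ r r<b → trans (update-other ρ₀ b _ (≢-fresh 0 r<b)) (fr₀ r r<b)) f⇓₀
      in ρ₁ , (λ t → ext (runs-while-++ (1 + b) body [ asg o (same b) ] v₀≡ (runs-asg b (inc b) ⨟ run₁) t)) ,
         b₁ , v₁ , fr₁

  programs-correct [] [] inp i≤o o≤b = _ , runs-[] , (λ ()) , λ _ _ → refl
  programs-correct {m = suc m} (g ∷ gs) {xs} {is = is} {o} {i} {b} {ρ} (g⇓ ∷ gs⇓) inp i≤o o≤b =
    let ρ₁ , r₁ , e₁ , fr₁ = program-correct g {is = is} {o} {b} {ρ} g⇓
          (input-step {ρ = ρ} {ρ} is xs inp (≤-trans i≤o (<⇒≤ o<b)) (λ _ _ → refl)) o<b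
        fr₁′ = λ r (r<o : r < o) → fr₁ r (<-trans r<o o<b) (<⇒≢ r<o)
        ρ₂ , r₂ , inp₂ , fr₂ = programs-correct gs {is = is} {suc o} {i} {b} {ρ₁} gs⇓
          (input-step {ρ = ρ} {ρ₁} is xs inp ≤-refl (λ r r<i → fr₁′ r (<-≤-trans r<i i≤o)))
          (m≤n⇒m≤1+n i≤o) (subst (_≤ b) (sym (+-suc m o)) o≤b)
    in ρ₂ , (r₁ ⨟ r₂) ,
       (λ { zero → o<b , trans (fr₂ o ≤-refl) e₁ ; (suc j) → inp₂ j }) ,
       λ r r<o → trans (fr₂ r (m<n⇒m<1+n r<o)) (fr₁′ r r<o)
    where
    o<b : o < b
    o<b = ≤-trans (s≤s (m≤n+m o m)) o≤b

-- Division, codes of lists, and codes of finite sets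

module Codes where

  open import Defs
  open Expressions
  open RegisterMachines
  open import Data.Bool using (if_then_else_)
  open import Data.Fin using (zero; suc; #_)
  open import Data.List as List using (List; []; _∷_)
  open import Data.List.Membership.Propositional using (_∈_)
  open import Data.List.Membership.Propositional.Properties
  open import Data.List.Relation.Unary.Any using (here; there)
  open import Data.Nat
  open import Data.Nat.Properties
  open import Data.Nat.Tactic.RingSolver using (solve-∀)
  open import Data.Product using (_×_; _,_; proj₁; proj₂)
  open import Data.Sum using (inj₁)
  open import Data.Vec as Vec using ([]; _∷_)
  open import Function using (_∘_)
  open import Relation.Binary.PropositionalEquality hiding ([_]; J)
  open import Relation.Nullary using (Dec; yes; no; does; contradiction)
  open import Relation.Nullary.Decidable using (dec-true; dec-false)

  -- If the quotients differed, the two sides would differ by more than a remainder can make up. All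
  -- later decoding of digits, classes and marks rests on this.
  radix-unique : ∀ d {r r′} q q′ → r < d → r′ < d → r + d * q ≡ r′ + d * q′ → r ≡ r′ × q ≡ q′
  radix-unique d zero zero r< r′< eq = (begin _ ≡⟨ lem _ ⟨ _ ≡⟨ eq ⟩ _ ≡⟨ lem _ ⟩ _ ∎) , refl
    where
    open ≡-Reasoning
    lem : ∀ r → r + d * 0 ≡ r
    lem r = trans (cong (r +_) (*-zeroʳ d)) (+-identityʳ r)
  radix-unique d {r} {r′} zero (suc q′) r< r′< eq = contradiction (begin-strict
    r                  <⟨ r< ⟩
    d                  ≤⟨ m≤m*n d (suc q′) ⟩
    d * suc q′         ≤⟨ m≤n+m _ r′ ⟩
    r′ + d * suc q′    ≡⟨ eq ⟨
    r + d * 0          ≡⟨ cong (r +_) (*-zeroʳ d) ⟩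
    r + 0              ≡⟨ +-identityʳ r ⟩
    r                  ∎) (<-irrefl refl)
    where open ≤-Reasoning
  radix-unique d {r} {r′} (suc q) zero r< r′< eq with radix-unique d zero (suc q) r′< r< (sym eq)
  ... | e , ()
  radix-unique d {r} {r′} (suc q) (suc q′) r< r′< eq
    with radix-unique d q q′ r< r′< (+-cancelʳ-≡ d _ _ (trans (lem r q) (trans eq (sym (lem r′ q′)))))
    where
    lem : ∀ r q → r + d * q + d ≡ r + d * suc q
    lem r q = trans (+-assoc r _ d) (cong (r +_) (trans (+-comm _ d) (sym (*-suc d q))))
  ... | e , e′ = e , cong suc e′

  -- Remainder and quotient as counters, written with the same recursion as `mdT` and `dvT`, so that
  -- the semantics of those terms agrees with them by computation.
  md dv : ℕ → ℕ → ℕ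
  md d = natrec 0 (λ k r → if does (suc r ≟ d) then 0 else suc r)
  dv d = natrec 0 (λ k s → if does (suc (md d k) ≟ d) then suc s else s)

  mdT dvT : Tm 2
  mdT = rec (var (# 1)) (lit 0) (ite (lit 1 ⊕ var (# 1) ≐ var (# 2)) (lit 0) (lit 1 ⊕ var (# 1)))
  dvT = rec (var (# 1)) (lit 0)
          (ite (lit 1 ⊕ call mdT (var (# 2) ∷ var zero ∷ []) ≐ var (# 2)) (lit 1 ⊕ var (# 1)) (var (# 1)))

  md-dv : ∀ d n → 0 < d → md d n < d × n ≡ md d n + d * dv d n
  md-dv d zero 0<d = 0<d , sym (*-zeroʳ d)
  md-dv d (suc n) 0<d with md-dv d n 0<d | suc (md d n) ≟ d
  ... | lt , eq | yes e rewrite dec-true (suc (md d n) ≟ d) e =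
    0<d , trans (cong suc eq) (trans (cong (_+ d * dv d n) e) (sym (*-suc d _)))
  ... | lt , eq | no ne rewrite dec-false (suc (md d n) ≟ d) ne = ≤∧≢⇒< lt ne , cong suc eq

  md< : ∀ d n → 0 < d → md d n < d
  md< d n 0<d = proj₁ (md-dv d n 0<d)

  md-digit : ∀ d {r} q → r < d → md d (r + d * q) ≡ r
  md-digit d {r} q r<d with md-dv d (r + d * q) (≤-<-trans z≤n r<d)
  ... | lt , eq = sym (proj₁ (radix-unique d q _ r<d lt eq))

  dv-digit : ∀ d {r} q → r < d → dv d (r + d * q) ≡ q
  dv-digit d {r} q r<d with md-dv d (r + d * q) (≤-<-trans z≤n r<d)
  ... | lt , eq = sym (proj₂ (radix-unique d q _ r<d lt eq))

  -- The cofactors are odd, so common factors 2 can be cancelled until one exponent is 0; then the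
  -- other one is 0 too.
  encList-∷-injective : ∀ x y m n → 2 ^ x * suc (2 * m) ≡ 2 ^ y * suc (2 * n) → x ≡ y × m ≡ n
  encList-∷-injective zero zero m n eq =
    refl , *-cancelˡ-≡ m n 2 (suc-injective (trans (sym (*-identityˡ _)) (trans eq (*-identityˡ _))))
  encList-∷-injective zero (suc y) m n eq =
    contradiction (proj₁ (radix-unique 2 m (2 ^ y * suc (2 * n)) ≤-refl z<s
      (trans (sym (*-identityˡ _)) (trans eq (*-assoc 2 (2 ^ y) _))))) λ ()
  encList-∷-injective (suc x) zero m n eq with encList-∷-injective zero (suc x) n m (sym eq)
  ... | () , _
  encList-∷-injective (suc x) (suc y) m n eq
    with encList-∷-injective x y m n (*-cancelˡ-≡ _ _ 2 (trans (sym (*-assoc 2 (2 ^ x) _)) (trans eq (*-assoc 2 (2 ^ y) _))))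
  ... | refl , e = refl , e

  encList-nonzero : ∀ x xs → encList (x ∷ xs) ≢ 0
  encList-nonzero x xs eq with m*n≡0⇒m≡0∨n≡0 (2 ^ x) eq
  ... | inj₁ e = <⇒≢ (m^n>0 2 x) (sym e)

  encList-injective : ∀ xs ys → encList xs ≡ encList ys → xs ≡ ys
  encList-injective [] [] _ = refl
  encList-injective [] (y ∷ ys) eq = contradiction (sym eq) (encList-nonzero y ys)
  encList-injective (x ∷ xs) [] eq = contradiction eq (encList-nonzero x xs)
  encList-injective (x ∷ xs) (y ∷ ys) eq with encList-∷-injective x y _ _ eq
  ... | refl , e = cong (x ∷_) (encList-injective xs ys e)

  n<2^n : ∀ n → n < 2 ^ n
  n<2^n zero = z<s
  n<2^n (suc n) = begin-strict
    suc n         <⟨ s<s (n<2^n n) ⟩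
    suc (2 ^ n)   ≤⟨ +-monoˡ-≤ (2 ^ n) (m^n>0 2 n) ⟩
    2 ^ n + 2 ^ n ≡⟨ cong (2 ^ n +_) (+-identityʳ (2 ^ n)) ⟨
    2 * 2 ^ n     ∎
    where open ≤-Reasoning

  ∈⇒<encList : ∀ {x xs} → x ∈ xs → x < encList xs
  ∈⇒<encList {xs = x ∷ xs} (here refl) = <-≤-trans (n<2^n x) (m≤m*n (2 ^ x) (suc (2 * encList xs)))
  ∈⇒<encList {x} {y ∷ xs} (there p) = begin-strict
    x                              <⟨ ∈⇒<encList p ⟩
    encList xs                     ≤⟨ m≤m+n _ _ ⟩
    2 * encList xs                 ≤⟨ n≤1+n _ ⟩
    suc (2 * encList xs)           ≤⟨ m≤n*m _ (2 ^ y) ⦃ >-nonZero (m^n>0 2 y) ⦄ ⟩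
    2 ^ y * suc (2 * encList xs)   ∎
    where open ≤-Reasoning

  -- Finite sets of numbers as binary expansions

  bit : ℕ → ℕ → ℕ
  bit e c = md 2 (dv (2 ^ e) c)

  bitT : Tm 2
  bitT = call mdT (lit 2 ∷ call dvT (lit 2 ⇑ var (# 0) ∷ var (# 1) ∷ []) ∷ [])

  binary : (ℕ → ℕ) → ℕ → ℕ
  binary f zero    = 0
  binary f (suc n) = f 0 + 2 * binary (f ∘ suc) n

  dv-2 : ∀ e b c → b < 2 → dv (2 ^ suc e) (b + 2 * c) ≡ dv (2 ^ e) c
  dv-2 e b c b<2 with md-dv (2 ^ e) c (m^n>0 2 e)
  ... | lt , eq = trans (cong (dv (2 ^ suc e)) (trans (cong (λ x → b + 2 * x) eq) (lem b (md (2 ^ e) c) (2 ^ e) (dv (2 ^ e) c))))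
                        (dv-digit (2 ^ suc e) _ low)
    where
    lem : ∀ b m p q → b + 2 * (m + p * q) ≡ b + 2 * m + 2 * p * q
    lem = solve-∀
    low : b + 2 * md (2 ^ e) c < 2 ^ suc e
    low = begin-strict
      b + 2 * md (2 ^ e) c   <⟨ +-monoˡ-< _ b<2 ⟩
      2 + 2 * md (2 ^ e) c   ≡⟨ *-suc 2 (md (2 ^ e) c) ⟨
      2 * suc (md (2 ^ e) c) ≤⟨ *-monoʳ-≤ 2 lt ⟩
      2 ^ suc e              ∎
      where open ≤-Reasoning

  dv-1 : ∀ c → dv 1 c ≡ c
  dv-1 c = trans (cong (dv 1) (sym (+-identityʳ c))) (dv-digit 1 c z<s)

  bit-binary : ∀ f n e → (∀ i → f i < 2) → e < n → bit e (binary f n) ≡ f e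
  bit-binary f (suc n) zero f<2 _ = trans (cong (md 2) (dv-1 (f 0 + 2 * binary (f ∘ suc) n))) (md-digit 2 (binary (f ∘ suc) n) (f<2 0))
  bit-binary f (suc n) (suc e) f<2 (s≤s e<n) =
    trans (cong (md 2) (dv-2 e (f 0) (binary (f ∘ suc) n) (f<2 0))) (bit-binary (f ∘ suc) n e (f<2 ∘ suc) e<n)

  -- A set bit contributes `2 ^ e` to c. Applied to the table it shows that all left and bottom
  -- colours of its tiles are below `a`, which gives the tile set a colour bound computable from
  -- `a`.
  bit⇒< : ∀ e c → bit e c ≡ 1 → e < c
  bit⇒< e c b with md-dv (2 ^ e) c (m^n>0 2 e)
  ... | lt , eq with dv (2 ^ e) c
  ... | suc q = <-≤-trans (n<2^n e) (subst (2 ^ e ≤_) (sym eq) (≤-trans (m≤m*n (2 ^ e) (suc q)) (m≤n+m _ _)))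

  open import Data.List.Membership.DecPropositional _≟_ using (_∈?_)

  χ<2 : ∀ {A : Set} (d : Dec A) → χ d < 2
  χ<2 (yes _) = ≤-refl
  χ<2 (no _)  = z<s

  binary< : ∀ f n → (∀ i → f i < 2) → binary f n < 2 ^ n
  binary< f zero _ = z<s
  binary< f (suc n) f<2 = begin-strict
    f 0 + 2 * binary (f ∘ suc) n   <⟨ +-monoˡ-< _ (f<2 0) ⟩
    2 + 2 * binary (f ∘ suc) n     ≡⟨ *-suc 2 (binary (f ∘ suc) n) ⟨
    2 * suc (binary (f ∘ suc) n)   ≤⟨ *-monoʳ-≤ 2 (binary< (f ∘ suc) n (f<2 ∘ suc)) ⟩
    2 ^ suc n                      ∎
    where open ≤-Reasoning

  abstract

    -- The number is far too large to be unfolded, hence abstract: only soundness and completeness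
    -- are used. The chosen number of bits suffices because each element is below `encList es`.
    table : List ℕ → ℕ
    table es = binary (λ e → χ (e ∈? es)) (suc (encList es))

    table-complete : ∀ {e es} → e ∈ es → bit e (table es) ≡ 1
    table-complete {e} {es} e∈ =
      trans (bit-binary _ (suc (encList es)) e (λ i → χ<2 (i ∈? es)) (m<n⇒m<1+n (∈⇒<encList e∈)))
            (cong (λ b → if b then 1 else 0) (dec-true (e ∈? es) e∈))

    table-sound : ∀ {e es} → bit e (table es) ≡ 1 → e ∈ es
    table-sound {e} {es} b with e ∈? es in eq
    ... | yes p = p
    ... | no e∉ with e <? suc (encList es)
    ...   | yes lt = contradiction (trans (sym b)
                       (trans (bit-binary _ (suc (encList es)) e (λ i → χ<2 (i ∈? es)) lt) (cong χ eq))) λ ()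
    ...   | no ge = contradiction (trans (sym b) zero-above) λ ()
      where
      zero-above : bit e (table es) ≡ 0
      zero-above = cong (md 2) (trans (cong (dv (2 ^ e)) (sym (trans (cong (table es +_) (*-zeroʳ (2 ^ e))) (+-identityʳ _))))
        (dv-digit (2 ^ e) 0 (<-≤-trans (binary< _ (suc (encList es)) (λ i → χ<2 (i ∈? es))) (^-monoʳ-≤ 2 (≮⇒≥ ge)))))

-- Payload tiles: one step of a register machine as a local rule

module PayloadTiles where

  open import Defs
  open Expressions
  open RegisterMachines
  open Codes
  open import Data.Bool using (Bool; true; false; if_then_else_)
  open import Data.Fin using (Fin; zero; suc; toℕ; #_)
  open import Data.List as List using (List; []; _∷_; length)
  open import Data.List.Membership.Propositional.Properties
  open import Data.Maybe using (Maybe; just; nothing)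
  open import Data.Nat
  open import Data.Nat.Properties
  open import Data.Product using (_×_; _,_; proj₁; proj₂)
  open import Data.Sum using (_⊎_; inj₁; inj₂)
  open import Data.Vec as Vec using (Vec; []; _∷_; lookup; tabulate; replicate)
  open import Data.Vec.Properties using (lookup∘tabulate; tabulate-cong)
  open import Function using (_∘_)
  open import Relation.Binary.PropositionalEquality hiding ([_]; J)
  open import Relation.Nullary using (does; contradiction)

  consT : ∀ {n} → Tm n → Tm n → Tm n
  consT x r = lit 2 ⇑ x ⊗ (lit 1 ⊕ lit 2 ⊗ r)

  quad : ℕ → ℕ → ℕ → ℕ → ℕ
  quad l b r t = encList (l ∷ b ∷ r ∷ t ∷ [])

  quad-injective : ∀ {l b r t l′ b′ r′ t′} → quad l b r t ≡ quad l′ b′ r′ t′ → l ≡ l′ × b ≡ b′ × r ≡ r′ × t ≡ t′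
  quad-injective {l} {b} {r} {t} {l′} {b′} {r′} {t′} e
    with encList-injective (l ∷ b ∷ r ∷ t ∷ []) (l′ ∷ b′ ∷ r′ ∷ t′ ∷ []) e
  ... | refl = refl , refl , refl , refl

  -- The variables are the left, bottom, right and top colours of a tile and the number a.
  -- Row 0 writes a + 1 into register 0; the other rows use the transition table coded by a.
  payloadF : Fm 5
  payloadF = call bitT (consT (var (# 0)) (consT (var (# 1)) (consT (var (# 2)) (consT (var (# 3)) (lit 0)))) ∷ var (# 4) ∷ []) ≐ lit 1
    ⩔ (var (# 0) ≐ lit 0 ⩓ var (# 1) ≐ lit 1 ⩓ var (# 2) ≐ var (# 4) ⊕ var (# 4) ⩓ var (# 3) ≐ lit 3)
    -- The left colour `a + k` counts down along row 0. The corner tile sets it to `a + a`, so the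
    -- corner is followed by exactly `a` marks `one` and then by `none`; in all register 0 receives
    -- `a + 1`.
    ⩔ ex (lit 1 ⊕ var (# 4)) (var (# 1) ≐ var (# 5) ⊕ var (# 0) ⩓ var (# 2) ≐ lit 1 ⩓ var (# 3) ≐ var (# 5) ⊕ (var (# 0) ⊖ lit 1)
        ⩓ (lit 0 ≺ var (# 0) ⩓ var (# 4) ≐ lit 4 ⩔ var (# 0) ≐ lit 0 ⩓ var (# 4) ≐ lit 5))

  Payload : ℕ → ℕ → ℕ → ℕ → ℕ → Set
  Payload a l b r t = Holds payloadF (l ∷ b ∷ r ∷ t ∷ a ∷ [])

  srcBound : Src → ℕ
  srcBound zer      = 0
  srcBound (same k) = suc k
  srcBound (inc k)  = suc k
  srcBound (dec k)  = suc k

  instrBound : Instr → ℕ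
  instrBound (asg i s) = suc i + srcBound s
  instrBound (jzf i k) = suc i
  instrBound (jb k)    = 0

  regBound : List Instr → ℕ
  regBound []       = 1
  regBound (c ∷ cs) = instrBound c + regBound cs

  fetch-bound : ∀ cs q {c} → fetch cs q ≡ just c → instrBound c ≤ regBound cs
  fetch-bound (c ∷ cs) zero refl = m≤m+n _ _
  fetch-bound (c ∷ cs) (suc q) e = ≤-trans (fetch-bound cs q e) (m≤n+m _ _)

  fetch< : ∀ cs q {c} → fetch cs q ≡ just c → q < length cs
  fetch< (c ∷ cs) zero e = z<s
  fetch< (c ∷ cs) (suc q) e = s<s (fetch< cs q e)

  next : List Instr → State → State
  next cs s with fetch cs (proj₁ s)
  ... | just c  = execute c s
  ... | nothing = s

  -- A row of the skewed run: n cells already left behind, then the cell with the head, then the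
  -- rest of the tape.
  shape : ∀ {A : Set} → A → A → (ℕ → A) → ℕ → ℕ → A
  shape x y z zero    zero    = y
  shape x y z zero    (suc i) = z i
  shape x y z (suc n) zero    = x
  shape x y z (suc n) (suc i) = shape x y z n i

  module Machine (cs : List Instr) where

    width = regBound cs

    Word : Set
    Word = Vec Bool width

    at : ∀ {m} → Vec Bool m → ℕ → Bool
    at []       _       = false
    at (x ∷ w) zero    = x
    at (x ∷ w) (suc i) = at w i

    -- Registers are unary and lie on parallel tracks: cell p records for each register whether its
    -- value exceeds p. Increments and decrements become shifts of a track, and all zero tests can
    -- be read in cell 0.
    word : Regs → ℕ → Word
    word ρ p = tabulate (λ i → p <ᵇ ρ (toℕ i))

    ones : Word
    ones = replicate _ true

    at-tabulate : ∀ {m} (f : ℕ → Bool) i → i < m → at (tabulate {n = m} (f ∘ toℕ)) i ≡ f i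
    at-tabulate {suc m} f zero    _         = refl
    at-tabulate {suc m} f (suc i) (s≤s i<m) = at-tabulate (f ∘ suc) i i<m

    at-replicate : ∀ m i → i < m → at (replicate m true) i ≡ true
    at-replicate (suc m) zero    _         = refl
    at-replicate (suc m) (suc i) (s≤s i<m) = at-replicate m i i<m

    -- Here x, y and z are the words of the cells p - 1, p and p + 1; `inc` reads the left neighbour
    -- and `dec` the right one.
    transfer : Src → Word → Word → Word → Bool
    transfer zer      x y z = false
    transfer (same k) x y z = at y k
    transfer (inc k)  x y z = at x k
    transfer (dec k)  x y z = at z k

    updated : Instr → Word → Word → Word → Word
    updated (asg i s) x y z = tabulate (λ j → if does (toℕ j ≟ i) then transfer s x y z else lookup y j)
    updated (jzf i k) x y z = y
    updated (jb k)    x y z = y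

    successor : Instr → ℕ → Word → ℕ
    successor (asg i s) q y = suc q
    successor (jzf i k) q y = if at y i then suc q else suc (k + q)
    successor (jb k)    q y = q ∸ k

    -- The bits of all registers to the left of position 0 count as set.
    before : Regs → ℕ → Word
    before ρ zero    = ones
    before ρ (suc p) = word ρ p

    at-word : ∀ ρ p k → k < width → at (word ρ p) k ≡ (p <ᵇ ρ k)
    at-word ρ p k = at-tabulate (λ i → p <ᵇ ρ i) k

    transfer-correct : ∀ s ρ p → srcBound s ≤ width →
      transfer s (before ρ p) (word ρ p) (word ρ (suc p)) ≡ (p <ᵇ source s ρ)
    transfer-correct zer ρ p _ = refl
    transfer-correct (same k) ρ p k<width = at-word ρ p k k<width
    transfer-correct (inc k) ρ zero k<width = at-replicate width k k<width
    transfer-correct (inc k) ρ (suc p) k<width = at-word ρ p k k<width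
    transfer-correct (dec k) ρ p k<width with ρ k in eq
    ... | zero  = trans (at-word ρ (suc p) k k<width) (cong (suc p <ᵇ_) eq)
    ... | suc v = trans (at-word ρ (suc p) k k<width) (cong (suc p <ᵇ_) eq)

    updated-correct : ∀ c q ρ p → instrBound c ≤ width →
      updated c (before ρ p) (word ρ p) (word ρ (suc p)) ≡ word (proj₂ (execute c (q , ρ))) p
    updated-correct (asg i s) q ρ p c≤width = tabulate-cong λ j → bitwise j (does (toℕ j ≟ i))
      where
      bitwise : ∀ (j : Fin width) (b : Bool) →
        (if b then transfer s (before ρ p) (word ρ p) (word ρ (suc p)) else lookup (word ρ p) j)
          ≡ (p <ᵇ (if b then source s ρ else ρ (toℕ j)))
      bitwise j true  = transfer-correct s ρ p (≤-trans (m≤n+m _ (suc i)) c≤width)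
      bitwise j false = lookup∘tabulate _ j
    updated-correct (jzf i k) q ρ p _ = refl
    updated-correct (jb k) q ρ p _ = refl

    successor-correct : ∀ c q ρ → instrBound c ≤ width → successor c q (word ρ 0) ≡ proj₁ (execute c (q , ρ))
    successor-correct (asg i s) q ρ _ = refl
    successor-correct (jzf i k) q ρ i<width = trans (cong (λ b → if b then suc q else suc (k + q)) (at-word ρ 0 i i<width)) (lemma (ρ i))
      where
      lemma : ∀ v → (if 0 <ᵇ v then suc q else suc (k + q)) ≡ jump v k q
      lemma zero    = refl
      lemma (suc v) = refl
    successor-correct (jb k) q ρ _ = refl

    -- Vertical wires carry a cell with the head (`hd`) or without it (`bd`). Horizontal wires carry
    -- the state together with the last one (`c₁`) or two (`c₂`) words seen. `start`, `one` and
    -- `none` are the cells that row 0 writes.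
    data Colour : Set where
      wall ground dead start one none : Colour
      hd c₁ : ℕ → Word → Colour
      bd : Word → Colour
      c₂ : ℕ → Word → Word → Colour

    bits : ∀ {m} → Vec Bool m → List ℕ
    bits []          = []
    bits (true ∷ w)  = 1 ∷ bits w
    bits (false ∷ w) = 0 ∷ bits w

    bits-injective : ∀ {m} (v w : Vec Bool m) → bits v ≡ bits w → v ≡ w
    bits-injective [] [] _ = refl
    bits-injective (true ∷ v) (true ∷ w) e = cong (true ∷_) (bits-injective v w (cong (List.drop 1) e))
    bits-injective (false ∷ v) (false ∷ w) e = cong (false ∷_) (bits-injective v w (cong (List.drop 1) e))
    bits-injective (true ∷ v) (false ∷ w) ()
    bits-injective (false ∷ v) (true ∷ w) ()

    number : Word → ℕ
    number w = encList (bits w)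

    number-injective : ∀ {v w} → number v ≡ number w → v ≡ w
    number-injective {v} {w} e = bits-injective v w (encList-injective _ _ e)

    -- The numbers 0, 1, 3, 4 and 5 occur literally in `payloadF`, so the codes below 6 must be the
    -- same for all programs.
    cd : Colour → ℕ
    cd wall       = 0
    cd ground     = 1
    cd dead       = 2
    cd start      = 3
    cd one        = 4
    cd none       = 5
    cd (hd q w)   = 6 + encList (0 ∷ q ∷ number w ∷ [])
    cd (bd w)     = 6 + encList (1 ∷ number w ∷ [])
    cd (c₁ q w)   = 6 + encList (2 ∷ q ∷ number w ∷ [])
    cd (c₂ q v w) = 6 + encList (3 ∷ q ∷ number v ∷ number w ∷ [])

    tag : Colour → ℕ
    tag (hd _ _)   = 0
    tag (bd _)     = 1
    tag (c₁ _ _)   = 2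
    tag (c₂ _ _ _) = 3
    tag _          = 4

    items : Colour → List ℕ
    items (hd q w)   = q ∷ number w ∷ []
    items (bd w)     = number w ∷ []
    items (c₁ q w)   = q ∷ number w ∷ []
    items (c₂ q v w) = q ∷ number v ∷ number w ∷ []
    items _          = []

    decode : ∀ x → cd x < 6 ⊎ cd x ≡ 6 + encList (tag x ∷ items x)
    decode wall = inj₁ (s≤s z≤n)
    decode ground = inj₁ (s≤s (s≤s z≤n))
    decode dead = inj₁ (s≤s (s≤s (s≤s z≤n)))
    decode start = inj₁ (s≤s (s≤s (s≤s (s≤s z≤n))))
    decode one = inj₁ (s≤s (s≤s (s≤s (s≤s (s≤s z≤n)))))
    decode none = inj₁ (s≤s (s≤s (s≤s (s≤s (s≤s (s≤s z≤n))))))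
    decode (hd _ _) = inj₂ refl
    decode (bd _) = inj₂ refl
    decode (c₁ _ _) = inj₂ refl
    decode (c₂ _ _ _) = inj₂ refl

    small : ∀ {k} m → k < 6 → k ≢ 6 + m
    small m k<6 refl = <⇒≱ k<6 (m≤m+n 6 m)

    big-injective : ∀ {xs ys} → 6 + encList xs ≡ 6 + encList ys → xs ≡ ys
    big-injective e = encList-injective _ _ (+-cancelˡ-≡ 6 _ _ e)

    fromCode : ℕ → Colour
    fromCode 0 = wall
    fromCode 1 = ground
    fromCode 2 = dead
    fromCode 3 = start
    fromCode 4 = one
    fromCode _ = none

    cd-injective : ∀ x y → cd x ≡ cd y → x ≡ y
    cd-injective x y e with decode x | decode y
    ... | inj₁ p | inj₁ q = trans (sym (back x p)) (trans (cong fromCode e) (back y q))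
      where
      back : ∀ x → cd x < 6 → fromCode (cd x) ≡ x
      back wall _ = refl
      back ground _ = refl
      back dead _ = refl
      back start _ = refl
      back one _ = refl
      back none _ = refl
      back (hd _ _) p = contradiction refl (small _ p)
      back (bd _) p = contradiction refl (small _ p)
      back (c₁ _ _) p = contradiction refl (small _ p)
      back (c₂ _ _ _) p = contradiction refl (small _ p)
    ... | inj₁ p | inj₂ q = contradiction (trans e q) (small _ p)
    ... | inj₂ p | inj₁ q = contradiction (trans (sym e) p) (small _ q)
    ... | inj₂ p | inj₂ q = same-items x y (big-injective (trans (sym p) (trans e q))) p q
      where
      same-items : ∀ x y → tag x ∷ items x ≡ tag y ∷ items y →
        cd x ≡ 6 + encList (tag x ∷ items x) → cd y ≡ 6 + encList (tag y ∷ items y) → x ≡ y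
      same-items (hd q w) (hd q′ w′) e _ _ with number w in eq | number w′ in eq′
      same-items (hd q w) (hd q′ w′) refl _ _ | _ | _ = cong (hd q) (number-injective (trans eq (sym eq′)))
      same-items (bd w) (bd w′) e _ _ with number w in eq | number w′ in eq′
      same-items (bd w) (bd w′) refl _ _ | _ | _ = cong bd (number-injective (trans eq (sym eq′)))
      same-items (c₁ q w) (c₁ q′ w′) e _ _ with number w in eq | number w′ in eq′
      same-items (c₁ q w) (c₁ q′ w′) refl _ _ | _ | _ = cong (c₁ q) (number-injective (trans eq (sym eq′)))
      same-items (c₂ q v w) (c₂ q′ v′ w′) e _ _ with number w in eq | number w′ in eq′ | number v in ev | number v′ in ev′
      same-items (c₂ q v w) (c₂ q′ v′ w′) refl _ _ | _ | _ | _ | _ =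
        cong₂ (c₂ q) (number-injective (trans ev (sym ev′))) (number-injective (trans eq (sym eq′)))
      same-items wall y e p q = contradiction p λ ()
      same-items ground y e p q = contradiction p (small {1} _ (s≤s (s≤s z≤n)))
      same-items dead y e p q = contradiction p (small {2} _ (s≤s (s≤s (s≤s z≤n))))
      same-items start y e p q = contradiction p (small {3} _ (s≤s (s≤s (s≤s (s≤s z≤n)))))
      same-items one y e p q = contradiction p (small {4} _ (s≤s (s≤s (s≤s (s≤s (s≤s z≤n))))))
      same-items none y e p q = contradiction p (small {5} _ (s≤s (s≤s (s≤s (s≤s (s≤s (s≤s z≤n)))))))
      same-items _ wall e p q = contradiction q λ ()
      same-items _ ground e p q = contradiction q (small {1} _ (s≤s (s≤s z≤n)))
      same-items _ dead e p q = contradiction q (small {2} _ (s≤s (s≤s (s≤s z≤n))))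
      same-items _ start e p q = contradiction q (small {3} _ (s≤s (s≤s (s≤s (s≤s z≤n)))))
      same-items _ one e p q = contradiction q (small {4} _ (s≤s (s≤s (s≤s (s≤s (s≤s z≤n))))))
      same-items _ none e p q = contradiction q (small {5} _ (s≤s (s≤s (s≤s (s≤s (s≤s (s≤s z≤n)))))))

    first rest : Word
    first = tabulate (λ i → toℕ i ≡ᵇ 0)
    rest  = tabulate (λ _ → false)

    -- The cells of the initial configuration have words whose length depends on the program. A
    -- fixed formula cannot name them, so row 0 writes aliases that are translated here.
    norm : Colour → Colour
    norm start = hd 0 first
    norm one   = bd first
    norm none  = bd rest
    norm x     = x

    -- When the word z of a cell is seen, the words x and y of its predecessors have come along the
    -- row, so the new word of the cell y can be written above z. This shifts the configuration by
    -- one column and makes the right and top colours functions of the other two. A state without an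
    -- instruction has no tile.
    δ′ : Colour → Colour → Maybe (Colour × Colour)
    δ′ wall dead = just (wall , dead)
    δ′ wall (hd q y) with fetch cs q
    ... | just c  = just (c₁ q y , dead)
    ... | nothing = nothing
    δ′ (c₁ q y) (bd z) with fetch cs q
    ... | just c  = just (c₂ q y z , hd (successor c q y) (updated c ones y z))
    ... | nothing = nothing
    δ′ (c₂ q x y) (bd z) with fetch cs q
    ... | just c  = just (c₂ q y z , bd (updated c x y z))
    ... | nothing = nothing
    δ′ _ _ = nothing

    δ : Colour → Colour → Maybe (Colour × Colour)
    δ l b = δ′ l (norm b)

-- The table of a program and the quadrant tiled by its run

module Simulations where

  open import Defs
  open Expressions
  open RegisterMachines
  open Codes
  open PayloadTiles
  open import Data.Bool using (Bool; true; false; if_then_else_; T)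
  open import Data.Empty using (⊥)
  open import Data.Fin using (zero; suc; toℕ)
  open import Data.List as List using (List; []; _∷_; _++_; length; [_]; concatMap; upTo)
  open import Data.List.Membership.Propositional using (_∈_; find; lose)
  open import Data.List.Membership.Propositional.Properties
  open import Data.List.Relation.Unary.Any using (here; there)
  open import Data.Maybe using (Maybe; just; nothing)
  open import Data.Maybe.Properties using (just-injective)
  open import Data.Nat
  open import Data.Nat.Properties
  open import Data.Product using (∃; _×_; _,_; proj₁; proj₂)
  open import Data.Sum using (_⊎_; inj₁; inj₂)
  open import Data.Vec as Vec using (Vec; []; _∷_)
  open import Data.Vec.Properties using (tabulate-cong)
  open import Function using (_∘_)
  open import Relation.Binary.PropositionalEquality hiding ([_]; J)
  open import Relation.Nullary using (¬_; contradiction)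

  words : ∀ m → List (Vec Bool m)
  words zero    = [ [] ]
  words (suc m) = List.map (true ∷_) (words m) ++ List.map (false ∷_) (words m)

  ∈-words : ∀ {m} (w : Vec Bool m) → w ∈ words m
  ∈-words [] = here refl
  ∈-words (true ∷ w)  = ∈-++⁺ˡ (∈-map⁺ _ (∈-words w))
  ∈-words (false ∷ w) = ∈-++⁺ʳ (List.map (true ∷_) (words _)) (∈-map⁺ _ (∈-words w))

  ∈-concatMap : ∀ {A B : Set} (f : A → List B) {xs x y} → x ∈ xs → y ∈ f x → y ∈ concatMap f xs
  ∈-concatMap f x∈ y∈ = ∈-concatMap⁺ f (lose x∈ y∈)

  next-just : ∀ cs s {c} → fetch cs (proj₁ s) ≡ just c → next cs s ≡ execute c s
  next-just cs s eq rewrite eq = refl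

  concatMap-∈ : ∀ {A B : Set} (f : A → List B) xs {y} → y ∈ concatMap f xs → ∃ λ x → y ∈ f x
  concatMap-∈ f xs y∈ = let x , _ , y∈f = find (∈-concatMap⁻ f {xs = xs} y∈) in x , y∈f

  module Simulation (cs : List Instr) where

    open Machine cs

    stateColours : ℕ → List Colour
    stateColours q = List.map (hd q) (words width) ++ List.map (c₁ q) (words width) ++
                     concatMap (λ v → List.map (c₂ q v) (words width)) (words width)

    colours : List Colour
    colours = wall ∷ ground ∷ dead ∷ start ∷ one ∷ none ∷ List.map bd (words width) ++ concatMap stateColours (upTo (length cs))

    ∈-state : ∀ {q x} → q < length cs → x ∈ stateColours q → x ∈ colours
    ∈-state q< x∈ = there (there (there (there (there (there
      (∈-++⁺ʳ (List.map bd (words width)) (∈-concatMap stateColours (∈-upTo⁺ q<) x∈)))))))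

    ∈-hd : ∀ {q} w → q < length cs → hd q w ∈ colours
    ∈-hd w q< = ∈-state q< (∈-++⁺ˡ (∈-map⁺ _ (∈-words w)))

    ∈-c₁ : ∀ {q} w → q < length cs → c₁ q w ∈ colours
    ∈-c₁ {q} w q< = ∈-state q< (∈-++⁺ʳ (List.map (hd q) (words width)) (∈-++⁺ˡ (∈-map⁺ _ (∈-words w))))

    ∈-c₂ : ∀ {q} v w → q < length cs → c₂ q v w ∈ colours
    ∈-c₂ {q} v w q< = ∈-state q< (∈-++⁺ʳ (List.map (hd q) (words width)) (∈-++⁺ʳ (List.map (c₁ q) (words width))
      (∈-concatMap _ (∈-words v) (∈-map⁺ _ (∈-words w)))))

    ∈-bd : ∀ w → bd w ∈ colours
    ∈-bd w = there (there (there (there (there (there (∈-++⁺ˡ (∈-map⁺ bd (∈-words w))))))))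

    entry : Colour → Colour → Maybe (Colour × Colour) → List ℕ
    entry l b (just (r , t)) = [ quad (cd l) (cd b) (cd r) (cd t) ]
    entry l b nothing        = []

    cell : Colour → Colour → List ℕ
    cell l b = entry l b (δ l b)

    row : Colour → List ℕ
    row l = concatMap (cell l) colours

    entries : List ℕ
    entries = concatMap row colours

    ∈-entry : ∀ {l b m e} → e ∈ entry l b m → ∃ λ r → ∃ λ t → m ≡ just (r , t) × e ≡ quad (cd l) (cd b) (cd r) (cd t)
    ∈-entry {m = just (r , t)} (here refl) = r , t , refl , refl

    -- Keeps the table out of row 0, whose bottom colour is `ground`: there only the two literal
    -- clauses of `payloadF` apply.
    δ-ground : ∀ l → δ l ground ≡ nothing
    δ-ground wall = refl
    δ-ground ground = refl
    δ-ground dead = refl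
    δ-ground start = refl
    δ-ground one = refl
    δ-ground none = refl
    δ-ground (hd _ _) = refl
    δ-ground (c₁ _ _) = refl
    δ-ground (bd _) = refl
    δ-ground (c₂ _ _ _) = refl

    a : ℕ
    a = table entries

    entries-complete : ∀ {l b r t} → l ∈ colours → b ∈ colours → δ l b ≡ just (r , t) →
                       bit (quad (cd l) (cd b) (cd r) (cd t)) a ≡ 1
    entries-complete {l} {b} {r} {t} l∈ b∈ eq = table-complete {quad (cd l) (cd b) (cd r) (cd t)} {entries}
      (∈-concatMap row l∈ (∈-concatMap (cell l) b∈
        (subst (λ m → quad (cd l) (cd b) (cd r) (cd t) ∈ entry l b m) (sym eq) (here refl))))

    ∈-entries : ∀ {e} → e ∈ entries → ∃ λ l → ∃ λ b → ∃ λ r → ∃ λ t →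
                δ l b ≡ just (r , t) × e ≡ quad (cd l) (cd b) (cd r) (cd t)
    ∈-entries {e} e∈ =
      let l , p  = concatMap-∈ row colours e∈
          b , p′ = concatMap-∈ (cell l) colours p
          r , t , eq , q = ∈-entry {l} {b} {δ l b} {e} p′
      in l , b , r , t , eq , q

    entries-sound : ∀ {l b r t} → bit (quad l b r t) a ≡ 1 → ∃ λ l′ → ∃ λ b′ → ∃ λ r′ → ∃ λ t′ →
                    δ l′ b′ ≡ just (r′ , t′) × l ≡ cd l′ × b ≡ cd b′ × r ≡ cd r′ × t ≡ cd t′
    entries-sound {l} {b} {r} {t} e =
      let l′ , b′ , r′ , t′ , eq , q = ∈-entries {quad l b r t} (table-sound {quad l b r t} {entries} e)
      in l′ , b′ , r′ , t′ , eq , quad-injective {l} {b} {r} {t} {cd l′} {cd b′} {cd r′} {cd t′} q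

    bit-bounds : ∀ {l b r t} → bit (quad l b r t) a ≡ 1 → l < a × b < a
    bit-bounds {l} {b} {r} {t} e =
      <-trans (∈⇒<encList {l} {xs} (here refl)) q<a , <-trans (∈⇒<encList {b} {xs} (there (here refl))) q<a
      where
      xs = l ∷ b ∷ r ∷ t ∷ []
      q<a = bit⇒< (quad l b r t) a e

    -- Every table contains the tile with `wall` and `dead`. Positivity separates the left colours
    -- `a + k` of row 0 from the colour 0 of its corner.
    a>0 : 0 < a
    a>0 = proj₁ (bit-bounds {0} {2} {0} {2} (entries-complete {wall} {dead} {wall} {dead} (here refl) (there (there (here refl))) refl))

    initial : Regs
    initial zero    = suc a
    initial (suc _) = 0

    conf : ℕ → State
    conf zero    = 0 , initial
    conf (suc n) = next cs (conf n)

    wordAt : ℕ → ℕ → Word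
    wordAt n = word (proj₂ (conf n))

    -- `Hc` switches one column after `Vc`, since the edge entering the head cell from the left is
    -- still `wall`.
    Hc Vc : ℕ → ℕ → Colour
    Hc n = shape wall (c₁ q (w 0)) (λ p → c₂ q (w p) (w (suc p))) (suc n)
      where q = proj₁ (conf n)
            w = wordAt n
    Vc n = shape dead (hd (proj₁ (conf n)) (wordAt n 0)) (λ p → bd (wordAt n (suc p))) n

    init : ℕ → Colour
    init zero    = start
    init (suc i) = if i <ᵇ a then one else none

    VC : ℕ → ℕ → Colour
    VC zero    = init
    VC (suc n) = Vc (suc n)

    H₀ : ℕ → ℕ
    H₀ zero    = 0
    H₀ (suc i) = a + (a ∸ i)

    H V : ℕ → ℕ → ℕ
    H i zero    = H₀ i
    H i (suc n) = cd (Hc n i)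
    V i zero    = 1
    V i (suc n) = cd (VC n i)

    norm-VC : ∀ n i → norm (VC n i) ≡ Vc n i
    norm-VC zero zero = cong (hd 0) (tabulate-cong λ j → lem (toℕ j))
      where
      lem : ∀ k → (k ≡ᵇ 0) ≡ (0 <ᵇ initial k)
      lem zero    = refl
      lem (suc k) = refl
    norm-VC zero (suc i) with i <ᵇ a in eq
    ... | true  = cong bd (tabulate-cong λ j → lem (toℕ j))
      where
      lem : ∀ k → (k ≡ᵇ 0) ≡ (suc i <ᵇ initial k)
      lem zero    = sym eq
      lem (suc k) = refl
    ... | false = cong bd (tabulate-cong λ j → lem (toℕ j))
      where
      lem : ∀ k → false ≡ (suc i <ᵇ initial k)
      lem zero    = sym eq
      lem (suc k) = refl
    norm-VC (suc n) i = norm-shape (λ p → wordAt (suc n) (suc p)) (suc n) i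
      where
      norm-shape : ∀ {q w} (z : ℕ → Word) m i → norm (shape dead (hd q w) (λ p → bd (z p)) m i) ≡ shape dead (hd q w) (λ p → bd (z p)) m i
      norm-shape z zero zero = refl
      norm-shape z zero (suc i) = refl
      norm-shape z (suc m) zero = refl
      norm-shape z (suc m) (suc i) = norm-shape z m i

    δ-step : ∀ n {c} → fetch cs (proj₁ (conf n)) ≡ just c → ∀ i → δ′ (Hc n i) (Vc n i) ≡ just (Hc n (suc i) , Vc (suc n) i)
    δ-step n {c} eq i = subst (λ s → δ′ (Hc n i) (Vc n i) ≡ just (Hc n (suc i) ,
        shape dead (hd (proj₁ s) (word (proj₂ s) 0)) (λ p → bd (word (proj₂ s) (suc p))) (suc n) i)) (sym next≡) (go n i)
      where
      q = proj₁ (conf n)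
      ρ = proj₂ (conf n)
      w = word ρ
      s = execute c (q , ρ)
      c≤ = fetch-bound cs q eq
      next≡ : next cs (conf n) ≡ s
      next≡ = next-just cs (conf n) eq
      C₂ = λ p → c₂ q (w p) (w (suc p))
      W = λ p → bd (w (suc p))
      go : ∀ m i → δ′ (shape wall (c₁ q (w 0)) C₂ (suc m) i) (shape dead (hd q (w 0)) W m i) ≡
        just (shape wall (c₁ q (w 0)) C₂ (suc m) (suc i) ,
              shape dead (hd (proj₁ s) (word (proj₂ s) 0)) (λ p → bd (word (proj₂ s) (suc p))) (suc m) i)
      go zero zero rewrite eq = refl
      go zero (suc zero) rewrite eq = cong₂ (λ q′ w′ → just (C₂ 0 , hd q′ w′)) (successor-correct c q ρ c≤) (updated-correct c q ρ 0 c≤)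
      go zero (suc (suc p)) rewrite eq = cong (λ w′ → just (C₂ (suc p) , bd w′)) (updated-correct c q ρ (suc p) c≤)
      go (suc m) zero = refl
      go (suc m) (suc i) = go m i

    δ-stuck : ∀ n → fetch cs (proj₁ (conf n)) ≡ nothing → δ′ (Hc n n) (Vc n n) ≡ nothing
    δ-stuck n eq = go n
      where
      go : ∀ m → δ′ (shape wall (c₁ (proj₁ (conf n)) (wordAt n 0)) (λ p → c₂ (proj₁ (conf n)) (wordAt n p) (wordAt n (suc p))) (suc m) m)
                    (shape dead (hd (proj₁ (conf n)) (wordAt n 0)) (λ p → bd (wordAt n (suc p))) m m) ≡ nothing
      go zero rewrite eq = refl
      go (suc m) = go m

    -- With an instruction at hand `δ-step` names the only outcome. After halting, tiles exist only
    -- to the left of the head, where they consist of `wall` and `dead` in every row.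
    δ-det : ∀ n i {r t} → δ′ (Hc n i) (Vc n i) ≡ just (r , t) → r ≡ Hc n (suc i) × t ≡ Vc (suc n) i
    δ-det n i {r} {t} e = cases (fetch cs (proj₁ (conf n))) refl
      where
      s = next cs (conf n)
      C₂ = λ p → c₂ (proj₁ (conf n)) (wordAt n p) (wordAt n (suc p))
      go : fetch cs (proj₁ (conf n)) ≡ nothing → ∀ m i → δ′ (shape wall (c₁ (proj₁ (conf n)) (wordAt n 0)) C₂ (suc m) i)
                      (shape dead (hd (proj₁ (conf n)) (wordAt n 0)) (λ p → bd (wordAt n (suc p))) m i) ≡ just (r , t) →
           r ≡ shape wall (c₁ (proj₁ (conf n)) (wordAt n 0)) C₂ (suc m) (suc i) ×
           t ≡ shape dead (hd (proj₁ s) (word (proj₂ s) 0)) (λ p → bd (word (proj₂ s) (suc p))) (suc m) i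
      go eq zero zero e rewrite eq = contradiction e λ ()
      go eq zero (suc zero) e rewrite eq = contradiction e λ ()
      go eq zero (suc (suc i)) e rewrite eq = contradiction e λ ()
      go eq (suc m) zero refl = refl , refl
      go eq (suc m) (suc i) e = go eq m i e
      cases : ∀ f → fetch cs (proj₁ (conf n)) ≡ f → r ≡ Hc n (suc i) × t ≡ Vc (suc n) i
      cases (just c) eq with just-injective (trans (sym e) (δ-step n eq i))
      ... | refl = refl , refl
      cases nothing eq = go eq n i e

    shape-all : ∀ {Φ : Colour → Set} {x y z} → Φ x → Φ y → (∀ p → Φ (z p)) → ∀ m i → Φ (shape x y z m i)
    shape-all px py pz zero zero = py
    shape-all px py pz zero (suc i) = pz i
    shape-all px py pz (suc m) zero = px
    shape-all {Φ} px py pz (suc m) (suc i) = shape-all {Φ} px py pz m i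

    init-all : ∀ {Φ : Colour → Set} → Φ start → Φ one → Φ none → ∀ i → Φ (init i)
    init-all s o n zero = s
    init-all s o n (suc i) with i <ᵇ a
    ... | true = o
    ... | false = n

    VC≢ground : ∀ n i → VC n i ≢ ground
    VC≢ground zero = init-all {λ x → x ≢ ground} (λ ()) (λ ()) (λ ())
    VC≢ground (suc n) = shape-all {λ x → x ≢ ground} (λ ()) (λ ()) (λ _ ()) (suc n)

    V≢1 : ∀ n i → V i (suc n) ≢ 1
    V≢1 n i e = VC≢ground n i (cd-injective _ ground e)

    H0≢0 : ∀ i → H (suc i) 0 ≢ 0
    H0≢0 i e = <⇒≢ a>0 (sym (m+n≡0⇒m≡0 a e))

    no-ground : ∀ {l r t} → bit (quad l 1 r t) a ≢ 1
    no-ground {l} {r} {t} e = go (entries-sound {l} {1} {r} {t} e)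
      where
      go : (∃ λ l′ → ∃ λ b′ → ∃ λ r′ → ∃ λ t′ → δ l′ b′ ≡ just (r′ , t′) × l ≡ cd l′ × 1 ≡ cd b′ × r ≡ cd r′ × t ≡ cd t′) → ⊥
      go (l′ , b′ , _ , _ , eq , _ , b≡ , _) =
        contradiction (trans (sym (δ-ground l′)) (trans (cong (δ l′) (cd-injective ground b′ b≡)) eq)) λ ()

    sound : ∀ l b {r t} → bit (quad (cd l) (cd b) r t) a ≡ 1 → ∃ λ r′ → ∃ λ t′ → δ l b ≡ just (r′ , t′) × r ≡ cd r′ × t ≡ cd t′
    sound l b {r} {t} e =
      let l′ , b′ , r′ , t′ , eq , l≡ , b≡ , rest = entries-sound {cd l} {cd b} {r} {t} e
      in r′ , t′ , trans (cong₂ δ (cd-injective l l′ l≡) (cd-injective b b′ b≡)) eq , rest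

    -- The clauses of `payloadF` never compete: bottom colour 1 occurs in row 0 only, and there left
    -- colour 0 separates the corner from the countdown.
    deterministic : ∀ i j {r t} → Payload a (H i j) (V i j) r t → r ≡ H (suc i) j × t ≡ V i (suc j)
    deterministic i zero {r} {t} (inj₁ e) = contradiction e (no-ground {H i 0} {r} {t})
    deterministic i (suc n) {r} {t} (inj₁ e) =
      let r′ , t′ , eq , r≡ , t≡ = sound (Hc n i) (VC n i) {r} {t} e
          r′≡ , t′≡ = δ-det n i (trans (cong (δ′ (Hc n i)) (sym (norm-VC n i))) eq)
          t″ : Vc (suc n) i ≡ VC (suc n) i
          t″ = refl
      in trans r≡ (cong cd r′≡) , trans t≡ (cong cd (trans t′≡ t″))
    deterministic zero zero (inj₂ (inj₁ (_ , _ , r≡ , t≡))) = r≡ , t≡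
    deterministic (suc i) zero (inj₂ (inj₁ (l≡ , _))) = contradiction l≡ (H0≢0 i)
    deterministic i (suc n) (inj₂ (inj₁ (_ , b≡ , _))) = contradiction b≡ (V≢1 n i)
    deterministic zero zero (inj₂ (inj₂ (k , _ , l≡ , _))) = contradiction (m+n≡0⇒m≡0 a (sym l≡)) (<⇒≢ a>0 ∘ sym)
    deterministic (suc i) zero (inj₂ (inj₂ (k , _ , l≡ , _ , r≡ , t≡))) with +-cancelˡ-≡ a _ _ l≡
    ... | refl = trans r≡ (cong (a +_) (pred[m∸n]≡m∸[1+n] a i)) , top t≡
      where
      top : ∀ {t} → 0 < a ∸ i × t ≡ 4 ⊎ a ∸ i ≡ 0 × t ≡ 5 → t ≡ cd (if i <ᵇ a then one else none)
      top (inj₁ (p , refl)) with i <ᵇ a in eq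
      ... | true = refl
      ... | false = contradiction p (≤⇒≯ (≤-reflexive (m≤n⇒m∸n≡0 (≮⇒≥ {i} {a} λ lt → subst T eq (<⇒<ᵇ {i} {a} lt)))))
      top (inj₂ (p , refl)) with i <ᵇ a in eq
      ... | true = contradiction p (m>n⇒m∸n≢0 (<ᵇ⇒< i a (subst T (sym eq) _)))
      ... | false = refl
    deterministic i (suc n) (inj₂ (inj₂ (k , _ , _ , b≡ , _))) = contradiction b≡ (V≢1 n i)

    -- Row n + 1 of tiles performs step n, because row 0 only writes the input; the skew has moved
    -- the head to column n by then.
    stuck-no-tile : ∀ n → fetch cs (proj₁ (conf n)) ≡ nothing → ∀ {r t} → ¬ Payload a (H n (suc n)) (V n (suc n)) r t
    stuck-no-tile n eq {r} {t} (inj₁ e) =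
      let _ , _ , eq′ , _ = sound (Hc n n) (VC n n) {r} {t} e
      in contradiction (trans (sym (δ-stuck n eq)) (trans (cong (δ′ (Hc n n)) (sym (norm-VC n n))) eq′)) λ ()
    stuck-no-tile n eq (inj₂ (inj₁ (_ , b≡ , _))) = V≢1 n n b≡
    stuck-no-tile n eq (inj₂ (inj₂ (k , _ , _ , b≡ , _))) = V≢1 n n b≡

    module _ (live : ∀ n → fetch cs (proj₁ (conf n)) ≢ nothing) where

      instr : ∀ n → ∃ λ c → fetch cs (proj₁ (conf n)) ≡ just c
      instr n with fetch cs (proj₁ (conf n)) in eq
      ... | just c  = c , refl
      ... | nothing = contradiction eq (live n)

      table-tile : ∀ i n → bit (quad (H i (suc n)) (V i (suc n)) (H (suc i) (suc n)) (V i (suc (suc n)))) a ≡ 1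
      table-tile i n = entries-complete {Hc n i} {VC n i} {Hc n (suc i)} {Vc (suc n) i}
          (shape-all {_∈ colours} (here refl) (∈-c₁ _ q<) (λ p → ∈-c₂ _ _ q<) (suc n) i) (VC∈ n refl)
          (trans (cong (δ′ (Hc n i)) (norm-VC n i)) (δ-step n (proj₂ (instr n)) i))
        where
        q< = fetch< cs _ (proj₂ (instr n))
        VC∈ : ∀ m → m ≡ n → VC m i ∈ colours
        VC∈ zero _ = init-all {_∈ colours} (there (there (there (here refl)))) (there (there (there (there (here refl)))))
                       (there (there (there (there (there (here refl)))))) i
        VC∈ (suc m) refl = shape-all {_∈ colours} (there (there (here refl))) (∈-hd _ q<) (λ p → ∈-bd _) (suc m) i

      live-tile : ∀ i j → Payload a (H i j) (V i j) (H (suc i) j) (V i (suc j))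
      live-tile zero zero = inj₂ (inj₁ (refl , refl , refl , refl))
      live-tile (suc i) zero = inj₂ (inj₂ (a ∸ i , s≤s (m∸n≤m a i) , refl , refl , cong (a +_) (sym (pred[m∸n]≡m∸[1+n] a i)) , top))
        where
        top : 0 < a ∸ i × cd (if i <ᵇ a then one else none) ≡ 4 ⊎ a ∸ i ≡ 0 × cd (if i <ᵇ a then one else none) ≡ 5
        top with i <ᵇ a in eq
        ... | true = inj₁ (m<n⇒0<n∸m (<ᵇ⇒< i a (subst T (sym eq) _)) , refl)
        ... | false = inj₂ (m≤n⇒m∸n≡0 (≮⇒≥ {i} {a} λ lt → subst T eq (<⇒<ᵇ {i} {a} lt)) , refl)
      live-tile i (suc n) = inj₁ (table-tile i n)

      tile-bounds : ∀ i n → H i (suc n) < a × V i (suc n) < a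
      tile-bounds i n = bit-bounds {H i (suc n)} {V i (suc n)} {H (suc i) (suc n)} {V i (suc (suc n))} (table-tile i n)

      H-bound : ∀ i j → H i j ≤ a + a
      H-bound zero zero = z≤n
      H-bound (suc i) zero = +-monoʳ-≤ a (m∸n≤m a i)
      H-bound i (suc n) = ≤-trans (<⇒≤ (proj₁ (tile-bounds i n))) (m≤m+n a a)

      V-bound : ∀ i j → V i j ≤ a + a
      V-bound i zero = ≤-trans a>0 (m≤m+n a a)
      V-bound i (suc n) = ≤-trans (<⇒≤ (proj₂ (tile-bounds i n))) (m≤m+n a a)

-- The hierarchical Wang tile set with a payload

module TileSet where

  open import Defs
  open Expressions
  open Codes
  open PayloadTiles using (payloadF; Payload)
  open import Data.Fin using (#_)
  open import Data.Nat
  open import Data.Nat.Properties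
  open import Data.Product using (_×_)
  open import Data.Vec as Vec using ([]; _∷_)
  open import Relation.Binary.PropositionalEquality hiding ([_]; J)

  -- `px` and `py` are the column and row modulo 3, and `rk` is the rank of the line along which the
  -- edge lies. `h₀`, `h₁` and `g` are base 3 digits of the position along that line: at the level
  -- of the line, one level higher and one lower. The wire `ty` is 0 outside, 1 when idle in a
  -- square, and 2 + c when it carries the payload colour c.
  record Edge (A : Set) : Set where
    constructor edge
    field px py rk h₀ h₁ g ty : A

  open Edge

  module _ {n : ℕ} where

    private E = Edge (Tm n)

    infix 4 _≢ᶠ_
    _≢ᶠ_ : Tm n → Tm n → Fm n
    s ≢ᶠ t = ∼ (s ≐ t)

    nextF : Tm n → Tm n
    nextF t = call mdT (lit 3 ∷ lit 1 ⊕ t ∷ [])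

    parityF : E → E → E → E → Fm n
    parityF l b r t = px l ≐ px b ⩓ py l ≐ py b ⩓ px r ≐ nextF (px l) ⩓ py r ≐ py l ⩓
                      px t ≐ px b ⩓ py t ≐ nextF (py b) ⩓ rk r ≐ rk l ⩓ rk t ≐ rk b

    wrapF : E → E → Fm n
    wrapF l r = g l ≐ lit 2 ⩓ g r ≐ lit 0

    -- Lines of equal level: each counter `h₀` steps up to the rank of the line it meets, and the
    -- higher digit `h₁` is untouched. At level 0 ranks equal parities; at higher levels the lower
    -- digit `g` wraps on both lines.
    equalF : Tm n → Tm n → E → E → E → E → Fm n
    equalF p q l b r t =
      (lit 1 ⊕ h₀ l ≐ rk b ⩓ h₀ r ≐ rk b) ⩓ (lit 1 ⊕ h₀ b ≐ rk l ⩓ h₀ t ≐ rk l) ⩓ h₁ r ≐ h₁ l ⩓ h₁ t ≐ h₁ b ⩓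
      (((p ≢ᶠ lit 0 ⩓ rk b ≐ p) ⩓ (q ≢ᶠ lit 0 ⩓ rk l ≐ q)) ⩔ (p ≐ lit 0 ⩓ q ≐ lit 0 ⩓ wrapF l r ⩓ wrapF b t))

    -- The column has higher level than the row, so the row's `h₀` wraps and the column's `h₀`
    -- stays. In the first alternative the difference of levels is one: the row's `h₁` steps to the
    -- rank of the column, and the column's `g` to the rank of the row. In the second it is larger,
    -- `h₁` wraps too, and `g` does not notice the row.
    crossF : Tm n → Tm n → E → E → E → E → Fm n
    crossF p q l b r t =
      (h₀ l ≐ lit 2 ⩓ h₀ r ≐ lit 0) ⩓ (h₀ t ≐ h₀ b ⩓ h₁ t ≐ h₁ b) ⩓
      ((lit 1 ⊕ h₁ l ≐ rk b ⩓ h₁ r ≐ rk b ⩓ lit 1 ⊕ g b ≐ rk l ⩓ g t ≐ rk l) ⩔ (h₁ l ≐ lit 2 ⩓ h₁ r ≐ lit 0 ⩓ g t ≐ g b)) ⩓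
      p ≐ lit 0 ⩓ ((q ≢ᶠ lit 0 ⩓ rk l ≐ q) ⩔ (q ≐ lit 0 ⩓ wrapF l r))

    -- A payload tile is demanded exactly where two active wires meet; at all other crossings both
    -- wires pass.
    passF : Tm n → E → E → E → E → Fm n
    passF a l b r t =
      (lit 1 ≺ ty l ⩓ lit 1 ≺ ty b) ⩓ (lit 1 ≺ ty r ⩓ lit 1 ≺ ty t) ⩓
        callF payloadF (ty l ⊖ lit 2 ∷ ty b ⊖ lit 2 ∷ ty r ⊖ lit 2 ∷ ty t ⊖ lit 2 ∷ a ∷ [])
      ⩔ ∼ (lit 1 ≺ ty l ⩓ lit 1 ≺ ty b) ⩓ ty r ≐ ty l ⩓ ty t ≐ ty b

    -- The wire from l to r crosses the side b of a computation square, of rank 1 on entry and 2 on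
    -- exit. No active wire may enter and no idle one may leave; this is what forces the free lines,
    -- and only these, to carry the run. On entry an active wire starts with payload colour k - 2,
    -- which is `wall` for rows and `ground` for columns.
    wallF : ℕ → E → E → E → E → Fm n
    wallF k l b r t = ty t ≐ ty b ⩓
      ((rk b ≐ lit 1 ⩓ ∼ (lit 1 ≺ ty l) ⩓ (ty r ≐ lit 1 ⩔ ty r ≐ lit k)) ⩔
       (rk b ≐ lit 2 ⩓ ty l ≢ᶠ lit 1 ⩓ ty r ≐ lit 0))

    ruleF : Tm n → E → E → E → E → Fm n
    ruleF a l b r t = parityF l b r t ⩓
      (equalF (px l) (py l) l b r t ⩓ passF a l b r t
      -- The higher line is the side of a computation square exactly where its own counter `h₀` is
      -- 1, in its middle third.
      ⩔ crossF (px l) (py l) l b r t ⩓ (h₀ b ≐ lit 1 ⩓ wallF 2 l b r t ⩔ h₀ b ≢ᶠ lit 1 ⩓ passF a l b r t)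
      ⩔ crossF (py l) (px l) b l t r ⩓ (h₀ l ≐ lit 1 ⩓ wallF 3 b l t r ⩔ h₀ l ≢ᶠ lit 1 ⩓ passF a l b r t))

    decodeT : Tm n → Edge (Tm n)
    decodeT c = edge (digit c) (digit c₁) (digit c₂) (digit c₃) (digit c₄) (digit c₅) (rest c₅)
      where
      digit rest : Tm n → Tm n
      digit c = call mdT (lit 3 ∷ c ∷ [])
      rest c  = call dvT (lit 3 ∷ c ∷ [])
      c₁ = rest c
      c₂ = rest c₁
      c₃ = rest c₂
      c₄ = rest c₃
      c₅ = rest c₄

  -- The variables are the left, bottom, right and top colours of a tile and the number a.
  tileF : Fm 5
  tileF = ruleF (var (# 4)) (decodeT (var (# 0))) (decodeT (var (# 1))) (decodeT (var (# 2))) (decodeT (var (# 3)))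

  ⟪_⟫ : Edge ℕ → Edge (Tm 0)
  ⟪ edge a b c d e f t ⟫ = edge (lit a) (lit b) (lit c) (lit d) (lit e) (lit f) (lit t)

  Wraps : Edge ℕ → Edge ℕ → Set
  Wraps l r = g l ≡ 2 × g r ≡ 0

  Equal Cross : ℕ → ℕ → Edge ℕ → Edge ℕ → Edge ℕ → Edge ℕ → Set
  Equal p q l b r t = Holds (equalF (lit p) (lit q) ⟪ l ⟫ ⟪ b ⟫ ⟪ r ⟫ ⟪ t ⟫) []
  Cross p q l b r t = Holds (crossF (lit p) (lit q) ⟪ l ⟫ ⟪ b ⟫ ⟪ r ⟫ ⟪ t ⟫) []

  Parity : Edge ℕ → Edge ℕ → Edge ℕ → Edge ℕ → Set
  Parity l b r t = Holds (parityF ⟪ l ⟫ ⟪ b ⟫ ⟪ r ⟫ ⟪ t ⟫) []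

  Pass : ℕ → Edge ℕ → Edge ℕ → Edge ℕ → Edge ℕ → Set
  Pass a l b r t = Holds (passF (lit a) ⟪ l ⟫ ⟪ b ⟫ ⟪ r ⟫ ⟪ t ⟫) []

  AtWall : ℕ → Edge ℕ → Edge ℕ → Edge ℕ → Edge ℕ → Set
  AtWall k l b r t = Holds (wallF k ⟪ l ⟫ ⟪ b ⟫ ⟪ r ⟫ ⟪ t ⟫) []

  Rule : ℕ → Edge ℕ → Edge ℕ → Edge ℕ → Edge ℕ → Set
  Rule a l b r t = Holds (ruleF (lit a) ⟪ l ⟫ ⟪ b ⟫ ⟪ r ⟫ ⟪ t ⟫) []

  digit rest : ℕ → ℕ
  digit = md 3
  rest  = dv 3

  decode : ℕ → Edge ℕ
  decode c = edge (digit c) (digit (rest c)) (digit (rest (rest c))) (digit (rest (rest (rest c))))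
    (digit (rest (rest (rest (rest c))))) (digit (rest (rest (rest (rest (rest c))))))
    (rest (rest (rest (rest (rest (rest c))))))

  encode : Edge ℕ → ℕ
  encode (edge a b c d e f t) = a + 3 * (b + 3 * (c + 3 * (d + 3 * (e + 3 * (f + 3 * t)))))

  record Ternary (E : Edge ℕ) : Set where
    constructor ternary
    field
      px<3 : px E < 3
      py<3 : py E < 3
      rk<3 : rk E < 3
      h₀<3 : h₀ E < 3
      h₁<3 : h₁ E < 3
      g<3  : g E < 3

  open Ternary public

  decode-ternary : ∀ c → Ternary (decode c)
  decode-ternary c = ternary (d c) (d (rest c)) (d (rest (rest c))) (d (rest (rest (rest c))))
    (d (rest (rest (rest (rest c))))) (d (rest (rest (rest (rest (rest c))))))
    where
    d : ∀ c → digit c < 3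
    d c = md< 3 c z<s

  edge-cong : ∀ {a a′ b b′ c c′ d d′ e e′ f f′ t t′ : ℕ} → a ≡ a′ → b ≡ b′ → c ≡ c′ → d ≡ d′ → e ≡ e′ → f ≡ f′ → t ≡ t′ →
              edge a b c d e f t ≡ edge a′ b′ c′ d′ e′ f′ t′
  edge-cong refl refl refl refl refl refl refl = refl

  decode-encode : ∀ E → Ternary E → decode (encode E) ≡ E
  decode-encode (edge a b c d e f t) (ternary a< b< c< d< e< f<) =
    edge-cong (md-digit 3 c₁ a<) (dig i₁ (md-digit 3 c₂ b<)) (dig i₂ (md-digit 3 c₃ c<)) (dig i₃ (md-digit 3 c₄ d<))
      (dig i₄ (md-digit 3 c₅ e<)) (dig i₅ (md-digit 3 t f<)) (trans (cong rest i₅) (dv-digit 3 t f<))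
    where
    c₅ = f + 3 * t
    c₄ = e + 3 * c₅
    c₃ = d + 3 * c₄
    c₂ = c + 3 * c₃
    c₁ = b + 3 * c₂
    dig : ∀ {x y z} → x ≡ y → digit y ≡ z → digit x ≡ z
    dig p q = trans (cong digit p) q
    i₁ : rest (a + 3 * c₁) ≡ c₁
    i₁ = dv-digit 3 c₁ a<
    i₂ = trans (cong rest i₁) (dv-digit 3 c₂ b<)
    i₃ = trans (cong rest i₂) (dv-digit 3 c₃ c<)
    i₄ = trans (cong rest i₃) (dv-digit 3 c₄ d<)
    i₅ = trans (cong rest i₄) (dv-digit 3 c₅ e<)

  tile⇒rule : ∀ {a l b r t} → Holds tileF (l ∷ b ∷ r ∷ t ∷ a ∷ []) → Rule a (decode l) (decode b) (decode r) (decode t)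
  tile⇒rule h = h

  rule⇒tile : ∀ {a l b r t} → Rule a (decode l) (decode b) (decode r) (decode t) → Holds tileF (l ∷ b ∷ r ∷ t ∷ a ∷ [])
  rule⇒tile h = h

-- Deleting the lines of level 0 preserves the hierarchical rule

module Coarsening where

  open import Defs
  open Expressions
  open Codes
  open TileSet
  open import Data.Fin using (zero; suc)
  open import Data.Nat
  open import Data.Nat.Properties
  open import Data.Product using (_×_; _,_; proj₁; proj₂)
  open import Data.Sum using (_⊎_; inj₁; inj₂)
  open import Function using (_∘_)
  open import Relation.Binary.PropositionalEquality hiding ([_]; J)
  open import Relation.Nullary using (¬_; Dec; yes; no; contradiction)

  open Edge

  -- The parities are parameters because those of the coarse grid are the phases `Φ` and `Ψ`, not
  -- the digits `px` and `py` of its edges.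
  HRule : ℕ → ℕ → Edge ℕ → Edge ℕ → Edge ℕ → Edge ℕ → Set
  HRule p q l b r t = rk r ≡ rk l × rk t ≡ rk b × (Equal p q l b r t ⊎ Cross p q l b r t ⊎ Cross q p b l t r)

  Equal-transpose : ∀ {p q l b r t} → Equal p q l b r t → Equal q p b l t r
  Equal-transpose (x , y , z , w , inj₁ (u , v)) = y , x , w , z , inj₁ (v , u)
  Equal-transpose (x , y , z , w , inj₂ (p≡ , q≡ , u , v)) = y , x , w , z , inj₂ (q≡ , p≡ , v , u)

  HRule-transpose : ∀ {p q l b r t} → HRule p q l b r t → HRule q p b l t r
  HRule-transpose {p} {q} {l} {b} {r} {t} (r≡ , t≡ , inj₁ e) = t≡ , r≡ , inj₁ (Equal-transpose {p} {q} {l} {b} {r} {t} e)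
  HRule-transpose (r≡ , t≡ , inj₂ (inj₁ c)) = t≡ , r≡ , inj₂ (inj₂ c)
  HRule-transpose (r≡ , t≡ , inj₂ (inj₂ c)) = t≡ , r≡ , inj₂ (inj₁ c)

  Grid : Set
  Grid = ℕ → ℕ → Edge ℕ

  flip′ : Grid → Grid
  flip′ H x y = H y x

  next₃ : ℕ → ℕ
  next₃ k = md 3 (suc k)

  -- H x y and V x y are the left and the bottom edge of the tile at (x , y).
  record Hierarchical (p q : ℕ → ℕ) (H V : Grid) : Set where
    field
      p-next : ∀ x → p (suc x) ≡ next₃ (p x)
      q-next : ∀ y → q (suc y) ≡ next₃ (q y)
      rule   : ∀ x y → HRule (p x) (q y) (H x y) (V x y) (H (suc x) y) (V x (suc y))
      H-h₁   : ∀ x y → h₁ (H x y) < 3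
      V-h₁   : ∀ x y → h₁ (V x y) < 3

    rank-row : ∀ x y → rk (H x y) ≡ rk (H 0 y)
    rank-row zero y = refl
    rank-row (suc x) y = trans (proj₁ (rule x y)) (rank-row x y)

    rank-column : ∀ x y → rk (V x y) ≡ rk (V x 0)
    rank-column x zero = refl
    rank-column x (suc y) = trans (proj₁ (proj₂ (rule x y))) (rank-column x y)

    -- A nonzero parity marks a line of level 0, and then the parities alone select one of the three
    -- cases; only crossings with both parities 0 are left open.
    rule-≢≢ : ∀ x y → p x ≢ 0 → q y ≢ 0 → Equal (p x) (q y) (H x y) (V x y) (H (suc x) y) (V x (suc y)) × rk (V x y) ≡ p x × rk (H x y) ≡ q y
    rule-≢≢ x y px qy with proj₂ (proj₂ (rule x y))
    ... | inj₁ e@(_ , _ , _ , _ , inj₁ ((_ , s) , (_ , r))) = e , s , r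
    ... | inj₁ (_ , _ , _ , _ , inj₂ (p0 , _)) = contradiction p0 px
    ... | inj₂ (inj₁ (_ , _ , _ , p0 , _)) = contradiction p0 px
    ... | inj₂ (inj₂ (_ , _ , _ , q0 , _)) = contradiction q0 qy

    rule-≡≢ : ∀ x y → p x ≡ 0 → q y ≢ 0 → Cross (p x) (q y) (H x y) (V x y) (H (suc x) y) (V x (suc y)) × rk (H x y) ≡ q y
    rule-≡≢ x y px qy with proj₂ (proj₂ (rule x y))
    ... | inj₁ (_ , _ , _ , _ , inj₁ ((p≢ , _) , _)) = contradiction px p≢
    ... | inj₁ (_ , _ , _ , _ , inj₂ (_ , q0 , _)) = contradiction q0 qy
    ... | inj₂ (inj₁ c@(_ , _ , _ , _ , inj₁ (_ , r))) = c , r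
    ... | inj₂ (inj₁ (_ , _ , _ , _ , inj₂ (q0 , _))) = contradiction q0 qy
    ... | inj₂ (inj₂ (_ , _ , _ , q0 , _)) = contradiction q0 qy

    rule-≢≡ : ∀ x y → p x ≢ 0 → q y ≡ 0 → Cross (q y) (p x) (V x y) (H x y) (V x (suc y)) (H (suc x) y) × rk (V x y) ≡ p x
    rule-≢≡ x y px qy with proj₂ (proj₂ (rule x y))
    ... | inj₁ (_ , _ , _ , _ , inj₁ (_ , (q≢ , _))) = contradiction qy q≢
    ... | inj₁ (_ , _ , _ , _ , inj₂ (p0 , _)) = contradiction p0 px
    ... | inj₂ (inj₁ (_ , _ , _ , p0 , _)) = contradiction p0 px
    ... | inj₂ (inj₂ c@(_ , _ , _ , _ , inj₁ (_ , r))) = c , r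
    ... | inj₂ (inj₂ (_ , _ , _ , _ , inj₂ (p0 , _))) = contradiction p0 px

    top-h₀ : ∀ x y → p x ≢ 0 → h₀ (V x (suc y)) ≡ q y
    top-h₀ x y px with q y ≟ 0
    ... | yes q0 = trans (proj₂ (proj₁ (proj₁ (rule-≢≡ x y px q0)))) (sym q0)
    ... | no q≢ with rule-≢≢ x y px q≢
    ...   | (_ , (_ , t) , _) , _ , r = trans t r

    rank-parity : ∀ x y → p x ≢ 0 → rk (V x y) ≡ p x
    rank-parity x y px with q y ≟ 0
    ... | yes q0 = proj₂ (rule-≢≡ x y px q0)
    ... | no q≢ = proj₁ (proj₂ (rule-≢≢ x y px q≢))

  open Hierarchical

  transpose : ∀ {p q H V} → Hierarchical p q H V → Hierarchical q p (flip′ V) (flip′ H)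
  transpose {H = H} {V} t = record
    { p-next = q-next t ; q-next = p-next t ; rule = λ x y → HRule-transpose {l = H y x} {V y x} {H (suc y) x} {V y (suc x)} (rule t y x)
    ; H-h₁ = λ x y → V-h₁ t y x ; V-h₁ = λ x y → H-h₁ t y x }

  -- The column ranks synchronise the phases of all rows of level 0.
  synchronise : ∀ u v {s₀ s₁ s₂} → u < 3 → v < 3 → (u ≢ 0 → s₀ ≡ u) → (v ≢ 0 → s₀ ≡ v) →
    (next₃ u ≢ 0 → s₁ ≡ next₃ u) → (next₃ v ≢ 0 → s₁ ≡ next₃ v) →
    (next₃ (next₃ u) ≢ 0 → s₂ ≡ next₃ (next₃ u)) → (next₃ (next₃ v) ≢ 0 → s₂ ≡ next₃ (next₃ v)) → u ≡ v
  synchronise 0 0 _ _ _ _ _ _ _ _ = refl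
  synchronise 1 1 _ _ _ _ _ _ _ _ = refl
  synchronise 2 2 _ _ _ _ _ _ _ _ = refl
  synchronise 0 1 _ _ _ _ a b _ _ = contradiction (trans (sym (a λ ())) (b λ ())) λ ()
  synchronise 0 2 _ _ _ _ _ _ a b = contradiction (trans (sym (a λ ())) (b λ ())) λ ()
  synchronise 1 0 _ _ _ _ a b _ _ = contradiction (trans (sym (a λ ())) (b λ ())) λ ()
  synchronise 1 2 _ _ a b _ _ _ _ = contradiction (trans (sym (a λ ())) (b λ ())) λ ()
  synchronise 2 0 _ _ _ _ _ _ a b = contradiction (trans (sym (a λ ())) (b λ ())) λ ()
  synchronise 2 1 _ _ a b _ _ _ _ = contradiction (trans (sym (a λ ())) (b λ ())) λ ()
  synchronise (suc (suc (suc _))) _ (s≤s (s≤s (s≤s ()))) _ _ _ _ _ _ _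
  synchronise 0 (suc (suc (suc _))) _ (s≤s (s≤s (s≤s ()))) _ _ _ _ _ _
  synchronise 1 (suc (suc (suc _))) _ (s≤s (s≤s (s≤s ()))) _ _ _ _ _ _
  synchronise 2 (suc (suc (suc _))) _ (s≤s (s≤s (s≤s ()))) _ _ _ _ _ _

  next-digit : ∀ {k l s} → k < 3 → (suc l ≡ s × k ≡ s) ⊎ (l ≡ 2 × k ≡ 0) → k ≡ next₃ l
  next-digit {l = 0} _ (inj₁ (refl , refl)) = refl
  next-digit {l = 1} _ (inj₁ (refl , refl)) = refl
  next-digit {l = suc (suc l)} k<3 (inj₁ (refl , refl)) = contradiction k<3 λ { (s≤s (s≤s (s≤s ()))) }
  next-digit _ (inj₂ (refl , refl)) = refl

  module Aligned {p q H V} (t : Hierarchical p q H V) (p₀ : p 0 ≡ 0) where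

    parity₀ : ∀ X → p (X * 3) ≡ 0
    parity₁ : ∀ X → p (1 + X * 3) ≡ 1
    parity₂ : ∀ X → p (2 + X * 3) ≡ 2
    parity₀ zero = p₀
    parity₀ (suc X) = trans (p-next t _) (cong next₃ (parity₂ X))
    parity₁ X = trans (p-next t _) (cong next₃ (parity₀ X))
    parity₂ X = trans (p-next t _) (cong next₃ (parity₁ X))

    ≢0 : ∀ {x k} → p x ≡ suc k → p x ≢ 0
    ≢0 e e′ = contradiction (trans (sym e) e′) λ ()

    module _ (y : ℕ) (qy : q y ≢ 0) where

      -- The parity of coarse column X as it is seen from the row y of level 0: the digit `h₁` just
      -- after the column.
      phase : ℕ → ℕ
      phase X = h₁ (H (1 + X * 3) y)

      phase-carry : ∀ X → h₁ (H (3 + X * 3) y) ≡ phase X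
      phase-carry X =
        trans (proj₁ (proj₂ (proj₂ (proj₁ (rule-≢≢ t (2 + X * 3) y (≢0 (parity₂ X)) qy)))))
              (proj₁ (proj₂ (proj₂ (proj₁ (rule-≢≢ t (1 + X * 3) y (≢0 (parity₁ X)) qy)))))

      phase-rank : ∀ X → phase X ≢ 0 → rk (V (X * 3) 0) ≡ phase X
      phase-rank X k≢ with proj₁ (rule-≡≢ t (X * 3) y (parity₀ X) qy)
      ... | _ , _ , inj₁ (_ , k≡ , _) , _ = trans (sym (rank-column t (X * 3) y)) (sym k≡)
      ... | _ , _ , inj₂ (_ , k≡ , _) , _ = contradiction k≡ k≢

      phase-next : ∀ X → phase (suc X) ≡ next₃ (phase X)
      phase-next X with proj₁ (rule-≡≢ t (suc X * 3) y (parity₀ (suc X)) qy)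
      ... | _ , _ , inj₁ (l≡ , k≡ , _) , _ =
        trans (next-digit (H-h₁ t _ y) (inj₁ (l≡ , k≡))) (cong next₃ (phase-carry X))
      ... | _ , _ , inj₂ (l≡ , k≡ , _) , _ =
        trans (next-digit {s = 0} (H-h₁ t _ y) (inj₂ (l≡ , k≡))) (cong next₃ (phase-carry X))

    phase-unique : ∀ y y′ (qy : q y ≢ 0) (qy′ : q y′ ≢ 0) X → phase y qy X ≡ phase y′ qy′ X
    phase-unique y y′ qy qy′ X = synchronise (f X) (f′ X) (H-h₁ t _ y) (H-h₁ t _ y′) (phase-rank y qy X) (phase-rank y′ qy′ X)
      (λ n → trans (phase-rank y qy (1 + X) (n ∘ trans (sym n₁))) n₁)
      (λ n → trans (phase-rank y′ qy′ (1 + X) (n ∘ trans (sym n₁′))) n₁′)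
      (λ n → trans (phase-rank y qy (2 + X) (n ∘ trans (sym n₂))) n₂)
      (λ n → trans (phase-rank y′ qy′ (2 + X) (n ∘ trans (sym n₂′))) n₂′)
      where
      f = phase y qy
      f′ = phase y′ qy′
      n₁ = phase-next y qy X
      n₁′ = phase-next y′ qy′ X
      n₂ = trans (phase-next y qy (1 + X)) (cong next₃ n₁)
      n₂′ = trans (phase-next y′ qy′ (1 + X)) (cong next₃ n₁′)

  module HalfCoarse {p q H V} (t : Hierarchical p q H V) (p₀ : p 0 ≡ 0) (q₀ : q 0 ≡ 0) where

    open Aligned t p₀ public
    module Tr = Aligned (transpose t) q₀

    q₁ : q 1 ≢ 0
    q₁ e = contradiction (trans (sym (Tr.parity₁ 0)) e) λ ()

    p₁ : p 1 ≢ 0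
    p₁ e = contradiction (trans (sym (parity₁ 0)) e) λ ()

    Φ Ψ : ℕ → ℕ
    Φ = phase 1 q₁
    Ψ = Tr.phase 1 p₁

    P-rank : ∀ X y → Φ X ≢ 0 → rk (V (X * 3) y) ≡ Φ X
    P-rank X y n = trans (rank-column t (X * 3) y) (phase-rank 1 q₁ X n)

    -- Crossing the two level-0 columns between neighbouring coarse columns.
    between : ∀ X Y → let r = H (1 + X * 3) (Y * 3) ; r′ = H (3 + X * 3) (Y * 3) in
      rk r′ ≡ rk r × h₀ r′ ≡ h₀ r × h₁ r′ ≡ h₁ r × (Ψ Y ≡ 0 → g r′ ≡ g r) × (Ψ Y ≢ 0 → g r ≡ 0 × g r′ ≡ 2)
    between X Y with rule-≢≡ t (1 + X * 3) (Y * 3) (≢0 (parity₁ X)) (Tr.parity₀ Y)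
                   | rule-≢≡ t (2 + X * 3) (Y * 3) (≢0 (parity₂ X)) (Tr.parity₀ Y)
                   | Tr.phase-unique (1 + X * 3) 1 (≢0 (parity₁ X)) p₁ Y
                   | Tr.phase-unique (2 + X * 3) 1 (≢0 (parity₂ X)) p₁ Y
    ... | (_ , (a₀ , a₁) , a , _) , s₁ | (_ , (b₀ , b₁) , b , _) , s₂ | n₁ | n₂ =
      trans (proj₁ (rule t (2 + X * 3) (Y * 3))) (proj₁ (rule t (1 + X * 3) (Y * 3))) ,
      trans b₀ a₀ , trans b₁ a₁ , zeroQ a b , nonzeroQ a b
      where
      zeroQ : _ → _ → Ψ Y ≡ 0 → g (H (3 + X * 3) (Y * 3)) ≡ g (H (1 + X * 3) (Y * 3))
      zeroQ (inj₁ (u , v , _)) _ z = contradiction (trans u (trans (sym v) (trans n₁ z))) λ ()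
      zeroQ (inj₂ _) (inj₁ (u , v , _)) z = contradiction (trans u (trans (sym v) (trans n₂ z))) λ ()
      zeroQ (inj₂ (_ , _ , u)) (inj₂ (_ , _ , v)) z = trans v u
      nonzeroQ : _ → _ → Ψ Y ≢ 0 → g (H (1 + X * 3) (Y * 3)) ≡ 0 × g (H (3 + X * 3) (Y * 3)) ≡ 2
      nonzeroQ (inj₂ (_ , u , _)) _ n = contradiction (trans (sym n₁) u) n
      nonzeroQ (inj₁ _) (inj₂ (_ , u , _)) n = contradiction (trans (sym n₂) u) n
      nonzeroQ (inj₁ (_ , _ , u , _)) (inj₁ (_ , _ , _ , v)) n =
        suc-injective (trans u (trans s₁ (parity₁ X))) , trans v (trans s₂ (parity₂ X))

    -- In a row of nonzero phase, `g` arrives at each coarse column as 2 and leaves it as 0. A row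
    -- of higher level than the column would keep `g` or raise it by one.
    no-cross : ∀ X Y → Ψ Y ≢ 0 → let x = suc X * 3 ; y = Y * 3 in
      ¬ Cross (q y) (p x) (V x y) (H x y) (V x (suc y)) (H (suc x) y)
    no-cross X Y n (_ , _ , inj₁ (_ , _ , _ , e) , _) with proj₂ (proj₂ (proj₂ (proj₂ (between (suc X) Y)))) n
    no-cross X Y n (_ , _ , inj₁ (_ , _ , l , e) , _) | z , _ = contradiction (trans l (trans (sym e) z)) λ ()
    no-cross X Y n (_ , _ , inj₂ (_ , _ , e) , _)
      with proj₂ (proj₂ (proj₂ (proj₂ (between X Y)))) n | proj₂ (proj₂ (proj₂ (proj₂ (between (suc X) Y)))) n
    ... | _ , two | z , _ = contradiction (trans (sym z) (trans e two)) λ ()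

  module CoarseTiling {p q H V} (t : Hierarchical p q H V) (p₀ : p 0 ≡ 0) (q₀ : q 0 ≡ 0) where

    module A = HalfCoarse t p₀ q₀
    module B = HalfCoarse (transpose t) q₀ p₀
    open A public using (Φ; Ψ)

    -- The first coarse lines are dropped, since the argument about `g` looks back to the preceding
    -- one.
    H′ V′ : Grid
    H′ X Y = H (suc X * 3) (suc Y * 3)
    V′ X Y = V (suc X * 3) (suc Y * 3)

    equal-cell : ∀ X Y → Φ (suc X) ≢ 0 → Ψ (suc Y) ≢ 0 → let x = suc X * 3 ; y = suc Y * 3 in
      Equal (p x) (q y) (H x y) (V x y) (H (suc x) y) (V x (suc y))
    equal-cell X Y np nq with proj₂ (proj₂ (rule t (suc X * 3) (suc Y * 3)))
    ... | inj₁ e = e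
    ... | inj₂ (inj₁ c) = contradiction c (B.no-cross Y (suc X) np)
    ... | inj₂ (inj₂ c) = contradiction c (A.no-cross X (suc Y) nq)

    -- An equal crossing would leave the row with positive `h₀`, but the next coarse column has
    -- phase 1 and must be reached with `h₀` equal to 0.
    not-equal-H : ∀ X Y → Φ (suc X) ≡ 0 → Ψ (suc Y) ≢ 0 → let x = suc X * 3 ; y = suc Y * 3 in
      ¬ Equal (p x) (q y) (H x y) (V x y) (H (suc x) y) (V x (suc y))
    not-equal-H X Y zp nq ((l≡ , r≡) , _)
      with equal-cell (suc X) Y n nq | A.P-rank (2 + X) (suc Y * 3) n | A.between (suc X) (suc Y)
      where
      one : Φ (2 + X) ≡ 1
      one = trans (A.phase-next 1 A.q₁ (suc X)) (cong next₃ zp)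
      n : Φ (2 + X) ≢ 0
      n e = contradiction (trans (sym one) e) λ ()
    ... | (l′ , _) , _ | s | _ , h , _ =
      contradiction (trans (trans l≡ (trans (sym r≡) (sym h))) (suc-injective (trans l′ (trans s one)))) λ ()
      where
      one : Φ (2 + X) ≡ 1
      one = trans (A.phase-next 1 A.q₁ (suc X)) (cong next₃ zp)

  module Coarsen {p q H V} (t : Hierarchical p q H V) (p₀ : p 0 ≡ 0) (q₀ : q 0 ≡ 0) where

    module C = CoarseTiling t p₀ q₀
    module Cᵗ = CoarseTiling (transpose t) q₀ p₀
    open C public

    -- The conditions on `h₀` and `h₁` are inherited, because `between` carries both digits
    -- unchanged to the next coarse line. Only the condition on the parities is new: for a nonzero
    -- phase it becomes the condition on ranks, and for phase 0 the wrap of `g` survives, since `g`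
    -- is then carried along as well.
    coarse-rule : ∀ X Y → HRule (Φ (suc X)) (Ψ (suc Y)) (H′ X Y) (V′ X Y) (H′ (suc X) Y) (V′ X (suc Y))
    coarse-rule X Y = trans rr (proj₁ fine) , trans tr (proj₁ (proj₂ fine)) , kind (Φ (suc X) ≟ 0) (Ψ (suc Y) ≟ 0) (proj₂ (proj₂ fine))
      where
      x = suc X * 3
      y = suc Y * 3
      fine = rule t x y
      betw = A.between (suc X) (suc Y)
      betwᵗ = B.between (suc Y) (suc X)
      rr = proj₁ betw
      tr = proj₁ betwᵗ
      r₀ = proj₁ (proj₂ betw)
      t₀ = proj₁ (proj₂ betwᵗ)
      r₁ = proj₁ (proj₂ (proj₂ betw))
      t₁ = proj₁ (proj₂ (proj₂ betwᵗ))
      rg = proj₁ (proj₂ (proj₂ (proj₂ betw)))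
      tg = proj₁ (proj₂ (proj₂ (proj₂ betwᵗ)))
      px₀ = A.parity₀ (suc X)
      qy₀ = A.Tr.parity₀ (suc Y)
      l = H x y
      b = V x y

      wraps : Wraps l (H (suc x) y) → Ψ (suc Y) ≡ 0 → Wraps l (H′ (suc X) Y)
      wraps (u , v) z = u , trans (rg z) v
      wrapsᵗ : Wraps b (V x (suc y)) → Φ (suc X) ≡ 0 → Wraps b (V′ X (suc Y))
      wrapsᵗ (u , v) z = u , trans (tg z) v

      equalᶜ : ∀ {p′ q′} → Equal (p x) (q y) l b (H (suc x) y) (V x (suc y)) →
              (((p′ ≢ 0 × rk b ≡ p′) × (q′ ≢ 0 × rk l ≡ q′)) ⊎ (p′ ≡ 0 × q′ ≡ 0 × Wraps l (H′ (suc X) Y) × Wraps b (V′ X (suc Y)))) →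
              Equal p′ q′ l b (H′ (suc X) Y) (V′ X (suc Y))
      equalᶜ ((a , a′) , (c , c′) , d , d′ , _) alt = (a , trans r₀ a′) , (c , trans t₀ c′) , trans r₁ d , trans t₁ d′ , alt

      cross : ∀ {q′} → Φ (suc X) ≡ 0 → Cross (p x) (q y) l b (H (suc x) y) (V x (suc y)) →
              ((q′ ≢ 0 × rk l ≡ q′) ⊎ (q′ ≡ 0 × Wraps l (H′ (suc X) Y))) → Cross (Φ (suc X)) q′ l b (H′ (suc X) Y) (V′ X (suc Y))
      cross z ((a , a′) , (c , c′) , inj₁ (d , d′ , e , e′) , _) alt =
        (a , trans r₀ a′) , (trans t₀ c , trans t₁ c′) , inj₁ (d , trans r₁ d′ , e , trans (tg z) e′) , z , alt
      cross z ((a , a′) , (c , c′) , inj₂ (d , d′ , e) , _) alt =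
        (a , trans r₀ a′) , (trans t₀ c , trans t₁ c′) , inj₂ (d , trans r₁ d′ , trans (tg z) e) , z , alt

      crossᵗ : ∀ {p′} → Ψ (suc Y) ≡ 0 → Cross (q y) (p x) b l (V x (suc y)) (H (suc x) y) →
              ((p′ ≢ 0 × rk b ≡ p′) ⊎ (p′ ≡ 0 × Wraps b (V′ X (suc Y)))) → Cross (Ψ (suc Y)) p′ b l (V′ X (suc Y)) (H′ (suc X) Y)
      crossᵗ z ((a , a′) , (c , c′) , inj₁ (d , d′ , e , e′) , _) alt =
        (a , trans t₀ a′) , (trans r₀ c , trans r₁ c′) , inj₁ (d , trans t₁ d′ , e , trans (rg z) e′) , z , alt
      crossᵗ z ((a , a′) , (c , c′) , inj₂ (d , d′ , e) , _) alt =
        (a , trans t₀ a′) , (trans r₀ c , trans r₁ c′) , inj₂ (d , trans t₁ d′ , trans (rg z) e) , z , alt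

      Goal = Equal (Φ (suc X)) (Ψ (suc Y)) l b (H′ (suc X) Y) (V′ X (suc Y)) ⊎
             Cross (Φ (suc X)) (Ψ (suc Y)) l b (H′ (suc X) Y) (V′ X (suc Y)) ⊎
             Cross (Ψ (suc Y)) (Φ (suc X)) b l (V′ X (suc Y)) (H′ (suc X) Y)

      kind : Dec (Φ (suc X) ≡ 0) → Dec (Ψ (suc Y) ≡ 0) → _ → Goal
      kind (no np) (no nq) _ = inj₁ (equalᶜ (C.equal-cell X Y np nq)
        (inj₁ ((np , A.P-rank (suc X) y np) , (nq , B.P-rank (suc Y) x nq))))
      kind (yes zp) (no nq) (inj₁ e) = contradiction e (C.not-equal-H X Y zp nq)
      kind (yes zp) (no nq) (inj₂ (inj₁ c)) = inj₂ (inj₁ (cross zp c (inj₁ (nq , B.P-rank (suc Y) x nq))))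
      kind (yes zp) (no nq) (inj₂ (inj₂ c)) = contradiction c (A.no-cross X (suc Y) nq)
      kind (no np) (yes zq) (inj₁ e) = contradiction (Equal-transpose {l = l} {b} {H (suc x) y} {V x (suc y)} e) (Cᵗ.not-equal-H Y X zq np)
      kind (no np) (yes zq) (inj₂ (inj₁ c)) = contradiction c (B.no-cross Y (suc X) np)
      kind (no np) (yes zq) (inj₂ (inj₂ c)) = inj₂ (inj₂ (crossᵗ zq c (inj₁ (np , A.P-rank (suc X) y np))))
      kind (yes zp) (yes zq) (inj₁ e@(_ , _ , _ , _ , inj₁ ((p≢ , _) , _))) = contradiction px₀ p≢
      kind (yes zp) (yes zq) (inj₁ e@(_ , _ , _ , _ , inj₂ (_ , _ , u , v))) =
        inj₁ (equalᶜ e (inj₂ (zp , zq , wraps u zq , wrapsᵗ v zp)))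
      kind (yes zp) (yes zq) (inj₂ (inj₁ c@(_ , _ , _ , _ , inj₁ (q≢ , _)))) = contradiction qy₀ q≢
      kind (yes zp) (yes zq) (inj₂ (inj₁ c@(_ , _ , _ , _ , inj₂ (_ , u)))) = inj₂ (inj₁ (cross zp c (inj₂ (zq , wraps u zq))))
      kind (yes zp) (yes zq) (inj₂ (inj₂ c@(_ , _ , _ , _ , inj₁ (p≢ , _)))) = contradiction px₀ p≢
      kind (yes zp) (yes zq) (inj₂ (inj₂ c@(_ , _ , _ , _ , inj₂ (_ , u)))) = inj₂ (inj₂ (crossᵗ zq c (inj₂ (zp , wrapsᵗ u zp))))

    coarse : Hierarchical (λ X → Φ (suc X)) (λ Y → Ψ (suc Y)) H′ V′
    coarse = record
      { p-next = λ X → A.phase-next 1 A.q₁ (suc X) ; q-next = λ Y → A.Tr.phase-next 1 A.p₁ (suc Y)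
      ; rule = coarse-rule ; H-h₁ = λ X Y → H-h₁ t _ _ ; V-h₁ = λ X Y → V-h₁ t _ _ }

-- Iterated coarsening: levels and computation squares in every tiling

module Hierarchy where

  open import Defs
  open Codes
  open TileSet
  open Coarsening
  open import Data.Fin using (Fin; zero; suc; toℕ)
  open import Data.Nat
  open import Data.Nat.Properties
  open import Data.Nat.Tactic.RingSolver using (solve-∀)
  open import Data.Product using (∃; _×_; _,_; proj₁; proj₂)
  open import Data.Sum using (_⊎_; inj₁; inj₂)
  open import Function using (_∘_; id)
  open import Relation.Binary.PropositionalEquality hiding ([_]; J)
  open import Relation.Nullary using (contradiction)

  open Edge

  -- Off n consists of the positions strictly between two neighbouring lines of level n.
  data Off : ℕ → Set where
    sub  : ∀ {n} → Fin 3 → Off n → Off (suc n)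
    line : ∀ {n} → Fin 2 → Off (suc n)

  val : ∀ {n} → Off n → ℕ
  val {suc n} (sub k o) = toℕ k * 3 ^ n + val o
  val {suc n} (line k)  = suc (toℕ k) * 3 ^ n

  -- hw s and vw s are crossings with the left/bottom (s = 1) or right/top (s = 2) sides of
  -- the computation squares.
  data Role : Set where
    plain : Role
    hw vw : ℕ → Role

  middle : Fin 3 → Role → Role
  middle zero          ρ = plain
  middle (suc zero)    ρ = ρ
  middle (suc (suc k)) ρ = plain

  role : ∀ {n} → Off n → Off n → Role
  role (sub _ o) (sub _ o′) = role o o′
  role (sub k _) (line i)   = middle k (vw (suc (toℕ i)))
  role (line i)  (sub k _)  = middle k (hw (suc (toℕ i)))
  role (line _)  (line _)   = plain

  Crosses : Edge ℕ → Edge ℕ → Edge ℕ → Edge ℕ → Set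
  Crosses l b r t = (h₀ l ≡ 2 × h₀ r ≡ 0) × h₀ t ≡ h₀ b

  -- Only `h₀` and ranks are mentioned: they decide which clause of `ruleF` a crossing has to obey.
  HasRole : Role → Edge ℕ → Edge ℕ → Edge ℕ → Edge ℕ → Set
  HasRole plain  l b r t = h₀ r ≡ suc (h₀ l) ⊎ (Crosses l b r t × h₀ b ≢ 1) ⊎ (Crosses b l t r × h₀ l ≢ 1)
  HasRole (hw s) l b r t = Crosses l b r t × h₀ b ≡ 1 × rk b ≡ s
  HasRole (vw s) l b r t = Crosses b l t r × h₀ l ≡ 1 × rk l ≡ s

  RoleAt : Grid → Grid → ℕ → ℕ → Role → Set
  RoleAt H V x y ρ = HasRole ρ (H x y) (V x y) (H (suc x) y) (V x (suc y))

  flip-role : Role → Role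
  flip-role plain  = plain
  flip-role (hw s) = vw s
  flip-role (vw s) = hw s

  -- The row y meets the lower column x on the way to the line z: the column's counter wraps, while
  -- the row's counter already has the value with which it will reach z.
  PassRow : Grid → Grid → ℕ → ℕ → ℕ → Set
  PassRow H V x y z = (h₀ (V x y) ≡ 2 × h₀ (V x (suc y)) ≡ 0) × h₀ (H x y) ≡ h₀ (H z y) × h₀ (H (suc x) y) ≡ h₀ (H z y)

  shift : ∀ {p q H V} i j → Hierarchical p q H V →
          Hierarchical (λ x → p (x + i)) (λ y → q (y + j)) (λ x y → H (x + i) (y + j)) (λ x y → V (x + i) (y + j))
  shift i j t = record
    { p-next = λ x → Hierarchical.p-next t (x + i) ; q-next = λ y → Hierarchical.q-next t (y + j)
    ; rule = λ x y → Hierarchical.rule t (x + i) (y + j)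
    ; H-h₁ = λ x y → Hierarchical.H-h₁ t _ _ ; V-h₁ = λ x y → Hierarchical.V-h₁ t _ _ }

  -- The search starts at index 1, as `p 0` is not known to be a digit.
  aligned : (p : ℕ → ℕ) → (∀ x → p (suc x) ≡ next₃ (p x)) → ∃ λ i → p i ≡ 0
  aligned p p-next = cases (p 1) refl (subst (_< 3) (sym (p-next 0)) (md< 3 (suc (p 0)) z<s))
    where
    cases : ∀ k → p 1 ≡ k → k < 3 → ∃ λ i → p i ≡ 0
    cases 0 e _ = 1 , e
    cases 2 e _ = 2 , trans (p-next 1) (cong next₃ e)
    cases 1 e _ = 3 , trans (p-next 2) (cong next₃ (trans (p-next 1) (cong next₃ e)))
    cases (suc (suc (suc _))) e (s≤s (s≤s (s≤s ())))

  -- The lines of level at least n as a grid of their own, with its parities. The links bridge the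
  -- gap between neighbouring lines, along which `h₀` does not change.
  record Lines (H V : Grid) (n : ℕ) (cx ry p q : ℕ → ℕ) : Set where
    field
      cx-next : ∀ X → cx (suc X) ≡ 3 ^ n + cx X
      tiling  : Hierarchical p q (λ X Y → H (cx X) (ry Y)) (λ X Y → V (cx X) (ry Y))
      link-H  : ∀ X Y → h₀ (H (suc (cx X)) (ry Y)) ≡ h₀ (H (cx (suc X)) (ry Y))
      link-V  : ∀ X Y → h₀ (V (cx X) (suc (ry Y))) ≡ h₀ (V (cx X) (ry (suc Y)))
      rows    : ∀ X Y (o : Off n) → PassRow H V (val o + cx X) (ry Y) (cx (suc X))

    cx-many : ∀ k X → cx (k + X) ≡ k * 3 ^ n + cx X
    cx-many zero X = refl
    cx-many (suc k) X = trans (cx-next (k + X)) (trans (cong (3 ^ n +_) (cx-many k X)) (sym (+-assoc (3 ^ n) _ _)))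

    at-sub : ∀ (k : Fin 3) (o : Off n) X → val (sub k o) + cx X ≡ val o + cx (toℕ k + X)
    at-sub k o X = trans (lemma (toℕ k * 3 ^ n) (val o) (cx X)) (cong (val o +_) (sym (cx-many (toℕ k) X)))
      where
      lemma : ∀ a b c → a + b + c ≡ b + (a + c)
      lemma = solve-∀

    at-line : ∀ (k : Fin 2) X → val (line {n} k) + cx X ≡ cx (suc (toℕ k) + X)
    at-line k X = sym (cx-many (suc (toℕ k)) X)

  open Lines

  module _ {H V n cx ry p q} (A : Lines H V n cx ry p q) (B : Lines (flip′ V) (flip′ H) n ry cx q p)
           {i j} (pᵢ : p i ≡ 0) (qⱼ : q j ≡ 0) where

    private
      module K = Coarsen (shift i j (tiling A)) pᵢ qⱼ
      colX rowY : ℕ → ℕ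
      colX X = suc X * 3 + i
      rowY Y = suc Y * 3 + j

    -- A position between two new lines lies between old ones or on one of the two deleted ones. In
    -- either case the counter of the row is followed to the right end of the gap, over the deleted
    -- columns that remain.
    refine : Lines H V (suc n) (cx ∘ colX) (ry ∘ rowY) (λ X → K.Φ (suc X)) (λ Y → K.Ψ (suc Y))
    cx-next refine X = trans (cx-many A 3 (colX X)) (cong (_+ cx (colX X)) refl)
    tiling refine = K.coarse
    link-H refine X Y = trans (link-H A (colX X) (rowY Y)) (sym (proj₁ (proj₂ (K.A.between (suc X) (suc Y)))))
    link-V refine X Y = trans (link-V A (colX X) (rowY Y)) (sym (proj₁ (proj₂ (K.B.between (suc Y) (suc X)))))
    rows refine X Y o = go o
      where
      x = colX X
      y = ry (rowY Y)
      odd₁ : p (1 + x) ≢ 0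
      odd₁ e = contradiction (trans (sym (K.A.parity₁ (suc X))) e) λ ()
      odd₂ : p (2 + x) ≢ 0
      odd₂ e = contradiction (trans (sym (K.A.parity₂ (suc X))) e) λ ()
      even : q (rowY Y) ≡ 0
      even = K.A.Tr.parity₀ (suc Y)
      cell : ∀ z → p z ≢ 0 → (h₀ (V (cx z) y) ≡ 2 × h₀ (V (cx z) (ry (suc (rowY Y)))) ≡ 0) × h₀ (H (cx (suc z)) y) ≡ h₀ (H (cx z) y)
      cell z odd = let (a , (b , _) , _) , _ = Hierarchical.rule-≢≡ (tiling A) z (rowY Y) odd even in a , b
      last : h₀ (H (cx (2 + x)) y) ≡ h₀ (H (cx (3 + x)) y)
      last = sym (proj₂ (cell (2 + x) odd₂))
      last₁ : h₀ (H (cx (1 + x)) y) ≡ h₀ (H (cx (3 + x)) y)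
      last₁ = trans (sym (proj₂ (cell (1 + x) odd₁))) last
      lasts : ∀ (k : Fin 3) → h₀ (H (cx (suc (toℕ k + x))) y) ≡ h₀ (H (cx (3 + x)) y)
      lasts zero = last₁
      lasts (suc zero) = last
      lasts (suc (suc zero)) = refl
      onLine : ∀ z → p z ≢ 0 → h₀ (H (cx z) y) ≡ h₀ (H (cx (3 + x)) y) → PassRow H V (cx z) y (cx (3 + x))
      onLine z odd e = let (a , b) , c = cell z odd in
        (a , trans (link-V A z (rowY Y)) b) , e , trans (link-H A z (rowY Y)) (trans c e)
      go : (o : Off (suc n)) → PassRow H V (val o + cx x) y (cx (3 + x))
      go (sub k o) = subst (λ z → PassRow H V z y (cx (3 + x))) (sym (at-sub A k o x))
        (let a , b , c = rows A (toℕ k + x) (rowY Y) o in a , trans b (lasts k) , trans c (lasts k))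
      go (line zero) = subst (λ z → PassRow H V z y (cx (3 + x))) (sym (at-line A zero x)) (onLine (1 + x) odd₁ last₁)
      go (line (suc zero)) = subst (λ z → PassRow H V z y (cx (3 + x))) (sym (at-line A (suc zero) x)) (onLine (2 + x) odd₂ last)

  module Levels {p⁰ q⁰ H V} (fine : Hierarchical p⁰ q⁰ H V) where

    record Level (n : ℕ) : Set where
      field
        {cx ry p q} : ℕ → ℕ
        horizontal : Lines H V n cx ry p q
        vertical   : Lines (flip′ V) (flip′ H) n ry cx q p
        inner      : ∀ X Y (o o′ : Off n) → RoleAt H V (val o + cx X) (val o′ + ry Y) (role o o′)

    open Level

    -- A deleted line keeps its counter between consecutive rows of the grid, so the counter is the
    -- parity of the last such row below; the rank of the line is its own parity.
    line-crossing : ∀ {n} (L : Level n) X Y (o : Off n) → p L X ≢ 0 →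
      let x = cx L X ; y = val o + ry L Y in
      Crosses (H x y) (V x y) (H (suc x) y) (V x (suc y)) × h₀ (V x y) ≡ q L Y × rk (V x y) ≡ p L X
    line-crossing L X Y o odd =
      let a , b , c = rows (vertical L) Y X o
          e = Hierarchical.top-h₀ (tiling (horizontal L)) X Y odd
      in (a , trans c (sym b)) , trans b e ,
         trans (Hierarchical.rank-column fine _ _) (trans (sym (Hierarchical.rank-column fine _ _))
           (Hierarchical.rank-parity (tiling (horizontal L)) X Y odd))

    line-crossingᵗ : ∀ {n} (L : Level n) X Y (o : Off n) → q L Y ≢ 0 →
      let x = val o + cx L X ; y = ry L Y in
      Crosses (V x y) (H x y) (V x (suc y)) (H (suc x) y) × h₀ (H x y) ≡ p L X × rk (H x y) ≡ q L Y
    line-crossingᵗ L X Y o odd =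
      let a , b , c = rows (horizontal L) X Y o
          e = Hierarchical.top-h₀ (tiling (vertical L)) Y X odd
      in (a , trans c (sym b)) , trans b e ,
         trans (Hierarchical.rank-row fine _ _) (trans (sym (Hierarchical.rank-row fine _ _))
           (Hierarchical.rank-parity (tiling (vertical L)) Y X odd))

    level : ∀ n → Level n
    level zero = record
      { cx = id ; ry = id ; horizontal = record
        { cx-next = λ _ → refl ; tiling = fine ; link-H = λ _ _ → refl ; link-V = λ _ _ → refl ; rows = λ _ _ () }
      ; vertical = record
        { cx-next = λ _ → refl ; tiling = transpose fine ; link-H = λ _ _ → refl ; link-V = λ _ _ → refl ; rows = λ _ _ () }
      ; inner = λ _ _ () }
    level (suc n) = record
      { horizontal = refine (horizontal L) (vertical L) pᵢ qⱼ
      ; vertical   = refine (vertical L) (horizontal L) qⱼ pᵢ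
      ; inner      = inner′ }
      where
      L = level n
      align = aligned (p L) (Hierarchical.p-next (tiling (horizontal L)))
      alignᵗ = aligned (q L) (Hierarchical.q-next (tiling (horizontal L)))
      i = proj₁ align
      j = proj₁ alignᵗ
      pᵢ = proj₂ align
      qⱼ = proj₂ alignᵗ
      module K = Aligned (shift i j (tiling (horizontal L))) pᵢ
      module Kᵗ = Aligned (transpose (shift i j (tiling (horizontal L)))) qⱼ

      phaseᵖ : ∀ X (k : Fin 3) → p L (toℕ k + (suc X * 3 + i)) ≡ toℕ k
      phaseᵖ X zero = K.parity₀ (suc X)
      phaseᵖ X (suc zero) = K.parity₁ (suc X)
      phaseᵖ X (suc (suc zero)) = K.parity₂ (suc X)
      phaseᵗ : ∀ Y (k : Fin 3) → q L (toℕ k + (suc Y * 3 + j)) ≡ toℕ k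
      phaseᵗ Y zero = Kᵗ.parity₀ (suc Y)
      phaseᵗ Y (suc zero) = Kᵗ.parity₁ (suc Y)
      phaseᵗ Y (suc (suc zero)) = Kᵗ.parity₂ (suc Y)
      odd : ∀ {k m} → m ≡ suc k → m ≢ 0
      odd refl ()
      phaseˡ : ∀ X (k : Fin 2) → p L (suc (toℕ k) + (suc X * 3 + i)) ≡ suc (toℕ k)
      phaseˡ X zero = K.parity₁ (suc X)
      phaseˡ X (suc zero) = K.parity₂ (suc X)
      phaseˡᵗ : ∀ Y (k : Fin 2) → q L (suc (toℕ k) + (suc Y * 3 + j)) ≡ suc (toℕ k)
      phaseˡᵗ Y zero = Kᵗ.parity₁ (suc Y)
      phaseˡᵗ Y (suc zero) = Kᵗ.parity₂ (suc Y)

      inner′ : ∀ X Y (o o′ : Off (suc n)) → RoleAt H V (val o + cx L (suc X * 3 + i)) (val o′ + ry L (suc Y * 3 + j)) (role o o′)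
      inner′ X Y (sub k o) (sub k′ o′)
        rewrite at-sub (horizontal L) k o (suc X * 3 + i) | at-sub (vertical L) k′ o′ (suc Y * 3 + j) = inner L _ _ o o′
      inner′ X Y (line k) (line k′)
        rewrite at-line (horizontal L) k (suc X * 3 + i) | at-line (vertical L) k′ (suc Y * 3 + j) =
        let x = suc (toℕ k) + (suc X * 3 + i) ; y = suc (toℕ k′) + (suc Y * 3 + j)
            ((a , a′) , _) , _ = Hierarchical.rule-≢≢ (tiling (horizontal L)) x y (odd (phaseˡ X k)) (odd (phaseˡᵗ Y k′))
        in inj₁ (trans (link-H (horizontal L) x y) (trans a′ (sym a)))
      inner′ X Y (line k) (sub k′ o′)
        rewrite at-line (horizontal L) k (suc X * 3 + i) | at-sub (vertical L) k′ o′ (suc Y * 3 + j)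
        with line-crossing L (suc (toℕ k) + (suc X * 3 + i)) (toℕ k′ + (suc Y * 3 + j)) o′ (odd (phaseˡ X k))
      inner′ X Y (line k) (sub zero o′) | c , v , s =
        inj₂ (inj₁ (c , λ e → contradiction (trans (sym e) (trans v (phaseᵗ Y zero))) λ ()))
      inner′ X Y (line k) (sub (suc zero) o′) | c , v , s = c , trans v (phaseᵗ Y (suc zero)) , trans s (phaseˡ X k)
      inner′ X Y (line k) (sub (suc (suc zero)) o′) | c , v , s =
        inj₂ (inj₁ (c , λ e → contradiction (trans (sym e) (trans v (phaseᵗ Y (suc (suc zero))))) λ ()))
      inner′ X Y (sub k o) (line k′)
        rewrite at-sub (horizontal L) k o (suc X * 3 + i) | at-line (vertical L) k′ (suc Y * 3 + j)
        with line-crossingᵗ L (toℕ k + (suc X * 3 + i)) (suc (toℕ k′) + (suc Y * 3 + j)) o (odd (phaseˡᵗ Y k′))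
      inner′ X Y (sub zero o) (line k′) | c , v , s =
        inj₂ (inj₂ (c , λ e → contradiction (trans (sym e) (trans v (phaseᵖ X zero))) λ ()))
      inner′ X Y (sub (suc zero) o) (line k′) | c , v , s = c , trans v (phaseᵖ X (suc zero)) , trans s (phaseˡᵗ Y k′)
      inner′ X Y (sub (suc (suc zero)) o) (line k′) | c , v , s =
        inj₂ (inj₂ (c , λ e → contradiction (trans (sym e) (trans v (phaseᵖ X (suc (suc zero))))) λ ()))

    -- All crossings in the interior and on the four sides of a computation square with lower left
    -- corner `x₀`, `y₀`; the corners are left out.
    record Square (n : ℕ) : Set where
      field
        x₀ y₀   : ℕ
        inside  : ∀ (o o′ : Off n) → RoleAt H V (val o + x₀) (val o′ + y₀) (role o o′)
        left    : ∀ (o : Off n) → RoleAt H V x₀ (val o + y₀) (hw 1)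
        right   : ∀ (o : Off n) → RoleAt H V (3 ^ n + x₀) (val o + y₀) (hw 2)
        bottom  : ∀ (o : Off n) → RoleAt H V (val o + x₀) y₀ (vw 1)
        top     : ∀ (o : Off n) → RoleAt H V (val o + x₀) (3 ^ n + y₀) (vw 2)

    -- After an aligned line come lines of parity 1 and 2. Between the rows of parity 1 and 2 the
    -- two columns have counter 1, and conversely, so together they bound a square.
    square : ∀ n → Square n
    square n = record
      { x₀ = cx L (1 + i) ; y₀ = ry L (1 + j) ; inside = inner L (1 + i) (1 + j)
      ; left = λ o → vertical′ 1 p₁ (λ ()) o
      ; right = λ o → subst (λ x → RoleAt H V x (val o + ry L (1 + j)) (hw 2)) (cx-next (horizontal L) (1 + i)) (vertical′ 2 p₂ (λ ()) o)
      ; bottom = λ o → horizontal′ 1 q₁ (λ ()) o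
      ; top = λ o → subst (λ y → RoleAt H V (val o + cx L (1 + i)) y (vw 2)) (cx-next (vertical L) (1 + j)) (horizontal′ 2 q₂ (λ ()) o) }
      where
      L = level n
      tl = tiling (horizontal L)
      align = aligned (p L) (Hierarchical.p-next tl)
      alignᵗ = aligned (q L) (Hierarchical.q-next tl)
      i = proj₁ align
      j = proj₁ alignᵗ
      p₁ : p L (1 + i) ≡ 1
      p₁ = trans (Hierarchical.p-next tl i) (cong next₃ (proj₂ align))
      p₂ : p L (2 + i) ≡ 2
      p₂ = trans (Hierarchical.p-next tl (1 + i)) (cong next₃ p₁)
      q₁ : q L (1 + j) ≡ 1
      q₁ = trans (Hierarchical.q-next tl j) (cong next₃ (proj₂ alignᵗ))
      q₂ : q L (2 + j) ≡ 2
      q₂ = trans (Hierarchical.q-next tl (1 + j)) (cong next₃ q₁)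
      vertical′ : ∀ k → p L (k + i) ≡ k → k ≢ 0 → ∀ o → RoleAt H V (cx L (k + i)) (val o + ry L (1 + j)) (hw k)
      vertical′ k e k≢0 o = let c , v , s = line-crossing L (k + i) (1 + j) o (k≢0 ∘ trans (sym e)) in c , trans v q₁ , trans s e
      horizontal′ : ∀ k → q L (k + j) ≡ k → k ≢ 0 → ∀ o → RoleAt H V (val o + cx L (1 + i)) (ry L (k + j)) (vw k)
      horizontal′ k e k≢0 o = let c , v , s = line-crossingᵗ L (1 + i) (k + j) o (k≢0 ∘ trans (sym e)) in c , trans v p₁ , trans s e

-- Every computation square contains an initial part of the run

module Forcing where

  open import Defs
  open Codes
  open PayloadTiles using (Payload)
  open TileSet
  open Coarsening
  open Hierarchy
  open import Data.Fin using (Fin; zero; suc; toℕ; #_)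
  open import Data.Nat
  open import Data.Nat.Properties
  open import Data.Nat.Tactic.RingSolver using (solve-∀)
  open import Data.Product using (∃; _×_; _,_; proj₁; proj₂)
  open import Data.Sum using (_⊎_; inj₁; inj₂)
  open import Function using (_∘_; const)
  open import Relation.Binary.PropositionalEquality hiding ([_]; J)
  open import Relation.Nullary using (yes; no; contradiction)

  open Edge

  -- An edge is named by the position before it, so this names the edge that enters the position
  -- `val o`.
  prd : ∀ {n} → Off n → ℕ
  prd {suc n} (sub k o) = toℕ k * 3 ^ n + prd o
  prd {suc n} (line k)  = pred (suc (toℕ k) * 3 ^ n)

  suc-pred-pos : ∀ {m} → 0 < m → suc (pred m) ≡ m
  suc-pred-pos (s≤s _) = refl

  3^n>0 : ∀ n → 0 < 3 ^ n
  3^n>0 = m^n>0 3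

  val≡suc-prd : ∀ {n} (o : Off n) → val o ≡ suc (prd o)
  val≡suc-prd {suc n} (sub k o) = trans (cong (toℕ k * 3 ^ n +_) (val≡suc-prd o)) (+-suc _ _)
  val≡suc-prd {suc n} (line k) = sym (suc-pred-pos (≤-trans (3^n>0 n) (m≤m+n _ _)))

  last : ℕ → ℕ
  last n = pred (3 ^ n)

  total : ∀ n → (Off n → ℕ) → ℕ
  total zero    f = 0
  total (suc n) f = total n (f ∘ sub (# 0)) + (f (line (# 0)) + (total n (f ∘ sub (# 1)) + (f (line (# 1)) + total n (f ∘ sub (# 2)))))

  prefix : ∀ {n} → (Off n → ℕ) → Off n → ℕ
  prefix f (sub zero o)             = prefix (f ∘ sub (# 0)) o
  prefix {suc n} f (line zero)      = total n (f ∘ sub (# 0))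
  prefix {suc n} f (sub (suc zero) o) = prefix (f ∘ sub (# 1)) o + (f (line (# 0)) + total n (f ∘ sub (# 0)))
  prefix {suc n} f (line (suc zero)) = total n (f ∘ sub (# 1)) + (f (line (# 0)) + total n (f ∘ sub (# 0)))
  prefix {suc n} f (sub (suc (suc zero)) o) =
    prefix (f ∘ sub (# 2)) o + (f (line (# 1)) + (total n (f ∘ sub (# 1)) + (f (line (# 0)) + total n (f ∘ sub (# 0)))))

  -- Induction along a block: `Q k c` speaks of the edge after position k when the values of f
  -- passed so far bring the count to c. With f = `free` the count is the number of payload lines
  -- passed; with f = 0 this is plain invariance.
  scan : ∀ n (f : Off n → ℕ) (Q : ℕ → ℕ → Set) base c →
    (∀ o → Q (prd o + base) (prefix f o + c) → Q (val o + base) (f o + (prefix f o + c))) → Q base c →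
    (∀ o → Q (prd o + base) (prefix f o + c)) × Q (last n + base) (total n f + c)
  scan zero f Q base c step q = (λ ()) , q
  scan (suc n) f Q base c step q₀ = all , subst₂ Q endpos endcount (proj₂ s₂)
    where
    N = 3 ^ n
    f₀ = f ∘ sub (# 0)
    f₁ = f ∘ sub (# 1)
    f₂ = f ∘ sub (# 2)
    c₀ = total n f₀
    c₁ = f (line (# 0)) + c₀
    c₂ = total n f₁ + c₁
    c₃ = f (line (# 1)) + c₂
    block : ∀ (k : Fin 3) g d → (∀ o → f (sub k o) ≡ g o) → (∀ o → prefix f (sub k o) ≡ prefix g o + d) → Q (toℕ k * N + base) (d + c) →
      (∀ o → Q (prd o + (toℕ k * N + base)) (prefix g o + (d + c))) × Q (last n + (toℕ k * N + base)) (total n g + (d + c))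
    block k g d f≡ p≡ = scan n g Q (toℕ k * N + base) (d + c) λ o q →
      subst₂ Q (sym (pos (val o))) (cong₂ _+_ (f≡ o) (count o))
        (step (sub k o) (subst₂ Q (pos (prd o)) (sym (count o)) q))
      where
      pos : ∀ v → v + (toℕ k * N + base) ≡ toℕ k * N + v + base
      pos v = lemma v (toℕ k * N) base
        where
        lemma : ∀ a b c → a + (b + c) ≡ b + a + c
        lemma = solve-∀
      count : ∀ o → prefix f (sub k o) + c ≡ prefix g o + (d + c)
      count o = trans (cong (_+ c) (p≡ o)) (+-assoc (prefix g o) d c)
    pos′ : ∀ (k : Fin 3) v → v + (toℕ k * N + base) ≡ toℕ k * N + v + base
    pos′ k v = lemma v (toℕ k * N) base
      where
      lemma : ∀ a b c → a + (b + c) ≡ b + a + c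
      lemma = solve-∀
    before : ∀ m → last n + (m * N + base) ≡ pred (suc m * N) + base
    before m = trans (sym (+-assoc (last n) (m * N) base)) (cong (_+ base) (pred-+ (3^n>0 n)))
      where
      pred-+ : ∀ {a b} → 0 < a → pred a + b ≡ pred (a + b)
      pred-+ (s≤s _) = refl
    s₀ = block zero f₀ 0 (λ _ → refl) (λ _ → sym (+-identityʳ _)) q₀
    l₀ = step (line zero) (subst₂ Q (before 0) refl (proj₂ s₀))
    s₁ = block (suc zero) f₁ c₁ (λ _ → refl) (λ _ → refl) (subst (Q _) (sym (+-assoc (f (line (# 0))) c₀ c)) l₀)
    l₁ = step (line (suc zero)) (subst₂ Q (before 1) (sym (+-assoc (total n f₁) c₁ c)) (proj₂ s₁))
    s₂ = block (suc (suc zero)) f₂ c₃ (λ _ → refl) (λ _ → refl) (subst (Q _) (sym (+-assoc (f (line (# 1))) c₂ c)) l₁)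
    all : ∀ o → Q (prd o + base) (prefix f o + c)
    all (sub zero o) = proj₁ s₀ o
    all (line zero) = subst₂ Q (before 0) refl (proj₂ s₀)
    all (sub (suc zero) o) = subst₂ Q (pos′ (# 1) (prd o)) (sym (+-assoc (prefix f₁ o) c₁ c)) (proj₁ s₁ o)
    all (line (suc zero)) = subst₂ Q (before 1) (sym (+-assoc (total n f₁) c₁ c)) (proj₂ s₁)
    all (sub (suc (suc zero)) o) = subst₂ Q (pos′ (# 2) (prd o)) (sym (+-assoc (prefix f₂ o) c₃ c)) (proj₁ s₂ o)
    endpos : last n + (2 * N + base) ≡ last (suc n) + base
    endpos = before 2
    endcount : total n f₂ + (c₃ + c) ≡ total (suc n) f + c
    endcount = lemma c₀ (f (line (# 0))) (total n f₁) (f (line (# 1))) (total n f₂) c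
      where
      lemma : ∀ x y z u v c → v + (u + (z + (y + x)) + c) ≡ x + (y + (z + (u + v))) + c
      lemma = solve-∀

  outer : Fin 3 → ℕ → ℕ
  outer zero             k = k
  outer (suc zero)       k = 0
  outer (suc (suc zero)) k = k

  -- A line is free when it meets no computation square of lower level.
  free : ∀ {n} → Off n → ℕ
  free (sub k o) = outer k (free o)
  free (line _)  = 1

  free-01 : ∀ {n} (o : Off n) → free o ≡ 0 ⊎ free o ≡ 1
  free-01 (sub zero o)             = free-01 o
  free-01 (sub (suc zero) o)       = inj₁ refl
  free-01 (sub (suc (suc zero)) o) = free-01 o
  free-01 (line _)                 = inj₂ refl

  rank : ∀ {n} → Off n → ℕ
  rank = prefix free

  total-zero : ∀ n → total n (const 0) ≡ 0
  total-zero zero = refl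
  total-zero (suc n) rewrite total-zero n = refl

  -- The first third repeats the free lines of the previous level, and each level adds at least one
  -- line.
  many-free : ∀ n → n ≤ total n free
  many-free zero = z≤n
  many-free (suc n) = ≤-trans (s≤s (many-free n)) (≤-trans (≤-reflexive (+-comm 1 _)) (+-monoʳ-≤ (total n free) (s≤s z≤n)))

  -- The order is: first third, first line, second line, last third. The middle third has no free
  -- lines, which explains the offset 2 + `total n free`.
  free-of-rank : ∀ n i → i < total n free → ∃ λ (o : Off n) → free o ≡ 1 × rank o ≡ i
  free-of-rank zero i ()
  free-of-rank (suc n) i i< with i <? total n free
  ... | yes lt = let o , fr , r = free-of-rank n i lt in sub zero o , fr , r
  ... | no ge with i ≟ total n free
  ...   | yes refl = line zero , refl , refl
  ...   | no ne with i ≟ suc (total n free)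
  ...     | yes refl = line (suc zero) , refl , cong (_+ suc (total n free)) (total-zero n)
  ...     | no ne′ = let o , fr , r = free-of-rank n (i ∸ (2 + total n free)) bound in
    sub (suc (suc zero)) o , fr , trans (cong₂ _+_ r (cong (λ z → suc (z + suc (total n free))) (total-zero n))) (m∸n+n≡m big)
    where
    big : 2 + total n free ≤ i
    big = ≤∧≢⇒< (≤∧≢⇒< (≮⇒≥ ge) (ne ∘ sym)) (ne′ ∘ sym)
    bound : i ∸ (2 + total n free) < total n free
    bound = +-cancelʳ-< (2 + total n free) _ _ (subst₂ _<_ (sym (m∸n+n≡m big)) shape i<)
      where
      shape : total (suc n) free ≡ total n free + (2 + total n free)
      shape = trans (cong (λ z → total n free + suc (z + suc (total n free))) (total-zero n)) refl

  data NotV : Role → Set where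
    plain : NotV plain
    hw : ∀ {s} → NotV (hw s)

  -- A horizontal side meets only columns in the middle third at its level, and those are not free.
  free-column : ∀ {n} (w : Off n) → free w ≡ 1 → ∀ u → NotV (role w u)
  free-column (sub zero w) f (sub _ u) = free-column w f u
  free-column (sub (suc (suc zero)) w) f (sub _ u) = free-column w f u
  free-column (sub zero w) f (line _) = plain
  free-column (sub (suc (suc zero)) w) f (line _) = plain
  free-column (line _) f (sub zero u) = plain
  free-column (line _) f (sub (suc zero) u) = hw
  free-column (line _) f (sub (suc (suc zero)) u) = plain
  free-column (line _) f (line _) = plain

  role-flip : ∀ {n} (w u : Off n) → role w u ≡ flip-role (role u w)
  role-flip (sub _ w) (sub _ u) = role-flip w u
  role-flip (line _) (line _) = refl
  role-flip (line _) (sub zero _) = refl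
  role-flip (line _) (sub (suc zero) _) = refl
  role-flip (line _) (sub (suc (suc zero)) _) = refl
  role-flip (sub zero _) (line _) = refl
  role-flip (sub (suc zero) _) (line _) = refl
  role-flip (sub (suc (suc zero)) _) (line _) = refl

  -- Wires without their payload: `N` is 0, `D` is idle inside a square, and `F` is active.
  data Class : Set where
    N D F : Class

  class : ℕ → Class
  class 0 = N
  class 1 = D
  class (suc (suc _)) = F

  Step : Role → Class → Class → Set
  Step plain  b t = t ≡ b
  Step (hw _) b t = t ≡ b
  Step (vw 1) b t = b ≢ F × t ≢ N
  Step (vw _) b t = b ≢ D × t ≡ N

  step-notV : ∀ {ρ b t} → NotV ρ → Step ρ b t → t ≡ b
  step-notV plain e = e
  step-notV hw e = e

  module _ (c : ℕ → Class) where

    Steps : ∀ {n} → Off n → ℕ → Set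
    Steps {n} w base = ∀ (u : Off n) → Step (role w u) (c (prd u + base)) (c (val u + base))

    constant : ∀ {n} (w : Off n) base → free w ≡ 1 → Steps w base →
      (∀ u → c (prd u + base) ≡ c base) × c (last n + base) ≡ c base
    constant {n} w base fr st = scan n (const 0) (λ k _ → c k ≡ c base) base 0
      (λ u e → trans (step-notV (free-column w fr u) (st u)) e) refl

    -- The clauses about the two ends of the block strengthen the induction, so that the three
    -- thirds of a larger block can be chained.
    Sealed : ∀ {n} → Off n → ℕ → Set
    Sealed {n} w base = c base ≢ F × c (last n + base) ≡ N × (∀ (u : Off n) → free u ≡ 1 → NotV (role w u) → c (prd u + base) ≢ F)

    N≢F : ∀ {x} → x ≡ N → x ≢ F
    N≢F refl ()

    module Blocks {n : ℕ} (base : ℕ) where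

      M₀ = 3 ^ n

      start : Fin 3 → ℕ
      start j = toℕ j * M₀ + base

      pos : ∀ (j : Fin 3) v → v + start j ≡ toℕ j * M₀ + v + base
      pos j v = lemma v (toℕ j * M₀) base
        where
        lemma : ∀ a b c → a + (b + c) ≡ b + a + c
        lemma = solve-∀

      before : ∀ m → last n + (m * M₀ + base) ≡ pred (suc m * M₀) + base
      before m = trans (sym (+-assoc (last n) (m * M₀) base)) (cong (_+ base) (pred-+ (3^n>0 n)))
        where
        pred-+ : ∀ {a b} → 0 < a → pred a + b ≡ pred (a + b)
        pred-+ (s≤s _) = refl

      inBlock : ∀ {k} {w : Off n} → Steps (sub k w) base → ∀ j → Steps w (start j)
      inBlock {w = w} st j u = subst₂ (λ x y → Step (role w u) (c x) (c y)) (sym (pos j (prd u))) (sym (pos j (val u))) (st (sub j u))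

      outer-sealed : ∀ {k} {w : Off n} → (∀ j → Sealed w (start j)) → Sealed (sub k w) base
      outer-sealed {k} {w} S₀ = proj₁ (S₀ (# 0)) , subst (λ x → c x ≡ N) (before 2) (proj₁ (proj₂ (S₀ (# 2)))) , go
        where
        go : ∀ (u : Off (suc n)) → free u ≡ 1 → NotV (role (sub k w) u) → c (prd u + base) ≢ F
        go (sub zero u) f nv = proj₂ (proj₂ (S₀ (# 0))) u f nv
        go (sub (suc (suc zero)) u) f nv = subst (λ x → c x ≢ F) (pos (# 2) (prd u)) (proj₂ (proj₂ (S₀ (# 2))) u f nv)
        go (line zero) f nv = subst (λ x → c x ≢ F) (before 0) (N≢F (proj₁ (proj₂ (S₀ (# 0)))))
        go (line (suc zero)) f nv = subst (λ x → c x ≢ F) (before 1) (N≢F (proj₁ (proj₂ (S₀ (# 1)))))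

      -- Such a wire runs through an inner square in the middle block. If it is free there, it is
      -- constant in the two outer blocks; entering the square excludes `F` before it, and leaving
      -- the square gives `N` after it.
      middle-sealed : ∀ {w : Off n} → Steps (sub (# 1) w) base → free w ≡ 1 ⊎ (∀ j → Sealed w (start j)) → Sealed (sub (# 1) w) base
      middle-sealed {w} st alt = proj₁ low , subst (λ x → c x ≡ N) (before 2) (proj₁ high) , go
        where
        enter : c (last n + start (# 0)) ≢ F
        enter = subst (λ x → c x ≢ F) (sym (before 0)) (proj₁ (st (line (# 0))))
        leave : c (start (# 2)) ≡ N
        leave = proj₂ (st (line (# 1)))
        Alternative = free w ≡ 1 ⊎ (∀ j → Sealed w (start j))
        lowOf : Alternative → c base ≢ F × (∀ (u : Off n) → free u ≡ 1 → NotV (role w u) → c (prd u + start (# 0)) ≢ F)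
        lowOf (inj₂ S₀) = proj₁ (S₀ (# 0)) , proj₂ (proj₂ (S₀ (# 0)))
        lowOf (inj₁ fr) = let each , end = constant w (start (# 0)) fr (inBlock st (# 0)) in
          enter ∘ trans end , λ u _ _ e → enter (trans end (trans (sym (each u)) e))
        low = lowOf alt
        highOf : Alternative → c (last n + start (# 2)) ≡ N × (∀ (u : Off n) → free u ≡ 1 → NotV (role w u) → c (prd u + start (# 2)) ≢ F)
        highOf (inj₂ S₀) = proj₂ (S₀ (# 2))
        highOf (inj₁ fr) = let each , end = constant w (start (# 2)) fr (inBlock st (# 2)) in
          trans end leave , λ u _ _ → N≢F (trans (each u) leave)
        high = highOf alt
        go : ∀ (u : Off (suc n)) → free u ≡ 1 → NotV (role (sub (# 1) w) u) → c (prd u + base) ≢ F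
        go (sub zero u) f nv = proj₂ low u f nv
        go (sub (suc (suc zero)) u) f nv = subst (λ x → c x ≢ F) (pos (# 2) (prd u)) (proj₂ high u f nv)
        go (line _) f ()

    -- On a column that is not free, every free row is reached outside of the computation squares.
    sealed : ∀ {n} (w : Off n) base → free w ≡ 0 → Steps w base → Sealed w base
    sealed {suc n} (sub zero w) base fr st = outer-sealed λ j → sealed w (start j) fr (inBlock st j)
      where open Blocks {n} base
    sealed {suc n} (sub (suc (suc zero)) w) base fr st = outer-sealed λ j → sealed w (start j) fr (inBlock st j)
      where open Blocks {n} base
    sealed {suc n} (sub (suc zero) w) base _ st with free-01 w
    ... | inj₁ fr = middle-sealed st (inj₂ λ j → sealed w (start j) fr (inBlock st j))
      where open Blocks {n} base
    ... | inj₂ fr = middle-sealed st (inj₁ fr)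
      where open Blocks {n} base

  LocalPayload : ℕ → Role → Edge ℕ → Edge ℕ → Edge ℕ → Edge ℕ → Set
  LocalPayload a plain  l b r t = Pass a l b r t
  LocalPayload a (hw s) l b r t = AtWall 2 l b r t × rk b ≡ s
  LocalPayload a (vw s) l b r t = AtWall 3 b l t r × rk l ≡ s

  -- The role says how `h₀` changes along both lines, and this contradicts every clause of `ruleF`
  -- but the intended one.
  local-payload : ∀ {a ρ l b r t} → Rule a l b r t → HasRole ρ l b r t → LocalPayload a ρ l b r t
  local-payload {ρ = plain} (_ , inj₁ (_ , pass)) _ = pass
  local-payload {ρ = plain} (_ , inj₂ (inj₁ (_ , inj₂ (_ , pass)))) _ = pass
  local-payload {ρ = plain} (_ , inj₂ (inj₂ (_ , inj₂ (_ , pass)))) _ = pass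
  local-payload {ρ = plain} (_ , inj₂ (inj₁ (((_ , r0) , _) , inj₁ _))) (inj₁ e) = contradiction (trans (sym r0) e) λ ()
  local-payload {ρ = plain} (_ , inj₂ (inj₁ (_ , inj₁ (b1 , _)))) (inj₂ (inj₁ (_ , b≢1))) = contradiction b1 b≢1
  local-payload {ρ = plain} (_ , inj₂ (inj₁ (((_ , _) , (t≡b , _) , _) , inj₁ _))) (inj₂ (inj₂ (((b2 , t0) , _) , _))) =
    contradiction (trans (sym t0) (trans t≡b b2)) λ ()
  local-payload {ρ = plain} (_ , inj₂ (inj₂ ((_ , (r≡l , _) , _) , inj₁ _))) (inj₁ e) = contradiction (trans (sym e) r≡l) 1+n≢n
  local-payload {ρ = plain} (_ , inj₂ (inj₂ ((_ , (r≡l , _) , _) , inj₁ _))) (inj₂ (inj₁ (((l2 , r0) , _) , _))) =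
    contradiction (trans (sym r0) (trans r≡l l2)) λ ()
  local-payload {ρ = plain} (_ , inj₂ (inj₂ (_ , inj₁ (l1 , _)))) (inj₂ (inj₂ (_ , l≢1))) = contradiction l1 l≢1
  local-payload {ρ = hw s} (_ , inj₁ (((e , e′) , _) , _)) (((_ , r0) , _) , _) = contradiction (trans e (trans (sym e′) r0)) λ ()
  local-payload {ρ = hw s} (_ , inj₂ (inj₁ (_ , inj₁ (_ , wall)))) (_ , _ , s≡) = wall , s≡
  local-payload {ρ = hw s} (_ , inj₂ (inj₁ (_ , inj₂ (b≢1 , _)))) (_ , b1 , _) = contradiction b1 b≢1
  local-payload {ρ = hw s} (_ , inj₂ (inj₂ ((_ , (r≡l , _) , _) , _))) (((l2 , r0) , _) , _) = contradiction (trans (sym r0) (trans r≡l l2)) λ ()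
  local-payload {ρ = vw s} (_ , inj₁ ((_ , (e , e′) , _) , _)) (((_ , t0) , _) , _) = contradiction (trans e (trans (sym e′) t0)) λ ()
  local-payload {ρ = vw s} (_ , inj₂ (inj₂ (_ , inj₁ (_ , wall)))) (_ , _ , s≡) = wall , s≡
  local-payload {ρ = vw s} (_ , inj₂ (inj₂ (_ , inj₂ (b≢1 , _)))) (_ , b1 , _) = contradiction b1 b≢1
  local-payload {ρ = vw s} (_ , inj₂ (inj₁ ((_ , (t≡b , _) , _) , _))) (((b2 , t0) , _) , _) = contradiction (trans (sym t0) (trans t≡b b2)) λ ()

  class-F : ∀ {k} → 1 < k → class k ≡ F
  class-F (s≤s (s≤s _)) = refl

  F-class : ∀ {k} → class k ≡ F → 1 < k
  F-class {suc (suc k)} _ = s≤s (s≤s z≤n)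

  pass-class : ∀ {a l b r t} → Pass a l b r t → class (ty r) ≡ class (ty l) × class (ty t) ≡ class (ty b)
  pass-class (inj₁ ((l , b) , (r , t) , _)) = trans (class-F r) (sym (class-F l)) , trans (class-F t) (sym (class-F b))
  pass-class (inj₂ (_ , r , t)) = cong class r , cong class t

  wall-class : ∀ {s k l b r t} → 1 < k → AtWall k l b r t → rk b ≡ s → Step (vw s) (class (ty l)) (class (ty r))
  wall-class {1} 1<k (_ , inj₁ (_ , nF , inj₁ r≡)) _ = (nF ∘ F-class) , λ e → contradiction (trans (sym (cong class r≡)) e) λ ()
  wall-class {1} 1<k (_ , inj₁ (_ , nF , inj₂ r≡)) _ = (nF ∘ F-class) , λ e → contradiction (trans (sym (trans (cong class r≡) (class-F 1<k))) e) λ ()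
  wall-class {1} 1<k (_ , inj₂ (two , _)) one = contradiction (trans (sym two) one) λ ()
  wall-class {0} 1<k (_ , inj₁ (one , _)) e = contradiction (trans (sym one) e) λ ()
  wall-class {0} 1<k (_ , inj₂ (two , _)) e = contradiction (trans (sym two) e) λ ()
  wall-class {suc (suc s)} 1<k (_ , inj₁ (one , _)) e = contradiction (trans (sym one) e) λ ()
  wall-class {suc (suc s)} {l = l} 1<k (_ , inj₂ (_ , l≢ , r0)) e = notD , cong class r0
    where
    notD : class (ty l) ≢ D
    notD e with ty l
    notD () | 0
    notD _ | 1 = l≢ refl
    notD () | suc (suc _)

  column-step : ∀ {a l b r t} ρ → LocalPayload a ρ l b r t → Step ρ (class (ty b)) (class (ty t))
  column-step {a} {l} {b} {r} {t} plain pass = proj₂ (pass-class {a} {l} {b} {r} {t} pass)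
  column-step (hw s) ((t≡b , _) , _) = cong class t≡b
  column-step {a} {l} {b} {r} {t} (vw s) (wall , e) = wall-class {s} {3} {b} {l} {t} {r} (s≤s (s≤s z≤n)) wall e

  row-step : ∀ {a l b r t} ρ → LocalPayload a ρ l b r t → Step (flip-role ρ) (class (ty l)) (class (ty r))
  row-step {a} {l} {b} {r} {t} plain pass = proj₁ (pass-class {a} {l} {b} {r} {t} pass)
  row-step (vw s) ((r≡l , _) , _) = cong class r≡l
  row-step {a} {l} {b} {r} {t} (hw s) (wall , e) = wall-class {s} {2} {l} {b} {r} {t} (s≤s (s≤s z≤n)) wall e

  entered : ∀ {k l b r t} → 1 < k → AtWall k l b r t → rk b ≡ 1 → class (ty r) ≡ F → ty r ≡ k
  entered _ (_ , inj₁ (_ , _ , inj₁ e)) _ f = contradiction (trans (sym (cong class e)) f) λ ()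
  entered _ (_ , inj₁ (_ , _ , inj₂ e)) _ _ = e
  entered _ (_ , inj₂ (two , _)) one _ = contradiction (trans (sym two) one) λ ()

  module Forced {p⁰ q⁰ H V} (fine : Hierarchical p⁰ q⁰ H V) (a : ℕ)
    (rules : ∀ x y → Rule a (H x y) (V x y) (H (suc x) y) (V x (suc y)))
    (Hp Vp : ℕ → ℕ → ℕ) (Hp₀ : ∀ j → Hp 0 j ≡ 0) (Vp₀ : ∀ i → Vp i 0 ≡ 1)
    (det : ∀ i j {r t} → Payload a (Hp i j) (Vp i j) r t → r ≡ Hp (suc i) j × t ≡ Vp i (suc j))
    {n : ℕ} (square : Levels.Square fine n) where

    open Levels.Square square

    local : ∀ {ρ} x y → RoleAt H V x y ρ → LocalPayload a ρ (H x y) (V x y) (H (suc x) y) (V x (suc y))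
    local {ρ} x y = local-payload {a} {ρ} {H x y} {V x y} {H (suc x) y} {V x (suc y)} (rules x y)

    left-edge : ∀ (w : Off n) y → H (suc (prd w + x₀)) y ≡ H (val w + x₀) y
    left-edge w y = cong (λ z → H (z + x₀) y) (sym (val≡suc-prd w))
    bottom-edge : ∀ x (u : Off n) → V x (suc (prd u + y₀)) ≡ V x (val u + y₀)
    bottom-edge x u = cong (λ z → V x (z + y₀)) (sym (val≡suc-prd u))

    rowClass columnClass : Off n → ℕ → Class
    rowClass u k = class (ty (H (suc k) (val u + y₀)))
    columnClass w k = class (ty (V (val w + x₀) (suc k)))

    row-steps : ∀ u → Steps (rowClass u) u x₀
    row-steps u w = subst₂ (λ ρ c → Step ρ c (rowClass u (val w + x₀))) (sym (role-flip u w))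
      (cong (class ∘ ty) (sym (left-edge w (val u + y₀)))) (row-step {a} {H (val w + x₀) (val u + y₀)} {V (val w + x₀) (val u + y₀)} {H (suc (val w + x₀)) (val u + y₀)} {V (val w + x₀) (suc (val u + y₀))} (role w u) (local {role w u} (val w + x₀) (val u + y₀) (inside w u)))

    column-steps : ∀ w → Steps (columnClass w) w y₀
    column-steps w u = subst (λ c → Step (role w u) c (columnClass w (val u + y₀)))
      (cong (class ∘ ty) (sym (bottom-edge (val w + x₀) u))) (column-step {a} {H (val w + x₀) (val u + y₀)} {V (val w + x₀) (val u + y₀)} {H (suc (val w + x₀)) (val u + y₀)} {V (val w + x₀) (suc (val u + y₀))} (role w u) (local {role w u} (val w + x₀) (val u + y₀) (inside w u)))

    module FreeRow (u : Off n) (fu : free u ≡ 1) where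

      y = val u + y₀
      const′ = constant (rowClass u) u x₀ fu (row-steps u)
      wall₁ = local {hw 1} x₀ y (left u)
      wall₂ = local {hw 2} (3 ^ n + x₀) y (right u)

      -- A free row meets no inner side, so its class is the same at both sides of the square: entry
      -- excludes `N` and exit excludes `D`.
      first : rowClass u x₀ ≡ F
      first with rowClass u x₀ in e | proj₂ const′ | wall-class {1} {2} {H x₀ y} {V x₀ y} {H (suc x₀) y} {V x₀ (suc y)} ≤-refl (proj₁ wall₁) (proj₂ wall₁)
                                    | wall-class {2} {2} {H (3 ^ n + x₀) y} {V (3 ^ n + x₀) y} {H (suc (3 ^ n + x₀)) y} {V (3 ^ n + x₀) (suc y)} ≤-refl (proj₁ wall₂) (proj₂ wall₂)
      ... | F | _ | _ | _ = refl
      ... | N | _ | _ , ≢N | _ = contradiction refl ≢N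
      ... | D | end | _ | ≢D , _ = contradiction (trans (cong (λ z → class (ty (H (z + x₀) y))) (sym (suc-pred-pos (3^n>0 n)))) end) ≢D

      start : ty (H (suc x₀) y) ≡ 2
      start = entered {2} {H x₀ y} {V x₀ y} {H (suc x₀) y} {V x₀ (suc y)} ≤-refl (proj₁ wall₁) (proj₂ wall₁) first

    module FreeColumn (w : Off n) (fw : free w ≡ 1) where

      x = val w + x₀
      const′ = constant (columnClass w) w y₀ fw (column-steps w)
      wall₁ = local {vw 1} x y₀ (bottom w)
      wall₂ = local {vw 2} x (3 ^ n + y₀) (top w)

      first : columnClass w y₀ ≡ F
      first with columnClass w y₀ in e | proj₂ const′ | wall-class {1} {3} {V x y₀} {H x y₀} {V x (suc y₀)} {H (suc x) y₀} (s≤s (s≤s z≤n)) (proj₁ wall₁) (proj₂ wall₁)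
                                       | wall-class {2} {3} {V x (3 ^ n + y₀)} {H x (3 ^ n + y₀)} {V x (suc (3 ^ n + y₀))} {H (suc x) (3 ^ n + y₀)} (s≤s (s≤s z≤n)) (proj₁ wall₂) (proj₂ wall₂)
      ... | F | _ | _ | _ = refl
      ... | N | _ | _ , ≢N | _ = contradiction refl ≢N
      ... | D | end | _ | ≢D , _ = contradiction (trans (cong (λ z → class (ty (V x (z + y₀)))) (sym (suc-pred-pos (3^n>0 n)))) end) ≢D

      start : ty (V x (suc y₀)) ≡ 3
      start = entered {3} {V x y₀} {H x y₀} {V x (suc y₀)} {H (suc x) y₀} (s≤s (s≤s z≤n)) (proj₁ wall₁) (proj₂ wall₁) first

    Row : ℕ → ℕ → Set
    Row k j = ∀ (w : Off n) → free w ≡ 1 → ty (V (val w + x₀) (suc k)) ≡ 2 + Vp (rank w) j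

    Along : Off n → ℕ → ℕ → ℕ → Set
    Along u j k i = ty (H (suc k) (val u + y₀)) ≡ 2 + Hp i j

    -- Two free lines can only meet in a plain crossing: a side would put one of them into a middle
    -- third. Both wires are active there, so `passF` demands a payload tile.
    computing : ∀ {w u i j} → free w ≡ 1 → free u ≡ 1 → Along u j (prd w + x₀) i →
      ty (V (val w + x₀) (suc (prd u + y₀))) ≡ 2 + Vp i j →
      let r = H (suc (val w + x₀)) (val u + y₀) ; t = V (val w + x₀) (suc (val u + y₀)) in
      (1 < ty r × 1 < ty t) × Payload a (Hp i j) (Vp i j) (ty r ∸ 2) (ty t ∸ 2)
    computing {w} {u} {i} {j} fw fu l≡ b≡
      with role w u | role-flip w u | free-column w fw u | free-column u fu w | local {role w u} (val w + x₀) (val u + y₀) (inside w u)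
    ... | plain | _ | _ | _ | inj₁ (_ , rt , pay) = rt , subst₂ (λ l b → Payload a (l ∸ 2) (b ∸ 2) (ty (H (suc (val w + x₀)) (val u + y₀)) ∸ 2) (ty (V (val w + x₀) (suc (val u + y₀))) ∸ 2)) l≡′ b≡′ pay
      where
      l≡′ = trans (cong ty (sym (left-edge w (val u + y₀)))) l≡
      b≡′ = trans (cong ty (sym (bottom-edge (val w + x₀) u))) b≡
    ... | plain | _ | _ | _ | inj₂ (none , _) = contradiction
      ( subst (1 <_) (sym (trans (cong ty (sym (left-edge w (val u + y₀)))) l≡)) (s≤s (s≤s z≤n))
      , subst (1 <_) (sym (trans (cong ty (sym (bottom-edge (val w + x₀) u))) b≡)) (s≤s (s≤s z≤n))) none
    ... | hw s | e | _ | nv | _ with role u w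
    computing {w} {u} {i} {j} fw fu l≡ b≡ | hw s | () | _ | _ | _ | plain
    computing {w} {u} {i} {j} fw fu l≡ b≡ | hw s | e | _ | () | _ | vw _

    from-2 : ∀ {k m} → 1 < k → k ∸ 2 ≡ m → k ≡ 2 + m
    from-2 (s≤s (s≤s _)) refl = refl

    -- At a free column `computing` and `det` yield the next colour. At any other column the wire
    -- passes unchanged, since by `sealed` such a column is not active where a free row crosses it
    -- plainly.
    along : ∀ u → free u ≡ 1 → Row (prd u + y₀) (rank u) → ∀ w → Along u (rank u) (prd w + x₀) (rank w)
    along u fu row w = subst (Along u (rank u) (prd w + x₀)) (+-identityʳ (rank w))
      (proj₁ (scan n free (Along u (rank u)) x₀ 0 step (trans (FreeRow.start u fu) (cong (2 +_) (sym (Hp₀ (rank u)))))) w)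
      where
      step : ∀ w → Along u (rank u) (prd w + x₀) (rank w + 0) → Along u (rank u) (val w + x₀) (free w + (rank w + 0))
      step w h with free-01 w
      ... | inj₂ fw rewrite fw | +-identityʳ (rank w) =
        let (r> , _) , pay = computing {w} {u} {rank w} {rank u} fw fu h (row w fw)
        in from-2 r> (proj₁ (det (rank w) (rank u) {ty (H (suc (val w + x₀)) (val u + y₀)) ∸ 2} {ty (V (val w + x₀) (suc (val u + y₀))) ∸ 2} pay))
      ... | inj₁ fw rewrite fw = trans (passes (role w u) (free-column u fu w) (role-flip u w) (local {role w u} (val w + x₀) (val u + y₀) (inside w u))
              (proj₂ (proj₂ (sealed (columnClass w) w y₀ fw (column-steps w))) u fu)) h′
        where
        h′ : ty (H (val w + x₀) (val u + y₀)) ≡ 2 + Hp (rank w + 0) (rank u)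
        h′ = trans (cong ty (sym (left-edge w (val u + y₀)))) h
        passes : ∀ ρ → NotV (role u w) → role u w ≡ flip-role ρ →
          LocalPayload a ρ (H (val w + x₀) (val u + y₀)) (V (val w + x₀) (val u + y₀)) (H (suc (val w + x₀)) (val u + y₀)) (V (val w + x₀) (suc (val u + y₀))) →
          (NotV ρ → columnClass w (prd u + y₀) ≢ F) →
          ty (H (suc (val w + x₀)) (val u + y₀)) ≡ ty (H (val w + x₀) (val u + y₀))
        passes plain nv e (inj₁ ((_ , b>) , _)) closed =
          contradiction (trans (cong (class ∘ ty) (bottom-edge (val w + x₀) u)) (class-F b>)) (closed plain)
        passes plain nv e (inj₂ (_ , r , _)) closed = r
        passes (vw s) nv e ((r , _) , _) closed = r
        passes (hw s) nv e _ closed with role u w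
        passes (hw s) () refl _ closed | vw .s

    rows : ∀ (u : Off n) → Row (prd u + y₀) (rank u)
    rows u = subst (Row (prd u + y₀)) (+-identityʳ (rank u))
      (proj₁ (scan n free Row y₀ 0 step λ w fw → trans (FreeColumn.start w fw) (cong (2 +_) (sym (Vp₀ (rank w))))) u)
      where
      step : ∀ u → Row (prd u + y₀) (rank u + 0) → Row (val u + y₀) (free u + (rank u + 0))
      step u h w fw with free-01 u
      ... | inj₂ fu rewrite fu | +-identityʳ (rank u) =
        let (_ , t>) , pay = computing {w} {u} {rank w} {rank u} fw fu (along u fu h w) (h w fw)
        in from-2 t> (proj₂ (det (rank w) (rank u) {ty (H (suc (val w + x₀)) (val u + y₀)) ∸ 2} {ty (V (val w + x₀) (suc (val u + y₀))) ∸ 2} pay))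
      ... | inj₁ fu rewrite fu = trans (passes (role w u) (free-column w fw u) (local {role w u} (val w + x₀) (val u + y₀) (inside w u))
              (λ nv → proj₂ (proj₂ (sealed (rowClass u) u x₀ fu (row-steps u))) w fw (subst NotV (sym (role-flip u w)) nv))) h′
        where
        h′ : ty (V (val w + x₀) (val u + y₀)) ≡ 2 + Vp (rank w) (rank u + 0)
        h′ = trans (cong ty (sym (bottom-edge (val w + x₀) u))) (h w fw)
        passes : ∀ ρ → NotV ρ →
          LocalPayload a ρ (H (val w + x₀) (val u + y₀)) (V (val w + x₀) (val u + y₀)) (H (suc (val w + x₀)) (val u + y₀)) (V (val w + x₀) (suc (val u + y₀))) →
          (NotV (flip-role ρ) → rowClass u (prd w + x₀) ≢ F) →
          ty (V (val w + x₀) (suc (val u + y₀))) ≡ ty (V (val w + x₀) (val u + y₀))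
        passes plain nv (inj₁ ((l> , _) , _)) closed =
          contradiction (trans (cong (class ∘ ty) (left-edge w (val u + y₀))) (class-F l>)) (closed plain)
        passes plain nv (inj₂ (_ , _ , t)) closed = t
        passes (hw s) nv ((t , _) , _) closed = t

    payload-tile : ∀ i j → i < n → j < n → ∃ λ r → ∃ λ t → Payload a (Hp i j) (Vp i j) r t
    payload-tile i j i< j<
      with free-of-rank n i (<-≤-trans i< (many-free n)) | free-of-rank n j (<-≤-trans j< (many-free n))
    ... | w , fw , refl | u , fu , refl = ty (H (suc (val w + x₀)) (val u + y₀)) ∸ 2 , ty (V (val w + x₀) (suc (val u + y₀))) ∸ 2 ,
        proj₂ (computing {w} {u} {rank w} {rank u} fw fu (along u fu (rows u) w) (rows u w fw))

-- Explicit colours for a block of the plane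

module Blocks where

  open import Defs
  open Expressions using (Holds)
  open Codes
  open PayloadTiles using (Payload)
  open TileSet
  open Coarsening
  open Hierarchy
  open Forcing using (free; free-01)
  open import Data.Bool using (Bool; true; false)
  open import Data.Fin as Fin using (Fin; zero; suc; toℕ; #_; inject₁)
  open import Data.Nat
  open import Data.Nat.Properties
  open import Data.Product using (_×_; _,_; proj₁; proj₂)
  open import Data.Sum using (_⊎_; inj₁; inj₂)
  open import Data.Vec using (Vec; []; _∷_; replicate)
  open import Relation.Binary.PropositionalEquality hiding ([_]; J)

  -- Existence: the hierarchical layer of a block

  Digits : ℕ → Set
  Digits = Vec (Fin 3)

  zeros twos : ∀ n → Digits n
  zeros n = replicate n (# 0)
  twos n  = replicate n (# 2)

  -- Edges of a row are numbered by the position to their left.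
  before after : ∀ {n} → Off n → Digits n
  before (sub k o) = k ∷ before o
  before (line i)  = inject₁ i ∷ twos _
  after (sub k o) = k ∷ after o
  after (line i)  = suc i ∷ zeros _

  rankOf : ∀ {n} → Off n → ℕ
  rankOf (sub _ o) = rankOf o
  rankOf (line i)  = suc (toℕ i)

  parityOf : ∀ {n} → Off n → ℕ
  parityOf (sub _ o)          = parityOf o
  parityOf (line {zero} i)    = suc (toℕ i)
  parityOf (line {suc n} i)   = 0

  -- An edge stores the parity of the position after it, hence the successor of its last digit.
  nextParity : ∀ {n} → Digits n → ℕ
  nextParity []            = 0
  nextParity (d ∷ [])      = next₃ (toℕ d)
  nextParity (_ ∷ d ∷ e)   = nextParity (d ∷ e)

  firstDigit : ∀ {n} → Digits n → ℕ
  firstDigit []      = 0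
  firstDigit (d ∷ _) = toℕ d

  -- The digits `h₀`, `h₁` and `g` of an edge at position e on the line o: at the level of o, above
  -- it and below it. The argument j is the digit above the block.
  d₀ d₁ d₂ : ∀ {n} → Fin 3 → Digits n → Off n → ℕ
  d₀ j (d ∷ e) (sub _ o) = d₀ d e o
  d₀ j (d ∷ e) (line _)  = toℕ d
  d₁ j (d ∷ e) (sub _ o) = d₁ d e o
  d₁ j (d ∷ e) (line _)  = toℕ j
  d₂ j (d ∷ e) (sub _ o) = d₂ d e o
  d₂ j (d ∷ e) (line _)  = firstDigit e

  nextParity-∷ : ∀ {n} d (e : Digits n) → Off n → nextParity (d ∷ e) ≡ nextParity e
  nextParity-∷ d (_ ∷ _) o = refl

  parity-before : ∀ {n} (o : Off n) → nextParity (before o) ≡ parityOf o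
  parity-before (sub k o) = trans (nextParity-∷ k (before o) o) (parity-before o)
  parity-before (line {zero} zero) = refl
  parity-before (line {zero} (suc zero)) = refl
  parity-before (line {suc n} i) = twos-next (inject₁ i) n
    where
    twos-next : ∀ d n → nextParity (d ∷ twos (suc n)) ≡ 0
    twos-next d zero = refl
    twos-next d (suc n) = twos-next (# 2) n

  parity-after : ∀ {n} (o : Off n) → nextParity (after o) ≡ next₃ (parityOf o)
  parity-after (sub k o) = trans (nextParity-∷ k (after o) o) (parity-after o)
  parity-after (line {zero} i) = refl
  parity-after (line {suc n} i) = zeros-next (suc i) n
    where
    zeros-next : ∀ d n → nextParity (d ∷ zeros (suc n)) ≡ 1
    zeros-next d zero = refl
    zeros-next d (suc n) = zeros-next (# 0) n

  hier : ∀ {n} → Fin 3 → Digits n → Off n → ℕ → Edge ℕ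
  hier j e o t = edge (nextParity e) (parityOf o) (rankOf o) (d₀ j e o) (d₁ j e o) (d₂ j e o) t

  -- The ranks of vertical edges count columns.
  hierᵗ : ∀ {n} → Fin 3 → Digits n → Off n → ℕ → Edge ℕ
  hierᵗ j e o t = edge (parityOf o) (nextParity e) (rankOf o) (d₀ j e o) (d₁ j e o) (d₂ j e o) t

  open Edge

  -- Crossing a line of higher level is a carry: all digits below turn from 2 to 0.
  jump₀ : ∀ {n} j j′ (o : Off n) → d₀ j (twos n) o ≡ 2 × d₀ j′ (zeros n) o ≡ 0
  jump₀ j j′ (sub _ o) = jump₀ (# 2) (# 0) o
  jump₀ j j′ (line _)  = refl , refl

  jump₁ : ∀ {n} (o : Off n) → d₁ (# 2) (twos n) o ≡ 2 × d₁ (# 0) (zeros n) o ≡ 0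
  jump₁ (sub _ o) = jump₁ o
  jump₁ (line _)  = refl , refl

  jump₂ : ∀ {n} j j′ (o : Off n) → (parityOf o ≢ 0 × rankOf o ≡ parityOf o) ⊎ (parityOf o ≡ 0 × d₂ j (twos n) o ≡ 2 × d₂ j′ (zeros n) o ≡ 0)
  jump₂ j j′ (sub _ o) = jump₂ (# 2) (# 0) o
  jump₂ j j′ (line {zero} i) = inj₁ ((λ ()) , refl)
  jump₂ j j′ (line {suc n} i) = inj₂ (refl , refl , refl)

  Kind : Role → ℕ → ℕ → Edge ℕ → Edge ℕ → Edge ℕ → Edge ℕ → Set
  Kind ρ p q l b r t =
    Equal p q l b r t × ρ ≡ plain ⊎
    Cross p q l b r t × (h₀ b ≡ 1 × ρ ≡ hw (rk b) ⊎ h₀ b ≢ 1 × ρ ≡ plain) ⊎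
    Cross q p b l t r × (h₀ l ≡ 1 × ρ ≡ vw (rk l) ⊎ h₀ l ≢ 1 × ρ ≡ plain)

  line-parity : ∀ {n} (i : Fin 2) → Off n → parityOf (line {n} i) ≡ 0
  line-parity {suc n} i o = refl

  -- Whether the lower line is exactly one level down, or further, selects the alternative of
  -- `crossF`.
  crossing-digit : ∀ {n} j (k : Fin 3) (o : Off n) → let i = inject₁ j in
    ((1 + d₁ i (twos n) o ≡ 1 + toℕ j × d₁ (suc j) (zeros n) o ≡ 1 + toℕ j × 1 + firstDigit (before o) ≡ rankOf o × firstDigit (after o) ≡ rankOf o) ⊎
     (d₁ i (twos n) o ≡ 2 × d₁ (suc j) (zeros n) o ≡ 0 × firstDigit (after o) ≡ firstDigit (before o)))
  crossing-digit j k (sub m o) = inj₂ (proj₁ (jump₁ o) , proj₂ (jump₁ o) , refl)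
  crossing-digit zero k (line zero) = inj₁ (refl , refl , refl , refl)
  crossing-digit zero k (line (suc zero)) = inj₁ (refl , refl , refl , refl)
  crossing-digit (suc zero) k (line zero) = inj₁ (refl , refl , refl , refl)
  crossing-digit (suc zero) k (line (suc zero)) = inj₁ (refl , refl , refl , refl)

  cross : ∀ {n} (i : Fin 2) (k : Fin 3) (o : Off n) jx jy tl tb tr tt →
    Cross 0 (parityOf o)
      (hier jx (before (line {n} i)) (sub k o) tl) (hierᵗ jy (before (sub k o)) (line {n} i) tb)
      (hier jx (after (line {n} i)) (sub k o) tr) (hierᵗ jy (after (sub k o)) (line {n} i) tt)
  cross i k o jx jy _ _ _ _ = jump₀ (inject₁ i) (suc i) o , (refl , refl) , crossing-digit i k o , refl , jump₂ (inject₁ i) (suc i) o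

  crossᵗ : ∀ {n} (i : Fin 2) (k : Fin 3) (o : Off n) jx jy tl tb tr tt →
    Cross 0 (parityOf o)
      (hierᵗ jy (before (line {n} i)) (sub k o) tb) (hier jx (before (sub k o)) (line {n} i) tl)
      (hierᵗ jy (after (line {n} i)) (sub k o) tt) (hier jx (after (sub k o)) (line {n} i) tr)
  crossᵗ i k o jx jy _ _ _ _ = jump₀ (inject₁ i) (suc i) o , (refl , refl) , crossing-digit i k o , refl , jump₂ (inject₁ i) (suc i) o

  equal-lines : ∀ {n} (i j : Fin 2) jx jy tl tb tr tt →
    Equal (parityOf (line {n} i)) (parityOf (line {n} j))
      (hier jx (before (line {n} i)) (line j) tl) (hierᵗ jy (before (line {n} j)) (line i) tb)
      (hier jx (after (line {n} i)) (line j) tr) (hierᵗ jy (after (line {n} j)) (line i) tt)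
  equal-lines {zero} i j jx jy _ _ _ _ = (digitˡ i , refl) , (digitˡ j , refl) , refl , refl , inj₁ (((λ ()) , refl) , ((λ ()) , refl))
    where
    digitˡ : ∀ (i : Fin 2) → suc (toℕ (inject₁ i)) ≡ suc (toℕ i)
    digitˡ zero = refl
    digitˡ (suc zero) = refl
  equal-lines {suc n} i j jx jy _ _ _ _ = (digitˡ i , refl) , (digitˡ j , refl) , refl , refl , inj₂ (refl , refl , (refl , refl) , (refl , refl))
    where
    digitˡ : ∀ (i : Fin 2) → suc (toℕ (inject₁ i)) ≡ suc (toℕ i)
    digitˡ zero = refl
    digitˡ (suc zero) = refl

  kind : ∀ {n} (w u : Off n) jx jy tl tb tr tt →
    Kind (role w u) (parityOf w) (parityOf u) (hier jx (before w) u tl) (hierᵗ jy (before u) w tb) (hier jx (after w) u tr) (hierᵗ jy (after u) w tt)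
  kind (sub k w) (sub l u) jx jy tl tb tr tt with kind w u k l tl tb tr tt
  ... | inj₁ x = inj₁ x
  ... | inj₂ (inj₁ x) = inj₂ (inj₁ x)
  ... | inj₂ (inj₂ x) = inj₂ (inj₂ x)
  kind {suc n} (line i) (line j) jx jy tl tb tr tt = inj₁ (equal-lines {n} i j jx jy tl tb tr tt , refl)
  kind (line i) (sub l u) jx jy tl tb tr tt rewrite line-parity i u = inj₂ (inj₁ (cross i l u jx jy tl tb tr tt , which l))
    where
    which : ∀ l → toℕ l ≡ 1 × middle l (hw (suc (toℕ i))) ≡ hw (suc (toℕ i)) ⊎ toℕ l ≢ 1 × middle l (hw (suc (toℕ i))) ≡ plain
    which zero = inj₂ ((λ ()) , refl)
    which (suc zero) = inj₁ (refl , refl)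
    which (suc (suc zero)) = inj₂ ((λ ()) , refl)
  kind (sub k w) (line j) jx jy tl tb tr tt rewrite line-parity j w = inj₂ (inj₂ (crossᵗ j k w jx jy tl tb tr tt , which k))
    where
    which : ∀ k → toℕ k ≡ 1 × middle k (vw (suc (toℕ j))) ≡ vw (suc (toℕ j)) ⊎ toℕ k ≢ 1 × middle k (vw (suc (toℕ j))) ≡ plain
    which zero = inj₂ ((λ ()) , refl)
    which (suc zero) = inj₁ (refl , refl)
    which (suc (suc zero)) = inj₂ ((λ ()) , refl)

  -- Existence: the payload layer of a block

  data Ty : Set where
    N D : Ty
    F   : ℕ → ℕ → Ty

  data Ini : Set where
    N D : Ini

  -- What enters a block on its free wires. `ini`: no payload. `F true i j`: wires that advance at
  -- each free line; i and j count the free lines of the enclosing square before the block, along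
  -- and across the wires. `F false i j`: wires that carry their payload unchanged past idle lines.
  data Ctx : Set where
    ini : Ini → Ctx
    F   : Bool → ℕ → ℕ → Ctx

  ty-of : Ini → Ty
  ty-of N = N
  ty-of D = D

  at : Ctx → ℕ → ℕ → Ty
  at (ini i)       m r = ty-of i
  at (F true i j)  m r = F (m + i) (r + j)
  at (F false i j) m r = F i (r + j)

  along across : ℕ → Ctx → Ctx
  along m (F true i j) = F true (m + i) j
  along m c            = c
  across m (F b i j) = F b i (m + j)
  across m c         = c

  freeze : Ctx → Ctx
  freeze (F _ i j) = F false i j
  freeze c         = c

  -- The number of free lines in a block: those of the two outer thirds and the two lines between
  -- the thirds.
  full : ℕ → ℕ
  full zero    = 0
  full (suc n) = full n + (2 + full n)

  count : ∀ {n} → Digits n → ℕ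
  count []                          = 0
  count {suc n} (zero ∷ e)          = count e
  count {suc n} (suc zero ∷ e)      = 1 + full n
  count {suc n} (suc (suc zero) ∷ e) = count e + (2 + full n)

  order : ∀ {n} → Off n → ℕ
  order (sub zero o)                     = order o
  order {suc n} (sub (suc zero) o)       = 1 + full n
  order {suc n} (sub (suc (suc zero)) o) = order o + (2 + full n)
  order {suc n} (line zero)              = full n
  order {suc n} (line (suc zero))        = 1 + full n

  -- The wires entering the subblock in column k and row l of a block, on its free and other rows.
  advance : ℕ → Fin 3 → Ctx → Ctx
  advance n zero             c = c
  advance n (suc zero)       c = freeze (along (1 + full n) c)
  advance n (suc (suc zero)) c = along (2 + full n) c

  context : ℕ → Fin 3 → Fin 3 → Ctx → Ini → Ctx
  context n k zero             c i = advance n k c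
  context n k (suc (suc zero)) c i = across (2 + full n) (advance n k c)
  context n zero             (suc zero) c i = ini i
  -- The central third is a computation square of its own, where the run starts afresh.
  context n (suc zero)       (suc zero) c i = F true 0 0
  context n (suc (suc zero)) (suc zero) c i = ini N

  initial : Fin 3 → Fin 3 → Ini → Ini
  initial zero       l          i = i
  initial (suc zero) (suc zero) i = D
  initial (suc _)    _          i = N

  wire : ∀ {n} → Ctx → Ini → Digits n → Off n → Ty
  wire {suc n} c i (k ∷ e) (sub l o) = wire (context n k l c i) (initial k l i) e o
  wire {suc n} c i (k ∷ e) (line j)  = at c (count (k ∷ e)) (order (line {n} j))

  count-zeros : ∀ n → count (zeros n) ≡ 0
  count-zeros zero = refl
  count-zeros (suc n) = count-zeros n

  count-twos : ∀ n → count (twos n) ≡ full n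
  count-twos zero = refl
  count-twos (suc n) = cong (_+ (2 + full n)) (count-twos n)

  count-before : ∀ {n} (o : Off n) → count (before o) ≡ order o
  count-before (sub zero o) = count-before o
  count-before (sub (suc zero) o) = refl
  count-before {suc n} (sub (suc (suc zero)) o) = cong (_+ (2 + full n)) (count-before o)
  count-before {suc n} (line zero) = count-twos n
  count-before (line (suc zero)) = refl

  count-after : ∀ {n} (o : Off n) → count (after o) ≡ free o + order o
  count-after (sub zero o) = count-after o
  count-after (sub (suc zero) o) = refl
  count-after {suc n} (sub (suc (suc zero)) o) = trans (cong (_+ (2 + full n)) (count-after o)) (+-assoc (free o) (order o) _)
  count-after (line zero) = refl
  count-after {suc n} (line (suc zero)) = cong (_+ (2 + full n)) (count-zeros n)

  at-advance : ∀ n k c (e : Digits n) r → at (advance n k c) (count e) r ≡ at c (count (k ∷ e)) r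
  at-advance n zero c e r = refl
  at-advance n (suc zero) (ini _) e r = refl
  at-advance n (suc zero) (F true i j) e r = refl
  at-advance n (suc zero) (F false i j) e r = refl
  at-advance n (suc (suc zero)) (ini _) e r = refl
  at-advance n (suc (suc zero)) (F true i j) e r = cong (λ z → F z (r + j)) (sym (+-assoc (count e) (2 + full n) i))
  at-advance n (suc (suc zero)) (F false i j) e r = refl

  at-across : ∀ c m d r → at (across d c) m r ≡ at c m (r + d)
  at-across (ini _) m d r = refl
  at-across (F true i j) m d r = cong (F (m + i)) (sym (+-assoc r d j))
  at-across (F false i j) m d r = cong (F i) (sym (+-assoc r d j))

  wire-free : ∀ {n} c i (e : Digits n) (o : Off n) → free o ≡ 1 → wire c i e o ≡ at c (count e) (order o)
  wire-free {suc n} c i (k ∷ e) (sub zero o) fr = trans (wire-free (advance n k c) _ e o fr) (at-advance n k c e (order o))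
  wire-free {suc n} c i (k ∷ e) (sub (suc (suc zero)) o) fr =
    trans (wire-free (across (2 + full n) (advance n k c)) _ e o fr)
      (trans (at-across (advance n k c) (count e) (2 + full n) (order o)) (at-advance n k c e _))
  wire-free {suc n} c i (k ∷ e) (line j) fr = refl

  wire-zeros : ∀ {n} c i (o : Off n) → free o ≡ 0 → wire c i (zeros n) o ≡ ty-of i
  wire-zeros c i (sub zero o) fr = wire-zeros _ i o fr
  wire-zeros c i (sub (suc (suc zero)) o) fr = wire-zeros _ i o fr
  wire-zeros {suc n} c i (sub (suc zero) o) _ with free-01 o
  ... | inj₁ fr = wire-zeros (ini i) i o fr
  ... | inj₂ fr = wire-free (ini i) i (zeros n) o fr

  -- A wire that is not free has passed through an inner square before the end of the block, and
  -- every square is left with `N`.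
  wire-twos : ∀ {n} c i (o : Off n) → free o ≡ 0 → wire c i (twos n) o ≡ N
  wire-twos c i (sub zero o) fr = wire-twos _ N o fr
  wire-twos c i (sub (suc (suc zero)) o) fr = wire-twos _ N o fr
  wire-twos {suc n} c i (sub (suc zero) o) _ with free-01 o
  ... | inj₁ fr = wire-twos (ini N) N o fr
  ... | inj₂ fr = wire-free (ini N) N (twos n) o fr

-- The explicit colours obey the rule inside a block

module BlockTilings where

  open Expressions using (Holds)
  open Codes
  open PayloadTiles using (Payload)
  open TileSet
  open Coarsening
  open Hierarchy
  open Forcing using (free; free-01; NotV; free-column; role-flip; prd; val≡suc-prd; 3^n>0)
  open Blocks
  open import Data.Bool using (true; false)
  open import Data.Fin as Fin using (Fin; zero; suc; toℕ; #_; inject₁)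
  open import Data.Fin.Properties using (toℕ<n; toℕ-injective)
  open import Data.Nat
  open import Data.Nat.Properties
  open import Data.Product using (∃; _×_; _,_; proj₁; proj₂)
  open import Data.Sum using (_⊎_; inj₁; inj₂)
  open import Data.Vec using ([]; _∷_)
  open import Function using (_∘_)
  open import Relation.Binary.PropositionalEquality hiding ([_]; J)
  open import Relation.Nullary using (¬_; contradiction)

  open Edge

  IsF : Ty → Set
  IsF x = ∃ λ i → ∃ λ j → x ≡ F i j

  Wall : ℕ → Ty → Ty → Set
  Wall s l r = s ≡ 1 × ¬ IsF l × (r ≡ D ⊎ ∃ λ j → r ≡ F 0 j) ⊎ s ≡ 2 × l ≢ D × r ≡ N

  Fits : Role → Ty → Ty → Ty → Ty → Set
  Fits plain  l b r t = (∃ λ i → ∃ λ j → (l ≡ F i j × b ≡ F j i) × r ≡ F (suc i) j × t ≡ F (suc j) i) ⊎ (¬ (IsF l × IsF b) × r ≡ l × t ≡ b)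
  Fits (hw s) l b r t = t ≡ b × Wall s l r
  Fits (vw s) l b r t = r ≡ l × Wall s b t

  fits-flip : ∀ {ρ l b r t} → Fits ρ l b r t → Fits (flip-role ρ) b l t r
  fits-flip {plain} (inj₁ (i , j , (l , b) , r , t)) = inj₁ (j , i , (b , l) , t , r)
  fits-flip {plain} (inj₂ (n , r , t)) = inj₂ ((λ { (x , y) → n (y , x) }) , t , r)
  fits-flip {hw s} x = x
  fits-flip {vw s} x = x

  -- The horizontal and vertical contexts that can meet: advancing wires only meet advancing ones,
  -- with exchanged indices, and frozen wires only meet idle ones, so that no payload tile is
  -- demanded there.
  data Good : Ctx → Ctx → Set where
    square : ∀ {i j} → Good (F true i j) (F true j i)
    idle   : ∀ {i j} → Good (ini i) (ini j)
    wireV  : ∀ {i a b} → Good (ini i) (F false a b)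
    wireH  : ∀ {i a b} → Good (F false a b) (ini i)

  good-flip : ∀ {c d} → Good c d → Good d c
  good-flip square = square
  good-flip idle = idle
  good-flip wireV = wireH
  good-flip wireH = wireV

  -- Free wires are frozen exactly while they pass beside the central third, where the crossing
  -- wires are idle; in the central third both directions start afresh.
  good-sub : ∀ n k l {c d} → Good c d → ∀ i j → Good (context n k l c i) (context n l k d j)
  good-sub n zero zero g i j = g
  good-sub n zero (suc zero) square i j = wireV
  good-sub n zero (suc zero) idle i j = idle
  good-sub n zero (suc zero) wireV i j = wireV
  good-sub n zero (suc zero) wireH i j = idle
  good-sub n zero (suc (suc zero)) square i j = square
  good-sub n zero (suc (suc zero)) idle i j = idle
  good-sub n zero (suc (suc zero)) wireV i j = wireV
  good-sub n zero (suc (suc zero)) wireH i j = wireH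
  good-sub n (suc zero) zero square i j = wireH
  good-sub n (suc zero) zero idle i j = idle
  good-sub n (suc zero) zero wireV i j = idle
  good-sub n (suc zero) zero wireH i j = wireH
  good-sub n (suc zero) (suc zero) g i j = square
  good-sub n (suc zero) (suc (suc zero)) square i j = wireH
  good-sub n (suc zero) (suc (suc zero)) idle i j = idle
  good-sub n (suc zero) (suc (suc zero)) wireV i j = idle
  good-sub n (suc zero) (suc (suc zero)) wireH i j = wireH
  good-sub n (suc (suc zero)) zero square i j = square
  good-sub n (suc (suc zero)) zero idle i j = idle
  good-sub n (suc (suc zero)) zero wireV i j = wireV
  good-sub n (suc (suc zero)) zero wireH i j = wireH
  good-sub n (suc (suc zero)) (suc zero) square i j = wireV
  good-sub n (suc (suc zero)) (suc zero) idle i j = idle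
  good-sub n (suc (suc zero)) (suc zero) wireV i j = wireV
  good-sub n (suc (suc zero)) (suc zero) wireH i j = idle
  good-sub n (suc (suc zero)) (suc (suc zero)) square i j = square
  good-sub n (suc (suc zero)) (suc (suc zero)) idle i j = idle
  good-sub n (suc (suc zero)) (suc (suc zero)) wireV i j = wireV
  good-sub n (suc (suc zero)) (suc (suc zero)) wireH i j = wireH

  notF : ∀ i → ¬ IsF (ty-of i)
  notF N (_ , _ , ())
  notF D (_ , _ , ())

  crossing : ∀ {c d} → Good c d → ∀ m r → Fits plain (at c m r) (at d r m) (at c (suc m) r) (at d (suc r) m)
  crossing square m r = inj₁ (_ , _ , (refl , refl) , refl , refl)
  crossing (idle {i}) m r = inj₂ ((λ { (x , _) → notF i x }) , refl , refl)
  crossing (wireV {i}) m r = inj₂ ((λ { (x , _) → notF i x }) , refl , refl)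
  crossing (wireH {i}) m r = inj₂ ((λ { (_ , x) → notF i x }) , refl , refl)

  wire-before : ∀ {n} c i (w u : Off n) → free u ≡ 1 → wire c i (before w) u ≡ at c (order w) (order u)
  wire-before c i w u fu = trans (wire-free c i (before w) u fu) (cong (λ m → at c m (order u)) (count-before w))

  wire-after : ∀ {n} c i (w u : Off n) → free u ≡ 1 → wire c i (after w) u ≡ at c (free w + order w) (order u)
  wire-after c i w u fu = trans (wire-free c i (after w) u fu) (cong (λ m → at c m (order u)) (count-after w))

  wire-unchanged : ∀ {n} c i (w u : Off n) → free w ≡ 0 → free u ≡ 1 → wire c i (after w) u ≡ wire c i (before w) u
  wire-unchanged c i w u fw fu =
    trans (wire-after c i w u fu) (trans (cong (λ f → at c (f + order w) (order u)) fw) (sym (wire-before c i w u fu)))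

  FitsAt : ∀ {n} → Role → Off n → Off n → Ctx → Ini → Ctx → Ini → Set
  FitsAt ρ w u c i d j = Fits ρ (wire c i (before w) u) (wire d j (before u) w) (wire c i (after w) u) (wire d j (after u) w)

  both-free : ∀ {n} (w u : Off n) → free w ≡ 1 → free u ≡ 1 → ∀ {c d} → Good c d → ∀ i j → FitsAt plain w u c i d j
  both-free w u fw fu {c} {d} good i j
    rewrite wire-before c i w u fu | wire-before d j u w fw | wire-after c i w u fu | wire-after d j u w fw | fw | fu =
    crossing good (order w) (order u)

  -- In an outer third the crossing row is free, or it is `N` on both sides of the line. In the
  -- middle third the line is a side of the central square, left for k = 0 and right for k = 1.
  line-fits : ∀ {n} (k : Fin 2) (l : Fin 3) (u : Off n) {c d} → Good c d → ∀ i j → FitsAt (role (line k) (sub l u)) (line k) (sub l u) c i d j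
  line-fits {n} k zero u {c} {d} good i j with free-01 u
  ... | inj₂ fu = both-free (line k) (sub zero u) refl fu good i j
  ... | inj₁ fu = inj₂ ((λ { ((_ , _ , x) , _) → contradiction (trans (sym (wire-twos _ _ u fu)) x) λ () }) ,
                        trans (wire-zeros _ _ u fu) (trans (lem k) (sym (wire-twos _ _ u fu))) , wire-unchanged d j (sub zero u) (line {n} k) fu refl)
    where
    lem : ∀ (k : Fin 2) → ty-of (initial (suc k) zero i) ≡ N
    lem zero = refl
    lem (suc zero) = refl
  line-fits {n} k (suc (suc zero)) u {c} {d} good i j with free-01 u
  ... | inj₂ fu = both-free (line k) (sub (# 2) u) refl fu good i j
  ... | inj₁ fu = inj₂ ((λ { ((_ , _ , x) , _) → contradiction (trans (sym (wire-twos _ _ u fu)) x) λ () }) ,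
                        trans (wire-zeros _ _ u fu) (trans (lem k) (sym (wire-twos _ _ u fu))) , wire-unchanged d j (sub (# 2) u) (line {n} k) fu refl)
    where
    lem : ∀ (k : Fin 2) → ty-of (initial (suc k) (# 2) i) ≡ N
    lem zero = refl
    lem (suc zero) = refl
  line-fits {n} zero (suc zero) u {c} {d} good i j = wire-unchanged d j (sub (# 1) u) (line {n} zero) refl refl , inj₁ (refl , leftNotF , right)
    where
    leftNotF : ¬ IsF (wire (ini i) i (twos n) u)
    leftNotF (_ , _ , x) with free-01 u
    ... | inj₁ fu = contradiction (trans (sym (wire-twos (ini i) i u fu)) x) λ ()
    ... | inj₂ fu = notF i (_ , _ , trans (sym (wire-free (ini i) i (twos n) u fu)) x)
    right : wire (F true 0 0) D (zeros n) u ≡ D ⊎ ∃ λ j → wire (F true 0 0) D (zeros n) u ≡ F 0 j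
    right with free-01 u
    ... | inj₁ fu = inj₁ (wire-zeros (F true 0 0) D u fu)
    ... | inj₂ fu = inj₂ (_ , trans (wire-free (F true 0 0) D (zeros n) u fu) (cong (λ m → F (m + 0) (order u + 0)) (count-zeros n)))
  line-fits {n} (suc zero) (suc zero) u {c} {d} good i j = wire-unchanged d j (sub (# 1) u) (line {n} (suc zero)) refl refl , inj₂ (refl , leftNotD , right)
    where
    leftNotD : wire (F true 0 0) D (twos n) u ≢ D
    leftNotD x with free-01 u
    ... | inj₁ fu = contradiction (trans (sym (wire-twos (F true 0 0) D u fu)) x) λ ()
    ... | inj₂ fu = contradiction (trans (sym (wire-free (F true 0 0) D (twos n) u fu)) x) λ ()
    right : wire (ini N) N (zeros n) u ≡ N
    right with free-01 u
    ... | inj₁ fu = wire-zeros (ini N) N u fu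
    ... | inj₂ fu = wire-free (ini N) N (zeros n) u fu

  fits : ∀ {n} (w u : Off n) {c d} → Good c d → ∀ i j → FitsAt (role w u) w u c i d j
  fits {suc n} (sub k w) (sub l u) good i j = fits w u (good-sub n k l good i j) (initial k l i) (initial l k j)
  fits (line k) (line l) good i j = both-free (line k) (line l) refl refl good i j
  fits (line k) (sub l u) good i j = line-fits k l u good i j
  fits {suc n} (sub k w) (line l) {c} {d} good i j = subst (λ ρ → FitsAt ρ (sub k w) (line l) c i d j) (sym (role-flip (sub k w) (line {n} l)))
    (fits-flip {role (line l) (sub k w)} (line-fits l k w (good-flip good) j i))

  -- The plane as a union of blocks, each one the middle third of the next

  num : ∀ {n} → Digits n → ℕ
  num []              = 0
  num {suc n} (d ∷ e) = toℕ d * 3 ^ n + num e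

  num< : ∀ {n} (e : Digits n) → num e < 3 ^ n
  num< [] = z<s
  num< {suc n} (d ∷ e) = begin-strict
    toℕ d * 3 ^ n + num e    <⟨ +-monoʳ-< (toℕ d * 3 ^ n) (num< e) ⟩
    toℕ d * 3 ^ n + 3 ^ n    ≡⟨ +-comm (toℕ d * 3 ^ n) (3 ^ n) ⟩
    suc (toℕ d) * 3 ^ n      ≤⟨ *-monoˡ-≤ (3 ^ n) (toℕ<n d) ⟩
    3 ^ suc n                ∎
    where open ≤-Reasoning

  leading-unique : ∀ {m x y} k l → x < m → y < m → k * m + x ≡ l * m + y → k ≡ l × x ≡ y
  leading-unique {m} {x} {y} k l x< y< eq = proj₂ digits , proj₁ digits
    where
    digits : x ≡ y × k ≡ l
    digits = radix-unique m k l x< y<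
      (trans (trans (+-comm x (m * k)) (cong (_+ x) (*-comm m k))) (trans eq (trans (cong (_+ y) (*-comm l m)) (+-comm (m * l) y))))

  num-injective : ∀ {n} (e f : Digits n) → num e ≡ num f → e ≡ f
  num-injective [] [] _ = refl
  num-injective {suc n} (d ∷ e) (d′ ∷ f) eq with leading-unique (toℕ d) (toℕ d′) (num< e) (num< f) eq
  ... | x , y = cong₂ _∷_ (toℕ-injective x) (num-injective e f y)

  num-zeros : ∀ n → num (zeros n) ≡ 0
  num-zeros zero = refl
  num-zeros (suc n) = num-zeros n

  num-after : ∀ {n} (o : Off n) → num (after o) ≡ val o
  num-after {suc n} (sub k o) = cong (toℕ k * 3 ^ n +_) (num-after o)
  num-after {suc n} (line k) = trans (cong (suc (toℕ k) * 3 ^ n +_) (num-zeros n)) (+-identityʳ _)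

  num-before : ∀ {n} (o : Off n) → suc (num (before o)) ≡ val o
  num-before {suc n} (sub k o) = trans (sym (+-suc (toℕ k * 3 ^ n) _)) (cong (toℕ k * 3 ^ n +_) (num-before o))
  num-before {suc n} (line k) = trans (cong (λ d → suc (d * 3 ^ n + num (twos n))) (inject k)) (trans (sym (+-suc (toℕ k * 3 ^ n) _))
      (trans (cong (toℕ k * 3 ^ n +_) (suc-twos n)) (+-comm (toℕ k * 3 ^ n) _)))
    where
    inject : ∀ (k : Fin 2) → toℕ (inject₁ k) ≡ toℕ k
    inject zero = refl
    inject (suc zero) = refl
    suc-twos : ∀ n → suc (num (twos n)) ≡ 3 ^ n
    suc-twos zero = refl
    suc-twos (suc n) = trans (sym (+-suc (2 * 3 ^ n) _)) (trans (cong (2 * 3 ^ n +_) (suc-twos n)) (+-comm (2 * 3 ^ n) (3 ^ n)))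

  after-injective : ∀ {n} (o o′ : Off n) → after o ≡ after o′ → o ≡ o′
  after-injective (sub k o) (sub k′ o′) e with after o in p | after o′ in p′
  after-injective (sub k o) (sub .k o′) refl | _ | _ = cong (sub k) (after-injective o o′ (trans p (sym p′)))
  after-injective {suc n} (line k) (line k′) e = cong line (go k k′ e)
    where
    go : ∀ (k k′ : Fin 2) → (Fin.suc k) ∷ zeros n ≡ suc k′ ∷ zeros n → k ≡ k′
    go zero zero _ = refl
    go (suc zero) (suc zero) _ = refl
  after-injective {suc n} (sub k o) (line k′) e = contradiction (trans (num-before o) (trans (sym (num-after o)) (trans (cong (λ { (_ ∷ x) → num x }) e) (num-zeros n)))) λ ()
  after-injective {suc n} (line k) (sub k′ o) e = contradiction (trans (num-before o) (trans (sym (num-after o)) (trans (cong (λ { (_ ∷ x) → num x }) (sym e)) (num-zeros n)))) λ ()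

  val-injective : ∀ {n} (o o′ : Off n) → val o ≡ val o′ → o ≡ o′
  val-injective o o′ e = after-injective o o′ (num-injective _ _ (trans (num-after o) (trans e (sym (num-after o′)))))

  position : ∀ n k → 0 < k → k < 3 ^ n → ∃ λ (o : Off n) → val o ≡ k
  position zero (suc k) _ (s≤s ())
  position (suc n) k 0<k k< with md-dv (3 ^ n) k (3^n>0 n)
  ... | r< , eq = go (dv (3 ^ n) k) (md (3 ^ n) k) r< (trans eq (trans (+-comm _ (3 ^ n * dv (3 ^ n) k)) (cong (_+ md (3 ^ n) k) (*-comm (3 ^ n) _))))
    where
    go : ∀ d r → r < 3 ^ n → k ≡ d * 3 ^ n + r → ∃ λ (o : Off (suc n)) → val o ≡ k
    go (suc (suc (suc d))) r r< e = contradiction (≤-trans k< (≤-reflexive refl)) (≤⇒≯ (subst (3 ^ suc n ≤_) (sym e)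
      (≤-trans (*-monoˡ-≤ (3 ^ n) {3} {3 + d} (m≤m+n 3 d)) (m≤m+n _ r))))
    go 0 zero r< e = contradiction e (<⇒≢ 0<k ∘ sym)
    go 1 zero r< e = line zero , sym (trans e (+-identityʳ _))
    go 2 zero r< e = line (suc zero) , sym (trans e (+-identityʳ _))
    go 0 (suc r) r< e = let o , v = position n (suc r) z<s r< in sub zero o , trans v (sym e)
    go 1 (suc r) r< e = let o , v = position n (suc r) z<s r< in sub (# 1) o , trans (cong (1 * 3 ^ n +_) v) (sym e)
    go 2 (suc r) r< e = let o , v = position n (suc r) z<s r< in sub (# 2) o , trans (cong (2 * 3 ^ n +_) v) (sym e)

-- From nested blocks to a tiling of the plane

module PlaneTilings where

  open Expressions using (Holds)
  open Codes
  open PayloadTiles using (Payload)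
  open TileSet
  open Coarsening
  open Hierarchy
  open Forcing using (3^n>0)
  open Blocks
  open BlockTilings
  open import Data.Bool using (true)
  open import Data.Fin as Fin using (zero; suc; toℕ; #_)
  open import Data.Fin.Properties using (toℕ<n)
  open import Data.Integer as ℤ using (ℤ)
  import Data.Integer.Properties as ℤₚ
  open import Data.Nat
  open import Data.Nat.Properties
  open import Data.Nat.Tactic.RingSolver using (solve-∀)
  open import Data.Product using (∃; _×_; _,_; proj₁; proj₂)
  open import Data.Sum using (_⊎_; inj₁; inj₂)
  open import Data.Vec using ([]; _∷_)
  open import Relation.Binary.PropositionalEquality hiding ([_]; J)
  open import Relation.Nullary using (¬_)

  open Edge

  parityOf<3 : ∀ {n} (o : Off n) → parityOf o < 3
  parityOf<3 (sub _ o) = parityOf<3 o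
  parityOf<3 (line {zero} i) = s≤s (toℕ<n i)
  parityOf<3 (line {suc n} i) = z<s

  rankOf<3 : ∀ {n} (o : Off n) → rankOf o < 3
  rankOf<3 (sub _ o) = rankOf<3 o
  rankOf<3 (line i) = s≤s (toℕ<n i)

  nextParity<3 : ∀ {n} (e : Digits n) → nextParity e < 3
  nextParity<3 [] = z<s
  nextParity<3 (d ∷ []) = md< 3 (suc (toℕ d)) z<s
  nextParity<3 (_ ∷ d ∷ e) = nextParity<3 (d ∷ e)

  firstDigit<3 : ∀ {n} (e : Digits n) → firstDigit e < 3
  firstDigit<3 [] = z<s
  firstDigit<3 (d ∷ _) = toℕ<n d

  d₀<3 : ∀ {n} j (e : Digits n) o → d₀ j e o < 3
  d₀<3 j (d ∷ e) (sub _ o) = d₀<3 d e o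
  d₀<3 j (d ∷ e) (line _) = toℕ<n d

  d₁<3 : ∀ {n} j (e : Digits n) o → d₁ j e o < 3
  d₁<3 j (d ∷ e) (sub _ o) = d₁<3 d e o
  d₁<3 j (d ∷ e) (line _) = toℕ<n j

  d₂<3 : ∀ {n} j (e : Digits n) o → d₂ j e o < 3
  d₂<3 j (d ∷ e) (sub _ o) = d₂<3 d e o
  d₂<3 j (d ∷ e) (line _) = firstDigit<3 e

  hier-ternary : ∀ {n} j (e : Digits n) o t → Ternary (hier j e o t)
  hier-ternary j e o t = ternary (nextParity<3 e) (parityOf<3 o) (rankOf<3 o) (d₀<3 j e o) (d₁<3 j e o) (d₂<3 j e o)

  hierᵗ-ternary : ∀ {n} j (e : Digits n) o t → Ternary (hierᵗ j e o t)
  hierᵗ-ternary j e o t = ternary (parityOf<3 o) (nextParity<3 e) (rankOf<3 o) (d₀<3 j e o) (d₁<3 j e o) (d₂<3 j e o)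

  encode< : ∀ {m} E → Ternary E → ty E < m → encode E < m * 729
  encode< {m} (edge _ _ _ _ _ _ _) (ternary a b c d e f) t< = ≤-trans (step a (step b (step c (step d (step e (step f t<)))))) (≤-reflexive (lem m))
    where
    step : ∀ {x m n} → x < 3 → n < m → x + 3 * n < 3 * m
    step {x} {m} {n} x< n< = ≤-trans (+-monoˡ-≤ (3 * n) x<) (≤-trans (≤-reflexive (sym (*-suc 3 n))) (*-monoʳ-≤ 3 n<))
    lem : ∀ m → 3 * (3 * (3 * (3 * (3 * (3 * m))))) ≡ m * 729
    lem = solve-∀

  mag : ℤ → ℕ
  mag (ℤ.+ m)      = m
  mag ℤ.-[1+ m ] = suc m

  mag-suc : ∀ x → mag (x ℤ.+ ℤ.1ℤ) ≤ suc (mag x)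
  mag-suc (ℤ.+ m) = ≤-reflexive (+-comm m 1)
  mag-suc ℤ.-[1+ zero ] = z≤n
  mag-suc ℤ.-[1+ suc m ] = ≤-trans (n≤1+n _) (n≤1+n _)

  -- The offset of the origin in the block of level n, (3^n - 1)/2; it makes each block the middle
  -- third of the next.
  half : ℕ → ℕ
  half zero    = 0
  half (suc n) = 3 ^ n + half n

  3^n≡half : ∀ n → 3 ^ n ≡ suc (half n + half n)
  3^n≡half zero = refl
  3^n≡half (suc n) = trans (cong (λ m → 3 ^ n + (3 ^ n + (m + 0))) (3^n≡half n)) (lem (3 ^ n) (half n))
    where
    lem : ∀ m k → m + (m + (suc (k + k) + 0)) ≡ suc (m + k + (m + k))
    lem = solve-∀

  n≤half : ∀ n → n ≤ half n
  n≤half zero = z≤n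
  n≤half (suc n) = +-mono-≤ (3^n>0 n) (n≤half n)

  -- Cell x of the plane is the position o of the block of level n around the origin.
  At : ∀ n → ℤ → Off n → Set
  At n x o = ℤ.+ val o ≡ x ℤ.+ ℤ.+ half n

  locate : ∀ n x → mag x < n → ∃ (At n x)
  locate n (ℤ.+ m) m<n = let o , v = position n (m + half n) (<-≤-trans (≤-<-trans z≤n m<n) (≤-trans (n≤half n) (m≤n+m _ m)))
                               (subst (m + half n <_) (sym (3^n≡half n)) (s≤s (+-monoˡ-≤ (half n) (≤-trans (<⇒≤ m<n) (n≤half n)))))
                         in o , cong ℤ.+_ v
  locate n ℤ.-[1+ m ] m<n = let o , v = position n (half n ∸ suc m) (m<n⇒0<n∸m m<h)
                                  (subst (half n ∸ suc m <_) (sym (3^n≡half n)) (s≤s (≤-trans (m∸n≤m (half n) (suc m)) (m≤m+n _ _))))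
                            in o , trans (cong ℤ.+_ v) (sym (ℤₚ.⊖-≥ (<⇒≤ m<h)))
    where
    m<h : suc m < half n
    m<h = ≤-trans m<n (n≤half n)

  at-unique : ∀ {n x o o′} → At n x o → At n x o′ → o ≡ o′
  at-unique p q = val-injective _ _ (ℤₚ.+-injective (trans p (sym q)))

  at-sub : ∀ {n x o} → At n x o → At (suc n) x (sub (# 1) o)
  at-sub {n} {x} {o} p = begin
    ℤ.+ (3 ^ n + 0 + val o)                  ≡⟨ cong (λ m → ℤ.+ (m + val o)) (+-identityʳ (3 ^ n)) ⟩
    ℤ.+ (3 ^ n) ℤ.+ ℤ.+ val o                ≡⟨ cong (λ z → ℤ.+ (3 ^ n) ℤ.+ z) p ⟩
    ℤ.+ (3 ^ n) ℤ.+ (x ℤ.+ ℤ.+ half n)        ≡⟨ ℤₚ.+-assoc (ℤ.+ (3 ^ n)) x (ℤ.+ half n) ⟨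
    ℤ.+ (3 ^ n) ℤ.+ x ℤ.+ ℤ.+ half n          ≡⟨ cong (ℤ._+ ℤ.+ half n) (ℤₚ.+-comm (ℤ.+ (3 ^ n)) x) ⟩
    x ℤ.+ ℤ.+ (3 ^ n) ℤ.+ ℤ.+ half n          ≡⟨ ℤₚ.+-assoc x (ℤ.+ (3 ^ n)) (ℤ.+ half n) ⟩
    x ℤ.+ ℤ.+ half (suc n)                    ∎
    where open ≡-Reasoning

  at-suc : ∀ {n x o o′} → At n x o → At n (x ℤ.+ ℤ.1ℤ) o′ → after o ≡ before o′
  at-suc {n} {x} {o} {o′} p q = num-injective _ _ (suc-injective (trans (cong suc (num-after o)) (sym (trans (num-before o′) (ℤₚ.+-injective (begin
    ℤ.+ val o′                        ≡⟨ q ⟩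
    x ℤ.+ ℤ.1ℤ ℤ.+ ℤ.+ half n         ≡⟨ cong (ℤ._+ ℤ.+ half n) (ℤₚ.+-comm x ℤ.1ℤ) ⟩
    ℤ.1ℤ ℤ.+ x ℤ.+ ℤ.+ half n         ≡⟨ ℤₚ.+-assoc ℤ.1ℤ x (ℤ.+ half n) ⟩
    ℤ.1ℤ ℤ.+ (x ℤ.+ ℤ.+ half n)       ≡⟨ cong (λ z → ℤ.1ℤ ℤ.+ z) p ⟨
    ℤ.+ suc (val o)                   ∎))))))
    where open ≡-Reasoning

  Rule-resp : ∀ {a l l′ b b′ r r′ t t′} → l′ ≡ l → b′ ≡ b → r′ ≡ r → t′ ≡ t → Rule a l b r t → Rule a l′ b′ r′ t′
  Rule-resp refl refl refl refl h = h

  encode-tile : ∀ {a L B R₀ T l b r t} → Ternary L → Ternary B → Ternary R₀ → Ternary T → l ≡ encode L → b ≡ encode B → r ≡ encode R₀ → t ≡ encode T →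
                Rule a L B R₀ T → Holds tileF (l ∷ b ∷ r ∷ t ∷ a ∷ [])
  encode-tile {a} {L} {B} {R₀} {T} L₃ B₃ R₃ T₃ refl refl refl refl h = rule⇒tile {a} {encode L} {encode B} {encode R₀} {encode T}
    (Rule-resp {a} {L} {decode (encode L)} {B} {decode (encode B)} {R₀} {decode (encode R₀)} {T} {decode (encode T)}
      (decode-encode L L₃) (decode-encode B B₃) (decode-encode R₀ R₃) (decode-encode T T₃) h)

  module Plane (a : ℕ) (Hp Vp : ℕ → ℕ → ℕ)
    (live : ∀ i j → Payload a (Hp i j) (Vp i j) (Hp (suc i) j) (Vp i (suc j)))
    (Hp₀ : ∀ j → Hp 0 j ≡ 0) (Vp₀ : ∀ i → Vp i 0 ≡ 1)
    (Hp≤ : ∀ i j → Hp i j ≤ a + a) (Vp≤ : ∀ i j → Vp i j ≤ a + a) where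

    numH numV : Ty → ℕ
    numH N       = 0
    numH D       = 1
    numH (F i j) = 2 + Hp i j
    numV N       = 0
    numV D       = 1
    numV (F j i) = 2 + Vp i j

    numH< : ∀ x → numH x < a + a + 3
    numH< x = <-≤-trans (bound x) (≤-reflexive (+-comm 3 (a + a)))
      where
      bound : ∀ x → numH x < 3 + (a + a)
      bound N = z<s
      bound D = s≤s z<s
      bound (F i j) = s≤s (s≤s (s≤s (Hp≤ i j)))

    numV< : ∀ x → numV x < a + a + 3
    numV< x = <-≤-trans (bound x) (≤-reflexive (+-comm 3 (a + a)))
      where
      bound : ∀ x → numV x < 3 + (a + a)
      bound N = z<s
      bound D = s≤s z<s
      bound (F j i) = s≤s (s≤s (s≤s (Vp≤ i j)))

    ofType : ℕ → Edge ℕ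
    ofType = edge 0 0 0 0 0 0

    notHF : ∀ x → ¬ IsF x → ¬ 1 < numH x
    notHF N _ ()
    notHF D _ (s≤s ())
    notHF (F i j) n _ = n (_ , _ , refl)

    notVF : ∀ x → ¬ IsF x → ¬ 1 < numV x
    notVF N _ ()
    notVF D _ (s≤s ())
    notVF (F i j) n _ = n (_ , _ , refl)

    passes : ∀ {l b r t} → Fits plain l b r t → Pass a (ofType (numH l)) (ofType (numV b)) (ofType (numH r)) (ofType (numV t))
    passes (inj₁ (i , j , (refl , refl) , refl , refl)) = inj₁ ((s≤s (s≤s z≤n) , s≤s (s≤s z≤n)) , (s≤s (s≤s z≤n) , s≤s (s≤s z≤n)) , live i j)
    passes {l} {b} (inj₂ (n , refl , refl)) = inj₂ (not-both l b n , refl , refl)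
      where
      not-both : ∀ l b → ¬ (IsF l × IsF b) → ¬ (1 < numH l × 1 < numV b)
      not-both N b n (() , _)
      not-both D b n (s≤s () , _)
      not-both (F _ _) N n (_ , ())
      not-both (F _ _) D n (_ , s≤s ())
      not-both (F i j) (F k m) n _ = n ((i , j , refl) , (k , m , refl))

    wallH : ∀ {s l b r t} → t ≡ b → Wall s l r → AtWall 2 (ofType (numH l)) (edge 0 0 s 0 0 0 (numV b)) (ofType (numH r)) (ofType (numV t))
    wallH {l = l} refl (inj₁ (refl , n , inj₁ refl)) = refl , inj₁ (refl , notHF l n , inj₁ refl)
    wallH {l = l} refl (inj₁ (refl , n , inj₂ (j , refl))) = refl , inj₁ (refl , notHF l n , inj₂ (cong (2 +_) (Hp₀ j)))
    wallH {l = l} refl (inj₂ (refl , n , refl)) = refl , inj₂ (refl , ≢1 l n , refl)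
      where
      ≢1 : ∀ l → l ≢ D → numH l ≢ 1
      ≢1 D n _ = n refl
      ≢1 (F i j) n ()

    wallV : ∀ {s l b r t} → r ≡ l → Wall s b t → AtWall 3 (ofType (numV b)) (edge 0 0 s 0 0 0 (numH l)) (ofType (numV t)) (ofType (numH r))
    wallV {b = b} refl (inj₁ (refl , n , inj₁ refl)) = refl , inj₁ (refl , notVF b n , inj₁ refl)
    wallV {b = b} refl (inj₁ (refl , n , inj₂ (j , refl))) = refl , inj₁ (refl , notVF b n , inj₂ (cong (2 +_) (Vp₀ j)))
    wallV {b = b} refl (inj₂ (refl , n , refl)) = refl , inj₂ (refl , ≢1 b n , refl)
      where
      ≢1 : ∀ b → b ≢ D → numV b ≢ 1
      ≢1 D n _ = n refl
      ≢1 (F j i) n ()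

    -- The digit `# 1`, the context `F true 0 0` and the value `D` are those of a central third, so
    -- a block keeps its colours when it is seen as part of the next block.
    horizontal vertical : ∀ {n} → Digits n → Off n → Edge ℕ
    horizontal e o = hier (# 1) e o (numH (wire (F true 0 0) D e o))
    vertical e o   = hierᵗ (# 1) e o (numV (wire (F true 0 0) D e o))

    block-rule : ∀ {n} (w u : Off n) → Rule a (horizontal (before w) u) (vertical (before u) w) (horizontal (after w) u) (vertical (after u) w)
    block-rule w u =
      (parity-before w , sym (parity-before u) , trans (parity-after w) (cong next₃ (sym (parity-before w))) , refl , refl ,
        trans (parity-after u) (cong next₃ (sym (parity-before u))) , refl , refl) ,
      kinds (parity-before w) (kind w u (# 1) (# 1) (ty L) (ty B) (ty R₀) (ty T)) (fits w u square D D)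
      where
      L = horizontal (before w) u
      B = vertical (before u) w
      R₀ = horizontal (after w) u
      T = vertical (after u) w
      kinds : ∀ {ρ p} → p ≡ parityOf w → Kind ρ (parityOf w) (parityOf u) L B R₀ T → FitsAt ρ w u (F true 0 0) D (F true 0 0) D →
        Equal p (parityOf u) L B R₀ T × Pass a L B R₀ T ⊎
        Cross p (parityOf u) L B R₀ T × (h₀ B ≡ 1 × AtWall 2 L B R₀ T ⊎ h₀ B ≢ 1 × Pass a L B R₀ T) ⊎
        Cross (parityOf u) p B L T R₀ × (h₀ L ≡ 1 × AtWall 3 B L T R₀ ⊎ h₀ L ≢ 1 × Pass a L B R₀ T)
      kinds refl (inj₁ (e , refl)) f = inj₁ (e , passes f)
      kinds refl (inj₂ (inj₁ (c , inj₁ (h , refl)))) (t≡ , f) = inj₂ (inj₁ (c , inj₁ (h , wallH t≡ f)))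
      kinds refl (inj₂ (inj₁ (c , inj₂ (h , refl)))) f = inj₂ (inj₁ (c , inj₂ (h , passes f)))
      kinds refl (inj₂ (inj₂ (c , inj₁ (h , refl)))) (r≡ , f) = inj₂ (inj₂ (c , inj₁ (h , wallV r≡ f)))
      kinds refl (inj₂ (inj₂ (c , inj₂ (h , refl)))) f = inj₂ (inj₂ (c , inj₂ (h , passes f)))

    module Side (side : ∀ {n} → Digits n → Off n → Edge ℕ)
                (side-sub : ∀ {n} (e : Digits n) (o : Off n) → side (# 1 ∷ e) (sub (# 1) o) ≡ side e o) where

      -- Any block that contains both coordinates gives the same colour; this level is large enough
      -- and needs no search.
      colour : ℤ → ℤ → ℕ
      colour x y = encode (side (before (proj₁ (locate n x (s≤s (m≤m+n _ _))))) (proj₁ (locate n y (s≤s (m≤n+m _ (mag x))))))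
        where
        n = suc (mag x + mag y)

      -- Climbing one level at a time: by `side-sub` the larger block repeats the smaller one in its
      -- centre.
      stable : ∀ k {n x y} {w u : Off n} {w′ u′ : Off (k + n)} → At n x w → At n y u → At (k + n) x w′ → At (k + n) y u′ →
               side (before w) u ≡ side (before w′) u′
      stable zero {n} {x} {y} {w} {u} {w′} {u′} wx uy w′x u′y = cong₂ (λ o → side (before o)) (at-unique {n} {x} {w} {w′} wx w′x) (at-unique {n} {y} {u} {u′} uy u′y)
      stable (suc k) {n} {x} {y} {w} {u} {w′} {u′} wx uy w′x u′y = begin
        side (before w) u                                        ≡⟨ stable k {n} {x} {y} {w} {u} {proj₁ v} {proj₁ t} wx uy (proj₂ v) (proj₂ t) ⟩
        side (before (proj₁ v)) (proj₁ t)                        ≡⟨ side-sub (before (proj₁ v)) (proj₁ t) ⟨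
        side (before (sub (# 1) (proj₁ v))) (sub (# 1) (proj₁ t)) ≡⟨ cong₂ (λ o → side (before o)) (at-unique {suc k + n} {x} {sub (# 1) (proj₁ v)} {w′} (at-sub {k + n} {x} {proj₁ v} (proj₂ v)) w′x) (at-unique {suc k + n} {y} {sub (# 1) (proj₁ t)} {u′} (at-sub {k + n} {y} {proj₁ t} (proj₂ t)) u′y) ⟩
        side (before w′) u′                                      ∎
        where
        open ≡-Reasoning
        lift : ∀ k {n x} {o : Off n} → At n x o → ∃ (At (k + n) x)
        lift zero {o = o} p = o , p
        lift (suc k) {n} {x} {o} p = let o′ , p′ = lift k {n} {x} {o} p in sub (# 1) o′ , at-sub {k + n} {x} {o′} p′
        v = lift k {n} {x} {w} wx
        t = lift k {n} {y} {u} uy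

      colour-level : ∀ n {x y} {w u : Off n} → suc (mag x + mag y) ≤ n → At n x w → At n y u → colour x y ≡ encode (side (before w) u)
      colour-level n {x} {y} {w} {u} m≤n p q = go (n ∸ m) (m∸n+n≡m m≤n)
        where
        m = suc (mag x + mag y)
        go : ∀ k → k + m ≡ n → colour x y ≡ encode (side (before w) u)
        go k refl = cong encode (stable k {m} {x} {y} {proj₁ a₁} {proj₁ a₂} {w} {u} (proj₂ a₁) (proj₂ a₂) p q)
          where
          a₁ = locate m x (s≤s (m≤m+n _ _))
          a₂ = locate m y (s≤s (m≤n+m _ (mag x)))

      colour< : (∀ {n} (e : Digits n) o → encode (side e o) < (a + a + 3) * 729) →
                ∀ x y → colour x y < (a + a + 3) * 729
      colour< bound x y = bound (before (proj₁ (locate (suc (mag x + mag y)) x (s≤s (m≤m+n _ _))))) (proj₁ (locate (suc (mag x + mag y)) y (s≤s (m≤n+m _ (mag x)))))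

    horizontal-sub : ∀ {n} (e : Digits n) (o : Off n) → horizontal (# 1 ∷ e) (sub (# 1) o) ≡ horizontal e o
    horizontal-sub e o = cong (λ p → edge p (parityOf o) (rankOf o) (d₀ (# 1) e o) (d₁ (# 1) e o) (d₂ (# 1) e o) (numH (wire (F true 0 0) D e o))) (nextParity-∷ (# 1) e o)

    vertical-sub : ∀ {n} (e : Digits n) (o : Off n) → vertical (# 1 ∷ e) (sub (# 1) o) ≡ vertical e o
    vertical-sub e o = cong (λ p → edge (parityOf o) p (rankOf o) (d₀ (# 1) e o) (d₁ (# 1) e o) (d₂ (# 1) e o) (numV (wire (F true 0 0) D e o))) (nextParity-∷ (# 1) e o)

    module H = Side horizontal horizontal-sub
    module V = Side vertical vertical-sub

    Hℤ Vℤ : ℤ → ℤ → ℕ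
    Hℤ x y = H.colour x y
    Vℤ x y = V.colour y x

    Hℤ< : ∀ x y → Hℤ x y < (a + a + 3) * 729
    Hℤ< = H.colour< (λ e o → encode< (horizontal e o) (hier-ternary (# 1) e o (numH (wire (F true 0 0) D e o))) (numH< (wire (F true 0 0) D e o)))

    Vℤ< : ∀ x y → Vℤ x y < (a + a + 3) * 729
    Vℤ< x y = V.colour< (λ e o → encode< (vertical e o) (hierᵗ-ternary (# 1) e o (numV (wire (F true 0 0) D e o))) (numV< (wire (F true 0 0) D e o))) y x

    plane-tile : ∀ x y → Holds tileF (Hℤ x y ∷ Vℤ x y ∷ Hℤ (x ℤ.+ ℤ.1ℤ) y ∷ Vℤ x (y ℤ.+ ℤ.1ℤ) ∷ a ∷ [])
    plane-tile x y = go (locate m x (s≤s (≤-trans (m≤m+n _ (mag y)) (n≤1+n _)))) (locate m (x ℤ.+ ℤ.1ℤ) (s≤s (≤-trans (mag-suc x) (s≤s (m≤m+n _ _)))))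
                        (locate m y (s≤s (≤-trans (m≤n+m _ (mag x)) (n≤1+n _)))) (locate m (y ℤ.+ ℤ.1ℤ) (s≤s (≤-trans (mag-suc y) (s≤s (m≤n+m _ (mag x))))))
      where
      -- One level more than the cell itself needs, so that its right and upper neighbours lie in
      -- the same block.
      m = suc (suc (mag x + mag y))
      go : ∃ (At m x) → ∃ (At m (x ℤ.+ ℤ.1ℤ)) → ∃ (At m y) → ∃ (At m (y ℤ.+ ℤ.1ℤ)) →
           Holds tileF (Hℤ x y ∷ Vℤ x y ∷ Hℤ (x ℤ.+ ℤ.1ℤ) y ∷ Vℤ x (y ℤ.+ ℤ.1ℤ) ∷ a ∷ [])
      go (w , pw) (w′ , pw′) (u , pu) (u′ , pu′) =
        encode-tile {a} {horizontal (before w) u} {vertical (before u) w} {horizontal (after w) u} {vertical (after u) w} {Hℤ x y} {Vℤ x y} {Hℤ (x ℤ.+ ℤ.1ℤ) y} {Vℤ x (y ℤ.+ ℤ.1ℤ)}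
          (hier-ternary (# 1) (before w) u (numH (wire (F true 0 0) D (before w) u))) (hierᵗ-ternary (# 1) (before u) w (numV (wire (F true 0 0) D (before u) w))) (hier-ternary (# 1) (after w) u (numH (wire (F true 0 0) D (after w) u))) (hierᵗ-ternary (# 1) (after u) w (numV (wire (F true 0 0) D (after u) w)))
          (H.colour-level m {x} {y} {w} {u} (n≤1+n _) pw pu)
          (V.colour-level m {y} {x} {u} {w} (≤-trans (≤-reflexive (cong suc (+-comm (mag y) (mag x)))) (n≤1+n _)) pu pw)
          (trans (H.colour-level m {x ℤ.+ ℤ.1ℤ} {y} {w′} {u} (s≤s (+-monoˡ-≤ (mag y) (mag-suc x))) pw′ pu)
            (cong (λ e → encode (horizontal e u)) (sym (at-suc {m} {x} {w} {w′} pw pw′))))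
          (trans (V.colour-level m {y ℤ.+ ℤ.1ℤ} {x} {u′} {w} (s≤s (≤-trans (≤-reflexive (+-comm _ (mag x))) (≤-trans (+-monoʳ-≤ (mag x) (mag-suc y)) (≤-reflexive (+-suc (mag x) (mag y)))))) pu′ pw)
            (cong (λ e → encode (vertical e w)) (sym (at-suc {m} {y} {u} {u′} pu pu′))))
          (block-rule w u)

-- The 29 bars: displacements, marks and classes

module Bars where

  open import Defs
  open Codes
  open import Data.Bool using (Bool; true; false; not)
  open import Data.Fin as Fin using (suc; toℕ; #_)
  open import Data.List as List using (List; []; _∷_)
  open import Data.Nat
  open import Data.Nat.Properties
  open import Data.Nat.Tactic.RingSolver using (solve-∀)
  open import Data.Product using (∃; _×_; _,_; proj₁; proj₂)
  open import Data.Unit using (⊤; tt)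
  open import Data.Vec as Vec using (Vec; []; _∷_; lookup; tabulate; map)
  open import Relation.Binary.PropositionalEquality hiding ([_]; J)
  open import Relation.Nullary using (¬_; contradiction)

  -- A displacement is stored in one of two digits according to its parity, and the other digit is
  -- 0; so the parity can be read off and opposite parities never mix.
  lo hi : Bool → ℕ → ℕ
  lo false n = n
  lo true  n = 0
  hi false n = 0
  hi true  n = n

  bool : Bool → ℕ
  bool false = 0
  bool true  = 1

  lo-hi-injective : ∀ π ρ {x y} → lo π (suc x) ≡ lo ρ (suc y) → hi π (suc x) ≡ hi ρ (suc y) → π ≡ ρ × x ≡ y
  lo-hi-injective false false refl _ = refl , refl
  lo-hi-injective true true _ refl = refl , refl

  -- All four numbers are positive. If ρ were `not π`, the right side would be 0 at the digit of π,
  -- unlike the left side. So ρ is π, the right side is positive at both digits, σ must supply the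
  -- other one, and the digit of π gives x = y.
  lo-hi-swap : ∀ π ρ σ {x y z w} →
    lo π (suc x) + lo σ (suc w) ≡ lo ρ (suc y) + lo (not π) (suc z) →
    hi π (suc x) + hi σ (suc w) ≡ hi ρ (suc y) + hi (not π) (suc z) → ρ ≡ π × x ≡ y × σ ≡ not π
  lo-hi-swap false false true e f = refl , suc-injective (trans (sym (+-identityʳ _)) (trans e (+-identityʳ _))) , refl
  lo-hi-swap false false false e ()
  lo-hi-swap true true true () f
  lo-hi-swap true true false e f = refl , suc-injective (trans (sym (+-identityʳ _)) (trans f (+-identityʳ _))) , refl
  lo-hi-swap true false true () f
  lo-hi-swap true false false e ()

  lo≤ : ∀ π n → lo π n ≤ n
  lo≤ false n = ≤-refl
  lo≤ true  n = z≤n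

  hi≤ : ∀ π n → hi π n ≤ n
  hi≤ false n = z≤n
  hi≤ true  n = ≤-refl

  module Digital (B m : ℕ) (2m<B : m + m < B) where

    poly : ℕ → ℕ → ℕ → ℕ → ℕ → ℕ
    poly d e f g h = d + B * (e + B * (f + B * (g + B * h)))

    poly-injective : ∀ {d e f g h d′ e′ f′ g′ h′} → d < B → e < B → f < B → g < B → d′ < B → e′ < B → f′ < B → g′ < B →
      poly d e f g h ≡ poly d′ e′ f′ g′ h′ → d ≡ d′ × e ≡ e′ × f ≡ f′ × g ≡ g′ × h ≡ h′
    poly-injective d< e< f< g< d′< e′< f′< g′< eq =
      let d≡ , eq₁ = radix-unique B _ _ d< d′< eq
          e≡ , eq₂ = radix-unique B _ _ e< e′< eq₁
          f≡ , eq₃ = radix-unique B _ _ f< f′< eq₂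
          g≡ , h≡ = radix-unique B _ _ g< g′< eq₃
      in d≡ , e≡ , f≡ , g≡ , h≡

    -- Digit 0 is reserved for `qOf`, digits 1 and 2 for `pOf`, digits 3 and 4 for `uOf`; so a sum
    -- of one of each kind can be taken apart. The condition 2m < B also admits sums of two of the
    -- same kind without a carry.
    pOf uOf : ℕ → Bool → ℕ
    pOf c π = B * (lo π (suc c) + B * hi π (suc c))
    uOf i π = B * (B * (B * (lo π (suc i) + B * hi π (suc i))))

    qOf : ℕ → Bool → ℕ
    qOf c π = bool π + 2 * c

    m<B : m < B
    m<B = ≤-<-trans (m≤m+n m m) 2m<B

    lo< : ∀ π {n} → n ≤ m → lo π n < B
    lo< π n≤ = ≤-<-trans (≤-trans (lo≤ π _) n≤) m<B

    hi< : ∀ π {n} → n ≤ m → hi π n < B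
    hi< π n≤ = ≤-<-trans (≤-trans (hi≤ π _) n≤) m<B

    step< : ∀ {x n k} → x < B → n < k → x + B * n < B * k
    step< {x} {n} {k} x< n< = ≤-trans (+-monoˡ-≤ (B * n) x<) (≤-trans (≤-reflexive (sym (*-suc B n))) (*-monoʳ-≤ B n<))

    pOf< : ∀ {c} π → c < m → pOf c π < B ^ 5
    pOf< {c} π c< = ≤-trans (step< (≤-<-trans z≤n m<B) (step< (lo< π c<) (hi< π c<)))
      (≤-trans (≤-reflexive (lem B)) (^-monoʳ-≤ B ⦃ >-nonZero (≤-<-trans z≤n m<B) ⦄ {3} {5} (s≤s (s≤s (s≤s z≤n)))))
      where
      lem : ∀ B → B * (B * B) ≡ B * (B * (B * 1))
      lem = solve-∀

    uOf< : ∀ {i} π → i < m → uOf i π < B ^ 5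
    uOf< {i} π i< = subst (uOf i π <_) (lem B) (step< 0<B (step< 0<B (step< 0<B (step< (lo< π i<) (hi< π i<)))))
      where
      0<B = ≤-<-trans z≤n m<B
      lem : ∀ B → B * (B * (B * (B * B))) ≡ B * (B * (B * (B * (B * 1))))
      lem = solve-∀

    qOf< : ∀ {c} π → suc (2 * c) ≤ m → qOf c π < B ^ 5
    qOf< {c} π c< = <-≤-trans (≤-<-trans (≤-trans (bound π) c<) m<B) (≤-trans (≤-reflexive (sym (*-identityʳ B))) (^-monoʳ-≤ B ⦃ >-nonZero (≤-<-trans z≤n m<B) ⦄ {1} {5} (s≤s z≤n)))
      where
      bound : ∀ π → bool π + 2 * c ≤ suc (2 * c)
      bound false = n≤1+n _
      bound true = ≤-refl

    bool-injective : ∀ π ρ {c d} → bool π + 2 * c ≡ bool ρ + 2 * d → π ≡ ρ × c ≡ d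
    bool-injective false false {c} {d} e = refl , *-cancelˡ-≡ c d 2 e
    bool-injective true true {c} {d} e = refl , *-cancelˡ-≡ c d 2 (suc-injective e)
    bool-injective false true {c} {d} e = contradiction (proj₁ (radix-unique 2 {0} {1} c d z<s ≤-refl e)) λ ()
    bool-injective true false {c} {d} e = contradiction (proj₁ (radix-unique 2 {1} {0} c d ≤-refl z<s e)) λ ()

    three : ∀ {c d i j e f} π π′ ρ ρ′ σ σ′ → c < m → d < m → i < m → j < m → suc (2 * e) ≤ m → suc (2 * f) ≤ m →
      pOf c π + uOf i ρ + qOf e σ ≡ pOf d π′ + uOf j ρ′ + qOf f σ′ → (π ≡ π′ × c ≡ d) × (ρ ≡ ρ′ × i ≡ j) × (σ ≡ σ′ × e ≡ f)
    three {c} {d} {i} {j} {e} {f} π π′ ρ ρ′ σ σ′ c< d< i< j< e< f< eq =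
      let a , b , b′ , g , g′ = poly-injective (low σ {e} e<) (lo< π c<) (hi< π c<) (lo< ρ i<) (low σ′ {f} f<) (lo< π′ d<) (hi< π′ d<) (lo< ρ′ j<)
                                  (trans (sym (lem B (qOf e σ) _ _ _ _)) (trans eq (lem B (qOf f σ′) _ _ _ _)))
      in lo-hi-injective π π′ b b′ , lo-hi-injective ρ ρ′ g g′ , bool-injective σ σ′ {e} {f} a
      where
      lem : ∀ B z x y v w → B * (x + B * y) + B * (B * (B * (v + B * w))) + z ≡ z + B * (x + B * (y + B * (v + B * w)))
      lem = solve-∀
      low : ∀ σ {e} → suc (2 * e) ≤ m → qOf e σ < B
      low false e< = ≤-<-trans (≤-trans (n≤1+n _) e<) m<B
      low true e< = ≤-<-trans e< m<B

    -- The digits of u are compared first and give ρ = π and σ = `not π`; with these values the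
    -- digits of p have the same form.
    four : ∀ {c d c′ d′ i j i′ j′} π ρ σ ρ₁ σ₁ π′ → π′ ≡ not π → c < m → d < m → c′ < m → d′ < m → i < m → j < m → i′ < m → j′ < m →
      uOf i π + pOf c ρ + (pOf d′ σ₁ + uOf j′ σ) ≡ pOf d ρ₁ + uOf j ρ + (uOf i′ π′ + pOf c′ σ) → (ρ ≡ π × i ≡ j) × c ≡ d
    four {c} {d} {c′} {d′} {i} {j} {i′} {j′} π ρ σ ρ₁ σ₁ _ refl c< d< c′< d′< i< j< i′< j′< eq =
      let _ , b , b′ , g , g′ = poly-injective {0} {h = hi π (suc i) + hi σ (suc j′)} {d′ = 0}
            0<B (two (lo≤ ρ _) c< (lo≤ σ₁ _) d′<) (two (hi≤ ρ _) c< (hi≤ σ₁ _) d′<) (two (lo≤ π _) i< (lo≤ σ _) j′<)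
            0<B (two (lo≤ ρ₁ _) d< (lo≤ σ _) c′<) (two (hi≤ ρ₁ _) d< (hi≤ σ _) c′<) (two (lo≤ ρ _) j< (lo≤ (not π) _) i′<)
            (trans (sym (lem B (lo ρ (suc c)) (lo σ₁ (suc d′)) (hi ρ (suc c)) (hi σ₁ (suc d′)) (lo π (suc i)) (lo σ (suc j′)) (hi π (suc i)) (hi σ (suc j′))))
              (trans eq (lem′ B (lo ρ₁ (suc d)) (lo σ (suc c′)) (hi ρ₁ (suc d)) (hi σ (suc c′)) (lo ρ (suc j)) (lo (not π) (suc i′)) (hi ρ (suc j)) (hi (not π) (suc i′)))))
      in go (lo-hi-swap π ρ σ g g′) b b′
      where
      0<B = ≤-<-trans z≤n m<B
      go : ρ ≡ π × i ≡ j × σ ≡ not π → lo ρ (suc c) + lo σ₁ (suc d′) ≡ lo ρ₁ (suc d) + lo σ (suc c′) →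
           hi ρ (suc c) + hi σ₁ (suc d′) ≡ hi ρ₁ (suc d) + hi σ (suc c′) → (ρ ≡ π × i ≡ j) × c ≡ d
      go (refl , refl , refl) b b′ = (refl , refl) , proj₁ (proj₂ (lo-hi-swap π ρ₁ σ₁ b b′))
      two : ∀ {x y x′ y′} → x ≤ x′ → x′ ≤ m → y ≤ y′ → y′ ≤ m → x + y < B
      two x≤ x′≤ y≤ y′≤ = ≤-<-trans (+-mono-≤ (≤-trans x≤ x′≤) (≤-trans y≤ y′≤)) 2m<B
      lem : ∀ B x x′ y y′ v v′ w w′ → B * (B * (B * (v + B * w))) + B * (x + B * y) + (B * (x′ + B * y′) + B * (B * (B * (v′ + B * w′)))) ≡
                                       0 + B * (x + x′ + B * (y + y′ + B * (v + v′ + B * (w + w′))))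
      lem = solve-∀
      lem′ : ∀ B x x′ y y′ v v′ w w′ → B * (x + B * y) + B * (B * (B * (v + B * w))) + (B * (B * (B * (v′ + B * w′))) + B * (x′ + B * y′)) ≡
                                       0 + B * (x + x′ + B * (y + y′ + B * (v + v′ + B * (w + w′))))
      lem′ = solve-∀

  -- uw x y and wu x y are the unit bars between rows, with mark x below and mark y above.
  data Name : Set where
    short long wide narrow fillᵘ fillʷ : Name
    uw wu : ℕ → ℕ → Name

  -- The marks 1, 2 and 3 of a lower bar demand the same mark of the upper bar, and the mark 4 of an upper bar
  -- demands the mark 4 of the lower one; the mark 5 of the fillers prevents rows that consist of fillers only.
  data UW : ℕ → ℕ → Set where
    ⟨0,0⟩ : UW 0 0
    ⟨0,1⟩ : UW 0 1
    ⟨0,2⟩ : UW 0 2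
    ⟨0,3⟩ : UW 0 3
    ⟨0,5⟩ : UW 0 5
    ⟨1,1⟩ : UW 1 1
    ⟨2,2⟩ : UW 2 2
    ⟨3,3⟩ : UW 3 3
    ⟨4,0⟩ : UW 4 0
    ⟨4,1⟩ : UW 4 1
    ⟨4,4⟩ : UW 4 4
    ⟨4,5⟩ : UW 4 5
    ⟨5,0⟩ : UW 5 0
    ⟨5,1⟩ : UW 5 1
    ⟨5,2⟩ : UW 5 2
    ⟨5,3⟩ : UW 5 3

  data WU : ℕ → ℕ → Set where
    ⟨0,0⟩ : WU 0 0
    ⟨0,1⟩ : WU 0 1
    ⟨0,2⟩ : WU 0 2
    ⟨0,3⟩ : WU 0 3
    ⟨1,1⟩ : WU 1 1
    ⟨2,2⟩ : WU 2 2
    ⟨3,3⟩ : WU 3 3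

  names : Vec Name 29
  names = short ∷ long ∷ wide ∷ narrow ∷ fillᵘ ∷ fillʷ ∷
    uw 0 0 ∷ uw 0 1 ∷ uw 0 2 ∷ uw 0 3 ∷ uw 0 5 ∷ uw 1 1 ∷ uw 2 2 ∷ uw 3 3 ∷ uw 4 0 ∷ uw 4 1 ∷ uw 4 4 ∷ uw 4 5 ∷ uw 5 0 ∷ uw 5 1 ∷ uw 5 2 ∷ uw 5 3 ∷
    wu 0 0 ∷ wu 0 1 ∷ wu 0 2 ∷ wu 0 3 ∷ wu 1 1 ∷ wu 2 2 ∷ wu 3 3 ∷ []

  Used : Name → Set
  Used (uw x y) = UW x y
  Used (wu x y) = WU x y
  Used _        = ⊤

  index : ∀ n → Used n → ∃ λ k → lookup names k ≡ n
  index short _ = # 0 , refl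
  index long _ = # 1 , refl
  index wide _ = # 2 , refl
  index narrow _ = # 3 , refl
  index fillᵘ _ = # 4 , refl
  index fillʷ _ = # 5 , refl
  index (uw _ _) ⟨0,0⟩ = # 6 , refl
  index (uw _ _) ⟨0,1⟩ = # 7 , refl
  index (uw _ _) ⟨0,2⟩ = # 8 , refl
  index (uw _ _) ⟨0,3⟩ = # 9 , refl
  index (uw _ _) ⟨0,5⟩ = # 10 , refl
  index (uw _ _) ⟨1,1⟩ = # 11 , refl
  index (uw _ _) ⟨2,2⟩ = # 12 , refl
  index (uw _ _) ⟨3,3⟩ = # 13 , refl
  index (uw _ _) ⟨4,0⟩ = # 14 , refl
  index (uw _ _) ⟨4,1⟩ = # 15 , refl
  index (uw _ _) ⟨4,4⟩ = # 16 , refl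
  index (uw _ _) ⟨4,5⟩ = # 17 , refl
  index (uw _ _) ⟨5,0⟩ = # 18 , refl
  index (uw _ _) ⟨5,1⟩ = # 19 , refl
  index (uw _ _) ⟨5,2⟩ = # 20 , refl
  index (uw _ _) ⟨5,3⟩ = # 21 , refl
  index (wu _ _) ⟨0,0⟩ = # 22 , refl
  index (wu _ _) ⟨0,1⟩ = # 23 , refl
  index (wu _ _) ⟨0,2⟩ = # 24 , refl
  index (wu _ _) ⟨0,3⟩ = # 25 , refl
  index (wu _ _) ⟨1,1⟩ = # 26 , refl
  index (wu _ _) ⟨2,2⟩ = # 27 , refl
  index (wu _ _) ⟨3,3⟩ = # 28 , refl

  open import Data.Vec.Relation.Unary.All as All using (All; []; _∷_)
  open import Data.Vec.Relation.Unary.All.Properties using (lookup⁺)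

  all-used : All Used names
  all-used = tt ∷ tt ∷ tt ∷ tt ∷ tt ∷ tt ∷
    ⟨0,0⟩ ∷ ⟨0,1⟩ ∷ ⟨0,2⟩ ∷ ⟨0,3⟩ ∷ ⟨0,5⟩ ∷ ⟨1,1⟩ ∷ ⟨2,2⟩ ∷ ⟨3,3⟩ ∷ ⟨4,0⟩ ∷ ⟨4,1⟩ ∷ ⟨4,4⟩ ∷ ⟨4,5⟩ ∷ ⟨5,0⟩ ∷ ⟨5,1⟩ ∷ ⟨5,2⟩ ∷ ⟨5,3⟩ ∷
    ⟨0,0⟩ ∷ ⟨0,1⟩ ∷ ⟨0,2⟩ ∷ ⟨0,3⟩ ∷ ⟨1,1⟩ ∷ ⟨2,2⟩ ∷ ⟨3,3⟩ ∷ []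

  used : ∀ k → Used (lookup names k)
  used = lookup⁺ all-used

  -- The vertical sides carry `rowClass`, so no row mixes the kinds; the other two classes force the
  -- kinds to follow each other with period 4: u, uw, w, wu.
  rowClass topClass bottomClass : Name → ℕ
  rowClass short    = 0
  rowClass long     = 0
  rowClass fillᵘ    = 0
  rowClass wide     = 1
  rowClass narrow   = 1
  rowClass fillʷ    = 1
  rowClass (uw _ _) = 2
  rowClass (wu _ _) = 3
  topClass short    = 0
  topClass long     = 0
  topClass fillᵘ    = 0
  topClass wide     = 2
  topClass narrow   = 2
  topClass fillʷ    = 2
  topClass (uw _ _) = 1
  topClass (wu _ _) = 3
  bottomClass short    = 3
  bottomClass long     = 3
  bottomClass fillᵘ    = 3
  bottomClass wide     = 1
  bottomClass narrow   = 1
  bottomClass fillʷ    = 1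
  bottomClass (uw _ _) = 0
  bottomClass (wu _ _) = 2

  -- The first condition that holds determines the mark.
  data Mark : List (Set × ℕ) → ℕ → Set₁ where
    none  : Mark [] 0
    here  : ∀ {A c r} → A → Mark ((A , c) ∷ r) c
    there : ∀ {A c d r} → ¬ A → Mark r d → Mark ((A , c) ∷ r) d

  mark-unique : ∀ {r c d} → Mark r c → Mark r d → c ≡ d
  mark-unique none none = refl
  mark-unique (here _) (here _) = refl
  mark-unique (here x) (there y _) = contradiction x y
  mark-unique (there x _) (here y) = contradiction y x
  mark-unique (there _ x) (there _ y) = mark-unique x y

  record Quad : Set where
    constructor quadruple
    field west south east north : ℕ

  open Quad public

  -- Tile τ in column x and row y, of parity π, is represented by four bars of two rows of the plane. With
  -- s = 18 J x + 6 J y, the bars short and long start at s and s + 5 J + u τ π, and in the row above them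
  -- wide and narrow start at s - 4 J + p (west τ) π and s + 8 J + q (north τ) (not π); fillers occupy the
  -- rest. The offsets of the marks are read off from these positions, and conversely force them. The
  -- parity alternates between rows and so tells apart the displacements of adjacent rows.
  record Layout : Set₁ where
    field
      J     : ℕ
      J>0   : 0 < J
      Good  : Quad → Set
      Col   : ℕ → Set
      p q   : ℕ → Bool → ℕ
      u     : Quad → Bool → ℕ

    SomeColour : (ℕ → Bool → Set) → Set
    SomeColour A = ∃ λ c → ∃ λ π → Col c × A c π

    SomeTile : (Quad → Bool → Set) → Set
    SomeTile A = ∃ λ τ → ∃ λ π → Good τ × A τ π

    -- Each condition is the offset at which a mark meets its counterpart in the intended layout.
    -- For example, the place 3 J after the start of `short` is 7 J - p after the start of `wide`.
    topMarks bottomMarks : Name → ℕ → List (Set × ℕ)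
    topMarks short    v = ((v ≡ 3 * J) , 1) ∷ []
    topMarks long     v = ((v ≡ 10 * J) , 2) ∷ ((v ≡ 4 * J) , 3) ∷ (SomeTile (λ τ π → v + u τ π ≡ J + p (west τ) π) , 4) ∷ []
    topMarks fillᵘ    v = ((0 ≡ 0) , 5) ∷ []
    topMarks wide     v = ((v ≡ 10 * J) , 1) ∷ []
    topMarks narrow   v = ((v ≡ 0) , 2) ∷ ((v ≡ 4 * J) , 3) ∷ []
    topMarks fillʷ    v = []
    topMarks (uw x y) v = ((0 ≡ 0) , y) ∷ []
    topMarks (wu x y) v = ((0 ≡ 0) , y) ∷ []
    bottomMarks short    v = (SomeColour (λ c π → v ≡ p c π) , 1) ∷ (SomeColour (λ c π → v ≡ 2 * J + q c π) , 2) ∷ []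
    bottomMarks long     v = (SomeTile (λ τ π → v + u τ π ≡ J + q (south τ) π) , 3) ∷ []
    bottomMarks fillᵘ    v = []
    bottomMarks wide     v = (SomeColour (λ c π → v + p c π ≡ 7 * J) , 1) ∷ (SomeTile (λ τ π → v + p (east τ) π ≡ J + u τ π) , 2) ∷ ((v ≡ 10 * J) , 4) ∷ []
    bottomMarks narrow   v = (SomeTile (λ τ π → v + q (north τ) (not π) ≡ J + u τ π) , 3) ∷ []
    bottomMarks fillʷ    v = ((0 ≡ 0) , 5) ∷ []
    bottomMarks (uw x y) v = ((0 ≡ 0) , x) ∷ []
    bottomMarks (wu x y) v = ((0 ≡ 0) , x) ∷ []

    size : Name → ℕ
    size short  = 4 * J
    size long   = 12 * J
    size wide   = 11 * J
    size narrow = 5 * J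
    size _      = 1

    size>0 : ∀ n → 0 < size n
    size>0 short = ≤-trans J>0 (m≤m+n J _)
    size>0 long = ≤-trans J>0 (m≤m+n J _)
    size>0 wide = ≤-trans J>0 (m≤m+n J _)
    size>0 narrow = ≤-trans J>0 (m≤m+n J _)
    size>0 fillᵘ = z<s
    size>0 fillʷ = z<s
    size>0 (uw _ _) = z<s
    size>0 (wu _ _) = z<s

  -- A bar reached along two paths yields an equation between sums of displacements. The two
  -- injectivity fields decode the equations that occur.
  record Separated (L : Layout) : Set where
    open Layout L
    field
      p<J : ∀ {c} π → Col c → p c π < J
      q<J : ∀ {c} π → Col c → q c π < J
      u<J : ∀ {τ} π → Good τ → u τ π < J
      sides : ∀ {τ} → Good τ → (Col (west τ) × Col (south τ)) × Col (east τ) × Col (north τ)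
      three-injective : ∀ {c d τ τ′ e f} π π′ ρ ρ′ σ σ′ → Col c → Col d → Good τ → Good τ′ → Col e → Col f →
        p c π + u τ ρ + q e σ ≡ p d π′ + u τ′ ρ′ + q f σ′ → (π ≡ π′ × c ≡ d) × (ρ ≡ ρ′ × τ ≡ τ′) × (σ ≡ σ′ × e ≡ f)
      four-injective : ∀ {c d c′ d′ τ υ τ′ υ′} π ρ σ ρ₁ σ₁ π′ → π′ ≡ not π →
        Col c → Col d → Col c′ → Col d′ → Good τ → Good υ → Good τ′ → Good υ′ →
        u τ π + p c ρ + (p d′ σ₁ + u υ′ σ) ≡ p d ρ₁ + u υ ρ + (u τ′ π′ + p c′ σ) → (ρ ≡ π × τ ≡ υ) × c ≡ d

  record Marked : Set₁ where
    field
      layout : Layout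

    open Layout layout public

    field
      topCode bottomCode : Name → ℕ → ℕ
      top-marked    : ∀ n v → Mark (topMarks n v) (topCode n v)
      bottom-marked : ∀ n v → Mark (bottomMarks n v) (bottomCode n v)

    bar : Name → Bar
    bar n = record
      { k      = pred (size n)
      ; top    = tabulate (λ j → topClass n + 4 * topCode n (toℕ j))
      ; bottom = tabulate (λ j → bottomClass n + 4 * bottomCode n (toℕ j))
      ; left   = rowClass n
      ; right  = rowClass n }

    bars : Vec Bar 29
    bars = map bar names

-- Every tiling by the bars contains a quadrant of Wang tiles

module Quadrants where

  open import Defs
  open Codes using (radix-unique)
  open Bars
  open import Data.Bool using (not)
  open import Data.Fin as Fin using (Fin; zero; suc; toℕ; fromℕ<)
  open import Data.Fin.Properties using (toℕ-fromℕ<; toℕ<n; toℕ-injective)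
  open import Data.Integer as ℤ using (ℤ)
  import Data.Integer.Properties as ℤₚ
  import Data.Integer.Tactic.RingSolver as ℤ-Solver
  open import Data.Nat
  open import Data.Nat.Properties
  open import Data.Product using (∃; _×_; _,_; proj₁; proj₂)
  open import Data.Sum using (_⊎_; inj₁; inj₂)
  open import Data.Vec as Vec using (lookup)
  open import Data.Vec.Properties using (lookup-map; lookup∘tabulate)
  open import Function using (_∘_)
  open import Relation.Binary.PropositionalEquality hiding ([_]; J)
  open import Relation.Nullary using (contradiction)

  infixl 6 _⊞_
  _⊞_ : ∀ {a b c d : ℤ} → a ≡ b → c ≡ d → a ℤ.+ c ≡ b ℤ.+ d
  _⊞_ = cong₂ ℤ._+_

  -- Linear arithmetic by ring identities: the hypotheses, added up, are a = b, and the remaining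
  -- identity is left to the solver.
  linear : ∀ {a b} x y → a ≡ b → x ℤ.+ b ≡ y ℤ.+ a → x ≡ y
  linear {a} x y refl e = trans (sym (lem x a)) (trans (cong (ℤ._- a) e) (lem y a))
    where
    lem : ∀ x a → x ℤ.+ a ℤ.- a ≡ x
    lem = ℤ-Solver.solve-∀

  module _ {N : ℕ → Set} (Good : Quad → Set) (up : ∀ {t} → N t → N (4 + t)) (right : ∀ {t} → N t → N t) (Linked : ∀ {t} → N t → N t → Set)
    (linked-right : ∀ {t} (A : N t) → Linked A (right A)) (linked-up : ∀ {t} (A B : N t) → Linked A B → Linked (up A) (up B))
    (quad : ∀ {t} → N t → Quad) (good : ∀ {t} (A : N t) → Good (quad A))
    (easts : ∀ {t} (A B : N t) → Linked A B → east (quad A) ≡ west (quad B)) (norths : ∀ {t} (A : N t) → north (quad A) ≡ south (quad (up A)))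
    {t : ℕ} (origin : N t) where

    private
      level : ℕ → ℕ
      level zero    = t
      level (suc y) = 4 + level y

      at : ∀ y → ℕ → N (level y)
      at zero    zero    = origin
      at zero    (suc x) = right (at zero x)
      at (suc y) x       = up (at y x)

      linked : ∀ y x → Linked (at y x) (at y (suc x))
      linked zero    x = linked-right (at zero x)
      linked (suc y) x = linked-up (at y x) (at y (suc x)) (linked y x)

    -- Only the bottom row is built by steps to the right. All other rows arise by steps up, along
    -- which neighbours stay linked.
    lattice : ∃ λ (quad : ℕ → ℕ → Quad) → (∀ x y → Good (quad x y)) × (∀ x y → east (quad x y) ≡ west (quad (suc x) y)) × (∀ x y → north (quad x y) ≡ south (quad x (suc y)))
    lattice = (λ x y → quad (at y x)) , (λ x y → good (at y x)) , (λ x y → easts (at y x) (at y (suc x)) (linked y x)) , (λ x y → norths (at y x))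

  module Extraction (marked : Marked) (separated : Separated (Marked.layout marked)) (tiling : Tiling (Marked.bars marked)) where

    open Marked marked
    open Separated separated
    open Tiling tiling

    cell : ℤ → ℕ → Cell bars
    cell x t = place x (ℤ.+ t)

    cell-vert : ∀ x t → topColour bars (cell x t) ≡ bottomColour bars (cell x (suc t))
    cell-vert x t = trans (vert x (ℤ.+ t)) (cong (λ s → bottomColour bars (place x (ℤ.+ s))) (+-comm t 1))

    record Starts (n : Name) (X : ℤ) (t : ℕ) : Set where
      constructor starts
      field
        ix    : Fin 29
        name  : lookup names ix ≡ n
        cover : ∀ j → cell (X ℤ.+ ℤ.+ toℕ j) t ≡ (ix , j)

    is-bar : ∀ k {n} → lookup names k ≡ n → lookup bars k ≡ bar n
    is-bar k refl = lookup-map k bar names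

    length-bar : ∀ n → len (bar n) ≡ size n
    length-bar n = suc-pred (size n) ⦃ >-nonZero (size>0 n) ⦄

    top-of : ∀ {n X t} → Starts n X t → ∀ v → v < size n → topColour bars (cell (X ℤ.+ ℤ.+ v) t) ≡ topClass n + 4 * topCode n v
    top-of {n} {X} {t} (starts k name cover) v v< = trans (go (bar n) (is-bar k name) v<len)
      (trans (lookup∘tabulate (λ j → topClass n + 4 * topCode n (toℕ j)) (fromℕ< v<len)) (cong (λ v → topClass n + 4 * topCode n v) (toℕ-fromℕ< v<len)))
      where
      v<len = subst (v <_) (sym (length-bar n)) v<
      go : ∀ b → lookup bars k ≡ b → (lt : v < len b) → topColour bars (cell (X ℤ.+ ℤ.+ v) t) ≡ lookup (Bar.top b) (fromℕ< lt)
      go _ refl lt = cong (topColour bars) (trans (cong (λ v → cell (X ℤ.+ ℤ.+ v) t) (sym (toℕ-fromℕ< lt))) (cover (fromℕ< lt)))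

    bottom-of : ∀ {n X t} → Starts n X t → ∀ v → v < size n → bottomColour bars (cell (X ℤ.+ ℤ.+ v) t) ≡ bottomClass n + 4 * bottomCode n v
    bottom-of {n} {X} {t} (starts k name cover) v v< = trans (go (bar n) (is-bar k name) v<len)
      (trans (lookup∘tabulate (λ j → bottomClass n + 4 * bottomCode n (toℕ j)) (fromℕ< v<len)) (cong (λ v → bottomClass n + 4 * bottomCode n v) (toℕ-fromℕ< v<len)))
      where
      v<len = subst (v <_) (sym (length-bar n)) v<
      go : ∀ b → lookup bars k ≡ b → (lt : v < len b) → bottomColour bars (cell (X ℤ.+ ℤ.+ v) t) ≡ lookup (Bar.bottom b) (fromℕ< lt)
      go _ refl lt = cong (bottomColour bars) (trans (cong (λ v → cell (X ℤ.+ ℤ.+ v) t) (sym (toℕ-fromℕ< lt))) (cover (fromℕ< lt)))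

    next-cell : ∀ {c c′ k} {j j′ : Fin (len (lookup bars k))} → HNext bars c c′ → c ≡ (k , j) → toℕ j′ ≡ suc (toℕ j) → c′ ≡ (k , j′)
    next-cell {k = k} {j} {j′} (inj₁ (e , _)) refl j′≡ = contradiction (subst (_< len (lookup bars k)) (trans j′≡ (cong suc e)) (toℕ<n j′)) (<-irrefl refl)
    next-cell {k = k} (inj₂ (_ , refl , e)) refl j′≡ = cong (k ,_) (toℕ-injective (trans e (sym j′≡)))

    previous-cell : ∀ {c c′ k v} {j′ : Fin (len (lookup bars k))} → HNext bars c c′ → c′ ≡ (k , j′) → toℕ j′ ≡ suc v →
                    ∃ λ (j : Fin (len (lookup bars k))) → toℕ j ≡ v × c ≡ (k , j)
    previous-cell (inj₁ (_ , e , _)) refl j′≡ = contradiction (trans (sym e) j′≡) λ ()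
    previous-cell {c = _ , j} (inj₂ (_ , refl , e)) refl j′≡ = j , suc-injective (trans (sym e) j′≡) , refl

    record Found (t : ℕ) (x : ℤ) : Set where
      constructor found
      field
        n    : Name
        X    : ℤ
        v    : ℕ
        v<   : v < size n
        x≡   : x ≡ X ℤ.+ ℤ.+ v
        bar! : Starts n X t
        uses : Used n

    -- By `HNext` one can walk left from a cell to the first cell of its bar, and from there right
    -- through the whole bar.
    find : ∀ x t → Found t x
    find x t with cell x t in eq
    ... | k , j = found (lookup names k) X (toℕ j) (subst (toℕ j <_) (trans (cong len (is-bar k {lookup names k} refl)) (length-bar (lookup names k))) (toℕ<n j)) x≡
                    (starts k refl (λ j → forward (toℕ j) j refl)) (used k)
      where
      back : ∀ v x (j : Fin (len (lookup bars k))) → toℕ j ≡ v → cell x t ≡ (k , j) →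
             ∃ λ X → x ≡ X ℤ.+ ℤ.+ v × ∃ λ (j : Fin (len (lookup bars k))) → toℕ j ≡ 0 × cell X t ≡ (k , j)
      back zero x j j≡ e = x , sym (ℤₚ.+-identityʳ x) , j , j≡ , e
      back (suc v) x j j≡ e with previous-cell (horiz (x ℤ.- ℤ.1ℤ) (ℤ.+ t)) (trans (cong (λ x → cell x t) (lem x)) e) j≡
        where
        lem : ∀ x → x ℤ.- ℤ.1ℤ ℤ.+ ℤ.1ℤ ≡ x
        lem = ℤ-Solver.solve-∀
      ... | j₁ , j₁≡ , e₁ = let X , x≡ , r = back v (x ℤ.- ℤ.1ℤ) j₁ j₁≡ e₁ in X , linear x (X ℤ.+ ℤ.+ suc v) x≡ (lem x X (ℤ.+ v)) , r
        where
        lem : ∀ x X v → x ℤ.+ (X ℤ.+ v) ≡ X ℤ.+ (ℤ.1ℤ ℤ.+ v) ℤ.+ (x ℤ.- ℤ.1ℤ)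
        lem = ℤ-Solver.solve-∀
      origin = back (toℕ j) x j refl eq
      X = proj₁ origin
      x≡ = proj₁ (proj₂ origin)
      forward : ∀ v (j : Fin (len (lookup bars k))) → toℕ j ≡ v → cell (X ℤ.+ ℤ.+ v) t ≡ (k , j)
      forward zero j j≡ with proj₂ (proj₂ origin)
      ... | j₀ , j₀≡ , e = trans (cong (λ x → cell x t) (ℤₚ.+-identityʳ X)) (trans e (cong (k ,_) (toℕ-injective (trans j₀≡ (sym j≡)))))
      forward (suc v) j j≡ = trans (cong (λ x → cell x t) (lem X (ℤ.+ v)))
        (next-cell {j = i} (horiz (X ℤ.+ ℤ.+ v) (ℤ.+ t)) (forward v i (toℕ-fromℕ< v<)) (trans j≡ (cong suc (sym (toℕ-fromℕ< v<)))))
        where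
        v< = <-trans (n<1+n v) (subst (_< len (lookup bars k)) j≡ (toℕ<n j))
        i = fromℕ< v<
        lem : ∀ X v → X ℤ.+ (ℤ.1ℤ ℤ.+ v) ≡ X ℤ.+ v ℤ.+ ℤ.1ℤ
        lem = ℤ-Solver.solve-∀

    coincide-≤ : ∀ {n X X′ t} e e′ → Starts n X t → Starts n X′ t → X ℤ.+ ℤ.+ e ≡ X′ ℤ.+ ℤ.+ e′ → e ≤ e′ → e′ < size n → X ≡ X′ × e ≡ e′
    coincide-≤ {n} {X} {X′} {t} e e′ (starts k name cover) (starts k′ name′ cover′) eq e≤ e′< = go (subst (d <_) (sym (trans (cong len (is-bar k′ name′)) (length-bar n))) (≤-<-trans (m∸n≤m e′ e) e′<))
       (subst (0 <_) (sym (trans (cong len (is-bar k name)) (length-bar n))) (size>0 n))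
      where
      d = e′ ∸ e
      e′≡ : e′ ≡ d + e
      e′≡ = sym (m∸n+n≡m e≤)
      X≡ : X ≡ X′ ℤ.+ ℤ.+ d
      X≡ = linear X (X′ ℤ.+ ℤ.+ d) (trans eq (cong (λ e → X′ ℤ.+ ℤ.+ e) e′≡)) (lem X X′ (ℤ.+ d) (ℤ.+ e))
        where
        lem : ∀ X X′ d e → X ℤ.+ (X′ ℤ.+ (d ℤ.+ e)) ≡ X′ ℤ.+ d ℤ.+ (X ℤ.+ e)
        lem = ℤ-Solver.solve-∀
      go : d < len (lookup bars k′) → 0 < len (lookup bars k) → X ≡ X′ × e ≡ e′
      go d< 0< = trans X≡ (trans (cong (λ d → X′ ℤ.+ ℤ.+ d) d≡0) (ℤₚ.+-identityʳ X′)) , sym (trans e′≡ (cong (_+ e) d≡0))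
        where
        same : (k′ , fromℕ< d<) ≡ (k , fromℕ< 0<)
        same = trans (sym (cover′ (fromℕ< d<))) (trans (cong (λ x → cell x t) (trans (cong (λ d → X′ ℤ.+ ℤ.+ d) (toℕ-fromℕ< d<)) (trans (sym X≡)
                 (trans (sym (ℤₚ.+-identityʳ X)) (cong (λ z → X ℤ.+ ℤ.+ z) (sym (toℕ-fromℕ< 0<))))))) (cover (fromℕ< 0<)))
        d≡0 : d ≡ 0
        d≡0 = trans (sym (toℕ-fromℕ< d<)) (trans (cong (λ (c : Cell bars) → toℕ (proj₂ c)) same) (toℕ-fromℕ< 0<))

    -- Copies of one bar that share a cell are the same copy. Displacements are small against the
    -- lengths, so a rough estimate of the places suffices to make them equal, and the offsets then
    -- satisfy an exact equation.
    coincide : ∀ {n X X′ t} e e′ → Starts n X t → Starts n X′ t → X ℤ.+ ℤ.+ e ≡ X′ ℤ.+ ℤ.+ e′ → e < size n → e′ < size n → X ≡ X′ × e ≡ e′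
    coincide e e′ s s′ eq e< e′< with ≤-total e e′
    ... | inj₁ e≤ = coincide-≤ e e′ s s′ eq e≤ e′<
    ... | inj₂ e≥ = let X≡ , e≡ = coincide-≤ e′ e s′ s (sym eq) e≥ e< in sym X≡ , sym e≡

    record Under (c k t : ℕ) (x : ℤ) : Set where
      constructor under
      field
        place! : Found t x
      open Found place! public
      field
        class : topClass n ≡ c
        mark  : topCode n v ≡ k

    record Over (c k t : ℕ) (x : ℤ) : Set where
      constructor over
      field
        place! : Found t x
      open Found place! public
      field
        class : bottomClass n ≡ c
        mark  : bottomCode n v ≡ k

    bottomClass<4 : ∀ n → bottomClass n < 4
    bottomClass<4 short = ≤-refl
    bottomClass<4 long = ≤-refl
    bottomClass<4 fillᵘ = ≤-refl
    bottomClass<4 wide = s≤s (s≤s z≤n)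
    bottomClass<4 narrow = s≤s (s≤s z≤n)
    bottomClass<4 fillʷ = s≤s (s≤s z≤n)
    bottomClass<4 (uw _ _) = z<s
    bottomClass<4 (wu _ _) = s≤s (s≤s (s≤s z≤n))

    topClass<4 : ∀ n → topClass n < 4
    topClass<4 short = z<s
    topClass<4 long = z<s
    topClass<4 fillᵘ = z<s
    topClass<4 wide = s≤s (s≤s (s≤s z≤n))
    topClass<4 narrow = s≤s (s≤s (s≤s z≤n))
    topClass<4 fillʷ = s≤s (s≤s (s≤s z≤n))
    topClass<4 (uw _ _) = s≤s (s≤s z≤n)
    topClass<4 (wu _ _) = ≤-refl

    top-found : ∀ {x t} (f : Found t x) → topColour bars (cell x t) ≡ topClass (Found.n f) + 4 * topCode (Found.n f) (Found.v f)
    top-found {x} {t} (found n X v v< x≡ bar! _) = trans (cong (λ x → topColour bars (cell x t)) x≡) (top-of bar! v v<)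

    bottom-found : ∀ {x t} (f : Found t x) → bottomColour bars (cell x t) ≡ bottomClass (Found.n f) + 4 * bottomCode (Found.n f) (Found.v f)
    bottom-found {x} {t} (found n X v v< x≡ bar! _) = trans (cong (λ x → bottomColour bars (cell x t)) x≡) (bottom-of bar! v v<)

    above : ∀ {x t c k} → c < 4 → topColour bars (cell x t) ≡ c + 4 * k → Over c k (suc t) x
    above {x} {t} {c} {k} c< e = let f = find x (suc t)
                                     class , mark = radix-unique 4 _ k (bottomClass<4 (Found.n f)) c< (trans (sym (bottom-found f)) (trans (sym (cell-vert x t)) e))
                                 in over f class mark

    below : ∀ {x t c k} → c < 4 → bottomColour bars (cell x (suc t)) ≡ c + 4 * k → Under c k t x
    below {x} {t} {c} {k} c< e = let f = find x t
                                     class , mark = radix-unique 4 _ k (topClass<4 (Found.n f)) c< (trans (sym (top-found f)) (trans (cell-vert x t) e))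
                                 in under f class mark

    above-uw : ∀ {x t k} → topColour bars (cell x t) ≡ 0 + 4 * k → ∃ λ k′ → UW k k′ × Over 1 k′ (2 + t) x
    above-uw {x} {t} {k} e with above {c = 0} z<s e
    ... | over f@(found (uw i k′) X v v< x≡ bar! uses) refl mark = k′ , subst (λ i → UW i k′) (trans (mark-unique (here refl) (bottom-marked (uw i k′) v)) mark) uses ,
      above (s≤s (s≤s z≤n)) (trans (top-found f) (cong (λ k → 1 + 4 * k) (mark-unique (top-marked (uw i k′) v) (here refl))))

    above-wu : ∀ {x t k} → topColour bars (cell x t) ≡ 2 + 4 * k → ∃ λ k′ → WU k k′ × Over 3 k′ (2 + t) x
    above-wu {x} {t} {k} e with above {c = 2} (s≤s (s≤s (s≤s z≤n))) e
    ... | over f@(found (wu i k′) X v v< x≡ bar! uses) refl mark = k′ , subst (λ i → WU i k′) (trans (mark-unique (here refl) (bottom-marked (wu i k′) v)) mark) uses ,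
      above ≤-refl (trans (top-found f) (cong (λ k → 3 + 4 * k) (mark-unique (top-marked (wu i k′) v) (here refl))))

    below-uw : ∀ {x t k} → bottomColour bars (cell x (2 + t)) ≡ 1 + 4 * k → ∃ λ k′ → UW k′ k × Under 0 k′ t x
    below-uw {x} {t} {k} e with below {c = 1} (s≤s (s≤s z≤n)) e
    ... | under f@(found (uw k′ i) X v v< x≡ bar! uses) refl mark = k′ , subst (UW k′) (trans (mark-unique (here refl) (top-marked (uw k′ i) v)) mark) uses ,
      below z<s (trans (bottom-found f) (cong (λ k → 0 + 4 * k) (mark-unique (bottom-marked (uw k′ i) v) (here refl))))

    j : ℤ
    j = ℤ.+ J

    K : ∀ k → ℤ.+ (k * J) ≡ ℤ.+ k ℤ.* j
    K k = ℤₚ.pos-* k J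

    top-mark : ∀ {n X t} k {c} → k * J < size n → Starts n X t → Mark (topMarks n (k * J)) c → topColour bars (cell (X ℤ.+ ℤ.+ (k * J)) t) ≡ topClass n + 4 * c
    top-mark {n} k lt s m = trans (top-of s (k * J) lt) (cong (λ c → topClass n + 4 * c) (mark-unique (top-marked n (k * J)) m))

    bottom-mark : ∀ {n X t} k {c} → k * J < size n → Starts n X t → Mark (bottomMarks n (k * J)) c → bottomColour bars (cell (X ℤ.+ ℤ.+ (k * J)) t) ≡ bottomClass n + 4 * c
    bottom-mark {n} k lt s m = trans (bottom-of s (k * J) lt) (cong (λ c → bottomClass n + 4 * c) (mark-unique (bottom-marked n (k * J)) m))

    kJ< : ∀ {k n} → k < n → k * J < n * J
    kJ< lt = *-monoˡ-< J ⦃ >-nonZero J>0 ⦄ lt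

    kJ≢ : ∀ {k n} → k < n → n * J ≢ k * J
    kJ≢ lt e = <⇒≢ (kJ< lt) (sym e)

    -- Each mark forces the bar that carries its counterpart.

    scaled : ∀ {x y} k → x ℤ.+ ℤ.+ (k * J) ≡ y → x ℤ.+ ℤ.+ k ℤ.* j ≡ y
    scaled {x} k e = trans (cong (λ z → x ℤ.+ z) (sym (K k))) e

    wide-above : ∀ {s t} → Starts short s t → ∃ λ w → Starts wide w (2 + t) × SomeColour λ c π → w ℤ.+ ℤ.+ 4 ℤ.* j ≡ s ℤ.+ ℤ.+ p c π
    wide-above {s} {t} st with above-uw {k = 1} (top-mark {short} 3 (kJ< {3} {4} ≤-refl) st (here refl))
    ... | _ , ⟨1,1⟩ , over (found wide w v v< x≡ bar! _) refl mark = w , bar! , go (subst (Mark _) mark (bottom-marked wide v))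
      where
      go : Mark (bottomMarks wide v) 1 → SomeColour λ c π → w ℤ.+ ℤ.+ 4 ℤ.* j ≡ s ℤ.+ ℤ.+ p c π
      go (here (c , π , col , e)) = c , π , col , linear (w ℤ.+ ℤ.+ 4 ℤ.* j) (s ℤ.+ ℤ.+ p c π) (sym (scaled {s} 3 x≡) ⊞ sym (trans (cong ℤ.+_ e) (K 7))) (lem w s j (ℤ.+ v) (ℤ.+ p c π))
        where
        lem : ∀ w s j v p → w ℤ.+ ℤ.+ 4 ℤ.* j ℤ.+ (s ℤ.+ ℤ.+ 3 ℤ.* j ℤ.+ (v ℤ.+ p)) ≡ s ℤ.+ p ℤ.+ (w ℤ.+ v ℤ.+ ℤ.+ 7 ℤ.* j)
        lem = ℤ-Solver.solve-∀
      go (there _ (there _ (there _ ())))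
    ... | _ , ⟨1,1⟩ , over (found narrow w v v< x≡ bar! _) refl mark = contradiction (subst (Mark _) mark (bottom-marked narrow v)) λ { (there _ ()) }
    ... | _ , ⟨1,1⟩ , over (found fillʷ w v v< x≡ bar! _) refl mark = contradiction (subst (Mark _) mark (bottom-marked fillʷ v)) λ { (there _ ()) }

    -- The first two conditions for `wide` hold only up to offset 7 J, so at 10 J they do not
    -- pre-empt the mark 4.
    no-wide-marks : ∀ {A : Set} v → 8 * J ≤ v → (SomeColour λ c π → v + p c π ≡ 7 * J) ⊎ (SomeTile λ τ π → v + p (east τ) π ≡ J + u τ π) → A
    no-wide-marks v ≤v (inj₁ (c , π , _ , e)) = contradiction (≤-trans ≤v (≤-trans (m≤m+n v _) (≤-reflexive e))) (<⇒≱ (kJ< {7} {8} ≤-refl))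
    no-wide-marks v ≤v (inj₂ (τ , π , good , e)) = contradiction (≤-trans ≤v (≤-trans (m≤m+n v _) (≤-reflexive e)))
      (<⇒≱ (<-≤-trans (+-monoʳ-< J (u<J π good)) (≤-trans (+-monoʳ-≤ J (m≤m+n J (6 * J))) ≤-refl)))

    8≤10 : 8 * J ≤ 10 * J
    8≤10 = *-monoˡ-≤ J {8} {10} (m≤m+n 8 2)

    long-below : ∀ {w t} → Starts wide w (2 + t) → ∃ λ a → Starts long a t × SomeTile λ τ π → a ℤ.+ ℤ.+ p (west τ) π ≡ w ℤ.+ ℤ.+ 9 ℤ.* j ℤ.+ ℤ.+ u τ π
    long-below {w} {t} st with below-uw {k = 4} (bottom-mark {wide} 10 (kJ< {10} {11} ≤-refl) st (there (no-wide-marks (10 * J) 8≤10 ∘ inj₁) (there (no-wide-marks (10 * J) 8≤10 ∘ inj₂) (here refl))))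
    ... | _ , ⟨4,4⟩ , under (found long a v v< x≡ bar! _) refl mark = a , bar! , go (subst (Mark _) mark (top-marked long v))
      where
      go : Mark (topMarks long v) 4 → SomeTile λ τ π → a ℤ.+ ℤ.+ p (west τ) π ≡ w ℤ.+ ℤ.+ 9 ℤ.* j ℤ.+ ℤ.+ u τ π
      go (there _ (there _ (here (τ , π , good , e)))) = τ , π , good , linear (a ℤ.+ ℤ.+ p (west τ) π) (w ℤ.+ ℤ.+ 9 ℤ.* j ℤ.+ ℤ.+ u τ π) (sym (scaled {w} 10 x≡) ⊞ sym (cong ℤ.+_ e)) (lem a w j (ℤ.+ v) (ℤ.+ p (west τ) π) (ℤ.+ u τ π))
        where
        lem : ∀ a w j v p u → a ℤ.+ p ℤ.+ (w ℤ.+ ℤ.+ 10 ℤ.* j ℤ.+ (v ℤ.+ u)) ≡ w ℤ.+ ℤ.+ 9 ℤ.* j ℤ.+ u ℤ.+ (a ℤ.+ v ℤ.+ (j ℤ.+ p))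
        lem = ℤ-Solver.solve-∀
      go (there _ (there _ (there _ ())))
    ... | _ , ⟨4,4⟩ , under (found short a v v< x≡ bar! _) refl mark = contradiction (subst (Mark _) mark (top-marked short v)) λ { (there _ ()) }
    ... | _ , ⟨4,4⟩ , under (found fillᵘ a v v< x≡ bar! _) refl mark = contradiction (subst (Mark _) mark (top-marked fillᵘ v)) λ { (there _ ()) }

    wide-after : ∀ {a t} → Starts long a t → ∃ λ w → Starts wide w (2 + t) × SomeTile λ τ π → w ℤ.+ ℤ.+ u τ π ≡ a ℤ.+ ℤ.+ 9 ℤ.* j ℤ.+ ℤ.+ p (east τ) π
    wide-after {a} {t} st with above-uw {k = 2} (top-mark {long} 10 (kJ< {10} {12} (n≤1+n 11)) st (here refl))
    ... | _ , ⟨2,2⟩ , over (found wide w v v< x≡ bar! _) refl mark = w , bar! , go (subst (Mark _) mark (bottom-marked wide v))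
      where
      go : Mark (bottomMarks wide v) 2 → SomeTile λ τ π → w ℤ.+ ℤ.+ u τ π ≡ a ℤ.+ ℤ.+ 9 ℤ.* j ℤ.+ ℤ.+ p (east τ) π
      go (there _ (here (τ , π , good , e))) = τ , π , good , linear (w ℤ.+ ℤ.+ u τ π) (a ℤ.+ ℤ.+ 9 ℤ.* j ℤ.+ ℤ.+ p (east τ) π) (sym (scaled {a} 10 x≡) ⊞ sym (cong ℤ.+_ e)) (lem w a j (ℤ.+ v) (ℤ.+ p (east τ) π) (ℤ.+ u τ π))
        where
        lem : ∀ w a j v p u → w ℤ.+ u ℤ.+ (a ℤ.+ ℤ.+ 10 ℤ.* j ℤ.+ (v ℤ.+ p)) ≡ a ℤ.+ ℤ.+ 9 ℤ.* j ℤ.+ p ℤ.+ (w ℤ.+ v ℤ.+ (j ℤ.+ u))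
        lem = ℤ-Solver.solve-∀
      go (there _ (there _ (there _ ())))
    ... | _ , ⟨2,2⟩ , over (found narrow w v v< x≡ bar! _) refl mark = contradiction (subst (Mark _) mark (bottom-marked narrow v)) λ { (there _ ()) }
    ... | _ , ⟨2,2⟩ , over (found fillʷ w v v< x≡ bar! _) refl mark = contradiction (subst (Mark _) mark (bottom-marked fillʷ v)) λ { (there _ ()) }

    narrow-above : ∀ {a t} → Starts long a t → ∃ λ w → Starts narrow w (2 + t) × SomeTile λ τ π → w ℤ.+ ℤ.+ u τ π ≡ a ℤ.+ ℤ.+ 3 ℤ.* j ℤ.+ ℤ.+ q (north τ) (not π)
    narrow-above {a} {t} st with above-uw {k = 3} (top-mark {long} 4 (kJ< {4} {12} (m≤m+n 5 7)) st (there (kJ≢ {4} {10} (m≤m+n 5 5) ∘ sym) (here refl)))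
    ... | _ , ⟨3,3⟩ , over (found narrow w v v< x≡ bar! _) refl mark = w , bar! , go (subst (Mark _) mark (bottom-marked narrow v))
      where
      go : Mark (bottomMarks narrow v) 3 → SomeTile λ τ π → w ℤ.+ ℤ.+ u τ π ≡ a ℤ.+ ℤ.+ 3 ℤ.* j ℤ.+ ℤ.+ q (north τ) (not π)
      go (here (τ , π , good , e)) = τ , π , good , linear (w ℤ.+ ℤ.+ u τ π) (a ℤ.+ ℤ.+ 3 ℤ.* j ℤ.+ ℤ.+ q (north τ) (not π)) (sym (scaled {a} 4 x≡) ⊞ sym (cong ℤ.+_ e)) (lem w a j (ℤ.+ v) (ℤ.+ q (north τ) (not π)) (ℤ.+ u τ π))
        where
        lem : ∀ w a j v q u → w ℤ.+ u ℤ.+ (a ℤ.+ ℤ.+ 4 ℤ.* j ℤ.+ (v ℤ.+ q)) ≡ a ℤ.+ ℤ.+ 3 ℤ.* j ℤ.+ q ℤ.+ (w ℤ.+ v ℤ.+ (j ℤ.+ u))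
        lem = ℤ-Solver.solve-∀
      go (there _ ())
    ... | _ , ⟨3,3⟩ , over (found wide w v v< x≡ bar! _) refl mark = contradiction (subst (Mark _) mark (bottom-marked wide v)) λ { (there _ (there _ (there _ ()))) }
    ... | _ , ⟨3,3⟩ , over (found fillʷ w v v< x≡ bar! _) refl mark = contradiction (subst (Mark _) mark (bottom-marked fillʷ v)) λ { (there _ ()) }

    short-above-wide : ∀ {w t} → Starts wide w t → ∃ λ s → Starts short s (2 + t) × SomeColour λ c π → s ℤ.+ ℤ.+ p c π ≡ w ℤ.+ ℤ.+ 10 ℤ.* j
    short-above-wide {w} {t} st with above-wu {k = 1} (top-mark {wide} 10 (kJ< {10} {11} ≤-refl) st (here refl))
    ... | _ , ⟨1,1⟩ , over (found short s v v< x≡ bar! _) refl mark = s , bar! , go (subst (Mark _) mark (bottom-marked short v))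
      where
      go : Mark (bottomMarks short v) 1 → SomeColour λ c π → s ℤ.+ ℤ.+ p c π ≡ w ℤ.+ ℤ.+ 10 ℤ.* j
      go (here (c , π , col , e)) = c , π , col , linear (s ℤ.+ ℤ.+ p c π) (w ℤ.+ ℤ.+ 10 ℤ.* j) (sym (scaled {w} 10 x≡) ⊞ sym (cong ℤ.+_ e)) (lem s w j (ℤ.+ v) (ℤ.+ p c π))
        where
        lem : ∀ s w j v p → s ℤ.+ p ℤ.+ (w ℤ.+ ℤ.+ 10 ℤ.* j ℤ.+ v) ≡ w ℤ.+ ℤ.+ 10 ℤ.* j ℤ.+ (s ℤ.+ v ℤ.+ p)
        lem = ℤ-Solver.solve-∀
      go (there _ (there _ ()))
    ... | _ , ⟨1,1⟩ , over (found long s v v< x≡ bar! _) refl mark = contradiction (subst (Mark _) mark (bottom-marked long v)) λ { (there _ ()) }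
    ... | _ , ⟨1,1⟩ , over (found fillᵘ s v v< x≡ bar! _) refl mark = contradiction (subst (Mark _) mark (bottom-marked fillᵘ v)) λ ()

    short-above-narrow : ∀ {w t} → Starts narrow w t → ∃ λ s → Starts short s (2 + t) × SomeColour λ c π → w ≡ s ℤ.+ ℤ.+ 2 ℤ.* j ℤ.+ ℤ.+ q c π
    short-above-narrow {w} {t} st with above-wu {k = 2} (top-mark {narrow} 0 (size>0 narrow) st (here refl))
    ... | _ , ⟨2,2⟩ , over (found short s v v< x≡ bar! _) refl mark = s , bar! , go (subst (Mark _) mark (bottom-marked short v))
      where
      go : Mark (bottomMarks short v) 2 → SomeColour λ c π → w ≡ s ℤ.+ ℤ.+ 2 ℤ.* j ℤ.+ ℤ.+ q c π
      go (there _ (here (c , π , col , e))) = c , π , col , linear (w) (s ℤ.+ ℤ.+ 2 ℤ.* j ℤ.+ ℤ.+ q c π) (x≡ ⊞ trans (cong ℤ.+_ e) (cong (λ z → z ℤ.+ ℤ.+ q c π) (K 2))) (lem w s j (ℤ.+ v) (ℤ.+ q c π))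
        where
        lem : ∀ w s j v q → w ℤ.+ (s ℤ.+ v ℤ.+ (ℤ.+ 2 ℤ.* j ℤ.+ q)) ≡ s ℤ.+ ℤ.+ 2 ℤ.* j ℤ.+ q ℤ.+ (w ℤ.+ ℤ.0ℤ ℤ.+ v)
        lem = ℤ-Solver.solve-∀
      go (there _ (there _ ()))
    ... | _ , ⟨2,2⟩ , over (found long s v v< x≡ bar! _) refl mark = contradiction (subst (Mark _) mark (bottom-marked long v)) λ { (there _ ()) }
    ... | _ , ⟨2,2⟩ , over (found fillᵘ s v v< x≡ bar! _) refl mark = contradiction (subst (Mark _) mark (bottom-marked fillᵘ v)) λ ()

    long-above : ∀ {w t} → Starts narrow w t → ∃ λ a → Starts long a (2 + t) × SomeTile λ τ π → a ℤ.+ ℤ.+ q (south τ) π ≡ w ℤ.+ ℤ.+ 3 ℤ.* j ℤ.+ ℤ.+ u τ π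
    long-above {w} {t} st with above-wu {k = 3} (top-mark {narrow} 4 (kJ< {4} {5} ≤-refl) st (there (kJ≢ {0} {4} z<s) (here refl)))
    ... | _ , ⟨3,3⟩ , over (found long a v v< x≡ bar! _) refl mark = a , bar! , go (subst (Mark _) mark (bottom-marked long v))
      where
      go : Mark (bottomMarks long v) 3 → SomeTile λ τ π → a ℤ.+ ℤ.+ q (south τ) π ≡ w ℤ.+ ℤ.+ 3 ℤ.* j ℤ.+ ℤ.+ u τ π
      go (here (τ , π , good , e)) = τ , π , good , linear (a ℤ.+ ℤ.+ q (south τ) π) (w ℤ.+ ℤ.+ 3 ℤ.* j ℤ.+ ℤ.+ u τ π) (sym (scaled {w} 4 x≡) ⊞ sym (cong ℤ.+_ e)) (lem a w j (ℤ.+ v) (ℤ.+ q (south τ) π) (ℤ.+ u τ π))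
        where
        lem : ∀ a w j v q u → a ℤ.+ q ℤ.+ (w ℤ.+ ℤ.+ 4 ℤ.* j ℤ.+ (v ℤ.+ u)) ≡ w ℤ.+ ℤ.+ 3 ℤ.* j ℤ.+ u ℤ.+ (a ℤ.+ v ℤ.+ (j ℤ.+ q))
        lem = ℤ-Solver.solve-∀
      go (there _ ())
    ... | _ , ⟨3,3⟩ , over (found short a v v< x≡ bar! _) refl mark = contradiction (subst (Mark _) mark (bottom-marked short v)) λ { (there _ (there _ ())) }
    ... | _ , ⟨3,3⟩ , over (found fillᵘ a v v< x≡ bar! _) refl mark = contradiction (subst (Mark _) mark (bottom-marked fillᵘ v)) λ ()

    -- A place of the lattice, anchored at its `wide` bar; the other bars are found by following
    -- marks. Each mark brings its own witnesses, so the tiles τ, υ, ν, σ and the colours c, d, e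
    -- still have to be shown to agree.
    record Node (t : ℕ) : Set where
      constructor node
      field
        {w}   : ℤ
        start : Starts wide w (2 + t)

      below!  = long-below start
      a       = proj₁ below!
      long!   = proj₁ (proj₂ below!)
      τ       = proj₁ (proj₂ (proj₂ below!))
      π       = proj₁ (proj₂ (proj₂ (proj₂ below!)))
      good    = proj₁ (proj₂ (proj₂ (proj₂ (proj₂ below!))))
      a≡ : a ℤ.+ ℤ.+ p (west τ) π ≡ w ℤ.+ ℤ.+ 9 ℤ.* j ℤ.+ ℤ.+ u τ π
      a≡      = proj₂ (proj₂ (proj₂ (proj₂ (proj₂ below!))))

      after!  = wide-after long!
      w⁺      = proj₁ after!
      wide⁺   = proj₁ (proj₂ after!)
      υ       = proj₁ (proj₂ (proj₂ after!))
      ρ       = proj₁ (proj₂ (proj₂ (proj₂ after!)))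
      goodυ   = proj₁ (proj₂ (proj₂ (proj₂ (proj₂ after!))))
      w⁺≡ : w⁺ ℤ.+ ℤ.+ u υ ρ ≡ a ℤ.+ ℤ.+ 9 ℤ.* j ℤ.+ ℤ.+ p (east υ) ρ
      w⁺≡     = proj₂ (proj₂ (proj₂ (proj₂ (proj₂ after!))))

      narrow! = narrow-above long!
      w′      = proj₁ narrow!
      narrow′ = proj₁ (proj₂ narrow!)
      ν       = proj₁ (proj₂ (proj₂ narrow!))
      ρν      = proj₁ (proj₂ (proj₂ (proj₂ narrow!)))
      goodν   = proj₁ (proj₂ (proj₂ (proj₂ (proj₂ narrow!))))
      w′≡ : w′ ℤ.+ ℤ.+ u ν ρν ≡ a ℤ.+ ℤ.+ 3 ℤ.* j ℤ.+ ℤ.+ q (north ν) (not ρν)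
      w′≡     = proj₂ (proj₂ (proj₂ (proj₂ (proj₂ narrow!))))

      short!  = short-above-wide start
      s       = proj₁ short!
      short↑  = proj₁ (proj₂ short!)
      c       = proj₁ (proj₂ (proj₂ short!))
      πc      = proj₁ (proj₂ (proj₂ (proj₂ short!)))
      colc    = proj₁ (proj₂ (proj₂ (proj₂ (proj₂ short!))))
      s≡ : s ℤ.+ ℤ.+ p c πc ≡ w ℤ.+ ℤ.+ 10 ℤ.* j
      s≡      = proj₂ (proj₂ (proj₂ (proj₂ (proj₂ short!))))

      short′  = short-above-narrow narrow′
      s′      = proj₁ short′
      d       = proj₁ (proj₂ (proj₂ short′))
      πd      = proj₁ (proj₂ (proj₂ (proj₂ short′)))
      cold    = proj₁ (proj₂ (proj₂ (proj₂ (proj₂ short′))))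
      s′≡ : w′ ≡ s′ ℤ.+ ℤ.+ 2 ℤ.* j ℤ.+ ℤ.+ q d πd
      s′≡     = proj₂ (proj₂ (proj₂ (proj₂ (proj₂ short′))))

      long↑   = long-above narrow′
      a′      = proj₁ long↑
      σ       = proj₁ (proj₂ (proj₂ long↑))
      ρσ      = proj₁ (proj₂ (proj₂ (proj₂ long↑)))
      goodσ   = proj₁ (proj₂ (proj₂ (proj₂ (proj₂ long↑))))
      a′≡ : a′ ℤ.+ ℤ.+ q (south σ) ρσ ≡ w′ ℤ.+ ℤ.+ 3 ℤ.* j ℤ.+ ℤ.+ u σ ρσ
      a′≡     = proj₂ (proj₂ (proj₂ (proj₂ (proj₂ long↑))))

      wide↑   = wide-above short↑
      w↑      = proj₁ wide↑
      e       = proj₁ (proj₂ (proj₂ wide↑))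
      πe      = proj₁ (proj₂ (proj₂ (proj₂ wide↑)))
      cole    = proj₁ (proj₂ (proj₂ (proj₂ (proj₂ wide↑))))
      w↑≡ : w↑ ℤ.+ ℤ.+ 4 ℤ.* j ≡ s ℤ.+ ℤ.+ p e πe
      w↑≡     = proj₂ (proj₂ (proj₂ (proj₂ (proj₂ wide↑))))

    up : ∀ {t} → Node t → Node (4 + t)
    up A = node (proj₁ (proj₂ (Node.wide↑ A)))

    right : ∀ {t} → Node t → Node t
    right A = node (Node.wide⁺ A)

    below-3J : ∀ {x y z} → x < J → y < J → z < J → x + y + z < 3 * J
    below-3J {x} {y} {z} x< y< z< = <-≤-trans (+-mono-< (+-mono-< x< y<) z<) (≤-reflexive (trans (+-assoc J J J) (cong (λ z → J + (J + z)) (sym (+-identityʳ J)))))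

    -- The `short` bar of the next row is reached from `wide` directly, and also through `long` and
    -- `narrow`. The two results overlap, so they are one bar.
    same-short : ∀ {t} (A : Node t) → let open Node A in s ≡ s′ × p c πc + u τ π + q (north ν) (not ρν) ≡ p (west τ) π + u ν ρν + q d πd
    same-short {t} A = coincide _ _ short↑ (proj₁ (proj₂ short′))
      (linear (s ℤ.+ (ℤ.+ p c πc ℤ.+ ℤ.+ u τ π ℤ.+ ℤ.+ q (north ν) (not ρν))) (s′ ℤ.+ (ℤ.+ p (west τ) π ℤ.+ ℤ.+ u ν ρν ℤ.+ ℤ.+ q d πd))
        (s≡ ⊞ sym a≡ ⊞ sym w′≡ ⊞ s′≡)
        (lem s s′ w a w′ j (ℤ.+ p c πc) (ℤ.+ u τ π) (ℤ.+ q (north ν) (not ρν)) (ℤ.+ p (west τ) π) (ℤ.+ u ν ρν) (ℤ.+ q d πd)))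
      (<-trans (below-3J (p<J πc colc) (u<J π good) (q<J (not ρν) (proj₂ (proj₂ (sides goodν))))) (kJ< {3} {4} ≤-refl))
      (<-trans (below-3J (p<J π (proj₁ (proj₁ (sides good)))) (u<J ρν goodν) (q<J πd cold)) (kJ< {3} {4} ≤-refl))
      where
      open Node A
      lem : ∀ s s′ w a w′ j p₅ u₃ q₄ p₃ u₄ q₆ →
        s ℤ.+ (p₅ ℤ.+ u₃ ℤ.+ q₄) ℤ.+ (w ℤ.+ ℤ.+ 10 ℤ.* j ℤ.+ (a ℤ.+ p₃) ℤ.+ (w′ ℤ.+ u₄) ℤ.+ (s′ ℤ.+ ℤ.+ 2 ℤ.* j ℤ.+ q₆)) ≡
        s′ ℤ.+ (p₃ ℤ.+ u₄ ℤ.+ q₆) ℤ.+ (s ℤ.+ p₅ ℤ.+ (w ℤ.+ ℤ.+ 9 ℤ.* j ℤ.+ u₃) ℤ.+ (a ℤ.+ ℤ.+ 3 ℤ.* j ℤ.+ q₄) ℤ.+ w′)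
      lem = ℤ-Solver.solve-∀

    short-digits : ∀ {t} (A : Node t) → let open Node A in (πc ≡ π × c ≡ west τ) × (π ≡ ρν × τ ≡ ν) × (not ρν ≡ πd × north ν ≡ d)
    short-digits A = three-injective πc π π ρν (not ρν) πd colc (proj₁ (proj₁ (sides good))) good goodν (proj₂ (proj₂ (sides goodν))) cold (proj₂ (same-short A))
      where open Node A

    -- The same argument for the `long` bar of the next row, reached through its `wide` bar and
    -- through the `narrow` bar below it.
    same-long : ∀ {t} (A : Node t) → let open Node A in let module B = Node (up A) in
                p (west B.τ) B.π + u σ ρσ + q d πd ≡ p e πe + u B.τ B.π + q (south σ) ρσ
    same-long A = proj₂ (coincide _ _ B.long! (proj₁ (proj₂ long↑))
      (linear (B.a ℤ.+ (ℤ.+ p (west B.τ) B.π ℤ.+ ℤ.+ u σ ρσ ℤ.+ ℤ.+ q d πd)) (a′ ℤ.+ (ℤ.+ p e πe ℤ.+ ℤ.+ u B.τ B.π ℤ.+ ℤ.+ q (south σ) ρσ))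
        (B.a≡ ⊞ w↑≡ ⊞ sym a′≡ ⊞ sym s′≡ ⊞ proj₁ (same-short A))
        (lem s s′ w↑ w′ B.a a′ j (ℤ.+ p (west B.τ) B.π) (ℤ.+ u σ ρσ) (ℤ.+ q d πd) (ℤ.+ p e πe) (ℤ.+ u B.τ B.π) (ℤ.+ q (south σ) ρσ)))
      (<-trans (below-3J (p<J B.π (proj₁ (proj₁ (sides B.good)))) (u<J ρσ goodσ) (q<J πd cold)) (kJ< {3} {12} (m≤m+n 4 8)))
      (<-trans (below-3J (p<J πe cole) (u<J B.π B.good) (q<J ρσ (proj₂ (proj₁ (sides goodσ))))) (kJ< {3} {12} (m≤m+n 4 8))))
      where
      open Node A
      module B = Node (up A)
      lem : ∀ s s′ w↑ w′ a a′ j p₃ u₇ q₆ p₁ u₃ q₇ →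
        a ℤ.+ (p₃ ℤ.+ u₇ ℤ.+ q₆) ℤ.+ (w↑ ℤ.+ ℤ.+ 9 ℤ.* j ℤ.+ u₃ ℤ.+ (s ℤ.+ p₁) ℤ.+ (a′ ℤ.+ q₇) ℤ.+ w′ ℤ.+ s′) ≡
        a′ ℤ.+ (p₁ ℤ.+ u₃ ℤ.+ q₇) ℤ.+ (a ℤ.+ p₃ ℤ.+ (w↑ ℤ.+ ℤ.+ 4 ℤ.* j) ℤ.+ (w′ ℤ.+ ℤ.+ 3 ℤ.* j ℤ.+ u₇) ℤ.+ (s′ ℤ.+ ℤ.+ 2 ℤ.* j ℤ.+ q₆) ℤ.+ s)
      lem = ℤ-Solver.solve-∀

    long-digits : ∀ {t} (A : Node t) → let open Node A in let module B = Node (up A) in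
                  (B.π ≡ πe × west B.τ ≡ e) × (ρσ ≡ B.π × σ ≡ B.τ) × (πd ≡ ρσ × d ≡ south σ)
    long-digits A = three-injective B.π πe ρσ B.π πd ρσ (proj₁ (proj₁ (sides B.good))) cole goodσ B.good cold (proj₂ (proj₁ (sides goodσ))) (same-long A)
      where
      open Node A
      module B = Node (up A)

    -- The `narrow` bar is displaced with parity `not π`, and the next row reads this displacement
    -- with its own parity.
    parity-alternates : ∀ {t} (A : Node t) → Node.π (up A) ≡ not (Node.π A)
    parity-alternates A = let _ , (π≡ , _) , (x , _) = short-digits A
                              _ , (y , _) , (z , _) = long-digits A
                          in trans (sym y) (trans (sym z) (trans (sym x) (cong not (sym π≡))))

    south-matches : ∀ {t} (A : Node t) → north (Node.τ A) ≡ south (Node.τ (up A))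
    south-matches A = let _ , (_ , τ≡) , (_ , x) = short-digits A
                          _ , (_ , y) , (_ , z) = long-digits A
                      in trans (cong north τ≡) (trans x (trans z (cong south y)))

    Linked : ∀ {t} → Node t → Node t → Set
    Linked A B = Node.w B ≡ Node.w⁺ A

    step-right : ∀ {t} (A : Node t) → let open Node A in
      w⁺ ℤ.+ (ℤ.+ u υ ρ ℤ.+ ℤ.+ p (west τ) π) ≡ w ℤ.+ ℤ.+ 18 ℤ.* j ℤ.+ (ℤ.+ u τ π ℤ.+ ℤ.+ p (east υ) ρ)
    step-right A = linear (w⁺ ℤ.+ (ℤ.+ u υ ρ ℤ.+ ℤ.+ p (west τ) π)) (w ℤ.+ ℤ.+ 18 ℤ.* j ℤ.+ (ℤ.+ u τ π ℤ.+ ℤ.+ p (east υ) ρ)) (w⁺≡ ⊞ a≡)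
      (lem w⁺ w a j (ℤ.+ u υ ρ) (ℤ.+ p (west τ) π) (ℤ.+ u τ π) (ℤ.+ p (east υ) ρ))
      where
      open Node A
      lem : ∀ w⁺ w a j u₂ p₃ u₃ p₂ → w⁺ ℤ.+ (u₂ ℤ.+ p₃) ℤ.+ (a ℤ.+ ℤ.+ 9 ℤ.* j ℤ.+ p₂ ℤ.+ (w ℤ.+ ℤ.+ 9 ℤ.* j ℤ.+ u₃)) ≡
                                   w ℤ.+ ℤ.+ 18 ℤ.* j ℤ.+ (u₃ ℤ.+ p₂) ℤ.+ (w⁺ ℤ.+ u₂ ℤ.+ (a ℤ.+ p₃))
      lem = ℤ-Solver.solve-∀

    step-up : ∀ {t} (A : Node t) → let open Node A in w↑ ℤ.+ ℤ.+ p c πc ≡ w ℤ.+ ℤ.+ 6 ℤ.* j ℤ.+ ℤ.+ p e πe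
    step-up A = linear (w↑ ℤ.+ ℤ.+ p c πc) (w ℤ.+ ℤ.+ 6 ℤ.* j ℤ.+ ℤ.+ p e πe) (w↑≡ ⊞ s≡) (lem w↑ w s j (ℤ.+ p c πc) (ℤ.+ p e πe))
      where
      open Node A
      lem : ∀ w↑ w s j p₅ p₁ → w↑ ℤ.+ p₅ ℤ.+ (s ℤ.+ p₁ ℤ.+ (w ℤ.+ ℤ.+ 10 ℤ.* j)) ≡ w ℤ.+ ℤ.+ 6 ℤ.* j ℤ.+ p₁ ℤ.+ (w↑ ℤ.+ ℤ.+ 4 ℤ.* j ℤ.+ (s ℤ.+ p₅))
      lem = ℤ-Solver.solve-∀

    step-across : ∀ {t} (A B : Node t) → Linked A B → let module A = Node A in let module B = Node B in
      B.w↑ ℤ.+ (ℤ.+ p B.c B.πc ℤ.+ (ℤ.+ u A.υ A.ρ ℤ.+ ℤ.+ p (west A.τ) A.π)) ≡ A.w ℤ.+ ℤ.+ 24 ℤ.* j ℤ.+ (ℤ.+ p B.e B.πe ℤ.+ (ℤ.+ u A.τ A.π ℤ.+ ℤ.+ p (east A.υ) A.ρ))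
    step-across A B link = linear (B.w↑ ℤ.+ (ℤ.+ p B.c B.πc ℤ.+ g)) (A.w ℤ.+ ℤ.+ 24 ℤ.* j ℤ.+ (ℤ.+ p B.e B.πe ℤ.+ h))
      (step-up B ⊞ link ⊞ step-right A) (lem B.w↑ B.w A.w⁺ A.w j (ℤ.+ p B.c B.πc) (ℤ.+ p B.e B.πe) g h)
      where
      module A = Node A
      module B = Node B
      g = ℤ.+ u A.υ A.ρ ℤ.+ ℤ.+ p (west A.τ) A.π
      h = ℤ.+ u A.τ A.π ℤ.+ ℤ.+ p (east A.υ) A.ρ
      lem : ∀ w↑ w w⁺ v j c e g h → w↑ ℤ.+ (c ℤ.+ g) ℤ.+ (w ℤ.+ ℤ.+ 6 ℤ.* j ℤ.+ e ℤ.+ w⁺ ℤ.+ (v ℤ.+ ℤ.+ 18 ℤ.* j ℤ.+ h)) ≡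
                                    v ℤ.+ ℤ.+ 24 ℤ.* j ℤ.+ (e ℤ.+ h) ℤ.+ (w↑ ℤ.+ c ℤ.+ w ℤ.+ (w⁺ ℤ.+ g))
      lem = ℤ-Solver.solve-∀

    step-around : ∀ {t} (A : Node t) → let module A = Node A in let module B = Node (up A) in
      B.w⁺ ℤ.+ (ℤ.+ p A.c A.πc ℤ.+ (ℤ.+ u B.υ B.ρ ℤ.+ ℤ.+ p (west B.τ) B.π)) ≡ A.w ℤ.+ ℤ.+ 24 ℤ.* j ℤ.+ (ℤ.+ p A.e A.πe ℤ.+ (ℤ.+ u B.τ B.π ℤ.+ ℤ.+ p (east B.υ) B.ρ))
    step-around A = linear (B.w⁺ ℤ.+ (ℤ.+ p A.c A.πc ℤ.+ g)) (A.w ℤ.+ ℤ.+ 24 ℤ.* j ℤ.+ (ℤ.+ p A.e A.πe ℤ.+ h))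
      (step-up A ⊞ step-right (up A)) (lem A.w↑ B.w⁺ A.w j (ℤ.+ p A.c A.πc) (ℤ.+ p A.e A.πe) g h)
      where
      module A = Node A
      module B = Node (up A)
      g = ℤ.+ u B.υ B.ρ ℤ.+ ℤ.+ p (west B.τ) B.π
      h = ℤ.+ u B.τ B.π ℤ.+ ℤ.+ p (east B.υ) B.ρ
      lem : ∀ w↑ w⁺ w j c e g h → w⁺ ℤ.+ (c ℤ.+ g) ℤ.+ (w ℤ.+ ℤ.+ 6 ℤ.* j ℤ.+ e ℤ.+ (w↑ ℤ.+ ℤ.+ 18 ℤ.* j ℤ.+ h)) ≡
                                  w ℤ.+ ℤ.+ 24 ℤ.* j ℤ.+ (e ℤ.+ h) ℤ.+ (w↑ ℤ.+ c ℤ.+ (w⁺ ℤ.+ g))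
      lem = ℤ-Solver.solve-∀

    -- Right and up, in either order, leads 24 J to the right up to six displacements. These add up
    -- to less than 11 J, the length of `wide`, so the two `wide` bars overlap.
    linked-up : ∀ {t} (A B : Node t) → Linked A B → Linked (up A) (up B)
    linked-up {t} A B link = proj₁ (coincide
      (p B.c B.πc + (u A.υ A.ρ + p (west A.τ) A.π) + (p A.e A.πe + (u A′.τ A′.π + p (east A′.υ) A′.ρ)))
      (p A.c A.πc + (u A′.υ A′.ρ + p (west A′.τ) A′.π) + (p B.e B.πe + (u A.τ A.π + p (east A.υ) A.ρ)))
      (Node.start (up B)) A′.wide⁺
      (linear (B.w↑ ℤ.+ (m₁ ℤ.+ n₂)) (A′.w⁺ ℤ.+ (m₂ ℤ.+ n₁)) (step-across A B link ⊞ sym (step-around A)) (lem B.w↑ A′.w⁺ (A.w ℤ.+ ℤ.+ 24 ℤ.* j) m₁ m₂ n₁ n₂))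
      (bound (p<J B.πc B.colc) (u<J A.ρ A.goodυ) (p<J A.π (proj₁ (proj₁ (sides A.good))))
        (p<J A.πe A.cole) (u<J A′.π A′.good) (p<J A′.ρ (proj₁ (proj₂ (sides A′.goodυ)))))
      (bound (p<J A.πc A.colc) (u<J A′.ρ A′.goodυ) (p<J A′.π (proj₁ (proj₁ (sides A′.good))))
        (p<J B.πe B.cole) (u<J A.π A.good) (p<J A.ρ (proj₁ (proj₂ (sides A.goodυ))))))
      where
      module A = Node A
      module B = Node B
      module A′ = Node (up A)
      m₁ = ℤ.+ p B.c B.πc ℤ.+ (ℤ.+ u A.υ A.ρ ℤ.+ ℤ.+ p (west A.τ) A.π)
      n₁ = ℤ.+ p B.e B.πe ℤ.+ (ℤ.+ u A.τ A.π ℤ.+ ℤ.+ p (east A.υ) A.ρ)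
      m₂ = ℤ.+ p A.c A.πc ℤ.+ (ℤ.+ u A′.υ A′.ρ ℤ.+ ℤ.+ p (west A′.τ) A′.π)
      n₂ = ℤ.+ p A.e A.πe ℤ.+ (ℤ.+ u A′.τ A′.π ℤ.+ ℤ.+ p (east A′.υ) A′.ρ)
      lem : ∀ x y z m₁ m₂ n₁ n₂ → x ℤ.+ (m₁ ℤ.+ n₂) ℤ.+ (z ℤ.+ n₁ ℤ.+ (y ℤ.+ m₂)) ≡ y ℤ.+ (m₂ ℤ.+ n₁) ℤ.+ (x ℤ.+ m₁ ℤ.+ (z ℤ.+ n₂))
      lem = ℤ-Solver.solve-∀
      bound : ∀ {x₁ x₂ x₃ x₄ x₅ x₆} → x₁ < J → x₂ < J → x₃ < J → x₄ < J → x₅ < J → x₆ < J → x₁ + (x₂ + x₃) + (x₄ + (x₅ + x₆)) < 11 * J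
      bound {x₁} {x₂} {x₃} {x₄} {x₅} {x₆} a b c d e f =
        <-≤-trans (+-mono-< (≤-<-trans (≤-reflexive (sym (+-assoc x₁ x₂ x₃))) (below-3J a b c)) (≤-<-trans (≤-reflexive (sym (+-assoc x₄ x₅ x₆))) (below-3J d e f)))
        (≤-trans (≤-reflexive (sym (*-distribʳ-+ J 3 3))) (*-monoˡ-≤ J (m≤m+n 6 5)))

    rank-parity : ∀ {t} (A : Node t) → let module B = Node (up A) in Node.s A ℤ.+ ℤ.+ p (west B.τ) B.π ≡ B.w ℤ.+ ℤ.+ 4 ℤ.* j
    rank-parity A = let (π≡ , c≡) , _ = long-digits A in trans (cong₂ (λ c π → s ℤ.+ ℤ.+ p c π) c≡ π≡) (sym w↑≡)
      where open Node A

    -- The `short` bars below and above one `wide` bar are displaced against it by the same amount,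
    -- so the displacements cancel and the rise is exact.
    rise : ∀ {t} (A : Node t) → Node.s (up A) ≡ Node.s A ℤ.+ ℤ.+ 6 ℤ.* j
    rise A = linear B.s (s ℤ.+ ℤ.+ 6 ℤ.* j)
      (trans (cong₂ (λ c π → B.s ℤ.+ ℤ.+ p c π) (sym (proj₂ (proj₁ (short-digits (up A))))) (sym (proj₁ (proj₁ (short-digits (up A)))))) B.s≡ ⊞ sym (rank-parity A))
      (lem B.s s B.w j (ℤ.+ p (west B.τ) B.π))
      where
      open Node A
      module B = Node (up A)
      lem : ∀ s↑ s w j p → s↑ ℤ.+ (w ℤ.+ ℤ.+ 10 ℤ.* j ℤ.+ (s ℤ.+ p)) ≡ s ℤ.+ ℤ.+ 6 ℤ.* j ℤ.+ (s↑ ℤ.+ p ℤ.+ (w ℤ.+ ℤ.+ 4 ℤ.* j))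
      lem = ℤ-Solver.solve-∀

    spacing : ∀ {t} (A B : Node t) → Linked A B → let module A′ = Node (up A) in let module B′ = Node (up B) in
      Node.s B ℤ.+ (ℤ.+ p (west B′.τ) B′.π ℤ.+ ℤ.+ u A′.υ A′.ρ) ≡ Node.s A ℤ.+ ℤ.+ 18 ℤ.* j ℤ.+ (ℤ.+ u A′.τ A′.π ℤ.+ ℤ.+ p (east A′.υ) A′.ρ)
    spacing A B link = linear (Node.s B ℤ.+ (ℤ.+ p (west B′.τ) B′.π ℤ.+ ℤ.+ u A′.υ A′.ρ)) (Node.s A ℤ.+ ℤ.+ 18 ℤ.* j ℤ.+ g)
      (trans (rank-parity B) (cong (ℤ._+ ℤ.+ 4 ℤ.* j) (linked-up A B link)) ⊞ middle)
      (lem (Node.s A) (Node.s B) A′.w⁺ j (ℤ.+ p (west B′.τ) B′.π) (ℤ.+ u A′.υ A′.ρ) g)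
      where
      module A′ = Node (up A)
      module B′ = Node (up B)
      g = ℤ.+ u A′.τ A′.π ℤ.+ ℤ.+ p (east A′.υ) A′.ρ
      lem₁ : ∀ s w w⁺ j p u g → w⁺ ℤ.+ u ℤ.+ (s ℤ.+ p ℤ.+ (w ℤ.+ ℤ.+ 18 ℤ.* j ℤ.+ g)) ≡ s ℤ.+ ℤ.+ 14 ℤ.* j ℤ.+ g ℤ.+ (w ℤ.+ ℤ.+ 4 ℤ.* j ℤ.+ (w⁺ ℤ.+ (u ℤ.+ p)))
      lem₁ = ℤ-Solver.solve-∀
      middle : A′.w⁺ ℤ.+ ℤ.+ u A′.υ A′.ρ ≡ Node.s A ℤ.+ ℤ.+ 14 ℤ.* j ℤ.+ g
      middle = linear (A′.w⁺ ℤ.+ ℤ.+ u A′.υ A′.ρ) (Node.s A ℤ.+ ℤ.+ 14 ℤ.* j ℤ.+ g) (sym (rank-parity A) ⊞ step-right (up A))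
        (lem₁ (Node.s A) A′.w A′.w⁺ j (ℤ.+ p (west A′.τ) A′.π) (ℤ.+ u A′.υ A′.ρ) g)
      lem : ∀ sA sB w⁺ j p u g → sB ℤ.+ (p ℤ.+ u) ℤ.+ (w⁺ ℤ.+ ℤ.+ 4 ℤ.* j ℤ.+ (sA ℤ.+ ℤ.+ 14 ℤ.* j ℤ.+ g)) ≡
                                 sA ℤ.+ ℤ.+ 18 ℤ.* j ℤ.+ g ℤ.+ (sB ℤ.+ p ℤ.+ (w⁺ ℤ.+ u))
      lem = ℤ-Solver.solve-∀

    -- The spacing of a column is the same in the next row, where the parity is the opposite one.
    east-matches : ∀ {t} (A B : Node t) → Linked A B → east (Node.τ (up A)) ≡ west (Node.τ (up B))
    east-matches {t} A B link = go (four-injective A′.π A′.ρ A″.ρ B′.π B″.π A″.π (parity-alternates (up A))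
        (proj₁ (proj₂ (sides A′.goodυ))) (proj₁ (proj₁ (sides B′.good))) (proj₁ (proj₂ (sides A″.goodυ))) (proj₁ (proj₁ (sides B″.good)))
        A′.good A′.goodυ A″.good A″.goodυ
        (ℤₚ.+-injective (linear (x₁ ℤ.+ x₂ ℤ.+ (x₃ ℤ.+ x₄)) (y₁ ℤ.+ y₂ ℤ.+ (y₃ ℤ.+ y₄))
          (sym (spacing A B link) ⊞ spacing (up A) (up B) (linked-up A B link) ⊞ rise A ⊞ sym (rise B))
          (lem (Node.s A) (Node.s B) A′.s B′.s j (x₁ ℤ.+ x₂) (x₃ ℤ.+ x₄) (y₁ ℤ.+ y₂) (y₃ ℤ.+ y₄)))))
      where
      module A′ = Node (up A)
      module B′ = Node (up B)
      module A″ = Node (up (up A))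
      module B″ = Node (up (up B))
      x₁ = ℤ.+ u A′.τ A′.π
      x₂ = ℤ.+ p (east A′.υ) A′.ρ
      x₃ = ℤ.+ p (west B″.τ) B″.π
      x₄ = ℤ.+ u A″.υ A″.ρ
      y₁ = ℤ.+ p (west B′.τ) B′.π
      y₂ = ℤ.+ u A′.υ A′.ρ
      y₃ = ℤ.+ u A″.τ A″.π
      y₄ = ℤ.+ p (east A″.υ) A″.ρ
      lem : ∀ sA sB sA′ sB′ j x x′ y y′ → x ℤ.+ x′ ℤ.+ (sB ℤ.+ y ℤ.+ (sA′ ℤ.+ ℤ.+ 18 ℤ.* j ℤ.+ y′) ℤ.+ (sA ℤ.+ ℤ.+ 6 ℤ.* j) ℤ.+ sB′) ≡
                                          y ℤ.+ y′ ℤ.+ (sA ℤ.+ ℤ.+ 18 ℤ.* j ℤ.+ x ℤ.+ (sB′ ℤ.+ x′) ℤ.+ sA′ ℤ.+ (sB ℤ.+ ℤ.+ 6 ℤ.* j))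
      lem = ℤ-Solver.solve-∀
      go : (A′.ρ ≡ A′.π × A′.τ ≡ A′.υ) × east A′.υ ≡ west B′.τ → east A′.τ ≡ west B′.τ
      go ((_ , e) , f) = trans (cong east e) f

    -- A row of fillers cannot continue upwards: the mark 5 of `fillᵘ` is never joined to the mark 5
    -- of `fillʷ`. So a `wide` or `narrow` bar lies above, and above that a `short` one.
    short-exists : ∃ λ s → ∃ λ t → Starts short s t
    short-exists = go₀ (find ℤ.0ℤ 0)
      where
      aboveNarrow : ∀ {w t} → Starts narrow w t → ∃ λ s → ∃ λ t → Starts short s t
      aboveNarrow st = let s , st′ , _ = short-above-narrow st in s , _ , st′
      aboveWide : ∀ {w t} → Starts wide w t → ∃ λ s → ∃ λ t → Starts short s t
      aboveWide st = let s , st′ , _ = short-above-wide st in s , _ , st′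
      aboveFill : ∀ {x t k k′} → UW k k′ → k ≡ 5 → Over 1 k′ t x → ∃ λ s → ∃ λ t → Starts short s t
      aboveFill _ _ (over (found wide w v v< x≡ bar! _) refl mark) = aboveWide bar!
      aboveFill _ _ (over (found narrow w v v< x≡ bar! _) refl mark) = aboveNarrow bar!
      aboveFill {k′ = k′} pair refl (over (found fillʷ w v v< x≡ bar! _) refl mark) =
        contradiction (subst (UW 5) (trans (sym mark) (mark-unique (bottom-marked fillʷ v) (here refl))) pair) λ ()
      fromU : ∀ {t x} (f : Found t x) → bottomClass (Found.n f) ≡ 3 → ∃ λ s → ∃ λ t → Starts short s t
      fromU (found short X v v< x≡ bar! _) refl = X , _ , bar!
      fromU (found long X v v< x≡ bar! _) refl = aboveNarrow (proj₁ (proj₂ (narrow-above bar!)))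
      fromU f@(found fillᵘ X v v< x≡ bar! _) refl =
        let _ , pair , o = above-uw {k = 5} (trans (top-found f) (cong (4 *_) (mark-unique (top-marked fillᵘ v) (here refl)))) in aboveFill pair refl o
      fromWU : ∀ {t x} (f : Found t x) → topClass (Found.n f) ≡ 3 → ∃ λ s → ∃ λ t → Starts short s t
      fromWU f c = let o = above {c = 3} {k = topCode (Found.n f) (Found.v f)} ≤-refl (trans (top-found f) (cong (_+ 4 * topCode (Found.n f) (Found.v f)) c)) in fromU (Over.place! o) (Over.class o)
      fromW : ∀ {t x} (f : Found t x) → topClass (Found.n f) ≡ 2 → ∃ λ s → ∃ λ t → Starts short s t
      fromW f c = let _ , _ , o = above-wu {k = topCode (Found.n f) (Found.v f)} (trans (top-found f) (cong (_+ 4 * topCode (Found.n f) (Found.v f)) c)) in fromU (Over.place! o) (Over.class o)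
      fromUW : ∀ {t x} (f : Found t x) → topClass (Found.n f) ≡ 1 → ∃ λ s → ∃ λ t → Starts short s t
      fromUW f c with above {c = 1} {k = topCode (Found.n f) (Found.v f)} (s≤s (s≤s z≤n)) (trans (top-found f) (cong (_+ 4 * topCode (Found.n f) (Found.v f)) c))
      ... | over f@(found wide X v v< x≡ bar! _) class _ = fromW f refl
      ... | over f@(found narrow X v v< x≡ bar! _) class _ = fromW f refl
      ... | over f@(found fillʷ X v v< x≡ bar! _) class _ = fromW f refl
      go₀ : Found 0 ℤ.0ℤ → ∃ λ s → ∃ λ t → Starts short s t
      go₀ f@(found short _ _ _ _ _ _) = fromU f refl
      go₀ f@(found long _ _ _ _ _ _) = fromU f refl
      go₀ f@(found fillᵘ _ _ _ _ _ _) = fromU f refl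
      go₀ f@(found wide _ _ _ _ _ _) = fromW f refl
      go₀ f@(found narrow _ _ _ _ _ _) = fromW f refl
      go₀ f@(found fillʷ _ _ _ _ _ _) = fromW f refl
      go₀ f@(found (uw _ _) _ _ _ _ _ _) = fromUW f refl
      go₀ f@(found (wu _ _) _ _ _ _ _ _) = fromWU f refl

    linked-right : ∀ {t} (A : Node t) → Linked A (right A)
    linked-right A = refl

    -- `east-matches` compares a row with its neighbours through the rise into it, so tiles are read
    -- one row above their node.
    upper-quad : ∀ {t} → Node t → Quad
    upper-quad A = Node.τ (up A)

    upper-good : ∀ {t} (A : Node t) → Good (upper-quad A)
    upper-good A = Node.good (up A)

    upper-south-matches : ∀ {t} (A : Node t) → north (upper-quad A) ≡ south (upper-quad (up A))
    upper-south-matches A = south-matches (up A)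

    origin : ∃ λ t → Node t
    origin = _ , node (proj₁ (proj₂ (wide-above (proj₂ (proj₂ short-exists)))))

    quads : ∃ λ (quad : ℕ → ℕ → Quad) → (∀ x y → Good (quad x y)) × (∀ x y → east (quad x y) ≡ west (quad (suc x) y)) × (∀ x y → north (quad x y) ≡ south (quad x (suc y)))
    quads = lattice {Node} Good up right Linked linked-right linked-up upper-quad upper-good east-matches upper-south-matches (proj₂ origin)

-- A tiling by the bars from a plane of Wang tiles

module BarTilings where

  open import Defs
  open Codes using (radix-unique)
  open Bars
  open Quadrants using (linear)
  open import Data.Bool using (Bool; false; not)
  open import Data.Bool.Properties using (not-involutive)
  open import Data.Empty using (⊥; ⊥-elim)
  open import Data.Fin as Fin using (Fin; zero; suc; toℕ; fromℕ<)
  open import Data.Fin.Properties using (toℕ-fromℕ<)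
  open import Data.Integer as ℤ using (ℤ)
  import Data.Integer.DivMod as ℤ÷
  import Data.Integer.Properties as ℤₚ
  import Data.Integer.Tactic.RingSolver as ℤ-Solver
  open import Data.List as List using (List; []; _∷_; replicate; _++_)
  open import Data.List.Relation.Unary.All as All using (All; []; _∷_)
  open import Data.List.Relation.Unary.All.Properties using (++⁺; replicate⁺)
  open import Data.Nat
  open import Data.Nat.Properties
  open import Data.Nat.Tactic.RingSolver using (solve-∀)
  open import Data.Product using (∃; _×_; _,_; proj₁; proj₂)
  open import Data.Sum using (_⊎_; inj₁; inj₂)
  open import Data.Unit using (tt)
  open import Data.Vec as Vec using (lookup)
  open import Data.Vec.Properties using (lookup-map; lookup∘tabulate)
  open import Relation.Binary.PropositionalEquality hiding ([_]; J)
  open import Relation.Nullary using (¬_; yes; no; contradiction)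

  linearℕ : ∀ {a b} x y → a ≡ b → x + b ≡ y + a → x ≡ y
  linearℕ {a} x y refl e = +-cancelʳ-≡ a x y e

  linear< : ∀ {a b} x y k → a < b → x + b + k ≡ y + a → x < y
  linear< {a} {b} x y k a<b e = +-cancelʳ-< b x y (≤-<-trans (m≤m+n (x + b) k) (≤-<-trans (≤-reflexive e) (+-monoʳ-< y a<b)))

  divide : ∀ d .⦃ _ : NonZero d ⦄ z → z ≡ ℤ.+ (z ℤ÷.%ℕ d) ℤ.+ (z ℤ÷./ℕ d) ℤ.* ℤ.+ d
  divide d z = ℤ÷.a≡a%ℕn+[a/ℕn]*n z d

  -- Adding the absolute values of both quotients makes them natural numbers, where `radix-unique`
  -- applies.
  quotient-unique : ∀ d {r r′} X X′ → r < d → r′ < d → ℤ.+ r ℤ.+ X ℤ.* ℤ.+ d ≡ ℤ.+ r′ ℤ.+ X′ ℤ.* ℤ.+ d → r ≡ r′ × X ≡ X′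
  quotient-unique d {r} {r′} X X′ r< r′< eq = proj₁ digits , linear X X′ (trans (proj₂ m) (trans (cong ℤ.+_ (proj₂ digits)) (sym (proj₂ m′)))) (cancel X X′ s)
    where
    s = ℤ.+ (ℤ.∣ X ∣ + ℤ.∣ X′ ∣)
    cancel : ∀ x y s → x ℤ.+ (y ℤ.+ s) ≡ y ℤ.+ (x ℤ.+ s)
    cancel = ℤ-Solver.solve-∀
    lift : ∀ w k → ∃ λ m → w ℤ.+ ℤ.+ (ℤ.∣ w ∣ + k) ≡ ℤ.+ m
    lift (ℤ.+ n) k = _ , refl
    lift ℤ.-[1+ n ] k = k , lem (ℤ.+ suc n) (ℤ.+ k)
      where
      lem : ∀ a k → ℤ.- a ℤ.+ (a ℤ.+ k) ≡ k
      lem = ℤ-Solver.solve-∀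
    m = lift X ℤ.∣ X′ ∣
    m′ = subst (λ k → ∃ λ m → X′ ℤ.+ ℤ.+ k ≡ ℤ.+ m) (+-comm ℤ.∣ X′ ∣ ℤ.∣ X ∣) (lift X′ ℤ.∣ X ∣)
    natural : ∀ r w (m : ∃ λ m → w ℤ.+ s ≡ ℤ.+ m) → ℤ.+ (r + d * proj₁ m) ≡ ℤ.+ r ℤ.+ w ℤ.* ℤ.+ d ℤ.+ s ℤ.* ℤ.+ d
    natural r w (m , e) = trans (cong (λ z → ℤ.+ r ℤ.+ z) (trans (ℤₚ.pos-* d m) (cong (λ z → ℤ.+ d ℤ.* z) (sym e)))) (lem (ℤ.+ r) (ℤ.+ d) w s)
      where
      lem : ∀ r d w s → r ℤ.+ d ℤ.* (w ℤ.+ s) ≡ r ℤ.+ w ℤ.* d ℤ.+ s ℤ.* d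
      lem = ℤ-Solver.solve-∀
    digits = radix-unique d (proj₁ m) (proj₁ m′) r< r′< (ℤₚ.+-injective (trans (natural r X m) (trans (cong (ℤ._+ s ℤ.* ℤ.+ d) eq) (sym (natural r′ X′ m′)))))

  remainder-step : ∀ d .⦃ _ : NonZero d ⦄ z (A : ℤ → ℕ → Set) → (∀ {r} → suc r < d → r ≡ z ℤ÷.%ℕ d → A (z ℤ÷./ℕ d) (suc r)) →
    (suc (z ℤ÷.%ℕ d) ≡ d → A (z ℤ÷./ℕ d ℤ.+ ℤ.1ℤ) 0) → A ((z ℤ.+ ℤ.1ℤ) ℤ÷./ℕ d) ((z ℤ.+ ℤ.1ℤ) ℤ÷.%ℕ d)
  remainder-step d z A inside wrap with m≤n⇒m<n∨m≡n (ℤ÷.n%ℕd<d z d)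
  ... | inj₁ lt = let r≡ , X≡ = quotient-unique d (z ℤ÷./ℕ d) ((z ℤ.+ ℤ.1ℤ) ℤ÷./ℕ d) lt (ℤ÷.n%ℕd<d (z ℤ.+ ℤ.1ℤ) d)
                                (trans (trans (lem (ℤ.+ (z ℤ÷.%ℕ d)) (z ℤ÷./ℕ d ℤ.* ℤ.+ d)) (cong (ℤ._+ ℤ.1ℤ) (sym (divide d z)))) (divide d (z ℤ.+ ℤ.1ℤ)))
                  in subst₂ A X≡ r≡ (inside lt refl)
    where
    lem : ∀ r x → ℤ.1ℤ ℤ.+ r ℤ.+ x ≡ r ℤ.+ x ℤ.+ ℤ.1ℤ
    lem = ℤ-Solver.solve-∀
  ... | inj₂ e = let r≡ , X≡ = quotient-unique d (z ℤ÷./ℕ d ℤ.+ ℤ.1ℤ) ((z ℤ.+ ℤ.1ℤ) ℤ÷./ℕ d) (subst (0 <_) e z<s) (ℤ÷.n%ℕd<d (z ℤ.+ ℤ.1ℤ) d)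
                                (trans (trans (lem (z ℤ÷./ℕ d) (ℤ.+ d)) (trans (cong (λ d′ → z ℤ÷./ℕ d ℤ.* ℤ.+ d ℤ.+ ℤ.+ d′) (sym e))
                                  (trans (lem′ (ℤ.+ (z ℤ÷.%ℕ d)) (z ℤ÷./ℕ d ℤ.* ℤ.+ d)) (cong (ℤ._+ ℤ.1ℤ) (sym (divide d z)))))) (divide d (z ℤ.+ ℤ.1ℤ)))
                  in subst₂ A X≡ r≡ (wrap e)
    where
    lem : ∀ X d → ℤ.0ℤ ℤ.+ (X ℤ.+ ℤ.1ℤ) ℤ.* d ≡ X ℤ.* d ℤ.+ d
    lem = ℤ-Solver.solve-∀
    lem′ : ∀ r x → x ℤ.+ (ℤ.1ℤ ℤ.+ r) ≡ r ℤ.+ x ℤ.+ ℤ.1ℤ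
    lem′ = ℤ-Solver.solve-∀

  odd : ℕ → Bool
  odd zero    = false
  odd (suc n) = not (odd n)

  oddℤ : ℤ → Bool
  oddℤ (ℤ.+ n)    = odd n
  oddℤ ℤ.-[1+ n ] = not (odd n)

  oddℤ-suc : ∀ y → not (oddℤ y) ≡ oddℤ (y ℤ.+ ℤ.1ℤ)
  oddℤ-suc (ℤ.+ n) = cong odd (+-comm 1 n)
  oddℤ-suc ℤ.-[1+ zero ] = refl
  oddℤ-suc ℤ.-[1+ suc n ] = cong not (not-involutive (odd n))

  Slot : Set
  Slot = Name × ℕ

  module Existence (marked : Marked) (separated : Separated (Marked.layout marked)) (H V : ℤ → ℤ → ℕ)
    (goods : ∀ x y → Layout.Good (Marked.layout marked) (quadruple (H x y) (V x y) (H (x ℤ.+ ℤ.1ℤ) y) (V x (y ℤ.+ ℤ.1ℤ)))) where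

    open Marked marked
    open Separated separated

    locate : Name → List Name → ℕ → Slot
    -- The default is the filler of the row, so every argument yields a unit slot of the right kind.
    locate d []       r = d , 0
    locate d (n ∷ ns) r with r <? size n
    ... | yes _ = n , r
    ... | no _  = locate d ns (r ∸ size n)

    total : List Name → ℕ
    total []       = 0
    total (n ∷ ns) = size n + total ns

    locate-here : ∀ d n ns r → r < size n → locate d (n ∷ ns) r ≡ (n , r)
    locate-here d n ns r r< with r <? size n
    ... | yes _ = refl
    ... | no ≥  = contradiction r< ≥

    locate-there : ∀ d n ns r → locate d (n ∷ ns) (size n + r) ≡ locate d ns r
    locate-there d n ns r with size n + r <? size n
    ... | yes <n = contradiction <n (≤⇒≯ (m≤m+n (size n) r))
    ... | no _   = cong (locate d ns) (m+n∸m≡n (size n) r)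

    locate-inside : ∀ d n ns k r → size n ≡ 1 → r < k → locate d (replicate k n ++ ns) r ≡ (n , 0)
    locate-inside d n ns (suc k) zero s _ = locate-here d n _ 0 (size>0 n)
    locate-inside d n ns (suc k) (suc r) s (s≤s r<) = trans (cong (λ i → locate d (n ∷ replicate k n ++ ns) (i + r)) (sym s)) (trans (locate-there d n _ r) (locate-inside d n ns k r s r<))

    locate-beyond : ∀ d n ns k r → size n ≡ 1 → locate d (replicate k n ++ ns) (k + r) ≡ locate d ns r
    locate-beyond d n ns zero r s = refl
    locate-beyond d n ns (suc k) r s = trans (cong (λ i → locate d (n ∷ replicate k n ++ ns) (i + (k + r))) (sym s)) (trans (locate-there d n _ (k + r)) (locate-beyond d n ns k r s))

    locate-zero : ∀ d ns → proj₂ (locate d ns 0) ≡ 0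
    locate-zero d [] = refl
    locate-zero d (n ∷ ns) = cong proj₂ (locate-here d n ns 0 (size>0 n))

    locate-all : ∀ {A : Name → Set} d ns r → A d → All A ns → A (proj₁ (locate d ns r))
    locate-all d [] r a _ = a
    locate-all d (n ∷ ns) r a (x ∷ xs) with r <? size n
    ... | yes _ = x
    ... | no _  = locate-all d ns _ a xs

    Valid : Slot → Set
    Valid (n , v) = v < size n

    locate-valid : ∀ d ns r → Valid (locate d ns r)
    locate-valid d [] r = size>0 d
    locate-valid d (n ∷ ns) r with r <? size n
    ... | yes r< = r<
    ... | no _   = locate-valid d ns _

    Next : Slot → Slot → Set
    Next (n , v) (n′ , v′) = (suc v ≡ size n × v′ ≡ 0) ⊎ (suc v < size n × n′ ≡ n × v′ ≡ suc v)

    locate-next : ∀ d ns r → suc r < total ns → Next (locate d ns r) (locate d ns (suc r))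
    locate-next d (n ∷ ns) r lt with r <? size n
    ... | yes r< with m≤n⇒m<n∨m≡n r<
    ...   | inj₁ sr< rewrite locate-here d n ns (suc r) sr< = inj₂ (sr< , refl , refl)
    ...   | inj₂ e = inj₁ (e , trans (cong (λ r → proj₂ (locate d (n ∷ ns) r)) (trans e (sym (+-identityʳ (size n))))) (trans (cong proj₂ (locate-there d n ns 0)) (locate-zero d ns)))
    locate-next d (n ∷ ns) r lt | no ≥ = subst (Next (locate d ns (r ∸ size n))) (trans (sym (locate-there d n ns (suc (r ∸ size n))))
        (cong (locate d (n ∷ ns)) (trans (+-suc (size n) (r ∸ size n)) (cong suc (m+[n∸m]≡n (≮⇒≥ ≥))))))
      (locate-next d ns (r ∸ size n) (+-cancelˡ-< (size n) _ _ (subst (_< size n + total ns) (sym (trans (+-suc (size n) (r ∸ size n)) (cong suc (m+[n∸m]≡n (≮⇒≥ ≥))))) lt)))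

    locate-last : ∀ d ns r → suc r ≡ total ns → suc (proj₂ (locate d ns r)) ≡ size (proj₁ (locate d ns r))
    locate-last d (n ∷ ns) r e with r <? size n
    ... | yes r< = ≤-antisym r< (≤-trans (m≤m+n (size n) (total ns)) (≤-reflexive (sym e)))
    ... | no ≥  = locate-last d ns (r ∸ size n) (+-cancelˡ-≡ (size n) _ _ (trans (trans (+-suc (size n) (r ∸ size n)) (cong suc (m+[n∸m]≡n (≮⇒≥ ≥)))) e))

    total-++ : ∀ xs ys → total (xs ++ ys) ≡ total xs + total ys
    total-++ [] ys = refl
    total-++ (x ∷ xs) ys = trans (cong (size x +_) (total-++ xs ys)) (sym (+-assoc (size x) (total xs) (total ys)))

    total-replicate : ∀ k n → size n ≡ 1 → total (replicate k n) ≡ k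
    total-replicate zero n s = refl
    total-replicate (suc k) n s = cong₂ _+_ s (total-replicate k n s)

    quad : ℤ → ℤ → Quad
    quad X Y = quadruple (H X Y) (V X Y) (H (X ℤ.+ ℤ.1ℤ) Y) (V X (Y ℤ.+ ℤ.1ℤ))

    module _ (X Y : ℤ) where

      p! u! q! : ℕ
      p! = p (H X Y) (oddℤ Y)
      u! = u (quad X Y) (oddℤ Y)
      q! = q (V X (Y ℤ.+ ℤ.1ℤ)) (not (oddℤ Y))

      p!< : p! < J
      p!< = p<J (oddℤ Y) (proj₁ (proj₁ (sides (goods X Y))))
      u!< : u! < J
      u!< = u<J (oddℤ Y) (goods X Y)
      q!< : q! < J
      q!< = q<J (not (oddℤ Y)) (proj₂ (proj₂ (sides (goods X Y))))

      -- One period of a row, belonging to the tile at X and Y. The fillers absorb the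
      -- displacements, so every period has length 18 J.
      uRow wRow : List Name
      uRow = short ∷ replicate (J + u!) fillᵘ ++ long ∷ replicate (J ∸ u!) fillᵘ
      wRow = replicate p! fillʷ ++ wide ∷ replicate (J ∸ p! + q!) fillʷ ++ narrow ∷ replicate (J ∸ q!) fillʷ

      total-uRow : total uRow ≡ 18 * J
      total-uRow = begin
        4 * J + total (replicate (J + u!) fillᵘ ++ long ∷ replicate (J ∸ u!) fillᵘ)
          ≡⟨ cong (4 * J +_) (trans (total-++ (replicate (J + u!) fillᵘ) (long ∷ replicate (J ∸ u!) fillᵘ))
               (cong₂ (λ a b → a + (12 * J + b)) (total-replicate (J + u!) fillᵘ refl) (total-replicate (J ∸ u!) fillᵘ refl))) ⟩
        4 * J + (J + u! + (12 * J + (J ∸ u!)))   ≡⟨ lem J u! (J ∸ u!) ⟩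
        17 * J + (u! + (J ∸ u!))                 ≡⟨ cong (17 * J +_) (m+[n∸m]≡n (<⇒≤ u!<)) ⟩
        17 * J + J                               ≡⟨ +-comm (17 * J) J ⟩
        18 * J                                   ∎
        where
        open ≡-Reasoning
        lem : ∀ J u v → 4 * J + (J + u + (12 * J + v)) ≡ 17 * J + (u + v)
        lem = solve-∀

      total-wRow : total wRow ≡ 18 * J
      total-wRow = begin
        total wRow
          ≡⟨ trans (total-++ (replicate p! fillʷ) _) (cong₂ (λ a b → a + (11 * J + b)) (total-replicate p! fillʷ refl)
               (trans (total-++ (replicate (J ∸ p! + q!) fillʷ) _) (cong₂ (λ a b → a + (5 * J + b)) (total-replicate (J ∸ p! + q!) fillʷ refl) (total-replicate (J ∸ q!) fillʷ refl)))) ⟩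
        p! + (11 * J + (J ∸ p! + q! + (5 * J + (J ∸ q!))))   ≡⟨ lem J p! (J ∸ p!) q! (J ∸ q!) ⟩
        16 * J + (p! + (J ∸ p!)) + (q! + (J ∸ q!))           ≡⟨ cong₂ (λ a b → 16 * J + a + b) (m+[n∸m]≡n (<⇒≤ p!<)) (m+[n∸m]≡n (<⇒≤ q!<)) ⟩
        16 * J + J + J                                       ≡⟨ lem′ J ⟩
        18 * J                                               ∎
        where
        open ≡-Reasoning
        lem : ∀ J p p′ q q′ → p + (11 * J + (p′ + q + (5 * J + q′))) ≡ 16 * J + (p + p′) + (q + q′)
        lem = solve-∀
        lem′ : ∀ J → 16 * J + J + J ≡ 18 * J
        lem′ = solve-∀

      uSlot wSlot : ℕ → Slot
      uSlot = locate fillᵘ uRow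
      wSlot = locate fillʷ wRow

      data UView (r : ℕ) : Slot → Set where
        in-short : r < 4 * J → UView r (short , r)
        gap      : ∀ r₁ → r ≡ 4 * J + r₁ → r₁ < J + u! → UView r (fillᵘ , 0)
        in-long  : ∀ v → r ≡ 4 * J + (J + u! + v) → v < 12 * J → UView r (long , v)
        end      : ∀ r₃ → r ≡ 4 * J + (J + u! + (12 * J + r₃)) → UView r (fillᵘ , 0)

      data WView (r : ℕ) : Slot → Set where
        start     : WView r (fillʷ , 0)
        in-wide   : ∀ v → r ≡ p! + v → v < 11 * J → WView r (wide , v)
        middle    : WView r (fillʷ , 0)
        in-narrow : ∀ v → r ≡ 12 * J + q! + v → v < 5 * J → WView r (narrow , v)

      split : ∀ k r → r < k ⊎ ∃ λ r′ → r ≡ k + r′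
      split k r with r <? k
      ... | yes r< = inj₁ r<
      ... | no r≥  = inj₂ (r ∸ k , sym (m+[n∸m]≡n (≮⇒≥ r≥)))

      u-long : ∀ v → v < 12 * J → uSlot (4 * J + (J + u! + v)) ≡ (long , v)
      u-long v v< = trans (locate-there fillᵘ short _ (J + u! + v)) (trans (locate-beyond fillᵘ fillᵘ _ (J + u!) v refl) (locate-here fillᵘ long _ v v<))

      u-short : ∀ v → v < 4 * J → uSlot v ≡ (short , v)
      u-short v v< = locate-here fillᵘ short _ v v<

      uView : ∀ r → UView r (uSlot r)
      uView r with split (4 * J) r
      ... | inj₁ r< = subst (UView r) (sym (u-short r r<)) (in-short r<)
      ... | inj₂ (r₁ , e₁) with split (J + u!) r₁
      ...   | inj₁ r₁< = subst (UView r) (sym (trans (cong uSlot e₁) (trans (locate-there fillᵘ short _ r₁) (locate-inside fillᵘ fillᵘ _ (J + u!) r₁ refl r₁<)))) (gap r₁ e₁ r₁<)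
      ...   | inj₂ (r₂ , e₂) with split (12 * J) r₂
      ...     | inj₁ r₂< = subst (UView r) (sym (trans (cong uSlot e) (u-long r₂ r₂<))) (in-long r₂ e r₂<)
        where e = trans e₁ (cong (4 * J +_) e₂)
      ...     | inj₂ (r₃ , e₃) = subst (UView r) (sym (trans (cong uSlot e) (trans (locate-there fillᵘ short _ (J + u! + (12 * J + r₃))) (trans (locate-beyond fillᵘ fillᵘ _ (J + u!) (12 * J + r₃) refl)
                                   (trans (locate-there fillᵘ long (replicate (J ∸ u!) fillᵘ) r₃) (fills (J ∸ u!) r₃)))))) (end r₃ e)
        where
        e = trans e₁ (cong (4 * J +_) (trans e₂ (cong (J + u! +_) e₃)))
        fills : ∀ k r → locate fillᵘ (replicate k fillᵘ) r ≡ (fillᵘ , 0)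
        fills zero r = refl
        fills (suc k) zero = refl
        fills (suc k) (suc r) = fills k r

      w-wide : ∀ v → v < 11 * J → wSlot (p! + v) ≡ (wide , v)
      w-wide v v< = trans (locate-beyond fillʷ fillʷ _ p! v refl) (locate-here fillʷ wide _ v v<)

      w-after-wide : ∀ r → wSlot (p! + (11 * J + r)) ≡ locate fillʷ (replicate (J ∸ p! + q!) fillʷ ++ narrow ∷ replicate (J ∸ q!) fillʷ) r
      w-after-wide r = trans (locate-beyond fillʷ fillʷ _ p! (11 * J + r) refl) (locate-there fillʷ wide _ r)

      narrow-offset : ∀ v → 12 * J + q! + v ≡ p! + (11 * J + (J ∸ p! + q! + v))
      narrow-offset v = trans (lem₀ J q! v) (trans (cong (λ i → 11 * J + i + (q! + v)) (sym (m+[n∸m]≡n (<⇒≤ p!<)))) (lem J p! (J ∸ p!) q! v))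
        where
        lem₀ : ∀ J q v → 12 * J + q + v ≡ 11 * J + J + (q + v)
        lem₀ = solve-∀
        lem : ∀ J p p′ q v → 11 * J + (p + p′) + (q + v) ≡ p + (11 * J + (p′ + q + v))
        lem = solve-∀

      w-narrow : ∀ v → v < 5 * J → wSlot (12 * J + q! + v) ≡ (narrow , v)
      w-narrow v v< = trans (cong wSlot (narrow-offset v)) (trans (w-after-wide (J ∸ p! + q! + v)) (trans (locate-beyond fillʷ fillʷ _ (J ∸ p! + q!) v refl) (locate-here fillʷ narrow _ v v<)))

      wView : ∀ r → WView r (wSlot r)
      wView r with split p! r
      ... | inj₁ r< = subst (WView r) (sym (locate-inside fillʷ fillʷ _ p! r refl r<)) start
      ... | inj₂ (r₁ , e₁) with split (11 * J) r₁
      ...   | inj₁ r₁< = subst (WView r) (sym (trans (cong wSlot e₁) (w-wide r₁ r₁<))) (in-wide r₁ e₁ r₁<)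
      ...   | inj₂ (r₂ , e₂) with split (J ∸ p! + q!) r₂
      ...     | inj₁ r₂< = subst (WView r) (sym (trans (cong wSlot (trans e₁ (cong (p! +_) e₂))) (trans (w-after-wide r₂) (locate-inside fillʷ fillʷ _ (J ∸ p! + q!) r₂ refl r₂<)))) middle
      ...     | inj₂ (r₃ , e₃) with split (5 * J) r₃
      ...       | inj₁ r₃< = subst (WView r) (sym (trans (cong wSlot e) (w-narrow r₃ r₃<))) (in-narrow r₃ e r₃<)
        where e = trans e₁ (trans (cong (p! +_) (trans e₂ (cong (11 * J +_) e₃))) (sym (narrow-offset r₃)))
      ...       | inj₂ (r₄ , e₄) = subst (WView r) (sym (trans (cong wSlot e) (trans (w-after-wide (J ∸ p! + q! + (5 * J + r₄))) (trans (locate-beyond fillʷ fillʷ _ (J ∸ p! + q!) (5 * J + r₄) refl)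
                                   (trans (locate-there fillʷ narrow (replicate (J ∸ q!) fillʷ) r₄) (fills (J ∸ q!) r₄)))))) middle
        where
        e = trans e₁ (cong (p! +_) (trans e₂ (cong (11 * J +_) (trans e₃ (cong (J ∸ p! + q! +_) e₄)))))
        fills : ∀ k r → locate fillʷ (replicate k fillʷ) r ≡ (fillʷ , 0)
        fills zero r = refl
        fills (suc k) zero = refl
        fills (suc k) (suc r) = fills k r

    topC bottomC : Slot → ℕ
    topC (n , v)    = topCode n v
    bottomC (n , v) = bottomCode n v

    top-is : ∀ {n v c} → Mark (topMarks n v) c → topCode n v ≡ c
    top-is {n} {v} = mark-unique (top-marked n v)

    bottom-is : ∀ {n v c} → Mark (bottomMarks n v) c → bottomCode n v ≡ c
    bottom-is {n} {v} = mark-unique (bottom-marked n v)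

    -- Away from 10 J the lower mark of `wide` demands nothing, so it can stand above the marks 0
    -- and 5.
    wide-code : ∀ v {c} → v ≢ 10 * J → Mark (bottomMarks wide v) c → UW 0 c × UW 5 c
    wide-code v ne (here _) = ⟨0,1⟩ , ⟨5,1⟩
    wide-code v ne (there _ (here _)) = ⟨0,2⟩ , ⟨5,2⟩
    wide-code v ne (there _ (there _ (here e))) = contradiction e ne
    wide-code v ne (there _ (there _ (there _ none))) = ⟨0,0⟩ , ⟨5,0⟩

    uw≡ : ∀ {k k′ c c′} → k ≡ k′ → c ≡ c′ → UW k′ c′ → UW k c
    uw≡ refl refl x = x

    wu≡ : ∀ {k k′ c c′} → k ≡ k′ → c ≡ c′ → WU k′ c′ → WU k c
    wu≡ refl refl x = x

    narrow-code : ∀ v {c} → Mark (bottomMarks narrow v) c → UW 0 c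
    narrow-code v (here _) = ⟨0,3⟩
    narrow-code v (there _ none) = ⟨0,0⟩

    ≢-of-< : ∀ {v} k l → k ≤ l → v < k * J → v ≢ l * J
    ≢-of-< k l k≤l v< = <⇒≢ (<-≤-trans v< (*-monoˡ-≤ J k≤l))

    apart : ∀ {a b x y} k → a < b → x ≡ y → x + b + k ≡ y + a → ⊥
    apart {a} {b} {x} {y} k a<b x≡y e = <-irrefl x≡y (linear< x y k a<b e)

    two-tiles : ∀ {v} → (SomeTile λ τ π → v + u τ π ≡ J + p (west τ) π) → v < 2 * J
    two-tiles {v} (τ , π , good , e) = linear< v (2 * J) (u τ π) (p<J π (proj₁ (proj₁ (sides good))))
      (linearℕ (v + J + u τ π) (2 * J + p (west τ) π) e (id′ v (u τ π) J (p (west τ) π)))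
      where
      id′ : ∀ v u J p → v + J + u + (J + p) ≡ 2 * J + p + (v + u)
      id′ = solve-∀

    after-two-tiles : ∀ {v} → (SomeTile λ τ π → v + p (east τ) π ≡ J + u τ π) → v < 2 * J
    after-two-tiles {v} (τ , π , good , e) = linear< v (2 * J) (p (east τ) π) (u<J π good)
      (linearℕ (v + J + p (east τ) π) (2 * J + u τ π) e (id′ v (p (east τ) π) J (u τ π)))
      where
      id′ : ∀ v u J p → v + J + u + (J + p) ≡ 2 * J + p + (v + u)
      id′ = solve-∀

    remove : ∀ {k} r → k < J → J ≤ r → ∃ λ v → r ≡ k + v × v ≤ r
    remove {k} r k< J≤r = r ∸ k , sym (m+[n∸m]≡n (≤-trans (<⇒≤ k<) J≤r)) , m∸n≤m r k

    module _ (X Y : ℤ) where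

      private
        p₀ = p! X Y
        u₀ = u! X Y
        q₀ = q! X Y

      -- The w period of a tile begins 4 J to the left of its u period. Hence the first 14 J cells
      -- of a u period lie below the w period of the same tile; the last 4 J lie below that of its
      -- right neighbour.
      uw-left : ∀ r → r < 14 * J → UW (topC (uSlot X Y r)) (bottomC (wSlot X Y (4 * J + r)))
      uw-left r r<14 = go (uView X Y r)
        where
        wide-at : J ≤ 4 * J + r → ∃ λ v → 4 * J + r ≡ p₀ + v × v ≤ 4 * J + r
        wide-at = remove (4 * J + r) (p!< X Y)
        J≤ : J ≤ 4 * J + r
        J≤ = ≤-trans (m≤m+n J _) (m≤m+n (4 * J) r)
        go : ∀ {s} → UView X Y r s → UW (topC s) (bottomC (wSlot X Y (4 * J + r)))
        go (in-short r<) with wide-at J≤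
        ... | v , e , v≤ = uw≡ refl (cong bottomC (trans (cong (wSlot X Y) e) (w-wide X Y v (linear< v (11 * J) (3 * J) (≤-<-trans v≤ (+-monoʳ-< (4 * J) r<)) (lem J v))))) (marks (top-marked short r))
          where
          lem : ∀ J v → v + (4 * J + 4 * J) + 3 * J ≡ 11 * J + v
          lem = solve-∀
          v<8 : v < 8 * J
          v<8 = linear< v (8 * J) 0 (≤-<-trans v≤ (+-monoʳ-< (4 * J) r<)) (lem′ J v)
            where
            lem′ : ∀ J v → v + (4 * J + 4 * J) + 0 ≡ 8 * J + v
            lem′ = solve-∀
          marks : ∀ {c} → Mark (topMarks short r) c → UW c (bottomCode wide v)
          marks (here r≡) rewrite bottom-is {wide} {v} (here (H X Y , oddℤ Y , proj₁ (proj₁ (sides (goods X Y))) ,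
            trans (+-comm v p₀) (trans (sym e) (trans (cong (4 * J +_) r≡) (sym (*-distribʳ-+ J 4 3)))))) = ⟨1,1⟩
          marks (there _ none) = proj₁ (wide-code v (≢-of-< 8 10 (m≤m+n 8 2) v<8) (bottom-marked wide v))
        go (gap r₁ e₁ r₁<) with wide-at J≤
        ... | v , e , v≤ = uw≡ (top-is {fillᵘ} {0} (here refl))
            (cong bottomC (trans (cong (wSlot X Y) e) (w-wide X Y v (<-trans v<10 (*-monoˡ-< J ⦃ >-nonZero J>0 ⦄ {10} {11} ≤-refl)))))
            (proj₂ (wide-code v (≢-of-< 10 10 ≤-refl v<10) (bottom-marked wide v)))
          where
          v<10 : v < 10 * J
          v<10 = linear< v (10 * J) 0 (≤-<-trans v≤ (≤-<-trans (≤-reflexive (cong (4 * J +_) e₁)) (+-monoʳ-< (4 * J) (+-monoʳ-< (4 * J) (<-trans r₁< (+-monoʳ-< J (u!< X Y))))))) (lem J v)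
            where
            lem : ∀ J v → v + (4 * J + (4 * J + (J + J))) + 0 ≡ 10 * J + v
            lem = solve-∀
        go (end r₃ e) = ⊥-elim (apart (u₀ + r₃ + 3 * J) r<14 e (lem J r u₀ r₃))
          where
          lem : ∀ J r u r₃ → r + 14 * J + (u + r₃ + 3 * J) ≡ 4 * J + (J + u + (12 * J + r₃)) + r
          lem = solve-∀
        go (in-long v e v<) = marks (top-marked long v)
          where
          -- o states that the mark 4 of the lower bar would be demanded.
          zero-pair : ∀ {s} → WView X Y (4 * J + r) s → (v + u₀ ≡ J + p₀ → ⊥) → UW 0 (bottomC s)
          zero-pair start o rewrite bottom-is {fillʷ} {0} (here refl) = ⟨0,5⟩
          zero-pair middle o rewrite bottom-is {fillʷ} {0} (here refl) = ⟨0,5⟩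
          zero-pair (in-narrow v′ e′ _) o = narrow-code v′ (bottom-marked narrow v′)
          zero-pair (in-wide v′ e′ _) o = proj₁ (wide-code v′ (λ v′≡ → o (linearℕ (v + u₀) (J + p₀)
            (trans (cong (4 * J +_) (sym e)) (trans e′ (cong (p₀ +_) v′≡))) (lem J v u₀ p₀))) (bottom-marked wide v′))
            where
            lem : ∀ J v u p → v + u + (p + 10 * J) ≡ J + p + (4 * J + (4 * J + (J + u + v)))
            lem = solve-∀
          four-pair : ∀ {s} → WView X Y (4 * J + r) s → v < 2 * J → UW 4 (bottomC s)
          four-pair start o rewrite bottom-is {fillʷ} {0} (here refl) = ⟨4,5⟩
          four-pair middle o rewrite bottom-is {fillʷ} {0} (here refl) = ⟨4,5⟩
          four-pair (in-narrow v′ e′ _) v<2 = ⊥-elim (apart (q₀ + v′) (+-mono-< (u!< X Y) v<2) (trans (cong (4 * J +_) (sym e)) e′) (lem J q₀ v′ u₀ v))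
            where
            lem : ∀ J q v′ u v → 4 * J + (4 * J + (J + u + v)) + (J + 2 * J) + (q + v′) ≡ 12 * J + q + v′ + (u + v)
            lem = solve-∀
          four-pair (in-wide v′ e′ _) v<2 = inner (bottom-marked wide v′)
            where
            lem : ∀ J r p v′ → p + v′ + (J + 2 * J) + (J + r) ≡ 4 * J + r + (p + v′)
            lem = solve-∀
            inner : ∀ {c} → Mark (bottomMarks wide v′) c → UW 4 c
            inner (here _) = ⟨4,1⟩
            inner (there _ (here o)) = ⊥-elim (apart (J + r) (+-mono-< (p!< X Y) (after-two-tiles o)) (sym e′) (lem J r p₀ v′))
            inner (there _ (there _ (here _))) = ⟨4,4⟩
            inner (there _ (there _ (there _ none))) = ⟨4,0⟩
          marks : ∀ {c} → Mark (topMarks long v) c → UW c (bottomC (wSlot X Y (4 * J + r)))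
          marks (here v≡) = ⊥-elim (apart (J + u₀) r<14 (trans e (cong (λ v → 4 * J + (J + u₀ + v)) v≡)) (lem J r u₀))
            where
            lem : ∀ J r u → r + 14 * J + (J + u) ≡ 4 * J + (J + u + 10 * J) + r
            lem = solve-∀
          marks (there _ (here v≡)) with remove (J + u₀) (q!< X Y) (m≤m+n J u₀)
          ... | v′ , e′ , v′≤ = uw≡ refl (trans (cong bottomC (trans (cong (wSlot X Y) at′) (w-narrow X Y v′ v′<5))) (bottom-is {narrow} {v′} (here (quad X Y , oddℤ Y , goods X Y , trans (+-comm v′ q₀) (sym e′))))) ⟨3,3⟩
            where
            lem : ∀ J u → 4 * J + (4 * J + (J + u + 4 * J)) ≡ 12 * J + (J + u)
            lem = solve-∀
            at′ : 4 * J + r ≡ 12 * J + q₀ + v′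
            at′ = trans (cong (4 * J +_) (trans e (cong (λ v → 4 * J + (J + u₀ + v)) v≡))) (trans (lem J u₀) (trans (cong (12 * J +_) e′) (sym (+-assoc (12 * J) q₀ v′))))
            v′<5 : v′ < 5 * J
            v′<5 = ≤-<-trans v′≤ (<-≤-trans (+-monoʳ-< J (u!< X Y)) (≤-trans (≤-reflexive (cong (J +_) (sym (+-identityʳ J)))) (*-monoˡ-≤ J {2} {5} (m≤m+n 2 3))))
          marks (there _ (there _ (here o))) = four-pair (wView X Y (4 * J + r)) (two-tiles o)
          marks (there _ (there _ (there absent none))) = zero-pair (wView X Y (4 * J + r)) (λ e → absent (quad X Y , oddℤ Y , goods X Y , e))

      private
        X₁ = X ℤ.+ ℤ.1ℤ
        p₁ = p! X₁ Y

      uw-right : ∀ r → r < 4 * J → UW (topC (uSlot X Y (14 * J + r))) (bottomC (wSlot X₁ Y r))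
      uw-right r r<4 = go (uView X Y (14 * J + r))
        where
        go : ∀ {s} → UView X Y (14 * J + r) s → UW (topC s) (bottomC (wSlot X₁ Y r))
        go (in-short r<) = contradiction r< (≤⇒≯ (≤-trans (*-monoˡ-≤ J {4} {14} (m≤m+n 4 10)) (m≤m+n (14 * J) r)))
        go (gap r₁ e r₁<) = ⊥-elim (apart (8 * J + r) (+-mono-< r₁< (u!< X Y)) (sym e) (lem J r r₁ u₀))
          where
          lem : ∀ J r r₁ u → 4 * J + r₁ + (J + u + J) + (8 * J + r) ≡ 14 * J + r + (r₁ + u)
          lem = solve-∀
        go (end r₃ e) = finish (remove r (p!< X₁ Y) (≤-trans (m≤m+n J (2 * J + u₀ + r₃)) (≤-reflexive (sym r≡))))
          where
          lem : ∀ J r u r₃ → r + (4 * J + (J + u + (12 * J + r₃))) ≡ J + (2 * J + u + r₃) + (14 * J + r)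
          lem = solve-∀
          r≡ : r ≡ J + (2 * J + u₀ + r₃)
          r≡ = linearℕ r (J + (2 * J + u₀ + r₃)) e (lem J r u₀ r₃)
          finish : (∃ λ v → r ≡ p₁ + v × v ≤ r) → UW (topCode fillᵘ 0) (bottomC (wSlot X₁ Y r))
          finish (v , e′ , v≤) = uw≡ (top-is {fillᵘ} {0} (here refl))
            (cong bottomC (trans (cong (wSlot X₁ Y) e′) (w-wide X₁ Y v (<-≤-trans (≤-<-trans v≤ r<4) (*-monoˡ-≤ J {4} {11} (m≤m+n 4 7))))))
            (proj₂ (wide-code v (≢-of-< 4 10 (m≤m+n 4 6) (≤-<-trans v≤ r<4)) (bottom-marked wide v)))
        go (in-long v e v<) = marks (top-marked long v)
          where
          zero-pair : ∀ {s} → WView X₁ Y r s → UW 0 (bottomC s)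
          zero-pair start rewrite bottom-is {fillʷ} {0} (here refl) = ⟨0,5⟩
          zero-pair middle rewrite bottom-is {fillʷ} {0} (here refl) = ⟨0,5⟩
          zero-pair (in-narrow v′ e′ _) = narrow-code v′ (bottom-marked narrow v′)
          zero-pair (in-wide v′ e′ _) = proj₁ (wide-code v′ (≢-of-< 4 10 (m≤m+n 4 6) (≤-<-trans (≤-trans (m≤n+m v′ p₁) (≤-reflexive (sym e′))) r<4)) (bottom-marked wide v′))
          marks : ∀ {c} → Mark (topMarks long v) c → UW c (bottomC (wSlot X₁ Y r))
          marks (here v≡) with remove (J + u₀) (p!< X₁ Y) (m≤m+n J u₀)
          ... | v′ , e′ , v′≤ = uw≡ refl (trans (cong bottomC (trans (cong (wSlot X₁ Y) (trans r≡ e′)) (w-wide X₁ Y v′ (<-≤-trans (≤-<-trans v′≤ (+-monoʳ-< J (u!< X Y))) (≤-trans (≤-reflexive (cong (J +_) (sym (+-identityʳ J)))) (*-monoˡ-≤ J {2} {11} (m≤m+n 2 9))))))) (bottom-is {wide} {v′} (there absent (here (quad X Y , oddℤ Y , goods X Y , trans (+-comm v′ p₁) (sym e′)))))) ⟨2,2⟩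
            where
            lem : ∀ J r u → r + (4 * J + (J + u + 10 * J)) ≡ J + u + (14 * J + r)
            lem = solve-∀
            r≡ : r ≡ J + u₀
            r≡ = linearℕ r (J + u₀) (trans e (cong (λ v → 4 * J + (J + u₀ + v)) v≡)) (lem J r u₀)
            lem′ : ∀ J v p → v + p + (J + J + J) + 4 * J ≡ 7 * J + (v + p)
            lem′ = solve-∀
            absent : ¬ SomeColour (λ c π → v′ + p c π ≡ 7 * J)
            absent (c , π , col , e) = apart (4 * J) (+-mono-< (≤-<-trans v′≤ (+-monoʳ-< J (u!< X Y))) (p<J π col)) e (lem′ J v′ (p c π))
          marks (there _ (here v≡)) = ⊥-elim (apart (4 * J + r) (u!< X Y) (sym (trans e (cong (λ v → 4 * J + (J + u₀ + v)) v≡))) (lem J r u₀))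
            where
            lem : ∀ J r u → 4 * J + (J + u + 4 * J) + J + (4 * J + r) ≡ 14 * J + r + u
            lem = solve-∀
          marks (there _ (there _ (here o))) = ⊥-elim (apart (6 * J + r) (+-mono-< (u!< X Y) (two-tiles o)) (sym e) (lem J r u₀ v))
            where
            lem : ∀ J r u v → 4 * J + (J + u + v) + (J + 2 * J) + (6 * J + r) ≡ 14 * J + r + (u + v)
            lem = solve-∀
          marks (there _ (there _ (there _ none))) = zero-pair (wView X₁ Y r)

    wu-zero : ∀ X Y r → WU 0 (bottomC (uSlot X Y r))
    wu-zero X Y r = go (uView X Y r)
      where
      go : ∀ {s} → UView X Y r s → WU 0 (bottomC s)
      go (in-short _) = marks (bottom-marked short r)
        where
        marks : ∀ {c} → Mark (bottomMarks short r) c → WU 0 c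
        marks (here _) = ⟨0,1⟩
        marks (there _ (here _)) = ⟨0,2⟩
        marks (there _ (there _ none)) = ⟨0,0⟩
      go (gap _ _ _) rewrite bottom-is {fillᵘ} {0} none = ⟨0,0⟩
      go (end _ _) rewrite bottom-is {fillᵘ} {0} none = ⟨0,0⟩
      go (in-long v _ _) = marks (bottom-marked long v)
        where
        marks : ∀ {c} → Mark (bottomMarks long v) c → WU 0 c
        marks (here _) = ⟨0,3⟩
        marks (there _ none) = ⟨0,0⟩

    -- All upper marks lie at least 10 J into a w period, and that is where the u period of the next
    -- row begins.
    w-low : ∀ X Y r → r < 10 * J → topC (wSlot X Y r) ≡ 0
    w-low X Y r r<10 = go (wView X Y r)
      where
      go : ∀ {s} → WView X Y r s → topC s ≡ 0
      go start = top-is {fillʷ} {0} none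
      go middle = top-is {fillʷ} {0} none
      go (in-wide v e _) = top-is {wide} {v} (there (λ v≡ → <⇒≱ r<10 (≤-trans (≤-reflexive (sym v≡)) (≤-trans (m≤n+m v (p! X Y)) (≤-reflexive (sym e))))) none)
      go (in-narrow v e _) = contradiction (≤-trans (*-monoˡ-≤ J {10} {12} (m≤m+n 10 2)) (≤-trans (m≤m+n (12 * J) (q! X Y + v)) (≤-reflexive (trans (sym (+-assoc (12 * J) (q! X Y) v)) (sym e))))) (<⇒≱ r<10)

    wu-high : ∀ X Y r → WU (topC (wSlot X Y (10 * J + r))) (bottomC (uSlot X (Y ℤ.+ ℤ.1ℤ) r))
    wu-high X Y r = go (wView X Y (10 * J + r))
      where
      Y₁ = Y ℤ.+ ℤ.1ℤ
      p₀ = p! X Y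
      q₀ = q! X Y
      u₁ = u! X Y₁
      go : ∀ {s} → WView X Y (10 * J + r) s → WU (topC s) (bottomC (uSlot X Y₁ r))
      go start rewrite top-is {fillʷ} {0} none = wu-zero X Y₁ r
      go middle rewrite top-is {fillʷ} {0} none = wu-zero X Y₁ r
      go (in-wide v e _) = marks (top-marked wide v)
        where
        marks : ∀ {c} → Mark (topMarks wide v) c → WU c (bottomC (uSlot X Y₁ r))
        marks (there _ none) = wu-zero X Y₁ r
        marks (here v≡) = wu≡ refl (trans (cong bottomC (trans (cong (uSlot X Y₁) r≡) (u-short X Y₁ p₀ (<-≤-trans (p!< X Y) (m≤m+n J (3 * J)))))) (bottom-is {short} {p₀} (here (H X Y , oddℤ Y , proj₁ (proj₁ (sides (goods X Y))) , refl)))) ⟨1,1⟩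
          where
          r≡ : r ≡ p₀
          r≡ = +-cancelˡ-≡ (10 * J) r p₀ (trans e (trans (cong (p₀ +_) v≡) (+-comm p₀ (10 * J))))
      go (in-narrow v e _) = marks (top-marked narrow v)
        where
        marks : ∀ {c} → Mark (topMarks narrow v) c → WU c (bottomC (uSlot X Y₁ r))
        marks (there _ (there _ none)) = wu-zero X Y₁ r
        marks (here v≡) = wu≡ refl (trans (cong bottomC (trans (cong (uSlot X Y₁) r≡) (u-short X Y₁ (2 * J + q₀) (<-≤-trans (+-monoʳ-< (2 * J) (q!< X Y)) (≤-trans (≤-reflexive (+-comm (2 * J) J)) (*-monoˡ-≤ J {3} {4} (n≤1+n 3))))))) (bottom-is {short} {2 * J + q₀} (there absent (here (V X Y₁ , not (oddℤ Y) , proj₂ (proj₂ (sides (goods X Y))) , refl))))) ⟨2,2⟩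
          where
          lem : ∀ J r q → r + (12 * J + q + 0) ≡ 2 * J + q + (10 * J + r)
          lem = solve-∀
          r≡ : r ≡ 2 * J + q₀
          r≡ = linearℕ r (2 * J + q₀) (trans e (cong (12 * J + q₀ +_) v≡)) (lem J r q₀)
          absent : ¬ SomeColour (λ c π → 2 * J + q₀ ≡ p c π)
          absent (c , π , col , e) = <⇒≱ (p<J π col) (≤-trans (≤-trans (m≤m+n J (J + 0)) (m≤m+n (2 * J) q₀)) (≤-reflexive e))
        marks (there _ (here v≡)) with remove (J + q₀) (u!< X Y₁) (m≤m+n J q₀)
        ... | v′ , e′ , v′≤ = wu≡ refl (trans (cong bottomC (trans (cong (uSlot X Y₁) r≡) (u-long X Y₁ v′ (<-≤-trans (≤-<-trans v′≤ (+-monoʳ-< J (q!< X Y))) (≤-trans (≤-reflexive (cong (J +_) (sym (+-identityʳ J)))) (*-monoˡ-≤ J {2} {12} (m≤m+n 2 10))))))) (bottom-is {long} {v′} (here (quad X Y₁ , oddℤ Y₁ , goods X Y₁ , trans (+-comm v′ u₁) (trans (sym e′) (cong (λ π → J + q (V X Y₁) π) (oddℤ-suc Y))))))) ⟨3,3⟩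
          where
          lem : ∀ J r q → r + (12 * J + q + 4 * J) ≡ 4 * J + (J + (J + q)) + (10 * J + r)
          lem = solve-∀
          r≡ : r ≡ 4 * J + (J + u₁ + v′)
          r≡ = trans (linearℕ r (4 * J + (J + (J + q₀))) (trans e (cong (12 * J + q₀ +_) v≡)) (lem J r q₀)) (cong (4 * J +_) (trans (cong (J +_) e′) (sym (+-assoc J u₁ v′))))

    instance
      18J≢0 : NonZero (18 * J)
      18J≢0 = >-nonZero (≤-trans J>0 (m≤m+n J (17 * J)))

    D : ℕ
    D = 18 * J

    j : ℤ
    j = ℤ.+ J

    -- Coordinates relative to row Y, which is shifted by 6 J Y: the quotient by 18 J is the column
    -- of the tile and the remainder is the place in the period.
    uPlace wPlace : ℤ → ℤ → ℤ
    uPlace x Y = x ℤ.- ℤ.+ 6 ℤ.* j ℤ.* Y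
    wPlace x Y = uPlace x Y ℤ.+ ℤ.+ 4 ℤ.* j

    uAt wAt : ℤ → ℤ → Slot
    uAt x Y = uSlot (uPlace x Y ℤ÷./ℕ D) Y (uPlace x Y ℤ÷.%ℕ D)
    wAt x Y = wSlot (wPlace x Y ℤ÷./ℕ D) Y (wPlace x Y ℤ÷.%ℕ D)

    uAt≡ : ∀ x Y X r → r < D → uPlace x Y ≡ ℤ.+ r ℤ.+ X ℤ.* ℤ.+ D → uAt x Y ≡ uSlot X Y r
    uAt≡ x Y X r r< e = let r≡ , X≡ = quotient-unique D (uPlace x Y ℤ÷./ℕ D) X (ℤ÷.n%ℕd<d (uPlace x Y) D) r< (trans (sym (divide D (uPlace x Y))) e)
                        in cong₂ (λ X r → uSlot X Y r) X≡ r≡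

    wAt≡ : ∀ x Y X r → r < D → wPlace x Y ≡ ℤ.+ r ℤ.+ X ℤ.* ℤ.+ D → wAt x Y ≡ wSlot X Y r
    wAt≡ x Y X r r< e = let r≡ , X≡ = quotient-unique D (wPlace x Y ℤ÷./ℕ D) X (ℤ÷.n%ℕd<d (wPlace x Y) D) r< (trans (sym (divide D (wPlace x Y))) e)
                        in cong₂ (λ X r → wSlot X Y r) X≡ r≡

    K : ∀ k → ℤ.+ (k * J) ≡ ℤ.+ k ℤ.* j
    K k = ℤₚ.pos-* k J

    uw-pair : ∀ x Y → UW (topC (uAt x Y)) (bottomC (wAt x Y))
    uw-pair x Y = go (split X Y (14 * J) r)
      where
      X = uPlace x Y ℤ÷./ℕ D
      r = uPlace x Y ℤ÷.%ℕ D
      r< = ℤ÷.n%ℕd<d (uPlace x Y) D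
      z≡ = divide D (uPlace x Y)
      go : r < 14 * J ⊎ (∃ λ r′ → r ≡ 14 * J + r′) → UW (topC (uAt x Y)) (bottomC (wAt x Y))
      go (inj₁ r<14) = subst (λ s → UW (topC (uAt x Y)) (bottomC s)) (sym (wAt≡ x Y X (4 * J + r) (<-≤-trans (+-monoʳ-< (4 * J) r<14) (≤-reflexive (sym (*-distribʳ-+ J 4 14))))
        (trans (cong₂ ℤ._+_ z≡ (sym (K 4))) (lem (ℤ.+ r) (X ℤ.* ℤ.+ D) (ℤ.+ (4 * J)))))) (uw-left X Y r r<14)
        where
        lem : ∀ r x k → r ℤ.+ x ℤ.+ k ≡ k ℤ.+ r ℤ.+ x
        lem = ℤ-Solver.solve-∀
      go (inj₂ (r′ , r≡)) = subst₂ (λ s s′ → UW (topC s) (bottomC s′)) (cong (uSlot X Y) (sym r≡))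
        (sym (wAt≡ x Y (X ℤ.+ ℤ.1ℤ) r′ (<-≤-trans r′<4 (*-monoˡ-≤ J {4} {18} (m≤m+n 4 14))) place≡)) (uw-right X Y r′ r′<4)
        where
        r′<4 : r′ < 4 * J
        r′<4 = +-cancelˡ-< (14 * J) r′ (4 * J) (subst₂ _<_ r≡ (*-distribʳ-+ J 14 4) r<)
        lem : ∀ r x j → ℤ.+ 14 ℤ.* j ℤ.+ r ℤ.+ x ℤ.* (ℤ.+ 18 ℤ.* j) ℤ.+ ℤ.+ 4 ℤ.* j ≡ r ℤ.+ (x ℤ.+ ℤ.1ℤ) ℤ.* (ℤ.+ 18 ℤ.* j)
        lem = ℤ-Solver.solve-∀
        place≡ : wPlace x Y ≡ ℤ.+ r′ ℤ.+ (X ℤ.+ ℤ.1ℤ) ℤ.* ℤ.+ D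
        place≡ = trans (cong (ℤ._+ ℤ.+ 4 ℤ.* j) (trans z≡ (cong₂ (λ a b → a ℤ.+ X ℤ.* b) (trans (cong ℤ.+_ r≡) (cong (ℤ._+ ℤ.+ r′) (K 14))) (K 18))))
          (trans (lem (ℤ.+ r′) X j) (cong (λ d → ℤ.+ r′ ℤ.+ (X ℤ.+ ℤ.1ℤ) ℤ.* d) (sym (K 18))))

    wu-pair : ∀ x Y → WU (topC (wAt x Y)) (bottomC (uAt x (Y ℤ.+ ℤ.1ℤ)))
    wu-pair x Y = go (split X Y (10 * J) r)
      where
      X = wPlace x Y ℤ÷./ℕ D
      r = wPlace x Y ℤ÷.%ℕ D
      r< = ℤ÷.n%ℕd<d (wPlace x Y) D
      z≡ = divide D (wPlace x Y)
      Y₁ = Y ℤ.+ ℤ.1ℤ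
      go : r < 10 * J ⊎ (∃ λ r′ → r ≡ 10 * J + r′) → WU (topC (wAt x Y)) (bottomC (uAt x Y₁))
      go (inj₁ r<10) = subst (λ c → WU c (bottomC (uAt x Y₁))) (sym (w-low X Y r r<10)) (wu-zero (uPlace x Y₁ ℤ÷./ℕ D) Y₁ (uPlace x Y₁ ℤ÷.%ℕ D))
      go (inj₂ (r′ , r≡)) = subst₂ (λ s s′ → WU (topC s) (bottomC s′)) (cong (wSlot X Y) (sym r≡))
        (sym (uAt≡ x Y₁ X r′ (≤-<-trans (≤-trans (m≤n+m r′ (10 * J)) (≤-reflexive (sym r≡))) r<) place≡)) (wu-high X Y r′)
        where
        lem : ∀ x Y j → x ℤ.- ℤ.+ 6 ℤ.* j ℤ.* (Y ℤ.+ ℤ.1ℤ) ≡ x ℤ.- ℤ.+ 6 ℤ.* j ℤ.* Y ℤ.+ ℤ.+ 4 ℤ.* j ℤ.- ℤ.+ 10 ℤ.* j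
        lem = ℤ-Solver.solve-∀
        lem′ : ∀ k r x → k ℤ.+ r ℤ.+ x ℤ.- k ≡ r ℤ.+ x
        lem′ = ℤ-Solver.solve-∀
        place≡ : uPlace x Y₁ ≡ ℤ.+ r′ ℤ.+ X ℤ.* ℤ.+ D
        place≡ = trans (lem x Y j) (trans (cong₂ ℤ._-_ (trans z≡ (cong (λ r → ℤ.+ r ℤ.+ X ℤ.* ℤ.+ D) r≡)) (sym (K 10))) (lem′ (ℤ.+ (10 * J)) (ℤ.+ r′) (X ℤ.* ℤ.+ D)))

    row-next : ∀ d (row : ℤ → List Name) → (∀ X → total (row X) ≡ D) → ∀ z →
      Next (locate d (row (z ℤ÷./ℕ D)) (z ℤ÷.%ℕ D)) (locate d (row ((z ℤ.+ ℤ.1ℤ) ℤ÷./ℕ D)) ((z ℤ.+ ℤ.1ℤ) ℤ÷.%ℕ D))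
    row-next d row total≡ z = remainder-step D z (λ X r → Next (locate d (row (z ℤ÷./ℕ D)) (z ℤ÷.%ℕ D)) (locate d (row X) r))
      (λ { lt refl → locate-next d (row (z ℤ÷./ℕ D)) (z ℤ÷.%ℕ D) (subst (suc (z ℤ÷.%ℕ D) <_) (sym (total≡ _)) lt) })
      (λ e → inj₁ (locate-last d (row (z ℤ÷./ℕ D)) (z ℤ÷.%ℕ D) (trans e (sym (total≡ _))) , locate-zero d (row (z ℤ÷./ℕ D ℤ.+ ℤ.1ℤ))))

    uAt-next : ∀ x Y → Next (uAt x Y) (uAt (x ℤ.+ ℤ.1ℤ) Y)
    uAt-next x Y = subst (λ z → Next (uAt x Y) (uSlot (z ℤ÷./ℕ D) Y (z ℤ÷.%ℕ D))) (lem x (ℤ.+ 6 ℤ.* j ℤ.* Y)) (row-next fillᵘ (λ X → uRow X Y) (λ X → total-uRow X Y) (uPlace x Y))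
      where
      lem : ∀ x y → x ℤ.- y ℤ.+ ℤ.1ℤ ≡ x ℤ.+ ℤ.1ℤ ℤ.- y
      lem = ℤ-Solver.solve-∀

    wAt-next : ∀ x Y → Next (wAt x Y) (wAt (x ℤ.+ ℤ.1ℤ) Y)
    wAt-next x Y = subst (λ z → Next (wAt x Y) (wSlot (z ℤ÷./ℕ D) Y (z ℤ÷.%ℕ D))) (lem x (ℤ.+ 6 ℤ.* j ℤ.* Y) (ℤ.+ 4 ℤ.* j)) (row-next fillʷ (λ X → wRow X Y) (λ X → total-wRow X Y) (wPlace x Y))
      where
      lem : ∀ x y z → x ℤ.- y ℤ.+ z ℤ.+ ℤ.1ℤ ≡ x ℤ.+ ℤ.1ℤ ℤ.- y ℤ.+ z
      lem = ℤ-Solver.solve-∀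

    IsU IsW : Name → Set
    IsU n = Used n × rowClass n ≡ 0 × topClass n ≡ 0 × bottomClass n ≡ 3
    IsW n = Used n × rowClass n ≡ 1 × topClass n ≡ 2 × bottomClass n ≡ 1

    uAt-class : ∀ x Y → IsU (proj₁ (uAt x Y))
    uAt-class x Y = locate-all {IsU} fillᵘ (uRow (uPlace x Y ℤ÷./ℕ D) Y) (uPlace x Y ℤ÷.%ℕ D) fill
      ((tt , refl , refl , refl) ∷ ++⁺ (replicate⁺ (J + u! (uPlace x Y ℤ÷./ℕ D) Y) fill) ((tt , refl , refl , refl) ∷ replicate⁺ (J ∸ u! (uPlace x Y ℤ÷./ℕ D) Y) fill))
      where
      fill : IsU fillᵘ
      fill = tt , refl , refl , refl

    wAt-class : ∀ x Y → IsW (proj₁ (wAt x Y))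
    wAt-class x Y = locate-all {IsW} fillʷ (wRow X Y) (wPlace x Y ℤ÷.%ℕ D) fill
      (++⁺ (replicate⁺ (p! X Y) fill) ((tt , refl , refl , refl) ∷ ++⁺ (replicate⁺ (J ∸ p! X Y + q! X Y) fill) ((tt , refl , refl , refl) ∷ replicate⁺ (J ∸ q! X Y) fill)))
      where
      X = wPlace x Y ℤ÷./ℕ D
      fill : IsW fillʷ
      fill = tt , refl , refl , refl

    rowSlot : ℤ → ℕ → ℤ → Slot
    rowSlot Y 0 x = uAt x Y
    rowSlot Y 1 x = uw (topC (uAt x Y)) (bottomC (wAt x Y)) , 0
    rowSlot Y 2 x = wAt x Y
    rowSlot Y (suc (suc (suc _))) x = wu (topC (wAt x Y)) (bottomC (uAt x (Y ℤ.+ ℤ.1ℤ))) , 0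

    row-used : ∀ Y ρ x → Used (proj₁ (rowSlot Y ρ x))
    row-used Y 0 x = proj₁ (uAt-class x Y)
    row-used Y 1 x = uw-pair x Y
    row-used Y 2 x = proj₁ (wAt-class x Y)
    row-used Y (suc (suc (suc _))) x = wu-pair x Y

    row-valid : ∀ Y ρ x → Valid (rowSlot Y ρ x)
    row-valid Y 0 x = locate-valid fillᵘ (uRow (uPlace x Y ℤ÷./ℕ D) Y) (uPlace x Y ℤ÷.%ℕ D)
    row-valid Y 1 x = z<s
    row-valid Y 2 x = locate-valid fillʷ (wRow (wPlace x Y ℤ÷./ℕ D) Y) (wPlace x Y ℤ÷.%ℕ D)
    row-valid Y (suc (suc (suc _))) x = z<s

    rowSlot-next : ∀ Y ρ x → Next (rowSlot Y ρ x) (rowSlot Y ρ (x ℤ.+ ℤ.1ℤ))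
    rowSlot-next Y 0 x = uAt-next x Y
    rowSlot-next Y 1 x = inj₁ (refl , refl)
    rowSlot-next Y 2 x = wAt-next x Y
    rowSlot-next Y (suc (suc (suc _))) x = inj₁ (refl , refl)

    rowSlot-class : ∀ Y ρ x x′ → rowClass (proj₁ (rowSlot Y ρ x)) ≡ rowClass (proj₁ (rowSlot Y ρ x′))
    rowSlot-class Y 0 x x′ = trans (proj₁ (proj₂ (uAt-class x Y))) (sym (proj₁ (proj₂ (uAt-class x′ Y))))
    rowSlot-class Y 1 x x′ = refl
    rowSlot-class Y 2 x x′ = trans (proj₁ (proj₂ (wAt-class x Y))) (sym (proj₁ (proj₂ (wAt-class x′ Y))))
    rowSlot-class Y (suc (suc (suc _))) x x′ = refl

    topColourOf bottomColourOf : Slot → ℕ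
    topColourOf (n , v)    = topClass n + 4 * topCode n v
    bottomColourOf (n , v) = bottomClass n + 4 * bottomCode n v

    rowSlot-vert : ∀ Y ρ x → suc ρ < 4 → topColourOf (rowSlot Y ρ x) ≡ bottomColourOf (rowSlot Y (suc ρ) x)
    rowSlot-vert Y 0 x _ = cong₂ (λ c k → c + 4 * k) (proj₁ (proj₂ (proj₂ (uAt-class x Y)))) (sym (bottom-is {rowSlot Y 1 x .proj₁} {0} (here refl)))
    rowSlot-vert Y 1 x _ = cong₂ (λ c k → c + 4 * k) (sym (proj₂ (proj₂ (proj₂ (wAt-class x Y))))) (top-is {rowSlot Y 1 x .proj₁} {0} (here refl))
    rowSlot-vert Y 2 x _ = cong₂ (λ c k → c + 4 * k) (proj₁ (proj₂ (proj₂ (wAt-class x Y)))) (sym (bottom-is {rowSlot Y 3 x .proj₁} {0} (here refl)))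
    rowSlot-vert Y (suc (suc (suc _))) x (s≤s (s≤s (s≤s (s≤s ()))))

    rowSlot-wrap : ∀ Y x → topColourOf (rowSlot Y 3 x) ≡ bottomColourOf (rowSlot (Y ℤ.+ ℤ.1ℤ) 0 x)
    rowSlot-wrap Y x = cong₂ (λ c k → c + 4 * k) (sym (proj₂ (proj₂ (proj₂ (uAt-class x (Y ℤ.+ ℤ.1ℤ)))))) (top-is {rowSlot Y 3 x .proj₁} {0} (here refl))

    is-bar : ∀ n (us : Used n) → lookup bars (proj₁ (index n us)) ≡ bar n
    is-bar n us = trans (lookup-map (proj₁ (index n us)) bar names) (cong bar (proj₂ (index n us)))

    length-is : ∀ n (us : Used n) → len (lookup bars (proj₁ (index n us))) ≡ size n
    length-is n us = trans (cong len (is-bar n us)) (suc-pred (size n) ⦃ >-nonZero (size>0 n) ⦄)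

    toCell : ∀ s → Used (proj₁ s) → Valid s → Cell bars
    toCell (n , v) us v< = proj₁ (index n us) , fromℕ< (subst (v <_) (sym (length-is n us)) v<)

    lookup-top : ∀ n (us : Used n) (i : Fin (len (lookup bars (proj₁ (index n us))))) → topColour bars (proj₁ (index n us) , i) ≡ topColourOf (n , toℕ i)
    lookup-top n us i = go (lookup bars (proj₁ (index n us))) (is-bar n us) i
      where
      go : ∀ b → b ≡ bar n → (i : Fin (len b)) → lookup (Bar.top b) i ≡ topColourOf (n , toℕ i)
      go _ refl i = lookup∘tabulate (λ j → topClass n + 4 * topCode n (toℕ j)) i

    lookup-bottom : ∀ n (us : Used n) (i : Fin (len (lookup bars (proj₁ (index n us))))) → bottomColour bars (proj₁ (index n us) , i) ≡ bottomColourOf (n , toℕ i)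
    lookup-bottom n us i = go (lookup bars (proj₁ (index n us))) (is-bar n us) i
      where
      go : ∀ b → b ≡ bar n → (i : Fin (len b)) → lookup (Bar.bottom b) i ≡ bottomColourOf (n , toℕ i)
      go _ refl i = lookup∘tabulate (λ j → bottomClass n + 4 * bottomCode n (toℕ j)) i

    cell-top : ∀ s us v< → topColour bars (toCell s us v<) ≡ topColourOf s
    cell-top (n , v) us v< = trans (lookup-top n us _) (cong (λ v → topColourOf (n , v)) (toℕ-fromℕ< _))

    cell-bottom : ∀ s us v< → bottomColour bars (toCell s us v<) ≡ bottomColourOf s
    cell-bottom (n , v) us v< = trans (lookup-bottom n us _) (cong (λ v → bottomColourOf (n , v)) (toℕ-fromℕ< _))

    index-unique : ∀ n (us us′ : Used n) → 1 < size n → proj₁ (index n us) ≡ proj₁ (index n us′)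
    index-unique short _ _ _ = refl
    index-unique long _ _ _ = refl
    index-unique wide _ _ _ = refl
    index-unique narrow _ _ _ = refl
    index-unique fillᵘ _ _ (s≤s ())
    index-unique fillʷ _ _ (s≤s ())
    index-unique (uw _ _) _ _ (s≤s ())
    index-unique (wu _ _) _ _ (s≤s ())

    cell-next : ∀ s s′ us us′ v< v′< → Next s s′ → rowClass (proj₁ s) ≡ rowClass (proj₁ s′) → HNext bars (toCell s us v<) (toCell s′ us′ v′<)
    cell-next (n , v) (n′ , v′) us us′ v< v′< (inj₁ (e , z)) cl = inj₁ (trans (toℕ-fromℕ< _) (suc-injective (trans e (sym (length-is n us)))) ,
      trans (toℕ-fromℕ< _) z , trans (cong Bar.right (is-bar n us)) (trans cl (sym (cong Bar.left (is-bar n′ us′)))))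
    cell-next (n , v) (n′ , v′) us us′ v< v′< (inj₂ (lt , refl , e)) cl = inj₂ (s≤s⁻¹ (subst (_< len (lookup bars (proj₁ (index n us)))) (cong suc (sym (toℕ-fromℕ< _))) (subst (suc v <_) (sym (length-is n us)) lt)) ,
      index-unique n us′ us (≤-<-trans (s≤s z≤n) lt) , trans (toℕ-fromℕ< _) (trans e (cong suc (sym (toℕ-fromℕ< _)))))

    tiling : Tiling bars
    tiling = record { place = place ; horiz = horiz ; vert = vert }
      where
      cellAt : ℤ → ℕ → ℤ → Cell bars
      cellAt Y ρ x = toCell (rowSlot Y ρ x) (row-used Y ρ x) (row-valid Y ρ x)
      place : ℤ → ℤ → Cell bars
      place x y = cellAt (y ℤ÷./ℕ 4) (y ℤ÷.%ℕ 4) x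
      horiz : ∀ x y → HNext bars (place x y) (place (x ℤ.+ ℤ.1ℤ) y)
      horiz x y = cell-next (rowSlot Y ρ x) (rowSlot Y ρ (x ℤ.+ ℤ.1ℤ)) (row-used Y ρ x) (row-used Y ρ (x ℤ.+ ℤ.1ℤ)) (row-valid Y ρ x) (row-valid Y ρ (x ℤ.+ ℤ.1ℤ))
        (rowSlot-next Y ρ x) (rowSlot-class Y ρ x (x ℤ.+ ℤ.1ℤ))
        where
        Y = y ℤ÷./ℕ 4
        ρ = y ℤ÷.%ℕ 4
      vert : ∀ x y → topColour bars (place x y) ≡ bottomColour bars (place x (y ℤ.+ ℤ.1ℤ))
      vert x y = remainder-step 4 y (λ Y′ ρ′ → topColour bars (place x y) ≡ bottomColour bars (cellAt Y′ ρ′ x))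
        (λ { lt refl → trans top (trans (rowSlot-vert Y ρ x lt) (sym (cell-bottom (rowSlot Y (suc ρ) x) (row-used Y (suc ρ) x) (row-valid Y (suc ρ) x)))) })
        (λ e → trans top (trans (cong (λ ρ → topColourOf (rowSlot Y ρ x)) (suc-injective e)) (trans (rowSlot-wrap Y x)
          (sym (cell-bottom (rowSlot (Y ℤ.+ ℤ.1ℤ) 0 x) (row-used (Y ℤ.+ ℤ.1ℤ) 0 x) (row-valid (Y ℤ.+ ℤ.1ℤ) 0 x))))))
        where
        Y = y ℤ÷./ℕ 4
        ρ = y ℤ÷.%ℕ 4
        top = cell-top (rowSlot Y ρ x) (row-used Y ρ x) (row-valid Y ρ x)

-- The code of the bars as a term in the parameter

module BarCodes where

  open import Defs
  open Expressions
  open Codes using (radix-unique)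
  open PayloadTiles using (consT)
  open Bars
  open import Data.Bool using (Bool; true; false; not)
  open import Data.Fin as Fin using (Fin; zero; suc; toℕ; #_)
  open import Data.Fin.Properties using (toℕ-injective; all?)
  open import Data.List as List using (List; []; _∷_)
  open import Data.Nat
  open import Data.Nat.Properties
  open import Data.Product using (_×_; _,_; proj₁)
  open import Data.Sum using (inj₁; inj₂)
  open import Data.Vec as Vec using (Vec; []; _∷_; lookup; tabulate; toList)
  open import Data.Vec.Properties using (lookup-map)
  open import Function using (_∘_; id)
  open import Relation.Binary.PropositionalEquality hiding ([_]; J)
  open import Relation.Nullary using (yes; no; contradiction)
  open import Relation.Nullary.Decidable using (toWitness)

  -- A set of Wang tiles is given by a formula in the left, bottom, right and top colours of a tile and
  -- a parameter, together with a bound for its colours.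
  module Encoding (tile : Fm 5) (bound : Tm 1) where

    -- `span` bounds the numbers of tiles and colours, `base` has room for the sum of two of them in
    -- one digit, and `unit` exceeds all displacements; they are m, B and J of the layout.
    colours span base unit : ∀ {n} → Tm n → Tm n
    colours a = call bound (a ∷ [])
    span a    = colours a ⊗ (colours a ⊗ (colours a ⊗ colours a)) ⊕ lit 2 ⊗ colours a
    base a    = lit 1 ⊕ (span a ⊕ span a)
    unit a    = base a ⇑ lit 5

    loT hiT : ∀ {n} → Bool → Tm n → Tm n
    loT false t = t
    loT true  t = lit 0
    hiT false t = lit 0
    hiT true  t = t

    pT qT : Bool → Tm 2
    pT π = base (var (# 1)) ⊗ (loT π (lit 1 ⊕ var (# 0)) ⊕ base (var (# 1)) ⊗ hiT π (lit 1 ⊕ var (# 0)))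
    qT π = lit (bool π) ⊕ lit 2 ⊗ var (# 0)

    rankT : Tm 5
    rankT = var (# 0) ⊕ K ⊗ (var (# 1) ⊕ K ⊗ (var (# 2) ⊕ K ⊗ var (# 3)))
      where K = colours (var (# 4))

    uT : Bool → Tm 5
    uT π = B ⊗ (B ⊗ (B ⊗ (loT π (lit 1 ⊕ rankT) ⊕ B ⊗ hiT π (lit 1 ⊕ rankT))))
      where B = base (var (# 4))

    someColour : (Bool → Fm 3) → Fm 2
    someColour A = ex (colours (var (# 1))) (A false ⩔ A true)

    -- The quantified colours are west, south, east and north, the innermost one being north.
    someTile : (Bool → Fm 6) → Fm 2
    someTile A = ex (colours (var (# 1))) (ex (colours (var (# 2))) (ex (colours (var (# 3))) (ex (colours (var (# 4)))
      (callF tile (var (# 3) ∷ var (# 2) ∷ var (# 1) ∷ var (# 0) ∷ var (# 5) ∷ []) ⩓ (A false ⩔ A true)))))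

    J₂ : Tm 2
    J₂ = unit (var (# 1))
    J₃ : Tm 3
    J₃ = unit (var (# 2))
    J₆ : Tm 6
    J₆ = unit (var (# 5))

    pC qC : Bool → Tm 3
    pC π = call (pT π) (var (# 0) ∷ var (# 2) ∷ [])
    qC π = call (qT π) (var (# 0) ∷ var (# 2) ∷ [])

    u₆ : Bool → Tm 6
    u₆ π = call (uT π) (var (# 3) ∷ var (# 2) ∷ var (# 1) ∷ var (# 0) ∷ var (# 5) ∷ [])

    p₆ q₆ : Fin 6 → Bool → Tm 6
    p₆ i π = call (pT π) (var i ∷ var (# 5) ∷ [])
    q₆ i π = call (qT π) (var i ∷ var (# 5) ∷ [])

    always : Fm 2
    always = lit 0 ≐ lit 0

    -- The conditions of `topMarks` and `bottomMarks` as formulas, kept parallel to the letter so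
    -- that both mean the same by computation.
    topTests bottomTests : Name → List (Fm 2 × ℕ)
    topTests short    = ((var (# 0) ≐ lit 3 ⊗ J₂) , 1) ∷ []
    topTests long     = ((var (# 0) ≐ lit 10 ⊗ J₂) , 2) ∷ ((var (# 0) ≐ lit 4 ⊗ J₂) , 3) ∷
                        (someTile (λ π → var (# 4) ⊕ u₆ π ≐ J₆ ⊕ p₆ (# 3) π) , 4) ∷ []
    topTests fillᵘ    = (always , 5) ∷ []
    topTests wide     = ((var (# 0) ≐ lit 10 ⊗ J₂) , 1) ∷ []
    topTests narrow   = ((var (# 0) ≐ lit 0) , 2) ∷ ((var (# 0) ≐ lit 4 ⊗ J₂) , 3) ∷ []
    topTests fillʷ    = []
    topTests (uw x y) = (always , y) ∷ []
    topTests (wu x y) = (always , y) ∷ []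
    bottomTests short    = (someColour (λ π → var (# 1) ≐ pC π) , 1) ∷ (someColour (λ π → var (# 1) ≐ lit 2 ⊗ J₃ ⊕ qC π) , 2) ∷ []
    bottomTests long     = (someTile (λ π → var (# 4) ⊕ u₆ π ≐ J₆ ⊕ q₆ (# 2) π) , 3) ∷ []
    bottomTests fillᵘ    = []
    bottomTests wide     = (someColour (λ π → var (# 1) ⊕ pC π ≐ lit 7 ⊗ J₃) , 1) ∷
                           (someTile (λ π → var (# 4) ⊕ p₆ (# 1) π ≐ J₆ ⊕ u₆ π) , 2) ∷ ((var (# 0) ≐ lit 10 ⊗ J₂) , 4) ∷ []
    bottomTests narrow   = (someTile (λ π → var (# 4) ⊕ q₆ (# 0) (not π) ≐ J₆ ⊕ u₆ π) , 3) ∷ []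
    bottomTests fillʷ    = (always , 5) ∷ []
    bottomTests (uw x y) = (always , x) ∷ []
    bottomTests (wu x y) = (always , x) ∷ []

    chain : List (Fm 2 × ℕ) → Tm 2
    chain []             = lit 0
    chain ((f , c) ∷ fs) = ite f (lit c) (chain fs)

    sizeT : Name → Tm 1
    sizeT short  = lit 4 ⊗ unit (var (# 0))
    sizeT long   = lit 12 ⊗ unit (var (# 0))
    sizeT wide   = lit 11 ⊗ unit (var (# 0))
    sizeT narrow = lit 5 ⊗ unit (var (# 0))
    sizeT _      = lit 1

    barT : Name → Tm 1
    barT n = consT k (consT (lit (rowClass n)) (consT (lit (rowClass n))
      (consT (codes (lit 1 ⊕ k) (lit (topClass n) ⊕ lit 4 ⊗ chain (topTests n)))
        (consT (codes (lit 1 ⊕ k) (lit (bottomClass n) ⊕ lit 4 ⊗ chain (bottomTests n))) (lit 0)))))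
      where k = sizeT n ⊖ lit 1

    barsT : ∀ {m} → Vec Name m → Tm 1
    barsT []       = lit 0
    barsT (n ∷ ns) = consT (barT n) (barsT ns)

    module At (a : ℕ) where

      K B m : ℕ
      K = ⟦ bound ⟧ (a ∷ [])
      m = K * (K * (K * K)) + 2 * K
      B = suc (m + m)

      open Digital B m ≤-refl

      rank : Quad → ℕ
      rank τ = west τ + K * (south τ + K * (east τ + K * north τ))

      Inside : Quad → Set
      Inside τ = (west τ < K × south τ < K) × east τ < K × north τ < K

      layout : Layout
      layout = record
        { J    = B ^ 5
        ; J>0  = m^n>0 B 5
        ; Good = λ τ → Inside τ × Holds tile (west τ ∷ south τ ∷ east τ ∷ north τ ∷ a ∷ [])
        ; Col  = _< K
        ; p    = λ c π → ⟦ pT π ⟧ (c ∷ a ∷ [])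
        ; q    = λ c π → ⟦ qT π ⟧ (c ∷ a ∷ [])
        ; u    = λ τ π → ⟦ uT π ⟧ (west τ ∷ south τ ∷ east τ ∷ north τ ∷ a ∷ []) }

      open Layout layout

      p≡ : ∀ c π → p c π ≡ pOf c π
      p≡ c false = refl
      p≡ c true  = refl

      u≡ : ∀ τ π → u τ π ≡ uOf (rank τ) π
      u≡ τ false = refl
      u≡ τ true  = refl

      q≡ : ∀ c π → q c π ≡ qOf c π
      q≡ c π = refl

      Inside⇒rank< : ∀ {τ} → Inside τ → rank τ < m
      Inside⇒rank< ((w , s) , e , n) = <-≤-trans (digit w (digit s (digit e n))) (m≤m+n _ (2 * K))
        where
        digit : ∀ {x y k} → x < K → y < k → x + K * y < K * k
        digit {x} {y} x< y< = ≤-trans (+-monoˡ-≤ (K * y) x<) (≤-trans (≤-reflexive (sym (*-suc K y))) (*-monoʳ-≤ K y<))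

      rank-injective : ∀ {τ υ} → Inside τ → Inside υ → rank τ ≡ rank υ → τ ≡ υ
      rank-injective {quadruple _ _ _ _} {quadruple _ _ _ _} ((w , s) , e , _) ((w′ , s′) , e′ , _) eq with radix-unique K _ _ w w′ eq
      ... | refl , eq₁ with radix-unique K _ _ s s′ eq₁
      ...   | refl , eq₂ with radix-unique K _ _ e e′ eq₂
      ...     | refl , refl = refl

      col<m : ∀ {c} → c < K → c < m
      col<m c< = <-≤-trans c< (≤-trans (m≤m+n K (K + 0)) (m≤n+m (2 * K) (K * (K * (K * K)))))

      col₂ : ∀ {c} → c < K → suc (2 * c) ≤ m
      col₂ {c} c< = ≤-trans (≤-trans (n≤1+n (suc (2 * c))) (≤-trans (≤-reflexive (sym (*-suc 2 c))) (*-monoʳ-≤ 2 c<))) (m≤n+m (2 * K) (K * (K * (K * K))))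

      separated : Separated layout
      separated = record
        { p<J = λ {c} π c< → subst (_< B ^ 5) (sym (p≡ c π)) (pOf< π (col<m c<))
        ; q<J = λ {c} π c< → subst (_< B ^ 5) (sym (q≡ c π)) (qOf< {c} π (col₂ c<))
        ; u<J = λ {τ} π good → subst (_< B ^ 5) (sym (u≡ τ π)) (uOf< π (Inside⇒rank< (proj₁ good)))
        ; sides = proj₁
        ; three-injective = λ {c} {d} {τ} {υ} {e} {f} π π′ ρ ρ′ σ σ′ c< d< τ! υ! e< f< eq →
            let x , (y , i) , z = three {c} {d} {rank τ} {rank υ} {e} {f} π π′ ρ ρ′ σ σ′ (col<m c<) (col<m d<) (Inside⇒rank< (proj₁ τ!)) (Inside⇒rank< (proj₁ υ!)) (col₂ e<) (col₂ f<)
                  (trans (sym (cong₂ _+_ (cong₂ _+_ (p≡ c π) (u≡ τ ρ)) (q≡ e σ))) (trans eq (cong₂ _+_ (cong₂ _+_ (p≡ d π′) (u≡ υ ρ′)) (q≡ f σ′))))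
            in x , (y , rank-injective (proj₁ τ!) (proj₁ υ!) i) , z
        ; four-injective = λ {c} {d} {c′} {d′} {τ} {υ} {τ′} {υ′} π ρ σ ρ₁ σ₁ π′ π≡ c< d< c′< d′< τ! υ! τ′! υ′! eq →
            let (x , i) , y = four {c} {d} {c′} {d′} {rank τ} {rank υ} {rank τ′} {rank υ′} π ρ σ ρ₁ σ₁ π′ π≡ (col<m c<) (col<m d<) (col<m c′<) (col<m d′<)
                  (Inside⇒rank< (proj₁ τ!)) (Inside⇒rank< (proj₁ υ!)) (Inside⇒rank< (proj₁ τ′!)) (Inside⇒rank< (proj₁ υ′!))
                  (trans (sym (cong₂ _+_ (cong₂ _+_ (u≡ τ π) (p≡ c ρ)) (cong₂ _+_ (p≡ d′ σ₁) (u≡ υ′ σ)))) (trans eq (cong₂ _+_ (cong₂ _+_ (p≡ d ρ₁) (u≡ υ ρ)) (cong₂ _+_ (u≡ τ′ π′) (p≡ c′ σ)))))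
            in (x , rank-injective (proj₁ τ!) (proj₁ υ!) i) , y }

      mark-step : ∀ {A : Set} {c r t} v (f : Fm 2) → (Holds f (v ∷ a ∷ []) → A) → (A → Holds f (v ∷ a ∷ [])) → Mark r (⟦ t ⟧ (v ∷ a ∷ [])) →
                  Mark ((A , c) ∷ r) (⟦ ite f (lit c) t ⟧ (v ∷ a ∷ []))
      mark-step v f to from rest with holds? f (v ∷ a ∷ [])
      ... | yes h = here (to h)
      ... | no ¬h = there (¬h ∘ from) rest

      module _ (v : ℕ) where

        colour-to : ∀ {A : ℕ → Bool → Set} (F : Bool → Fm 3) → (∀ c π → Holds (F π) (c ∷ v ∷ a ∷ []) → A c π) → Holds (someColour F) (v ∷ a ∷ []) → SomeColour A
        colour-to F f (c , c< , inj₁ h) = c , false , c< , f c false h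
        colour-to F f (c , c< , inj₂ h) = c , true , c< , f c true h

        colour-from : ∀ {A : ℕ → Bool → Set} (F : Bool → Fm 3) → (∀ c π → A c π → Holds (F π) (c ∷ v ∷ a ∷ [])) → SomeColour A → Holds (someColour F) (v ∷ a ∷ [])
        colour-from F f (c , false , c< , h) = c , c< , inj₁ (f c false h)
        colour-from F f (c , true , c< , h) = c , c< , inj₂ (f c true h)

        tile-to : ∀ {A : Quad → Bool → Set} (F : Bool → Fm 6) → (∀ w s e n π → Holds (F π) (n ∷ e ∷ s ∷ w ∷ v ∷ a ∷ []) → A (quadruple w s e n) π) →
                  Holds (someTile F) (v ∷ a ∷ []) → SomeTile A
        tile-to F f (w , w< , s , s< , e , e< , n , n< , t , inj₁ h) = quadruple w s e n , false , (((w< , s<) , e< , n<) , t) , f w s e n false h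
        tile-to F f (w , w< , s , s< , e , e< , n , n< , t , inj₂ h) = quadruple w s e n , true , (((w< , s<) , e< , n<) , t) , f w s e n true h

        tile-from : ∀ {A : Quad → Bool → Set} (F : Bool → Fm 6) → (∀ w s e n π → A (quadruple w s e n) π → Holds (F π) (n ∷ e ∷ s ∷ w ∷ v ∷ a ∷ [])) →
                    SomeTile A → Holds (someTile F) (v ∷ a ∷ [])
        tile-from F f (quadruple w s e n , false , (((w< , s<) , e< , n<) , t) , h) = w , w< , s , s< , e , e< , n , n< , t , inj₁ (f w s e n false h)
        tile-from F f (quadruple w s e n , true , (((w< , s<) , e< , n<) , t) , h) = w , w< , s , s< , e , e< , n , n< , t , inj₂ (f w s e n true h)

        colour-step : ∀ {A : ℕ → Bool → Set} {c r t} (F : Bool → Fm 3) → (∀ c π → Holds (F π) (c ∷ v ∷ a ∷ []) → A c π) → (∀ c π → A c π → Holds (F π) (c ∷ v ∷ a ∷ [])) →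
          Mark r (⟦ t ⟧ (v ∷ a ∷ [])) → Mark ((SomeColour A , c) ∷ r) (⟦ ite (someColour F) (lit c) t ⟧ (v ∷ a ∷ []))
        colour-step {t = t} F to from = mark-step {t = t} v (someColour F) (colour-to F to) (colour-from F from)

        tile-step : ∀ {A : Quad → Bool → Set} {c r t} (F : Bool → Fm 6) → (∀ w s e n π → Holds (F π) (n ∷ e ∷ s ∷ w ∷ v ∷ a ∷ []) → A (quadruple w s e n) π) →
          (∀ w s e n π → A (quadruple w s e n) π → Holds (F π) (n ∷ e ∷ s ∷ w ∷ v ∷ a ∷ [])) →
          Mark r (⟦ t ⟧ (v ∷ a ∷ [])) → Mark ((SomeTile A , c) ∷ r) (⟦ ite (someTile F) (lit c) t ⟧ (v ∷ a ∷ []))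
        tile-step {t = t} F to from = mark-step {t = t} v (someTile F) (tile-to F to) (tile-from F from)

      topCode bottomCode : Name → ℕ → ℕ
      topCode n v    = ⟦ chain (topTests n) ⟧ (v ∷ a ∷ [])
      bottomCode n v = ⟦ chain (bottomTests n) ⟧ (v ∷ a ∷ [])

      top-marked : ∀ n v → Mark (topMarks n v) (topCode n v)
      top-marked short v = mark-step {t = lit 0} v (var (# 0) ≐ lit 3 ⊗ J₂) id id none
      top-marked long v = mark-step {t = chain (List.drop 1 (topTests long))} v (var (# 0) ≐ lit 10 ⊗ J₂) id id
        (mark-step {t = chain (List.drop 2 (topTests long))} v (var (# 0) ≐ lit 4 ⊗ J₂) id id
        (tile-step v {t = lit 0} (λ π → var (# 4) ⊕ u₆ π ≐ J₆ ⊕ p₆ (# 3) π) (λ _ _ _ _ _ → id) (λ _ _ _ _ _ → id) none))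
      top-marked fillᵘ v = mark-step {t = lit 0} v always id id none
      top-marked wide v = mark-step {t = lit 0} v (var (# 0) ≐ lit 10 ⊗ J₂) id id none
      top-marked narrow v = mark-step {t = chain (List.drop 1 (topTests narrow))} v (var (# 0) ≐ lit 0) id id (mark-step {t = lit 0} v (var (# 0) ≐ lit 4 ⊗ J₂) id id none)
      top-marked fillʷ v = none
      top-marked (uw x y) v = mark-step {t = lit 0} v always id id none
      top-marked (wu x y) v = mark-step {t = lit 0} v always id id none

      bottom-marked : ∀ n v → Mark (bottomMarks n v) (bottomCode n v)
      bottom-marked short v = colour-step v {t = chain (List.drop 1 (bottomTests short))} (λ π → var (# 1) ≐ pC π) (λ _ _ → id) (λ _ _ → id)
        (colour-step v {t = lit 0} (λ π → var (# 1) ≐ lit 2 ⊗ J₃ ⊕ qC π) (λ _ _ → id) (λ _ _ → id) none)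
      bottom-marked long v = tile-step v {t = lit 0} (λ π → var (# 4) ⊕ u₆ π ≐ J₆ ⊕ q₆ (# 2) π) (λ _ _ _ _ _ → id) (λ _ _ _ _ _ → id) none
      bottom-marked fillᵘ v = none
      bottom-marked wide v = colour-step v {t = chain (List.drop 1 (bottomTests wide))} (λ π → var (# 1) ⊕ pC π ≐ lit 7 ⊗ J₃) (λ _ _ → id) (λ _ _ → id)
        (tile-step v {t = chain (List.drop 2 (bottomTests wide))} (λ π → var (# 4) ⊕ p₆ (# 1) π ≐ J₆ ⊕ u₆ π) (λ _ _ _ _ _ → id) (λ _ _ _ _ _ → id)
        (mark-step {t = lit 0} v (var (# 0) ≐ lit 10 ⊗ J₂) id id none))
      bottom-marked narrow v = tile-step v {t = lit 0} (λ π → var (# 4) ⊕ q₆ (# 0) (not π) ≐ J₆ ⊕ u₆ π) (λ _ _ _ _ _ → id) (λ _ _ _ _ _ → id) none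
      bottom-marked fillʷ v = mark-step {t = lit 0} v always id id none
      bottom-marked (uw x y) v = mark-step {t = lit 0} v always id id none
      bottom-marked (wu x y) v = mark-step {t = lit 0} v always id id none

      marked : Marked
      marked = record { layout = layout ; topCode = topCode ; bottomCode = bottomCode ; top-marked = top-marked ; bottom-marked = bottom-marked }

      open Marked marked using (bar; bars)

      interval≡tabulate : ∀ (f : ℕ → ℕ) s n → interval f s n ≡ toList (tabulate {n = n} (λ i → f (s + toℕ i)))
      interval≡tabulate f s zero = refl
      interval≡tabulate f s (suc n) = cong₂ _∷_ (cong f (sym (+-identityʳ s))) (trans (interval≡tabulate f (suc s) n) (cong toList (Vec-cong n)))
        where
        open import Data.Vec.Properties using (tabulate-cong)
        Vec-cong : ∀ n → tabulate {n = n} (λ i → f (suc s + toℕ i)) ≡ tabulate (λ i → f (s + suc (toℕ i)))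
        Vec-cong n = tabulate-cong (λ i → cong f (sym (+-suc s (toℕ i))))

      sizeT≡ : ∀ n → ⟦ sizeT n ⟧ (a ∷ []) ≡ size n
      sizeT≡ short = refl
      sizeT≡ long = refl
      sizeT≡ wide = refl
      sizeT≡ narrow = refl
      sizeT≡ fillᵘ = refl
      sizeT≡ fillʷ = refl
      sizeT≡ (uw _ _) = refl
      sizeT≡ (wu _ _) = refl

      barT≡ : ∀ n → ⟦ barT n ⟧ (a ∷ []) ≡ encBar (bar n)
      barT≡ n = go (⟦ sizeT n ⟧ (a ∷ [])) (size n) (sizeT≡ n)
        where
        T = λ v → topClass n + 4 * topCode n v
        U = λ v → bottomClass n + 4 * bottomCode n v
        go : ∀ k l → k ≡ l → encList (k ∸ 1 ∷ rowClass n ∷ rowClass n ∷ encList (interval T 0 (suc (k ∸ 1))) ∷ encList (interval U 0 (suc (k ∸ 1))) ∷ []) ≡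
          encBar (record { k = pred l ; top = tabulate (λ j → T (toℕ j)) ; bottom = tabulate (λ j → U (toℕ j)) ; left = rowClass n ; right = rowClass n })
        go k _ refl = cong₂ (λ t b → encList (k ∸ 1 ∷ rowClass n ∷ rowClass n ∷ encList t ∷ encList b ∷ [])) (interval≡tabulate T 0 (suc (k ∸ 1))) (interval≡tabulate U 0 (suc (k ∸ 1)))

      barsT≡ : ∀ {m} (ns : Vec Name m) → ⟦ barsT ns ⟧ (a ∷ []) ≡ encList (toList (Vec.map encBar (Vec.map bar ns)))
      barsT≡ [] = refl
      barsT≡ (n ∷ ns) = cong₂ (λ x y → 2 ^ x * suc (2 * y)) (barT≡ n) (barsT≡ ns)

      code≡ : ⟦ barsT names ⟧ (a ∷ []) ≡ code bars
      code≡ = barsT≡ names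

      colour-injective : ∀ {x y n n′ v} → topClass n ≡ topClass n′ → topClass n + 4 * topCode n v ≡ topClass n′ + 4 * topCode n′ v → Mark (topMarks n v) x → Mark (topMarks n′ v) y → x ≡ y
      colour-injective {n = n} {n′} {v} c e mx my = trans (mark-unique mx (top-marked n v)) (trans (*-cancelˡ-≡ (topCode n v) (topCode n′ v) 4
        (+-cancelˡ-≡ (topClass n) _ _ (trans e (cong (_+ 4 * topCode n′ v) (sym c))))) (mark-unique (top-marked n′ v) my))

      colour-injective′ : ∀ {x y n n′ v} → bottomClass n ≡ bottomClass n′ → bottomClass n + 4 * bottomCode n v ≡ bottomClass n′ + 4 * bottomCode n′ v → Mark (bottomMarks n v) x → Mark (bottomMarks n′ v) y → x ≡ y
      colour-injective′ {n = n} {n′} {v} c e mx my = trans (mark-unique mx (bottom-marked n v)) (trans (*-cancelˡ-≡ (bottomCode n v) (bottomCode n′ v) 4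
        (+-cancelˡ-≡ (bottomClass n) _ _ (trans e (cong (_+ 4 * bottomCode n′ v) (sym c))))) (mark-unique (bottom-marked n′ v) my))

      -- The vertical sides separate the kinds, the lengths separate the bars of a u or w row, and
      -- the marks separate the unit bars.
      bar-injective : ∀ n n′ → bar n ≡ bar n′ → n ≡ n′
      bar-injective n n′ e = go n n′ (cong Bar.left e) (trans (sym (sz n)) (trans (cong (suc ∘ Bar.k) e) (sz n′)))
          (cong (λ b → lookup (Bar.top b) zero) e) (cong (λ b → lookup (Bar.bottom b) zero) e)
        where
        sz : ∀ n → suc (pred (size n)) ≡ size n
        sz n = suc-pred (size n) ⦃ >-nonZero (size>0 n) ⦄
        J≢0 : NonZero (B ^ 5)
        J≢0 = >-nonZero (m^n>0 B 5)
        lengths : ∀ x y {A : Set} → x ≢ y → x * B ^ 5 ≡ y * B ^ 5 → A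
        lengths x y x≢y e = contradiction (*-cancelʳ-≡ x y (B ^ 5) ⦃ J≢0 ⦄ e) x≢y
        one : ∀ x {A : Set} → 2 ≤ x → x * B ^ 5 ≡ 1 → A
        one x 2≤x e = contradiction (≤-trans 2≤x (≤-trans (m≤m*n x (B ^ 5) ⦃ J≢0 ⦄) (≤-reflexive e))) λ { (s≤s ()) }
        go : ∀ n n′ → rowClass n ≡ rowClass n′ → size n ≡ size n′ → topClass n + 4 * topCode n 0 ≡ topClass n′ + 4 * topCode n′ 0 →
             bottomClass n + 4 * bottomCode n 0 ≡ bottomClass n′ + 4 * bottomCode n′ 0 → n ≡ n′
        go short short _ _ _ _ = refl
        go short long _ e _ _ = lengths 4 12 (λ ()) e
        go short fillᵘ _ e _ _ = one 4 (s≤s (s≤s z≤n)) e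
        go long short _ e _ _ = lengths 12 4 (λ ()) e
        go long long _ _ _ _ = refl
        go long fillᵘ _ e _ _ = one 12 (s≤s (s≤s z≤n)) e
        go fillᵘ short _ e _ _ = one 4 (s≤s (s≤s z≤n)) (sym e)
        go fillᵘ long _ e _ _ = one 12 (s≤s (s≤s z≤n)) (sym e)
        go fillᵘ fillᵘ _ _ _ _ = refl
        go wide wide _ _ _ _ = refl
        go wide narrow _ e _ _ = lengths 11 5 (λ ()) e
        go wide fillʷ _ e _ _ = one 11 (s≤s (s≤s z≤n)) e
        go narrow wide _ e _ _ = lengths 5 11 (λ ()) e
        go narrow narrow _ _ _ _ = refl
        go narrow fillʷ _ e _ _ = one 5 (s≤s (s≤s z≤n)) e
        go fillʷ wide _ e _ _ = one 11 (s≤s (s≤s z≤n)) (sym e)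
        go fillʷ narrow _ e _ _ = one 5 (s≤s (s≤s z≤n)) (sym e)
        go fillʷ fillʷ _ _ _ _ = refl
        go (uw x y) (uw x′ y′) _ _ t b = cong₂ uw (colour-injective′ {n = uw x y} {uw x′ y′} {0} refl b (here refl) (here refl)) (colour-injective {n = uw x y} {uw x′ y′} {0} refl t (here refl) (here refl))
        go (wu x y) (wu x′ y′) _ _ t b = cong₂ wu (colour-injective′ {n = wu x y} {wu x′ y′} {0} refl b (here refl) (here refl)) (colour-injective {n = wu x y} {wu x′ y′} {0} refl t (here refl) (here refl))

      distinct : Distinct bars
      distinct i j e = toℕ-injective (trans (sym (positions i)) (trans (cong position (bar-injective _ _ (trans (sym (lookup-map i bar names)) (trans e (lookup-map j bar names))))) (positions j)))
        where
        -- A left inverse of `lookup names`; its 29 values are checked by computation.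
        position : Name → ℕ
        position short = 0
        position long = 1
        position wide = 2
        position narrow = 3
        position fillᵘ = 4
        position fillʷ = 5
        position (uw 0 5) = 10
        position (uw 0 y) = 6 + y
        position (uw 1 y) = 11
        position (uw 2 y) = 12
        position (uw 3 y) = 13
        position (uw 4 0) = 14
        position (uw 4 1) = 15
        position (uw 4 y) = 12 + y
        position (uw x y) = 18 + y
        position (wu 0 y) = 22 + y
        position (wu x y) = 25 + x
        positions : ∀ k → position (lookup names k) ≡ toℕ k
        positions = toWitness {a? = all? (λ k → position (lookup names k) ≟ toℕ k)} _

-- Bars simulate any tile set given by a formula

module TileBars where

  open import Defs
  open Expressions
  open Bars
  open Quadrants using (module Extraction)
  open BarTilings using (module Existence)
  open BarCodes
  open import Data.Integer as ℤ using (ℤ)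
  open import Data.Nat
  open import Data.Product using (∃; _×_; _,_; proj₂)
  open import Data.Vec using ([]; _∷_)
  open import Relation.Binary.PropositionalEquality

  module Tiles (tile : Fm 5) (bound : Tm 1) (a : ℕ) where

    open Encoding.At tile bound a

    Tile : ℕ → ℕ → ℕ → ℕ → Set
    Tile l b r t = Holds tile (l ∷ b ∷ r ∷ t ∷ a ∷ [])

    abstract

      plane⇒Tileable : (h v : ℤ → ℤ → ℕ) → (∀ x y → h x y < ⟦ bound ⟧ (a ∷ [])) → (∀ x y → v x y < ⟦ bound ⟧ (a ∷ [])) →
        (∀ x y → Tile (h x y) (v x y) (h (x ℤ.+ ℤ.1ℤ) y) (v x (y ℤ.+ ℤ.1ℤ))) → Tileable (Marked.bars marked)
      plane⇒Tileable h v h< v< tiles = Existence.tiling marked separated h v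
        (λ x y → ((h< x y , v< x y) , h< (x ℤ.+ ℤ.1ℤ) y , v< x (y ℤ.+ ℤ.1ℤ)) , tiles x y)

      -- A quadrant is all that the marks yield, and it suffices: the hierarchy forces squares of
      -- every size already there.
      Tileable⇒quadrant : Tileable (Marked.bars marked) → ∃ λ (h : ℕ → ℕ → ℕ) → ∃ λ (v : ℕ → ℕ → ℕ) → ∀ x y → Tile (h x y) (v x y) (h (suc x) y) (v x (suc y))
      Tileable⇒quadrant tiling = go (Extraction.quads marked separated tiling)
        where
        go : (∃ λ (quad : ℕ → ℕ → Quad) → (∀ x y → Marked.Good marked (quad x y)) × (∀ x y → east (quad x y) ≡ west (quad (suc x) y)) × (∀ x y → north (quad x y) ≡ south (quad x (suc y)))) →
          ∃ λ (h : ℕ → ℕ → ℕ) → ∃ λ (v : ℕ → ℕ → ℕ) → ∀ x y → Tile (h x y) (v x y) (h (suc x) y) (v x (suc y))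
        go (quad , good , east≡ , north≡) = (λ x y → west (quad x y)) , (λ x y → south (quad x y)) ,
          λ x y → subst₂ (λ r t → Tile (west (quad x y)) (south (quad x y)) r t) (east≡ x y) (north≡ x y) (proj₂ (good x y))

-- The reduction and the diagonal argument

open import Defs
open Expressions
open RegisterMachines
open Codes
open PayloadTiles
open Simulations
open TileSet
open Coarsening
open Hierarchy
open Bars
open import Data.Fin as Fin using (zero; suc; #_)
open import Data.List as List using (List; []; _∷_; _++_; length; [_])
open import Data.List.Properties using (++-assoc; length-++)
open import Data.Maybe using (just; nothing)
open import Data.Nat
open import Data.Nat.Properties
open import Data.Product using (Σ; ∃; _×_; _,_; proj₁; proj₂)
open import Data.Sum using (inj₁; inj₂)
open import Data.Vec as Vec using ([]; _∷_)
open import Function using (_∘_)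
open import Relation.Binary.PropositionalEquality hiding ([_]; J)
open import Relation.Nullary using (¬_; contradiction)

-- Six ternary digits give 729 = 3^6. Payload colours are at most `a + a`, and wires shift them by
-- 2, which leaves `a + a + 3` values.
boundT : Tm 1
boundT = (var (# 0) ⊕ var (# 0) ⊕ lit 3) ⊗ lit 729

open BarCodes.Encoding tileF boundT using (barsT; module At)

open Edge

rule-kind : ∀ {a p q l b r t} → px l ≡ p → py l ≡ q → Rule a l b r t → HRule p q l b r t
rule-kind refl refl ((_ , _ , _ , _ , _ , _ , r≡ , t≡) , inj₁ (e , _)) = r≡ , t≡ , inj₁ e
rule-kind refl refl ((_ , _ , _ , _ , _ , _ , r≡ , t≡) , inj₂ (inj₁ (c , _))) = r≡ , t≡ , inj₂ (inj₁ c)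
rule-kind refl refl ((_ , _ , _ , _ , _ , _ , r≡ , t≡) , inj₂ (inj₂ (c , _))) = r≡ , t≡ , inj₂ (inj₂ c)

hierarchical : ∀ {a} (h v : ℕ → ℕ → ℕ) → (∀ x y → Rule a (decode (h x y)) (decode (v x y)) (decode (h (suc x) y)) (decode (v x (suc y)))) →
  Hierarchical (λ x → px (decode (h x 0))) (λ y → py (decode (h 0 y))) (λ x y → decode (h x y)) (λ x y → decode (v x y))
hierarchical {a} h v rules = record
  { p-next = λ x → proj₁ (proj₂ (proj₂ (parities x 0)))
  ; q-next = λ y → trans (proj₁ (proj₂ (parities 0 (suc y)))) (trans (proj₁ (proj₂ (proj₂ (proj₂ (proj₂ (proj₂ (parities 0 y))))))) (cong next₃ (sym (proj₁ (proj₂ (parities 0 y))))))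
  ; rule = λ x y → rule-kind {a} {px (L x 0)} {py (L 0 y)} {L x y} {B x y} {L (suc x) y} {B x (suc y)} (column x y) (row x y) (rules x y)
  ; H-h₁ = λ x y → h₁<3 (decode-ternary (h x y))
  ; V-h₁ = λ x y → h₁<3 (decode-ternary (v x y)) }
  where
  L B : ℕ → ℕ → Edge ℕ
  L x y = decode (h x y)
  B x y = decode (v x y)
  parities : ∀ x y → Parity (L x y) (B x y) (L (suc x) y) (B x (suc y))
  parities x y = proj₁ (rules x y)
  column : ∀ x y → px (L x y) ≡ px (L x 0)
  column x zero = refl
  column x (suc y) = trans (proj₁ (parities x (suc y))) (trans (proj₁ (proj₂ (proj₂ (proj₂ (proj₂ (parities x y)))))) (trans (sym (proj₁ (parities x y))) (column x y)))
  row : ∀ x y → py (L x y) ≡ py (L 0 y)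
  row zero y = refl
  row (suc x) y = trans (proj₁ (proj₂ (proj₂ (proj₂ (parities x y))))) (row x y)

next-nothing : ∀ cs s → fetch cs (proj₁ s) ≡ nothing → next cs s ≡ s
next-nothing cs s e rewrite e = refl

module Reduction (cs : List Instr) where

  open Simulation cs
  open At a
  open TileBars.Tiles tileF boundT a using (plane⇒Tileable; Tileable⇒quadrant)

  -- A square of level n + 2 has enough free lines to contain the place (n, n + 1) of the run, where
  -- no payload tile fits.
  stuck⇒¬Tileable : ∀ n → fetch cs (proj₁ (conf n)) ≡ nothing → ¬ Tileable (Marked.bars marked)
  stuck⇒¬Tileable n stuck tiling with Tileable⇒quadrant tiling
  ... | h , v , tiles = stuck-no-tile n stuck (proj₂ (proj₂ tile))
    where
    rules : ∀ x y → Rule a (decode (h x y)) (decode (v x y)) (decode (h (suc x) y)) (decode (v x (suc y)))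
    rules x y = tile⇒rule {a} {h x y} {v x y} {h (suc x) y} {v x (suc y)} (tiles x y)
    fine = hierarchical {a} h v rules
    first-column : ∀ j → H 0 j ≡ 0
    first-column zero = refl
    first-column (suc j) = refl
    tile : ∃ λ r → ∃ λ t → Payload a (H n (suc n)) (V n (suc n)) r t
    tile = Forcing.Forced.payload-tile fine a rules H V first-column (λ i → refl) deterministic (Levels.square fine (2 + n)) n (suc n) (n≤1+n (suc n)) ≤-refl

  live⇒Tileable : (∀ n → fetch cs (proj₁ (conf n)) ≢ nothing) → Tileable (Marked.bars marked)
  live⇒Tileable live = plane⇒Tileable Hℤ Vℤ Hℤ< Vℤ< plane-tile
    where
    first-column : ∀ j → H 0 j ≡ 0
    first-column zero = refl
    first-column (suc j) = refl
    open PlaneTilings.Plane a H V (live-tile live) first-column (λ i → refl) (H-bound live) (V-bound live)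

  evaluates : ∀ f {y} → Eval f (code (Marked.bars marked) ∷ []) y → Eval (C f (compile (barsT names) ∷ [])) (a ∷ []) y
  evaluates f ev = eC (subst (Eval (compile (barsT names)) (a ∷ [])) code≡ (compile-correct (barsT names) (a ∷ [])) ∷ []) ev

  decided : ∀ f → DecidesTiling 29 f → (Tileable (Marked.bars marked) → Eval f (code (Marked.bars marked) ∷ []) 1) × (¬ Tileable (Marked.bars marked) → Eval f (code (Marked.bars marked) ∷ []) 0)
  decided f decides = decides (Marked.bars marked) distinct

  -- No case distinction on tileability is needed: a tiling would bring the answer 1, the machine
  -- would halt and there would be no tiling. So the answer is 0, the machine runs forever, and a
  -- tiling exists after all.
  undecided : ∀ f → DecidesTiling 29 f → (Eval (C f (compile (barsT names) ∷ [])) (a ∷ []) 1 → ∃ λ n → fetch cs (proj₁ (conf n)) ≡ nothing) →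
    ¬ (Eval (C f (compile (barsT names) ∷ [])) (a ∷ []) 0 → ∀ n → fetch cs (proj₁ (conf n)) ≢ nothing)
  undecided f decides rejects accepts = ¬tileable (live⇒Tileable (accepts (evaluates f (proj₂ (decided f decides) ¬tileable))))
    where
    ¬tileable : ¬ Tileable (Marked.bars marked)
    ¬tileable t = let n , stuck = rejects (evaluates f (proj₁ (decided f decides) t)) in stuck⇒¬Tileable n stuck t

  reaches : ∀ m {s t} → conf m ≡ s → Path cs s t → ∃ λ n → conf n ≡ t
  reaches m e ε = m , e
  reaches m refl (_◅_ {c} f p) = reaches (suc m) (next-just cs (conf m) f) p

  remains : ∀ n → next cs (conf n) ≡ conf n → ∀ m → conf (m + n) ≡ conf n
  remains n e zero = refl
  remains n e (suc m) = trans (cong (next cs) (remains n e m)) e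

  -- A configuration that reproduces itself and a halted one both persist, so they would agree at
  -- time n + k.
  looping⇒live : ∀ n {c} → fetch cs (proj₁ (conf n)) ≡ just c → next cs (conf n) ≡ conf n → ∀ k → fetch cs (proj₁ (conf k)) ≢ nothing
  looping⇒live n f e k stuck = contradiction (trans (sym f) (trans (cong (fetch cs ∘ proj₁) agree) stuck)) λ ()
    where
    agree : conf n ≡ conf k
    agree = trans (sym (remains n e k)) (trans (cong conf (+-comm k n)) (remains k (next-nothing cs (conf k) stuck) n))

-- Register 0 starts as `a + 1`, since the corner cell counts as a mark; the decrement restores `a`.
body : PR 1 → List Instr
body p = asg 0 (dec 0) ∷ program p (0 ∷ []) 1 2

-- With register 1 zero this enters the loop jb 0, otherwise it jumps out of the program.
test : List Instr
test = jzf 1 2 ∷ asg 1 zer ∷ jzf 1 1 ∷ jb 0 ∷ []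

body-correct : ∀ p {ρ y} → Eval p (pred (ρ 0) ∷ []) y → ∃ λ ρ′ → Runs (body p) ρ ρ′ × ρ′ 1 ≡ y
body-correct p {ρ} ev with program-correct p {is = 0 ∷ []} {1} {2} {ρ [ 0 ≔ pred (ρ 0) ]} ev (λ { zero → z<s , refl }) ≤-refl
... | ρ′ , runs , ρ≡ , _ = ρ′ , (runs-asg 0 (dec 0) {ρ} ⨟ runs) , ρ≡

fetch-beyond : ∀ cs → fetch cs (length cs) ≡ nothing
fetch-beyond []       = refl
fetch-beyond (c ∷ cs) = fetch-beyond cs

fetch-inside : ∀ cs pre c rest → fetch (cs ++ pre ++ c ∷ rest) (length pre + length cs) ≡ just c
fetch-inside cs pre c rest = trans (cong₂ fetch (sym (++-assoc cs pre (c ∷ rest))) (trans (+-comm (length pre) (length cs)) (sym (length-++ cs)))) (fetch-++ (cs ++ pre) c rest)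

module Decider (p : PR 1) (cs : List Instr) (cs≡ : cs ≡ body p ++ test) where

  open Simulation cs
  open Reduction cs

  after-body : ∀ {y} → Eval p (a ∷ []) y → ∃ λ n → ∃ λ ρ → conf n ≡ (length (body p) , ρ) × ρ 1 ≡ y
  after-body {y} ev with body-correct p {initial} ev
  ... | ρ , runs , ρ≡ with reaches 0 refl (within (sym cs≡) (runs [] test))
  ...   | n , e = n , ρ , e , ρ≡

  fetch-test : ∀ pre c rest → test ≡ pre ++ c ∷ rest → fetch cs (length pre + length (body p)) ≡ just c
  fetch-test pre c rest e = trans (cong (λ is → fetch is (length pre + length (body p))) (trans cs≡ (cong (body p ++_) e))) (fetch-inside (body p) pre c rest)

  step : ∀ n {q ρ c} → conf n ≡ (q , ρ) → fetch cs q ≡ just c → conf (suc n) ≡ execute c (q , ρ)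
  step n {q} {ρ} e f = trans (cong (next cs) e) (next-just cs (q , ρ) f)

  rejects : Eval p (a ∷ []) 1 → ∃ λ n → fetch cs (proj₁ (conf n)) ≡ nothing
  rejects ev with after-body ev
  ... | n , ρ , f₀ , ρ≡ = 3 + n , trans (cong (fetch cs ∘ proj₁) f₃) (trans (cong₂ fetch cs≡ (trans (+-comm 4 (length (body p))) (sym (length-++ (body p))))) (fetch-beyond (body p ++ test)))
    where
    L = length (body p)
    f₁ : conf (1 + n) ≡ (1 + L , ρ)
    f₁ = trans (step n f₀ (fetch-test [] (jzf 1 2) _ refl)) (cong (λ v → jump v 2 L , ρ) ρ≡)
    f₂ : conf (2 + n) ≡ (2 + L , ρ [ 1 ≔ 0 ])
    f₂ = step (1 + n) f₁ (fetch-test (jzf 1 2 ∷ []) (asg 1 zer) _ refl)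
    f₃ : conf (3 + n) ≡ (4 + L , ρ [ 1 ≔ 0 ])
    f₃ = step (2 + n) f₂ (fetch-test (jzf 1 2 ∷ asg 1 zer ∷ []) (jzf 1 1) _ refl)

  accepts : Eval p (a ∷ []) 0 → ∀ n → fetch cs (proj₁ (conf n)) ≢ nothing
  accepts ev with after-body ev
  ... | n , ρ , f₀ , ρ≡ = looping⇒live (1 + n) (trans (cong (fetch cs ∘ proj₁) f₁) loop) (trans (step (1 + n) f₁ loop) (sym f₁))
    where
    L = length (body p)
    loop : fetch cs (3 + L) ≡ just (jb 0)
    loop = fetch-test (jzf 1 2 ∷ asg 1 zer ∷ jzf 1 1 ∷ []) (jb 0) [] refl
    f₁ : conf (1 + n) ≡ (3 + L , ρ)
    f₁ = trans (step n f₀ (fetch-test [] (jzf 1 2) _ refl)) (cong (λ v → jump v 2 L , ρ) ρ≡)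

-- The program enters as a variable with an equation, so that its instruction list is not unfolded
-- in the arguments about `a`.
undecidable : ∀ f cs → cs ≡ body (C f (compile (barsT names) ∷ [])) ++ test → ¬ DecidesTiling 29 f
undecidable f cs cs≡ decides = Reduction.undecided cs f decides (Decider.rejects p cs cs≡) (Decider.accepts p cs cs≡)
  where
  p : PR 1
  p = C f (compile (barsT names) ∷ [])

theorem4 : ¬ Σ (PR 1) (DecidesTiling 29)
theorem4 (f , decides) = undecidable f (body (C f (compile (barsT names) ∷ [])) ++ test) refl decides
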